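{- Let $q\geq 4$ be a prime power, $m\geq 2$, $0\leq t\leq m-2$ and $2\leq s\leq q-2$ be integers. Let $f\in R_q(t(q-1)+s,m)$ be a second weight codeword, i.e. $|f|=(q-s+1)(q-1)q^{m-t-2}$, and let $S$ be its support. Then $S$ is contained in an affine subspace $G$ of $\mathbb{F}_q^m$ of codimension $t$, and either $S$ is the union of $q-s+1$ parallel affine subspaces of codimension $t+1$ (contained in $G$) minus their intersection with an affine subspace of codimension $t+1$ which is not parallel to them, or $S$ is the union of $q-s+1$ affine subspaces of codimension $t+1$ (contained in $G$) which meet in a common affine subspace of codimension $t+2$, minus this common intersection.
   Context: $\mathbb{F}_q$ is the finite field with $q$ elements and $B_m^q$ is the $\mathbb{F}_q$-algebra of all functions $\mathbb{F}_q^m\to\mathbb{F}_q$. Every $f\in B_m^q$ is given by a unique polynomial in $\mathbb{F}_q[X_1,\ldots,X_m]$ of degree at most $q-1$ in each variable (its reduced form), and $\deg(f)$ is the total degree of this reduced form. For $0\leq r\leq m(q-1)$, $R_q(r,m)=\{f\in B_m^q:\deg(f)\leq r\}$ is the generalized Reed–Muller code. The support of $f$ is $\{x\in\mathbb{F}_q^m: f(x)\neq 0\}$ and $|f|$ denotes its cardinality (Hamming weight). Subspaces and hyperplanes are affine subspaces of $\mathbb{F}_q^m$ and codimensions are taken in $\mathbb{F}_q^m$. Under the hypotheses, $(q-s+1)(q-1)q^{m-t-2}$ is the second smallest nonzero weight of $R_q(t(q-1)+s,m)$; second weight codewords are the codewords of that weight. -}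

module Defs where

open import Level using (0ℓ)
open import Data.Nat as ℕ using (ℕ; zero; suc; _≤_)
open import Data.Fin as Fin using (Fin; toℕ)
open import Data.Vec as Vec using (Vec; []; _∷_; zipWith; lookup)
open import Data.List as List using (List; [_]; concatMap; allFin; filter; length)
open import Data.Product using (Σ; ∃; _×_; _,_)
open import Relation.Nullary using (¬_; Dec; ¬?)
open import Relation.Binary.PropositionalEquality using (_≡_; _≢_)
open import Function.Bundles using (_↔_; Inverse)
open import Algebra.Structures using (IsCommutativeRing)

-- A finite field with exactly q elements (propositional equality).
-- Any such q is automatically a prime power.
record FiniteField (q : ℕ) : Set₁ where
  infixl 6 _+_
  infixl 7 _*_
  field
    Carrier : Set
    _+_ _*_ : Carrier → Carrier → Carrier
    -_      : Carrier → Carrier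
    0# 1#   : Carrier
    isCommutativeRing : IsCommutativeRing _≡_ _+_ _*_ -_ 0# 1#
    0≢1     : 0# ≢ 1#
    inverse : ∀ x → x ≢ 0# → ∃ λ y → x * y ≡ 1#
    _≟_     : (x y : Carrier) → Dec (x ≡ y)
    enum    : Fin q ↔ Carrier

allVecs : ∀ {A : Set} → List A → (m : ℕ) → List (Vec A m)
allVecs xs zero    = [ [] ]
allVecs xs (suc m) = concatMap (λ x → List.map (x ∷_) (allVecs xs m)) xs

module _ {q : ℕ} (F : FiniteField q) where
  open FiniteField F

  elems : List Carrier
  elems = List.map (Inverse.to enum) (allFin q)

  points : (m : ℕ) → List (Vec Carrier m)
  points m = allVecs elems m

  Fun : ℕ → Set
  Fun m = Vec Carrier m → Carrier

  sumL : List Carrier → Carrier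
  sumL = List.foldr _+_ 0#

  pow : Carrier → ℕ → Carrier
  pow x zero    = 1#
  pow x (suc n) = x * pow x n

  monomial : ∀ {m} → Vec (Fin q) m → Vec Carrier m → Carrier
  monomial []       []       = 1#
  monomial (e ∷ es) (x ∷ xs) = pow x (toℕ e) * monomial es xs

  totalDeg : ∀ {m} → Vec (Fin q) m → ℕ
  totalDeg []       = 0
  totalDeg (e ∷ es) = toℕ e ℕ.+ totalDeg es

  -- a reduced polynomial: a coefficient for every exponent vector with
  -- each exponent at most q-1
  RedPoly : ℕ → Set
  RedPoly m = Vec (Fin q) m → Carrier

  evalPoly : ∀ {m} → RedPoly m → Fun m
  evalPoly {m} c x = sumL (List.map (λ e → c e * monomial e x) (allVecs (allFin q) m))

  DegLe : ∀ {m} → RedPoly m → ℕ → Set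
  DegLe c r = ∀ e → c e ≢ 0# → totalDeg e ≤ r

  -- f ∈ R_q(r,m): the (unique) reduced form of f has total degree ≤ r
  InRM : (r m : ℕ) → Fun m → Set
  InRM r m f = Σ (RedPoly m) λ c → (∀ x → f x ≡ evalPoly c x) × DegLe c r

  weight : ∀ {m} → Fun m → ℕ
  weight {m} f = length (filter (λ x → ¬? (f x ≟ 0#)) (points m))

  _⊕_ : ∀ {m} → Vec Carrier m → Vec Carrier m → Vec Carrier m
  _⊕_ = zipWith _+_

  zeroV : ∀ {m} → Vec Carrier m
  zeroV = Vec.replicate _ 0#

  scale : ∀ {m} → Carrier → Vec Carrier m → Vec Carrier m
  scale a = Vec.map (a *_)

  lincomb : ∀ {m d} → Vec Carrier d → Vec (Vec Carrier m) d → Vec Carrier m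
  lincomb []       []       = zeroV
  lincomb (a ∷ as) (v ∷ vs) = scale a v ⊕ lincomb as vs

  LinIndep : ∀ {m d} → Vec (Vec Carrier m) d → Set
  LinIndep {d = d} vs = ∀ (λs : Vec Carrier d) → lincomb λs vs ≡ zeroV → λs ≡ Vec.replicate d 0#

  InSpan : ∀ {m d} → Vec Carrier m → Vec (Vec Carrier m) d → Set
  InSpan {d = d} v vs = Σ (Vec Carrier d) λ λs → v ≡ lincomb λs vs

  record AffSub (m d : ℕ) : Set where
    field
      base  : Vec Carrier m
      dirs  : Vec (Vec Carrier m) d
      indep : LinIndep dirs

  AffCodim : (m k : ℕ) → Set
  AffCodim m k = AffSub m (m ℕ.∸ k)

  _∈A_ : ∀ {m d} → Vec Carrier m → AffSub m d → Set
  _∈A_ {d = d} x A = Σ (Vec Carrier d) λ λs → x ≡ AffSub.base A ⊕ lincomb λs (AffSub.dirs A)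

  Parallel : ∀ {m d e} → AffSub m d → AffSub m e → Set
  Parallel A B = (∀ i → InSpan (lookup (AffSub.dirs A) i) (AffSub.dirs B))
               × (∀ j → InSpan (lookup (AffSub.dirs B) j) (AffSub.dirs A))

  SameSet : ∀ {m d e} → AffSub m d → AffSub m e → Set
  SameSet A B = ∀ x → (x ∈A A → x ∈A B) × (x ∈A B → x ∈A A)

  Supp : ∀ {m} → Fun m → Vec Carrier m → Set
  Supp f x = f x ≢ 0#

{-# OPTIONS --safe #-}

-- The degree of f drops by one on division by the equation of a hyperplane missing the support S, and by
-- q - 1 on projection, that is, on summation over all lines of a given direction. If j hyperplanes of a
-- parallel class miss S, then comparing |S| with the minimum weight of the other q - j slices leaves few
-- values of j. Some hyperplane always misses S: in the plane this is Bruen's bound for multiple blocking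
-- sets, and the general case follows by induction, projecting along a line which meets S in one point.
-- For t ≥ 1 the projection of f has parameter t - 1; its structure shows that S lies in a hyperplane, so
-- that t can be lowered to 0. For t = 0 all nonzero slices of a suitable class have minimum weight, and f
-- depends on two coordinates only. In the plane, f is either a product of s linear forms, s - 1 of which
-- are parallel, or x times a curve with s - 1 points on every vertical line x = a ≠ 0; dividing y^q by the
-- equation of the curve shows that it consists of s - 1 concurrent or parallel lines.

module Submission where

open import Defs
open import Level using (0ℓ)
open import Data.Nat using (ℕ; _∸_; _^_; _≤_)
open import Data.Nat.Base as ℕ using (zero; suc; s≤s; z≤n; _<_)
import Data.Nat.Properties as ℕP
open import Data.Nat.Solver using (module +-*-Solver)
open import Data.Fin.Base using (Fin; zero; suc; toℕ)
open import Data.Vec.Base as Vec using (Vec; []; _∷_)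
import Data.Vec.Properties as VecP
open import Data.List.Base as List using (List; []; _∷_)
import Data.List.Properties as ListP
open import Data.List.Membership.Propositional using (_∈_; _∉_)
open import Data.List.Membership.Propositional.Properties using (∈-map⁺; ∈-map⁻; ∈-allFin; ∈-lookup; ∈-filter⁺; ∈-filter⁻)
open import Data.List.Relation.Unary.All as All using (All; []; _∷_)
import Data.List.Relation.Unary.All.Properties as AllP
open import Data.List.Relation.Unary.AllPairs as AllPairs using (AllPairs; []; _∷_)
import Data.List.Relation.Unary.AllPairs.Properties as AllPairsP
open import Data.List.Relation.Unary.Any as Any using (here; there)
open import Data.List.Relation.Unary.Any.Properties using (lookup-index)
open import Data.List.Relation.Unary.Unique.Propositional using (Unique)
import Data.List.Relation.Unary.Unique.Propositional.Properties as UniqueP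
open import Data.Maybe.Base using (Maybe; just; nothing)
open import Data.Product using (Σ; ∃; _×_; _,_; proj₁; proj₂)
open import Data.Sum using (_⊎_; inj₁; inj₂)
open import Data.Empty using (⊥; ⊥-elim)
open import Relation.Nullary using (¬_; Dec; yes; no; ¬?; contradiction)
open import Relation.Binary.Definitions using (DecidableEquality; tri<; tri≈; tri>)
open import Relation.Binary.PropositionalEquality
open import Algebra.Structures using (IsCommutativeMonoid; IsCommutativeRing)
open import Algebra.Bundles using (CommutativeMonoid; CommutativeRing; RawRing)
import Algebra.Solver.Ring
open import Algebra.Solver.Ring.AlmostCommutativeRing using (AlmostCommutativeRing; fromCommutativeRing; _-Raw-AlmostCommutative⟶_)
open import Function.Base using (_∘_)
open import Function.Bundles using (Inverse)

-- Degrees are measured by `D`, generated by sums and by products with affine functions: this makes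
-- invariance under affine substitution immediate, and reduced forms are needed in one coordinate at
-- a time only. The bound is strict, so that truncated subtraction is harmless, `D 0` containing
-- only the zero function. Two identities carry the counting. The second weight is σ s = (q - s) q +
-- s - 1 in units of q^n, so s units on top of the minimum weight (q - s) q are one too many. And (q
-- - j)(q - (s - j)) = σ s + (j - 1)(s - j - 1), so that 1 ≤ j < s leaves only j = 1 and j = s - 1,
-- the two cases of the plane. That some hyperplane misses the support is proved for every nonzero
-- function of weight up to the second weight, because projections and slices may lose weight.
-- Functions on a finite field do not show multiplicities or derivatives. Bruen's bound is therefore
-- proved for coefficient sequences, and derivatives are taken from a derivation of `D`. In the case
-- j = 1 of the plane, the quotient of y^q by the curve is wanted because its product with the curve
-- vanishes on all columns but one; on any other line that product is determined by a single value.

module Solver {S : Set} {_⊞_ _⊠_ : S → S → S} {⊟_ : S → S} {𝟘 𝟙 : S}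
  (isCR : IsCommutativeRing _≡_ _⊞_ _⊠_ ⊟_ 𝟘 𝟙) where

  R : CommutativeRing 0ℓ 0ℓ
  R = record { isCommutativeRing = isCR }

  open CommutativeRing R hiding (zero; refl; sym; trans; reflexive; setoid; _≈_)
  open import Algebra.Properties.Ring ring
  open import Algebra.Properties.AbelianGroup +-abelianGroup using (⁻¹-∙-comm)
  open import Algebra.Properties.CommutativeSemigroup (CommutativeMonoid.commutativeSemigroup +-commutativeMonoid) using (interchange)
  open import Algebra.Properties.Semiring.Mult semiring using (×-homo-+; ×1-homo-*) renaming (_×_ to _·ₙ_)
  open ≡-Reasoning

  infixl 9 _·1
  -- The separate clause for one makes `1 ·1` reduce to `1#` instead of `1# + 0#`. As `⟦_⟧`
  -- subtracts nothing when its second component is zero, `con (0 , 0)` and `con (1 , 0)` compute to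
  -- `0#` and `1#`, on which the solver calls below rely.
  _·1 : ℕ → Carrier
  n ·1 = n ×ᵣ 1# where
    _×ᵣ_ : ℕ → Carrier → Carrier
    zero ×ᵣ x = 0#
    suc zero ×ᵣ x = x
    suc (suc n) ×ᵣ x = x + suc n ×ᵣ x
  suc·1 : ∀ n → suc n ·1 ≡ 1# + n ·1
  suc·1 zero = sym (+-identityʳ 1#)
  suc·1 (suc n) = refl
  ·1≈× : ∀ n → n ·1 ≡ n ·ₙ 1#
  ·1≈× zero = refl
  ·1≈× (suc n) = trans (suc·1 n) (+-congˡ (·1≈× n))
  ·1-+ : ∀ m n → (m ℕ.+ n) ·1 ≡ m ·1 + n ·1
  ·1-+ m n = begin
    (m ℕ.+ n) ·1 ≡⟨ ·1≈× (m ℕ.+ n) ⟩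
    (m ℕ.+ n) ·ₙ 1# ≡⟨ ×-homo-+ 1# m n ⟩
    m ·ₙ 1# + n ·ₙ 1# ≡⟨ sym (+-cong (·1≈× m) (·1≈× n)) ⟩
    m ·1 + n ·1 ∎
  ·1-* : ∀ m n → (m ℕ.* n) ·1 ≡ m ·1 * n ·1
  ·1-* m n = begin
    (m ℕ.* n) ·1 ≡⟨ ·1≈× (m ℕ.* n) ⟩
    (m ℕ.* n) ·ₙ 1# ≡⟨ ×1-homo-* m n ⟩
    (m ·ₙ 1#) * (n ·ₙ 1#) ≡⟨ sym (*-cong (·1≈× m) (·1≈× n)) ⟩
    m ·1 * n ·1 ∎

  -- (a , b) stands for the integer a - b.
  Diff : Set
  Diff = ℕ × ℕ

  ⟦_⟧ : Diff → Carrier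
  ⟦ a , zero ⟧ = a ·1
  ⟦ a , suc b ⟧ = a ·1 - suc b ·1

  ⟦⟧-def : ∀ x → ⟦ x ⟧ ≡ proj₁ x ·1 - proj₂ x ·1
  ⟦⟧-def (a , zero) = sym (trans (+-congˡ -0#≈0#) (+-identityʳ _))
  ⟦⟧-def (a , suc b) = refl

  -- Coefficients are kept in lowest terms, so that equal ones evaluate to identical terms.
  norm : ℕ → ℕ → Diff
  norm (suc a) (suc b) = norm a b
  norm a       b       = a , b

  ⟦norm⟧ : ∀ a b → ⟦ norm a b ⟧ ≡ a ·1 - b ·1
  ⟦norm⟧ zero    b       = ⟦⟧-def (zero , b)
  ⟦norm⟧ (suc a) zero    = ⟦⟧-def (suc a , zero)
  ⟦norm⟧ (suc a) (suc b) = begin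
    ⟦ norm a b ⟧ ≡⟨ ⟦norm⟧ a b ⟩
    a ·1 - b ·1 ≡⟨ sym (+-identityˡ _) ⟩
    0# + (a ·1 - b ·1) ≡⟨ cong (_+ (a ·1 - b ·1)) (sym (-‿inverseʳ 1#)) ⟩
    (1# - 1#) + (a ·1 - b ·1) ≡⟨ interchange _ _ _ _ ⟩
    (1# + a ·1) + (- 1# - b ·1) ≡⟨ cong₂ _+_ (sym (suc·1 a)) (trans (⁻¹-∙-comm _ _) (cong -_ (sym (suc·1 b)))) ⟩
    suc a ·1 - suc b ·1 ∎

  infixl 6 _+D_
  infixl 7 _*D_
  _+D_ _*D_ : Diff → Diff → Diff
  (a , b) +D (c , d) = norm (a ℕ.+ c) (b ℕ.+ d)
  (a , b) *D (c , d) = norm (a ℕ.* c ℕ.+ b ℕ.* d) (a ℕ.* d ℕ.+ b ℕ.* c)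
  -D_ : Diff → Diff
  -D (a , b) = b , a

  +D-homo : ∀ x y → ⟦ x +D y ⟧ ≡ ⟦ x ⟧ + ⟦ y ⟧
  +D-homo x@(a , b) y@(c , d) = begin
    ⟦ x +D y ⟧ ≡⟨ ⟦norm⟧ (a ℕ.+ c) (b ℕ.+ d) ⟩
    (a ℕ.+ c) ·1 - (b ℕ.+ d) ·1 ≡⟨ +-cong (·1-+ a c) (-‿cong (·1-+ b d)) ⟩
    (a ·1 + c ·1) - (b ·1 + d ·1) ≡⟨ +-congˡ (sym (⁻¹-∙-comm _ _)) ⟩
    (a ·1 + c ·1) + (- b ·1 - d ·1) ≡⟨ interchange _ _ _ _ ⟩
    (a ·1 - b ·1) + (c ·1 - d ·1) ≡⟨ sym (+-cong (⟦⟧-def x) (⟦⟧-def y)) ⟩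
    ⟦ x ⟧ + ⟦ y ⟧ ∎

  -D-homo : ∀ x → ⟦ -D x ⟧ ≡ - ⟦ x ⟧
  -D-homo x@(a , b) = begin
    ⟦ b , a ⟧ ≡⟨ ⟦⟧-def (b , a) ⟩
    b ·1 - a ·1 ≡⟨ +-comm _ _ ⟩
    - a ·1 + b ·1 ≡⟨ +-congˡ (sym (-‿involutive _)) ⟩
    - a ·1 - (- b ·1) ≡⟨ ⁻¹-∙-comm _ _ ⟩
    - (a ·1 - b ·1) ≡⟨ -‿cong (sym (⟦⟧-def x)) ⟩
    - ⟦ x ⟧ ∎

  *D-homo : ∀ x y → ⟦ x *D y ⟧ ≡ ⟦ x ⟧ * ⟦ y ⟧
  *D-homo x@(a , b) y@(c , d) = begin
    ⟦ x *D y ⟧ ≡⟨ ⟦norm⟧ (a ℕ.* c ℕ.+ b ℕ.* d) (a ℕ.* d ℕ.+ b ℕ.* c) ⟩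
    (a ℕ.* c ℕ.+ b ℕ.* d) ·1 - (a ℕ.* d ℕ.+ b ℕ.* c) ·1
      ≡⟨ +-cong (trans (·1-+ (a ℕ.* c) (b ℕ.* d)) (+-cong (·1-* a c) (·1-* b d)))
                (-‿cong (trans (·1-+ (a ℕ.* d) (b ℕ.* c)) (+-cong (·1-* a d) (·1-* b c)))) ⟩
    (A * C + B * D) - (A * D + B * C) ≡⟨ +-congˡ (sym (⁻¹-∙-comm _ _)) ⟩
    (A * C + B * D) + (- (A * D) - B * C) ≡⟨ interchange _ _ _ _ ⟩
    (A * C - A * D) + (B * D - B * C) ≡⟨ +-congˡ (+-comm _ _) ⟩
    (A * C - A * D) + (- (B * C) + B * D) ≡⟨ +-cong (+-congˡ (-‿distribʳ-* _ _)) (+-cong (-‿distribˡ-* _ _) (sym neg²)) ⟩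
    (A * C + A * - D) + (- B * C + - B * - D) ≡⟨ sym (+-cong (distribˡ _ _ _) (distribˡ _ _ _)) ⟩
    A * (C - D) + - B * (C - D) ≡⟨ sym (distribʳ _ _ _) ⟩
    (A - B) * (C - D) ≡⟨ sym (*-cong (⟦⟧-def x) (⟦⟧-def y)) ⟩
    ⟦ x ⟧ * ⟦ y ⟧ ∎
    where
    A B C D : Carrier
    A = a ·1
    B = b ·1
    C = c ·1
    D = d ·1
    neg² : - B * - D ≡ B * D
    neg² = begin
      - B * - D ≡⟨ sym (-‿distribˡ-* _ _) ⟩
      - (B * - D) ≡⟨ -‿cong (sym (-‿distribʳ-* _ _)) ⟩
      - - (B * D) ≡⟨ -‿involutive _ ⟩
      B * D ∎

  ACR : AlmostCommutativeRing 0ℓ 0ℓ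
  ACR = fromCommutativeRing R

  rawDiff : RawRing 0ℓ 0ℓ
  rawDiff = record { Carrier = Diff ; _≈_ = _≡_ ; _+_ = _+D_ ; _*_ = _*D_ ; -_ = -D_ ; 0# = 0 , 0 ; 1# = 1 , 0 }

  morphism : rawDiff -Raw-AlmostCommutative⟶ ACR
  morphism = record
    { ⟦_⟧ = ⟦_⟧ ; +-homo = +D-homo ; *-homo = *D-homo ; -‿homo = -D-homo
    ; 0-homo = refl ; 1-homo = refl }

  coeff≟ : ∀ x y → Maybe (⟦ x ⟧ ≡ ⟦ y ⟧)
  coeff≟ x@(a , b) y@(c , d) with a ℕ.+ d ℕP.≟ c ℕ.+ b
  ... | no _ = nothing
  ... | yes p = just (begin
    ⟦ x ⟧ ≡⟨ ⟦⟧-def x ⟩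
    a ·1 - b ·1 ≡⟨ +-congʳ (sym (+-identityʳ _)) ⟩
    (a ·1 + 0#) - b ·1 ≡⟨ +-congʳ (+-congˡ (sym (-‿inverseʳ _))) ⟩
    (a ·1 + (d ·1 - d ·1)) - b ·1 ≡⟨ +-congʳ (sym (+-assoc _ _ _)) ⟩
    ((a ·1 + d ·1) - d ·1) - b ·1 ≡⟨ +-congʳ (+-congʳ (trans (sym (·1-+ a d)) (trans (cong _·1 p) (·1-+ c b)))) ⟩
    ((c ·1 + b ·1) - d ·1) - b ·1 ≡⟨ +-assoc _ _ _ ⟩
    (c ·1 + b ·1) + (- d ·1 - b ·1) ≡⟨ interchange _ _ _ _ ⟩
    (c ·1 - d ·1) + (b ·1 - b ·1) ≡⟨ +-congˡ (-‿inverseʳ _) ⟩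
    (c ·1 - d ·1) + 0# ≡⟨ +-identityʳ _ ⟩
    c ·1 - d ·1 ≡⟨ sym (⟦⟧-def y) ⟩
    ⟦ y ⟧ ∎)

  open Algebra.Solver.Ring rawDiff ACR morphism coeff≟ public
    using (Polynomial; con; _:+_; _:*_; _:-_; :-_; _:^_; _:=_; solve)

module Proof {Q : ℕ} (F : FiniteField (suc Q)) (3≤Q : 3 ≤ Q) where

  open FiniteField F public
  open IsCommutativeRing isCommutativeRing public
    using (+-assoc; +-comm; +-identityˡ; +-identityʳ; *-assoc; *-comm; *-identityˡ; *-identityʳ;
           distribˡ; distribʳ; zeroˡ; zeroʳ; -‿inverseˡ; -‿inverseʳ;
           +-isCommutativeMonoid; *-isCommutativeMonoid)
  open Solver isCommutativeRing public
    using (solve; con; _:=_; _:+_; _:*_; _:-_; :-_)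
  open CommutativeRing (Solver.R isCommutativeRing) public using (_-_)

  q : ℕ
  q = suc Q

  pick : ∀ {P A : Set} → Dec P → A → A → A
  pick (yes _) a b = a
  pick (no _)  a b = b

  -- The value 0 at 0 makes `inv` an involution of the whole field, and it removes the term at 0
  -- from sums weighted by `inv ξ`.
  inv : Carrier → Carrier
  inv x with x ≟ 0#
  ... | yes _ = 0#
  ... | no p  = proj₁ (inverse x p)

  inv-r : ∀ {x} → x ≢ 0# → x * inv x ≡ 1#
  inv-r {x} p with x ≟ 0#
  ... | yes e = contradiction e p
  ... | no p′ = proj₂ (inverse x p′)

  inv-l : ∀ {x} → x ≢ 0# → inv x * x ≡ 1#
  inv-l p = trans (*-comm _ _) (inv-r p)

  *-cancelˡ : ∀ {x} → x ≢ 0# → ∀ {y z} → x * y ≡ x * z → y ≡ z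
  *-cancelˡ {x} p {y} {z} e = begin
    y ≡⟨ step y ⟩
    inv x * (x * y) ≡⟨ cong (inv x *_) e ⟩
    inv x * (x * z) ≡⟨ sym (step z) ⟩
    z ∎
    where
    open ≡-Reasoning
    step : ∀ w → w ≡ inv x * (x * w)
    step w = begin
      w ≡⟨ sym (*-identityˡ w) ⟩
      1# * w ≡⟨ cong (_* w) (sym (inv-l p)) ⟩
      inv x * x * w ≡⟨ *-assoc _ _ _ ⟩
      inv x * (x * w) ∎

  *≡0 : ∀ {x y} → x ≢ 0# → x * y ≡ 0# → y ≡ 0#
  *≡0 {x} p e = *-cancelˡ p (trans e (sym (zeroʳ x)))

  *≢0 : ∀ {x y} → x ≢ 0# → y ≢ 0# → x * y ≢ 0#
  *≢0 p p′ e = p′ (*≡0 p e)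

  inv≢0 : ∀ {x} → x ≢ 0# → inv x ≢ 0#
  inv≢0 {x} p e = 0≢1 (trans (sym (zeroʳ x)) (trans (cong (x *_) (sym e)) (inv-r p)))

  -≡0⇒≡ : ∀ {x y} → x - y ≡ 0# → x ≡ y
  -≡0⇒≡ {x} {y} e = begin
    x ≡⟨ solve 2 (λ a b → a := (a :- b) :+ b) refl x y ⟩
    (x - y) + y ≡⟨ cong (_+ y) e ⟩
    0# + y ≡⟨ +-identityˡ y ⟩
    y ∎
    where open ≡-Reasoning

  x-x≡0 : ∀ {x y} → x ≡ y → x - y ≡ 0#
  x-x≡0 {x} refl = -‿inverseʳ x

  _≟V_ : ∀ {m} → DecidableEquality (Vec Carrier m)
  _≟V_ = VecP.≡-dec _≟_

  enum-injective : ∀ {i j} → Inverse.to enum i ≡ Inverse.to enum j → i ≡ j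
  enum-injective {i} {j} e =
    trans (sym (Inverse.strictlyInverseʳ enum i)) (trans (cong (Inverse.from enum) e) (Inverse.strictlyInverseʳ enum j))

  abstract
    -- Keeps the q = suc Q entries of the list from unfolding.
    E : List Carrier
    E = elems F

    E≡elems : E ≡ elems F
    E≡elems = refl

    length-E : List.length E ≡ q
    length-E = trans (ListP.length-map (Inverse.to enum) (List.allFin q)) (ListP.length-tabulate {n = q} (λ i → i))

    ∈-E : ∀ a → a ∈ E
    ∈-E a = subst (_∈ elems F) (Inverse.strictlyInverseˡ enum a) (∈-map⁺ (Inverse.to enum) (∈-allFin (Inverse.from enum a)))

    unique-E : Unique E
    unique-E = UniqueP.map⁺ enum-injective (UniqueP.allFin⁺ q)

  pts : (m : ℕ) → List (Vec Carrier m)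
  pts = allVecs E

  -- Finite sums and products over the field and over its coordinate spaces

  module Sum {M : Set} {_∙_ : M → M → M} {ε : M} (isCM : IsCommutativeMonoid _≡_ _∙_ ε) where
    private
      monoid : CommutativeMonoid 0ℓ 0ℓ
      monoid = record { isCommutativeMonoid = isCM }
    open CommutativeMonoid monoid using (assoc; comm; identityˡ; identityʳ; commutativeSemigroup)
    open import Algebra.Properties.CommutativeSemigroup commutativeSemigroup using (interchange)
    open ≡-Reasoning

    ΣL : ∀ {A : Set} → List A → (A → M) → M
    ΣL []       g = ε
    ΣL (x ∷ xs) g = g x ∙ ΣL xs g

    ΣC : (Carrier → M) → M
    ΣC = ΣL E

    ΣV : (m : ℕ) → (Vec Carrier m → M) → M
    ΣV m = ΣL (pts m)

    ΣL-cong∈ : ∀ {A : Set} (xs : List A) {g h : A → M} → (∀ {x} → x ∈ xs → g x ≡ h x) → ΣL xs g ≡ ΣL xs h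
    ΣL-cong∈ []       e = refl
    ΣL-cong∈ (x ∷ xs) e = cong₂ _∙_ (e (here refl)) (ΣL-cong∈ xs (λ i → e (there i)))

    ΣL-cong : ∀ {A : Set} (xs : List A) {g h : A → M} → (∀ x → g x ≡ h x) → ΣL xs g ≡ ΣL xs h
    ΣL-cong xs e = ΣL-cong∈ xs (λ {x} _ → e x)

    ΣL-ε : ∀ {A : Set} (xs : List A) → ΣL xs (λ _ → ε) ≡ ε
    ΣL-ε []       = refl
    ΣL-ε (x ∷ xs) = trans (identityˡ _) (ΣL-ε xs)

    ΣL-∙ : ∀ {A : Set} (xs : List A) (g h : A → M) → ΣL xs (λ x → g x ∙ h x) ≡ ΣL xs g ∙ ΣL xs h
    ΣL-∙ []       g h = sym (identityˡ ε)
    ΣL-∙ (x ∷ xs) g h = trans (cong ((g x ∙ h x) ∙_) (ΣL-∙ xs g h)) (interchange _ _ _ _)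

    ΣL-swap : ∀ {A B : Set} (xs : List A) (ys : List B) (g : A → B → M) →
              ΣL xs (λ x → ΣL ys (g x)) ≡ ΣL ys (λ y → ΣL xs (λ x → g x y))
    ΣL-swap []       ys g = sym (ΣL-ε ys)
    ΣL-swap (x ∷ xs) ys g = trans (cong (ΣL ys (g x) ∙_) (ΣL-swap xs ys g)) (sym (ΣL-∙ ys _ _))

    ΣL-map : ∀ {A B : Set} (φ : A → B) (xs : List A) (g : B → M) → ΣL (List.map φ xs) g ≡ ΣL xs (g ∘ φ)
    ΣL-map φ []       g = refl
    ΣL-map φ (x ∷ xs) g = cong (g (φ x) ∙_) (ΣL-map φ xs g)

    ΣL-++ : ∀ {A : Set} (xs ys : List A) (g : A → M) → ΣL (xs List.++ ys) g ≡ ΣL xs g ∙ ΣL ys g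
    ΣL-++ []       ys g = sym (identityˡ _)
    ΣL-++ (x ∷ xs) ys g = trans (cong (g x ∙_) (ΣL-++ xs ys g)) (sym (assoc _ _ _))

    ΣL-concatMap : ∀ {A B : Set} (φ : A → List B) (xs : List A) (g : B → M) →
                   ΣL (List.concatMap φ xs) g ≡ ΣL xs (λ x → ΣL (φ x) g)
    ΣL-concatMap φ []       g = refl
    ΣL-concatMap φ (x ∷ xs) g = trans (ΣL-++ (φ x) _ g) (cong (ΣL (φ x) g ∙_) (ΣL-concatMap φ xs g))

    ΣV-suc : ∀ m (g : Vec Carrier (suc m) → M) → ΣV (suc m) g ≡ ΣC (λ x → ΣV m (λ v → g (x ∷ v)))
    ΣV-suc m g = trans (ΣL-concatMap (λ x → List.map (x ∷_) (pts m)) E g) (ΣL-cong E (λ x → ΣL-map (x ∷_) (pts m) g))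

    ΣV-0 : (g : Vec Carrier 0 → M) → ΣV 0 g ≡ g []
    ΣV-0 g = identityʳ _

    ΣV-1 : (g : Vec Carrier 1 → M) → ΣV 1 g ≡ ΣC (λ x → g (x ∷ []))
    ΣV-1 g = trans (ΣV-suc 0 g) (ΣL-cong E (λ x → ΣV-0 (λ v → g (x ∷ v))))

    -- Says that every element occurs exactly once in the list, in the form in which it is used
    -- under a sum.
    Delta : {A : Set} → DecidableEquality A → List A → Set
    Delta {A} _≟A_ xs = ∀ a (g : A → M) → ΣL xs (λ x → pick (x ≟A a) (g x) ε) ≡ g a

    unique⇒Delta : ∀ {A : Set} (_≟A_ : DecidableEquality A) (xs : List A) → Unique xs → (∀ a → a ∈ xs) → Delta _≟A_ xs
    unique⇒Delta {A} _≟A_ xs u c a g = go xs u (c a)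
      where
      h : A → M
      h x = pick (x ≟A a) (g x) ε
      off : ∀ ys → All (a ≢_) ys → ΣL ys h ≡ ε
      off []       _ = refl
      off (y ∷ ys) (p ∷ ps) with y ≟A a
      ... | yes e = contradiction (sym e) p
      ... | no _  = trans (identityˡ _) (off ys ps)
      go : ∀ ys → Unique ys → a ∈ ys → ΣL ys h ≡ g a
      go (y ∷ ys) (p ∷ ps) (here refl) with a ≟A a
      ... | yes _ = trans (cong (g a ∙_) (off ys p)) (identityʳ _)
      ... | no ¬e = contradiction refl ¬e
      go (y ∷ ys) (p ∷ ps) (there i) with y ≟A a
      ... | yes refl = contradiction refl (All.lookup p i)
      ... | no _ = trans (identityˡ _) (go ys ps i)

    δC : Delta _≟_ E
    δC = unique⇒Delta _≟_ E unique-E ∈-E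

    δV : ∀ m → Delta _≟V_ (pts m)
    δV zero [] g = ΣV-0 (λ x → pick (x ≟V []) (g x) ε)
    δV (suc m) (a ∷ as) g = begin
      ΣV (suc m) (λ x → pick (x ≟V (a ∷ as)) (g x) ε) ≡⟨ ΣV-suc m _ ⟩
      ΣC (λ x → ΣV m (λ v → pick ((x ∷ v) ≟V (a ∷ as)) (g (x ∷ v)) ε)) ≡⟨ ΣL-cong E inner ⟩
      ΣC (λ x → pick (x ≟ a) (g (x ∷ as)) ε) ≡⟨ δC a (λ x → g (x ∷ as)) ⟩
      g (a ∷ as) ∎
      where
      split : ∀ x v (y : M) → pick ((x ∷ v) ≟V (a ∷ as)) y ε ≡ pick (x ≟ a) (pick (v ≟V as) y ε) ε
      split x v y with (x ∷ v) ≟V (a ∷ as) | x ≟ a | v ≟V as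
      ... | yes _ | yes _ | yes _ = refl
      ... | no _  | no _  | _     = refl
      ... | no _  | yes _ | no _  = refl
      ... | no ¬e | yes refl | yes refl = contradiction refl ¬e
      ... | yes e | no ¬e | _     = contradiction (VecP.∷-injectiveˡ e) ¬e
      ... | yes e | yes _ | no ¬e = contradiction (VecP.∷-injectiveʳ e) ¬e
      inner : ∀ x → ΣV m (λ v → pick ((x ∷ v) ≟V (a ∷ as)) (g (x ∷ v)) ε) ≡ pick (x ≟ a) (g (x ∷ as)) ε
      inner x = trans (ΣL-cong (pts m) (λ v → split x v (g (x ∷ v)))) (outer (x ≟ a))
        where
        outer : (d : Dec (x ≡ a)) → ΣV m (λ v → pick d (pick (v ≟V as) (g (x ∷ v)) ε) ε) ≡ pick d (g (x ∷ as)) ε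
        outer (no _)  = ΣL-ε (pts m)
        outer (yes _) = δV m as (λ v → g (x ∷ v))

    -- Both sides are a sum over the graph of φ, taken in the two possible orders.
    reindex : ∀ {A B : Set} (_≟A_ : DecidableEquality A) (xs : List A) → Delta _≟A_ xs →
              (_≟B_ : DecidableEquality B) (ys : List B) → Delta _≟B_ ys →
              (φ : A → B) (ψ : B → A) → (∀ x → ψ (φ x) ≡ x) → (∀ y → φ (ψ y) ≡ y) →
              (g : B → M) → ΣL xs (g ∘ φ) ≡ ΣL ys g
    reindex _≟A_ xs dA _≟B_ ys dB φ ψ l r g = begin
      ΣL xs (g ∘ φ) ≡⟨ ΣL-cong xs (λ x → sym (dB (φ x) g)) ⟩
      ΣL xs (λ x → ΣL ys (λ y → pick (y ≟B φ x) (g y) ε)) ≡⟨ ΣL-swap xs ys _ ⟩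
      ΣL ys (λ y → ΣL xs (λ x → pick (y ≟B φ x) (g y) ε)) ≡⟨ ΣL-cong ys (λ y → ΣL-cong xs (flip y)) ⟩
      ΣL ys (λ y → ΣL xs (λ x → pick (x ≟A ψ y) (g y) ε)) ≡⟨ ΣL-cong ys (λ y → dA (ψ y) (λ _ → g y)) ⟩
      ΣL ys g ∎
      where
      flip : ∀ y x → pick (y ≟B φ x) (g y) ε ≡ pick (x ≟A ψ y) (g y) ε
      flip y x with y ≟B φ x | x ≟A ψ y
      ... | yes _ | yes _ = refl
      ... | no _  | no _  = refl
      ... | yes e | no ¬e = contradiction (trans (sym (l x)) (cong ψ (sym e))) ¬e
      ... | no ¬e | yes e = contradiction (sym (trans (cong φ e) (r y))) ¬e

    reindexC : (φ ψ : Carrier → Carrier) → (∀ x → ψ (φ x) ≡ x) → (∀ y → φ (ψ y) ≡ y) →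
               (g : Carrier → M) → ΣC (g ∘ φ) ≡ ΣC g
    reindexC = reindex _≟_ E δC _≟_ E δC

    reindexV : ∀ m (φ ψ : Vec Carrier m → Vec Carrier m) → (∀ x → ψ (φ x) ≡ x) → (∀ y → φ (ψ y) ≡ y) →
               (g : Vec Carrier m → M) → ΣV m (g ∘ φ) ≡ ΣV m g
    reindexV m = reindex _≟V_ (pts m) (δV m) _≟V_ (pts m) (δV m)

  open Sum +-isCommutativeMonoid public
  module Π = Sum *-isCommutativeMonoid
  module N = Sum ℕP.+-0-isCommutativeMonoid

  ΣL-*ˡ : ∀ {A : Set} (xs : List A) (c : Carrier) (g : A → Carrier) → ΣL xs (λ x → c * g x) ≡ c * ΣL xs g
  ΣL-*ˡ []       c g = sym (zeroʳ c)
  ΣL-*ˡ (x ∷ xs) c g = trans (cong (c * g x +_) (ΣL-*ˡ xs c g)) (sym (distribˡ c _ _))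

  -- Hamming weight and exhaustive search

  nz : Carrier → ℕ
  nz c = pick (c ≟ 0#) 0 1

  nz-0 : ∀ {c} → c ≡ 0# → nz c ≡ 0
  nz-0 {c} e with c ≟ 0#
  ... | yes _ = refl
  ... | no p = contradiction e p

  nz-1 : ∀ {c} → c ≢ 0# → nz c ≡ 1
  nz-1 {c} p with c ≟ 0#
  ... | yes e = contradiction e p
  ... | no _ = refl

  nz≡0 : ∀ {c} → nz c ≡ 0 → c ≡ 0#
  nz≡0 {c} e with c ≟ 0#
  ... | yes p = p

  nz≤1 : ∀ c → nz c ℕ.≤ 1
  nz≤1 c with c ≟ 0#
  ... | yes _ = z≤n
  ... | no _ = s≤s z≤n

  nz-cong : ∀ {a b} → (a ≡ 0# → b ≡ 0#) → (b ≡ 0# → a ≡ 0#) → nz a ≡ nz b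
  nz-cong {a} {b} f g with a ≟ 0# | b ≟ 0#
  ... | yes _ | yes _ = refl
  ... | no _ | no _ = refl
  ... | yes p | no p′ = contradiction (f p) p′
  ... | no p | yes p′ = contradiction (g p′) p

  wt : ∀ {m} → Fun F m → ℕ
  wt {m} f = N.ΣV m (λ p → nz (f p))

  weight≡wt : ∀ {m} (f : Fun F m) → weight F f ≡ wt f
  weight≡wt {m} f = trans (cong (λ e → List.length (List.filter (λ x → ¬? (f x ≟ 0#)) (allVecs e m))) (sym E≡elems)) (go (pts m))
    where
    go : ∀ xs → List.length (List.filter (λ x → ¬? (f x ≟ 0#)) xs) ≡ N.ΣL xs (λ p → nz (f p))
    go [] = refl
    go (x ∷ xs) with f x ≟ 0#
    ... | yes _ = go xs
    ... | no _ = cong suc (go xs)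

  ΣN-mono : ∀ {A : Set} (xs : List A) {g h : A → ℕ} → (∀ x → g x ℕ.≤ h x) → N.ΣL xs g ℕ.≤ N.ΣL xs h
  ΣN-mono [] e = z≤n
  ΣN-mono (x ∷ xs) e = ℕP.+-mono-≤ (e x) (ΣN-mono xs e)

  ΣN-const : ∀ {A : Set} (xs : List A) c → N.ΣL xs (λ _ → c) ≡ List.length xs ℕ.* c
  ΣN-const [] c = refl
  ΣN-const (x ∷ xs) c = cong (c ℕ.+_) (ΣN-const xs c)

  ΣNC-const : ∀ c → N.ΣC (λ _ → c) ≡ q ℕ.* c
  ΣNC-const c = trans (ΣN-const E c) (cong (ℕ._* c) length-E)

  wt-suc : ∀ {m} (f : Fun F (suc m)) → wt f ≡ N.ΣC (λ x → wt (λ v → f (x ∷ v)))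
  wt-suc {m} f = N.ΣV-suc m _

  wt-cong : ∀ {m} {f g : Fun F m} → (∀ p → f p ≡ g p) → wt f ≡ wt g
  wt-cong {m} e = N.ΣL-cong (pts m) (λ p → cong nz (e p))

  wt-≡0 : ∀ {m} {f : Fun F m} → (∀ p → f p ≡ 0#) → wt f ≡ 0
  wt-≡0 {m} e = trans (N.ΣL-cong (pts m) (λ p → nz-0 (e p))) (N.ΣL-ε (pts m))

  term≤ΣV : ∀ m (g : Vec Carrier m → ℕ) p → g p ℕ.≤ N.ΣV m g
  term≤ΣV m g p = ℕP.≤-trans (ℕP.≤-reflexive (sym (N.δV m p g))) (ΣN-mono (pts m) le)
    where
    le : ∀ x → pick (x ≟V p) (g x) 0 ℕ.≤ g x
    le x with x ≟V p
    ... | yes _ = ℕP.≤-refl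
    ... | no _ = z≤n

  wt-pos : ∀ {m} {f : Fun F m} p → f p ≢ 0# → 1 ℕ.≤ wt f
  wt-pos {m} {f} p z = ℕP.≤-trans (ℕP.≤-reflexive (sym (nz-1 z))) (term≤ΣV m (λ p → nz (f p)) p)

  ∃C? : {P : Carrier → Set} → (∀ x → Dec (P x)) → (∃ λ x → P x) ⊎ (∀ x → ¬ P x)
  ∃C? {P} P? with go E
    where
    go : ∀ xs → (∃ λ x → P x) ⊎ (∀ x → x ∈ xs → ¬ P x)
    go [] = inj₂ λ _ ()
    go (x ∷ xs) with P? x
    ... | yes p = inj₁ (x , p)
    ... | no ¬p with go xs
    ... | inj₁ r = inj₁ r
    ... | inj₂ n = inj₂ λ { y (here refl) → ¬p ; y (there i) → n y i }
  ... | inj₁ r = inj₁ r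
  ... | inj₂ n = inj₂ λ x → n x (∈-E x)

  ∃V? : ∀ m {P : Vec Carrier m → Set} → (∀ x → Dec (P x)) → (∃ λ x → P x) ⊎ (∀ x → ¬ P x)
  ∃V? zero P? with P? []
  ... | yes p = inj₁ ([] , p)
  ... | no ¬p = inj₂ λ { [] → ¬p }
  ∃V? (suc m) {P} P? with ∃C? dec
    where
    dec : ∀ x → Dec (∃ λ v → P (x ∷ v))
    dec x with ∃V? m (λ v → P? (x ∷ v))
    ... | inj₁ r = yes r
    ... | inj₂ n = no λ { (v , p) → n v p }
  ... | inj₁ (x , v , p) = inj₁ (x ∷ v , p)
  ... | inj₂ n = inj₂ λ { (x ∷ v) p → n x (v , p) }

  zero? : ∀ {m} (f : Fun F m) → (∀ p → f p ≡ 0#) ⊎ (∃ λ p → f p ≢ 0#)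
  zero? {m} f with ∃V? m (λ p → ¬? (f p ≟ 0#))
  ... | inj₁ r = inj₂ r
  ... | inj₂ n = inj₁ λ p → go p
    where
    go : ∀ p → f p ≡ 0#
    go p with f p ≟ 0#
    ... | yes e = e
    ... | no ¬e = ⊥-elim (n p ¬e)

  -- Univariate polynomials

  Seq : Set
  Seq = ℕ → Carrier

  ev : ℕ → Seq → Carrier → Carrier
  ev zero    c x = 0#
  ev (suc n) c x = c 0 + x * ev n (c ∘ suc) x

  ev-cong : ∀ n {c d : Seq} x → (∀ i → i < n → c i ≡ d i) → ev n c x ≡ ev n d x
  ev-cong zero    x e = refl
  ev-cong (suc n) x e = cong₂ (λ a b → a + x * b) (e 0 (s≤s z≤n)) (ev-cong n x (λ i i<n → e (suc i) (s≤s i<n)))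

  ev-+ : ∀ n (c d : Seq) x → ev n (λ i → c i + d i) x ≡ ev n c x + ev n d x
  ev-+ zero    c d x = sym (+-identityˡ 0#)
  ev-+ (suc n) c d x = trans (cong (λ z → c 0 + d 0 + x * z) (ev-+ n (c ∘ suc) (d ∘ suc) x))
    (solve 5 (λ a b x u v → a :+ b :+ x :* (u :+ v) := (a :+ x :* u) :+ (b :+ x :* v)) refl _ _ _ _ _)

  ev-* : ∀ n a (c : Seq) x → ev n (λ i → a * c i) x ≡ a * ev n c x
  ev-* zero    a c x = sym (zeroʳ a)
  ev-* (suc n) a c x = trans (cong (λ z → a * c 0 + x * z) (ev-* n a (c ∘ suc) x))
    (solve 4 (λ a c x u → a :* c :+ x :* (a :* u) := a :* (c :+ x :* u)) refl _ _ _ _)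

  ev-0 : ∀ n (c : Seq) x → (∀ i → i < n → c i ≡ 0#) → ev n c x ≡ 0#
  ev-0 zero    c x e = refl
  ev-0 (suc n) c x e = trans (cong₂ (λ a b → a + x * b) (e 0 (s≤s z≤n)) (ev-0 n (c ∘ suc) x (λ i l → e (suc i) (s≤s l))))
    (solve 1 (λ x → con (0 , 0) :+ x :* con (0 , 0) := con (0 , 0)) refl x)

  ev-last : ∀ n (c : Seq) x → ev (suc n) c x ≡ ev n c x + c n * pow F x n
  ev-last zero    c x = solve 2 (λ c x → c :+ x :* con (0 , 0) := con (0 , 0) :+ c :* con (1 , 0)) refl (c 0) x
  ev-last (suc n) c x = trans (cong (λ z → c 0 + x * z) (ev-last n (c ∘ suc) x))
    (solve 5 (λ c x u d p → c :+ x :* (u :+ d :* p) := (c :+ x :* u) :+ d :* (x :* p)) refl _ _ _ _ _)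

  ev-extend : ∀ n k (c : Seq) x → n ≤ k → (∀ i → n ≤ i → c i ≡ 0#) → ev k c x ≡ ev n c x
  ev-extend zero k c x _ e = ev-0 k c x (λ i _ → e i z≤n)
  ev-extend (suc n) (suc k) c x (s≤s n≤k) e = cong (λ z → c 0 + x * z) (ev-extend n k (c ∘ suc) x n≤k (λ i l → e (suc i) (s≤s l)))

  unit : ℕ → Seq
  unit zero    zero    = 1#
  unit zero    (suc i) = 0#
  unit (suc k) zero    = 0#
  unit (suc k) (suc i) = unit k i

  ev-unit : ∀ n k x → k < n → ev n (unit k) x ≡ pow F x k
  ev-unit (suc n) zero x _ = trans (cong (λ z → 1# + x * z) (ev-0 n _ x (λ _ _ → refl)))
    (solve 1 (λ x → con (1 , 0) :+ x :* con (0 , 0) := con (1 , 0)) refl x)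
  ev-unit (suc n) (suc k) x (s≤s l) = trans (+-identityˡ _) (cong (x *_) (ev-unit n k x l))

  -- Synthetic division by X - a.
  quo : ℕ → Seq → Carrier → Seq
  quo zero    c a i       = 0#
  quo (suc n) c a zero    = ev n (c ∘ suc) a
  quo (suc n) c a (suc i) = quo n (c ∘ suc) a i

  ev-quo : ∀ n (c : Seq) a x → ev (suc n) c x ≡ ev (suc n) c a + (x - a) * ev n (quo (suc n) c a) x
  ev-quo zero    c a x = solve 3 (λ c a x → c :+ x :* con (0 , 0) := c :+ a :* con (0 , 0) :+ (x :- a) :* con (0 , 0)) refl (c 0) a x
  ev-quo (suc n) c a x = trans (cong (λ z → c 0 + x * z) (ev-quo n (c ∘ suc) a x))
    (solve 5 (λ c a x e v → c :+ x :* (e :+ (x :- a) :* v) := c :+ a :* e :+ (x :- a) :* (e :+ x :* v)) refl _ _ _ _ _)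

  quo≡0⇒≡0 : ∀ n (c : Seq) a → (∀ i → i < n → quo (suc n) c a i ≡ 0#) → ev (suc n) c a ≡ 0# → ∀ i → i < suc n → c i ≡ 0#
  quo≡0⇒≡0 zero c a e z zero _ = trans (solve 2 (λ c a → c := c :+ a :* con (0 , 0)) refl (c 0) a) z
  quo≡0⇒≡0 zero c a e z (suc i) (s≤s ())
  quo≡0⇒≡0 (suc n) c a e z zero _ =
    trans (solve 2 (λ c a → c := c :+ a :* con (0 , 0)) refl (c 0) a)
    (trans (cong (λ w → c 0 + a * w) (sym (e 0 (s≤s z≤n)))) z)
  quo≡0⇒≡0 (suc n) c a e z (suc i) (s≤s l) =
    quo≡0⇒≡0 n (c ∘ suc) a (λ j j<n → e (suc j) (s≤s j<n)) (e 0 (s≤s z≤n)) i l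

  roots : ∀ n (c : Seq) (xs : List Carrier) → Unique xs → n ≤ List.length xs → (∀ {x} → x ∈ xs → ev n c x ≡ 0#) →
          ∀ i → i < n → c i ≡ 0#
  roots zero c xs _ _ _ i ()
  roots (suc n) c (a ∷ xs) (p ∷ u) (s≤s l) z =
    quo≡0⇒≡0 n c a (roots n (quo (suc n) c a) xs u l z′) (z (here refl))
    where
    z′ : ∀ {x} → x ∈ xs → ev n (quo (suc n) c a) x ≡ 0#
    z′ {x} i = *≡0 (λ e → All.lookup p i (sym (-≡0⇒≡ e)))
      (begin
        (x - a) * ev n (quo (suc n) c a) x ≡⟨ sym (+-identityˡ _) ⟩
        0# + (x - a) * ev n (quo (suc n) c a) x ≡⟨ cong (_+ (x - a) * ev n (quo (suc n) c a) x) (sym (z (here refl))) ⟩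
        ev (suc n) c a + (x - a) * ev n (quo (suc n) c a) x ≡⟨ sym (ev-quo n c a x) ⟩
        ev (suc n) c x ≡⟨ z (there i) ⟩
        0# ∎)
      where open ≡-Reasoning

  ev≡0⇒≡0 : ∀ n (c : Seq) → n ≤ q → (∀ x → ev n c x ≡ 0#) → ∀ i → i < n → c i ≡ 0#
  ev≡0⇒≡0 n c n≤q z = roots n c E unique-E (subst (n ≤_) (sym length-E) n≤q) (λ {x} _ → z x)

  ev-inj : ∀ n (c d : Seq) → n ≤ q → (∀ x → ev n c x ≡ ev n d x) → ∀ i → i < n → c i ≡ d i
  ev-inj n c d n≤q e i l = -≡0⇒≡ (trans (solve 2 (λ a b → a :- b := a :+ :- con (1 , 0) :* b) refl (c i) (d i))
    (ev≡0⇒≡0 n (λ i → c i + - 1# * d i) n≤q (λ x → trans (ev-+ n c (λ i → - 1# * d i) x)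
      (trans (cong (ev n c x +_) (ev-* n (- 1#) d x))
      (trans (cong (λ z → z + - 1# * ev n d x) (e x)) (solve 1 (λ a → a :+ :- con (1 , 0) :* a := con (0 , 0)) refl _)))) i l))

  -- Power sums

  1≤Q : 1 ≤ Q
  1≤Q = ℕP.≤-trans (s≤s z≤n) 3≤Q

  pow-* : ∀ x y n → pow F (x * y) n ≡ pow F x n * pow F y n
  pow-* x y zero    = sym (*-identityˡ 1#)
  pow-* x y (suc n) = trans (cong (x * y *_) (pow-* x y n))
    (solve 4 (λ x y a b → x :* y :* (a :* b) := x :* a :* (y :* b)) refl _ _ _ _)

  Π-const : ∀ (xs : List Carrier) x → Π.ΣL xs (λ _ → x) ≡ pow F x (List.length xs)
  Π-const []       x = refl
  Π-const (_ ∷ xs) x = cong (x *_) (Π-const xs x)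

  Π≢0 : ∀ (xs : List Carrier) (g : Carrier → Carrier) → (∀ x → g x ≢ 0#) → Π.ΣL xs g ≢ 0#
  Π≢0 []       g n = λ e → 0≢1 (sym e)
  Π≢0 (x ∷ xs) g n = *≢0 (n x) (Π≢0 xs g n)

  1≢0 : 1# ≢ 0#
  1≢0 e = 0≢1 (sym e)

  -- Multiplication by x permutes the nonzero elements, hence preserves their product. They enter
  -- through `g`, which is 1 at 0.
  fermat : ∀ {x} → x ≢ 0# → pow F x Q ≡ 1#
  fermat {x} x≢0 = trans (sym Πh) (*-cancelˡ Πg≢0 (trans (*-comm _ _) (trans mul (sym (*-identityʳ _)))))
    where
    g h : Carrier → Carrier
    g y = pick (y ≟ 0#) 1# y
    h y = pick (y ≟ 0#) 1# x
    Πg≢0 : Π.ΣC g ≢ 0#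
    Πg≢0 = Π≢0 E g n
      where
      n : ∀ y → g y ≢ 0#
      n y with y ≟ 0#
      ... | yes _ = 1≢0
      ... | no p = p
    mul : Π.ΣC h * Π.ΣC g ≡ Π.ΣC g
    mul = trans (sym (Π.ΣL-∙ E h g)) (trans (Π.ΣL-cong E hg) (Π.reindexC (x *_) (inv x *_) l r g))
      where
      l : ∀ y → inv x * (x * y) ≡ y
      l y = trans (sym (*-assoc _ _ _)) (trans (cong (_* y) (inv-l x≢0)) (*-identityˡ y))
      r : ∀ y → x * (inv x * y) ≡ y
      r y = trans (sym (*-assoc _ _ _)) (trans (cong (_* y) (inv-r x≢0)) (*-identityˡ y))
      hg : ∀ y → h y * g y ≡ g (x * y)
      hg y with y ≟ 0# | (x * y) ≟ 0#
      ... | yes _ | yes _ = *-identityˡ 1#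
      ... | no _ | no _ = refl
      ... | yes refl | no p = contradiction (zeroʳ x) p
      ... | no p | yes e = contradiction (*≡0 x≢0 e) p
    Πh : Π.ΣC h ≡ pow F x Q
    -- An extra factor x at y = 0 completes the product to all q elements, giving x^q; then one x is
    -- cancelled.
    Πh = *-cancelˡ x≢0 (begin
      x * Π.ΣC h ≡⟨ cong (_* Π.ΣC h) (sym (Π.δC 0# (λ _ → x))) ⟩
      Π.ΣC (λ y → pick (y ≟ 0#) x 1#) * Π.ΣC h ≡⟨ sym (Π.ΣL-∙ E _ h) ⟩
      Π.ΣC (λ y → pick (y ≟ 0#) x 1# * h y) ≡⟨ Π.ΣL-cong E one ⟩
      Π.ΣC (λ _ → x) ≡⟨ Π-const E x ⟩
      pow F x (List.length E) ≡⟨ cong (pow F x) length-E ⟩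
      x * pow F x Q ∎)
      where
      open ≡-Reasoning
      one : ∀ y → pick (y ≟ 0#) x 1# * h y ≡ x
      one y with y ≟ 0#
      ... | yes _ = *-identityʳ x
      ... | no _ = *-identityˡ x

  pow-0 : ∀ n → 1 ≤ n → pow F 0# n ≡ 0#
  pow-0 (suc n) _ = zeroˡ _

  pow-q : ∀ x → pow F x q ≡ x
  pow-q x with x ≟ 0#
  ... | yes refl = zeroˡ _
  ... | no p = trans (cong (x *_) (fermat p)) (*-identityʳ x)

  -- Translation by 1 permutes the field, so adding 1 to each of the q terms does not change the sum
  -- of all elements.
  Σ-1 : ΣC (λ _ → 1#) ≡ 0#
  Σ-1 = sym (trans (sym (-‿inverseˡ S)) (trans (cong (- S +_) shift) (solve 2 (λ s t → :- s :+ (s :+ t) := t) refl S _)))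
    where
    S : Carrier
    S = ΣC (λ x → x)
    shift : S ≡ S + ΣC (λ _ → 1#)
    shift = trans (sym (reindexC (_+ 1#) (_- 1#) (λ x → solve 1 (λ x → x :+ con (1 , 0) :- con (1 , 0) := x) refl x)
        (λ x → solve 1 (λ x → x :- con (1 , 0) :+ con (1 , 0) := x) refl x) (λ x → x)))
      (ΣL-∙ E (λ x → x) (λ _ → 1#))

  -- Scaling by a multiplies the sum by a^i, which settles the matter if some a ≠ 0 has a^i ≠ 1.
  -- Otherwise x^(i+1) - x vanishes everywhere, although its degree is less than q.
  Σ-pow : ∀ i → i < Q → ΣC (λ x → pow F x i) ≡ 0#
  Σ-pow zero _ = Σ-1
  Σ-pow i@(suc j) i<Q with ∃C? {P = λ a → a ≢ 0# × pow F a i ≢ 1#} dec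
    where
    dec : ∀ a → Dec (a ≢ 0# × pow F a i ≢ 1#)
    dec a with a ≟ 0# | pow F a i ≟ 1#
    ... | no p | no p′ = yes (p , p′)
    ... | yes e | _ = no λ { (p , _) → p e }
    ... | _ | yes e = no λ { (_ , p) → p e }
  ... | inj₁ (a , a≢0 , ai≢1) = *≡0 {pow F a i - 1#} (λ e → ai≢1 (-≡0⇒≡ e)) (begin
      (pow F a i - 1#) * S ≡⟨ solve 2 (λ p s → (p :- con (1 , 0)) :* s := p :* s :- s) refl _ S ⟩
      pow F a i * S - S ≡⟨ cong (_- S) (sym (ΣL-*ˡ E _ _)) ⟩
      ΣC (λ x → pow F a i * pow F x i) - S ≡⟨ cong (_- S) (ΣL-cong E (λ x → sym (pow-* a x i))) ⟩
      ΣC (λ x → pow F (a * x) i) - S ≡⟨ cong (_- S) (reindexC (a *_) (inv a *_) l r (λ x → pow F x i)) ⟩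
      S - S ≡⟨ -‿inverseʳ S ⟩
      0# ∎)
    where
    open ≡-Reasoning
    S : Carrier
    S = ΣC (λ x → pow F x i)
    l : ∀ y → inv a * (a * y) ≡ y
    l y = trans (sym (*-assoc _ _ _)) (trans (cong (_* y) (inv-l a≢0)) (*-identityˡ y))
    r : ∀ y → a * (inv a * y) ≡ y
    r y = trans (sym (*-assoc _ _ _)) (trans (cong (_* y) (inv-r a≢0)) (*-identityˡ y))
  ... | inj₂ none = contradiction lead 1≢0
    where
    c : Seq
    c k = unit (suc i) k + - 1# * unit 1 k
    vanish : ∀ x → ev (suc (suc i)) c x ≡ 0#
    vanish x = trans (ev-+ (suc (suc i)) (unit (suc i)) (λ k → - 1# * unit 1 k) x) (trans (cong₂ _+_ (ev-unit (suc (suc i)) (suc i) x ℕP.≤-refl)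
      (trans (ev-* (suc (suc i)) (- 1#) (unit 1) x) (cong (- 1# *_) (ev-unit (suc (suc i)) 1 x (s≤s (s≤s z≤n)))))) go)
      where
      go : x * pow F x i + - 1# * (x * 1#) ≡ 0#
      go with x ≟ 0#
      ... | yes refl = solve 1 (λ u → con (0 , 0) :* u :+ :- con (1 , 0) :* (con (0 , 0) :* con (1 , 0)) := con (0 , 0)) refl _
      ... | no p with pow F x i ≟ 1#
      ... | yes e = trans (cong (λ u → x * u + - 1# * (x * 1#)) e) (solve 1 (λ x → x :* con (1 , 0) :+ :- con (1 , 0) :* (x :* con (1 , 0)) := con (0 , 0)) refl x)
      ... | no ne = ⊥-elim (none x (p , ne))
    unit-self : ∀ k → unit k k ≡ 1#
    unit-self zero = refl
    unit-self (suc k) = unit-self k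
    lead : 1# ≡ 0#
    lead = trans (trans (solve 0 (con (1 , 0) := con (1 , 0) :+ :- con (1 , 0) :* con (0 , 0)) refl)
      (cong (_+ - 1# * 0#) (sym (unit-self j)))) (ev≡0⇒≡0 (suc (suc i)) c (s≤s i<Q) vanish (suc i) ℕP.≤-refl)

  Σ-pow-Q : ΣC (λ x → pow F x Q) ≡ - 1#
  Σ-pow-Q = begin
    ΣC (λ x → pow F x Q) ≡⟨ ΣL-cong E pt ⟩
    ΣC (λ x → 1# + pick (x ≟ 0#) (- 1#) 0#) ≡⟨ ΣL-∙ E _ _ ⟩
    ΣC (λ _ → 1#) + ΣC (λ x → pick (x ≟ 0#) (- 1#) 0#) ≡⟨ cong₂ _+_ Σ-1 (δC 0# (λ _ → - 1#)) ⟩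
    0# + - 1# ≡⟨ +-identityˡ _ ⟩
    - 1# ∎
    where
    open ≡-Reasoning
    pt : ∀ x → pow F x Q ≡ 1# + pick (x ≟ 0#) (- 1#) 0#
    pt x with x ≟ 0#
    ... | yes refl = trans (pow-0 Q 1≤Q) (sym (-‿inverseʳ 1#))
    ... | no p = trans (fermat p) (sym (+-identityʳ 1#))

  Σ-ev : ∀ n (c : Seq) → n ≤ Q → ΣC (ev n c) ≡ 0#
  Σ-ev zero    c _ = ΣL-ε E
  Σ-ev (suc n) c n<Q = begin
    ΣC (ev (suc n) c) ≡⟨ ΣL-cong E (ev-last n c) ⟩
    ΣC (λ x → ev n c x + c n * pow F x n) ≡⟨ ΣL-∙ E _ _ ⟩
    ΣC (ev n c) + ΣC (λ x → c n * pow F x n) ≡⟨ cong₂ _+_ (Σ-ev n c (ℕP.<⇒≤ n<Q)) (trans (ΣL-*ˡ E (c n) _) (cong (c n *_) (Σ-pow n n<Q))) ⟩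
    0# + c n * 0# ≡⟨ solve 1 (λ a → con (0 , 0) :+ a :* con (0 , 0) := con (0 , 0)) refl (c n) ⟩
    0# ∎
    where open ≡-Reasoning

  -- Summation over a line reads off the coefficient of x^(q-1); this is why a projection lowers the
  -- degree by q - 1.
  Σ-ev-q : ∀ (c : Seq) → ΣC (ev q c) ≡ - c Q
  Σ-ev-q c = begin
    ΣC (ev q c) ≡⟨ ΣL-cong E (ev-last Q c) ⟩
    ΣC (λ x → ev Q c x + c Q * pow F x Q) ≡⟨ ΣL-∙ E _ _ ⟩
    ΣC (ev Q c) + ΣC (λ x → c Q * pow F x Q) ≡⟨ cong₂ _+_ (Σ-ev Q c ℕP.≤-refl) (trans (ΣL-*ˡ E (c Q) _) (cong (c Q *_) Σ-pow-Q)) ⟩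
    0# + c Q * - 1# ≡⟨ solve 1 (λ a → con (0 , 0) :+ a :* :- con (1 , 0) := :- a) refl (c Q) ⟩
    - c Q ∎
    where open ≡-Reasoning

  -- Vectors, affine functions and affine maps

  V : ℕ → Set
  V = Vec Carrier

  infixl 6 _⊞_
  infixr 7 _·_
  _⊞_ : ∀ {m} → V m → V m → V m
  _⊞_ = _⊕_ F
  _·_ : ∀ {m} → Carrier → V m → V m
  _·_ = scale F
  0V : ∀ {m} → V m
  0V = zeroV F

  ⊞-assoc : ∀ {m} (u v w : V m) → (u ⊞ v) ⊞ w ≡ u ⊞ (v ⊞ w)
  ⊞-assoc = VecP.zipWith-assoc +-assoc
  ⊞-comm : ∀ {m} (u v : V m) → u ⊞ v ≡ v ⊞ u
  ⊞-comm = VecP.zipWith-comm +-comm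
  ⊞-identityˡ : ∀ {m} (v : V m) → 0V ⊞ v ≡ v
  ⊞-identityˡ = VecP.zipWith-identityˡ +-identityˡ
  ⊞-identityʳ : ∀ {m} (v : V m) → v ⊞ 0V ≡ v
  ⊞-identityʳ = VecP.zipWith-identityʳ +-identityʳ
  0· : ∀ {m} (v : V m) → 0# · v ≡ 0V
  0· []      = refl
  0· (x ∷ v) = cong₂ _∷_ (zeroˡ x) (0· v)
  1· : ∀ {m} (v : V m) → 1# · v ≡ v
  1· []      = refl
  1· (x ∷ v) = cong₂ _∷_ (*-identityˡ x) (1· v)
  ·0V : ∀ {m} c → c · 0V {m} ≡ 0V
  ·0V {zero}  c = refl
  ·0V {suc m} c = cong₂ _∷_ (zeroʳ c) (·0V c)
  ·-⊞ : ∀ {m} c (u v : V m) → c · (u ⊞ v) ≡ c · u ⊞ c · v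
  ·-⊞ c []      []      = refl
  ·-⊞ c (x ∷ u) (y ∷ v) = cong₂ _∷_ (distribˡ c x y) (·-⊞ c u v)
  +-· : ∀ {m} a b (v : V m) → (a + b) · v ≡ a · v ⊞ b · v
  +-· a b []      = refl
  +-· a b (x ∷ v) = cong₂ _∷_ (distribʳ x a b) (+-· a b v)
  *-· : ∀ {m} a b (v : V m) → (a * b) · v ≡ a · (b · v)
  *-· a b []      = refl
  *-· a b (x ∷ v) = cong₂ _∷_ (*-assoc a b x) (*-· a b v)
  ⊞-inverseʳ : ∀ {m} (v : V m) → v ⊞ - 1# · v ≡ 0V
  ⊞-inverseʳ []      = refl
  ⊞-inverseʳ (x ∷ v) = cong₂ _∷_ (solve 1 (λ x → x :+ :- con (1 , 0) :* x := con (0 , 0)) refl x) (⊞-inverseʳ v)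
  ⊞-cancel : ∀ {m} (u v : V m) → u ⊞ (v ⊞ - 1# · u) ≡ v
  ⊞-cancel []      []      = refl
  ⊞-cancel (x ∷ u) (y ∷ v) = cong₂ _∷_ (solve 2 (λ x y → x :+ (y :+ :- con (1 , 0) :* x) := y) refl x y) (⊞-cancel u v)
  ⊞-interchange : ∀ {m} (a b c d : V m) → (a ⊞ b) ⊞ (c ⊞ d) ≡ (a ⊞ c) ⊞ (b ⊞ d)
  ⊞-interchange []      []      []      []      = refl
  ⊞-interchange (a ∷ u) (b ∷ v) (c ∷ w) (d ∷ z) =
    cong₂ _∷_ (solve 4 (λ a b c d → (a :+ b) :+ (c :+ d) := (a :+ c) :+ (b :+ d)) refl a b c d) (⊞-interchange u v w z)

  record IsAff {m} (a : Fun F m) : Set where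
    constructor mkAff
    field
      lin : Fun F m
      add : ∀ p v → a (p ⊞ v) ≡ a p + lin v
      hom : ∀ c v → lin (c · v) ≡ c * lin v

  record AffMap (k m : ℕ) : Set where
    constructor mkMap
    field
      app : V k → V m
      lin : V k → V m
      add : ∀ p v → app (p ⊞ v) ≡ app p ⊞ lin v
      hom : ∀ c v → lin (c · v) ≡ c · lin v
  open AffMap public using (app)

  aff-∘ : ∀ {k m} {a : Fun F m} → IsAff a → (φ : AffMap k m) → IsAff (λ p → a (app φ p))
  aff-∘ {a = a} A φ = mkAff (λ v → A.lin (φ.lin v))
    (λ p v → trans (cong a (φ.add p v)) (A.add _ _))
    (λ c v → trans (cong A.lin (φ.hom c v)) (A.hom _ _))
    where
    module A = IsAff A
    module φ = AffMap φ

  map-∘ : ∀ {j k m} → AffMap k m → AffMap j k → AffMap j m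
  map-∘ φ ψ = mkMap (λ p → φ.app (ψ.app p)) (λ v → φ.lin (ψ.lin v))
    (λ p v → trans (cong φ.app (ψ.add p v)) (φ.add _ _))
    (λ c v → trans (cong φ.lin (ψ.hom c v)) (φ.hom _ _))
    where
    module φ = AffMap φ
    module ψ = AffMap ψ

  map-id : ∀ {m} → AffMap m m
  map-id = mkMap (λ p → p) (λ p → p) (λ _ _ → refl) (λ _ _ → refl)

  aff-const : ∀ {m} c → IsAff {m} (λ _ → c)
  aff-const c = mkAff (λ _ → 0#) (λ _ _ → sym (+-identityʳ c)) (λ c _ → sym (zeroʳ c))

  aff-+ : ∀ {m} {a b : Fun F m} → IsAff a → IsAff b → IsAff (λ p → a p + b p)
  aff-+ A B = mkAff (λ v → A.lin v + B.lin v)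
    (λ p v → trans (cong₂ _+_ (A.add p v) (B.add p v)) (solve 4 (λ a b c d → (a :+ b) :+ (c :+ d) := (a :+ c) :+ (b :+ d)) refl _ _ _ _))
    (λ c v → trans (cong₂ _+_ (A.hom c v) (B.hom c v)) (sym (distribˡ c _ _)))
    where
    module A = IsAff A
    module B = IsAff B

  aff-* : ∀ {m} c {a : Fun F m} → IsAff a → IsAff (λ p → c * a p)
  aff-* c A = mkAff (λ v → c * A.lin v)
    (λ p v → trans (cong (c *_) (A.add p v)) (distribˡ c _ _))
    (λ d v → trans (cong (c *_) (A.hom d v)) (solve 3 (λ c d x → c :* (d :* x) := d :* (c :* x)) refl c d _))
    where module A = IsAff A

  aff-cong : ∀ {m} {a b : Fun F m} → IsAff a → (∀ p → b p ≡ a p) → IsAff b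
  aff-cong A e = mkAff (IsAff.lin A) (λ p v → trans (e (p ⊞ v)) (trans (IsAff.add A p v) (cong (_+ IsAff.lin A v) (sym (e p))))) (IsAff.hom A)

  head : ∀ {m} → V (suc m) → Carrier
  head (x ∷ _) = x

  tail : ∀ {m} → V (suc m) → V m
  tail (_ ∷ v) = v

  aff-head : ∀ {m} → IsAff {suc m} head
  aff-head = mkAff head (λ { (x ∷ p) (y ∷ v) → refl }) (λ { c (y ∷ v) → refl })

  map-tail : ∀ {m} → AffMap (suc m) m
  map-tail = mkMap tail tail (λ { (x ∷ p) (y ∷ v) → refl }) (λ { c (y ∷ v) → refl })

  map-∷ : ∀ {k m} {a : Fun F k} → IsAff a → AffMap k m → AffMap k (suc m)
  map-∷ {a = a} A φ = mkMap (λ p → a p ∷ app φ p) (λ v → IsAff.lin A v ∷ AffMap.lin φ v)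
    (λ p v → cong₂ _∷_ (IsAff.add A p v) (AffMap.add φ p v)) (λ c v → cong₂ _∷_ (IsAff.hom A c v) (AffMap.hom φ c v))

  map-[] : ∀ {k} → AffMap k 0
  map-[] = mkMap (λ _ → []) (λ _ → []) (λ _ _ → refl) (λ _ _ → refl)

  map-line : ∀ {m} → V m → V m → AffMap 1 m
  map-line p w = mkMap (λ ξ → p ⊞ head ξ · w) (λ ξ → head ξ · w)
    (λ { (x ∷ []) (y ∷ []) → trans (cong (p ⊞_) (+-· x y w)) (sym (⊞-assoc p _ _)) })
    (λ { c (x ∷ []) → *-· c x w })

  map-translate : ∀ {m} → V m → AffMap m m
  map-translate p = mkMap (p ⊞_) (λ v → v) (λ u v → sym (⊞-assoc p u v)) (λ _ _ → refl)

  aff-split : ∀ {m} {a : Fun F (suc m)} (A : IsAff a) x z → a (x ∷ z) ≡ a (0# ∷ z) + IsAff.lin A (1# ∷ 0V) * x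
  aff-split {a = a} A x z = begin
    a (x ∷ z) ≡⟨ cong a (cong₂ _∷_ (sym (trans (+-identityˡ _) (*-identityʳ x))) (sym (trans (cong (z ⊞_) (·0V x)) (⊞-identityʳ z)))) ⟩
    a ((0# ∷ z) ⊞ x · (1# ∷ 0V)) ≡⟨ IsAff.add A _ _ ⟩
    a (0# ∷ z) + IsAff.lin A (x · (1# ∷ 0V)) ≡⟨ cong (a (0# ∷ z) +_) (trans (IsAff.hom A _ _) (*-comm _ _)) ⟩
    a (0# ∷ z) + IsAff.lin A (1# ∷ 0V) * x ∎
    where open ≡-Reasoning

  map-at : ∀ {m} → Carrier → AffMap m (suc m)
  map-at x = map-∷ (aff-const x) map-id

  -- Functions of bounded degree

  -- D n f: f has degree less than n.
  data D {m : ℕ} : ℕ → Fun F m → Set where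
    dzero  : ∀ {n f} → (∀ p → f p ≡ 0#) → D n f
    dconst : ∀ {n f} c → (∀ p → f p ≡ c) → D (suc n) f
    dadd   : ∀ {n f g h} → D n g → D n h → (∀ p → f p ≡ g p + h p) → D n f
    dmul   : ∀ {n f a g} → IsAff a → D n g → (∀ p → f p ≡ a p * g p) → D (suc n) f

  D-cong : ∀ {m n} {f g : Fun F m} → D n f → (∀ p → g p ≡ f p) → D n g
  D-cong (dzero z)      e = dzero (λ p → trans (e p) (z p))
  D-cong (dconst c z)   e = dconst c (λ p → trans (e p) (z p))
  D-cong (dadd d d′ z)  e = dadd d d′ (λ p → trans (e p) (z p))
  D-cong (dmul a d z)   e = dmul a d (λ p → trans (e p) (z p))

  D-mono : ∀ {m n k} {f : Fun F m} → n ≤ k → D n f → D k f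
  D-mono l (dzero z) = dzero z
  D-mono (s≤s l) (dconst c z) = dconst c z
  D-mono l (dadd d d′ z) = dadd (D-mono l d) (D-mono l d′) z
  D-mono (s≤s l) (dmul a d z) = dmul a (D-mono l d) z

  D-cast : ∀ {m n k} {f : Fun F m} → n ≡ k → D n f → D k f
  D-cast refl d = d

  D-0 : ∀ {m} {f : Fun F m} → D 0 f → ∀ p → f p ≡ 0#
  D-0 (dzero z) p = z p
  D-0 (dadd d d′ z) p = trans (z p) (trans (cong₂ _+_ (D-0 d p) (D-0 d′ p)) (+-identityˡ 0#))

  D-1 : ∀ {m} {f : Fun F m} → D 1 f → ∃ λ c → ∀ p → f p ≡ c
  D-1 (dzero z) = 0# , z
  D-1 (dconst c z) = c , z
  D-1 (dadd d d′ z) with D-1 d | D-1 d′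
  ... | c , e | c′ , e′ = c + c′ , λ p → trans (z p) (cong₂ _+_ (e p) (e′ p))
  D-1 (dmul {a = a} _ d z) = 0# , λ p → trans (z p) (trans (cong (a p *_) (D-0 d p)) (zeroʳ _))

  D-2 : ∀ {m} {f : Fun F m} → D 2 f → IsAff f
  D-2 (dzero z) = aff-cong (aff-const 0#) z
  D-2 (dconst c z) = aff-cong (aff-const c) z
  D-2 (dadd d d′ z) = aff-cong (aff-+ (D-2 d) (D-2 d′)) z
  D-2 (dmul {a = a} A d z) with D-1 d
  ... | c , e = aff-cong (aff-* c A) (λ p → trans (z p) (trans (cong (a p *_) (e p)) (*-comm _ _)))

  D-∘ : ∀ {k m n} {f : Fun F m} → D n f → (φ : AffMap k m) → D n (λ p → f (app φ p))
  D-∘ (dzero z) φ = dzero (λ p → z _)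
  D-∘ (dconst c z) φ = dconst c (λ p → z _)
  D-∘ (dadd d d′ z) φ = dadd (D-∘ d φ) (D-∘ d′ φ) (λ p → z _)
  D-∘ (dmul a d z) φ = dmul (aff-∘ a φ) (D-∘ d φ) (λ p → z _)

  D-scale : ∀ {m n} {f : Fun F m} c → D n f → D n (λ p → c * f p)
  D-scale c (dzero z) = dzero (λ p → trans (cong (c *_) (z p)) (zeroʳ c))
  D-scale c (dconst d z) = dconst (c * d) (λ p → cong (c *_) (z p))
  D-scale c (dadd d d′ z) = dadd (D-scale c d) (D-scale c d′) (λ p → trans (cong (c *_) (z p)) (distribˡ c _ _))
  D-scale c (dmul a d z) = dmul a (D-scale c d) (λ p → trans (cong (c *_) (z p)) (solve 3 (λ c a g → c :* (a :* g) := a :* (c :* g)) refl c _ _))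

  D-+ : ∀ {m n} {f g : Fun F m} → D n f → D n g → D n (λ p → f p + g p)
  D-+ d d′ = dadd d d′ (λ _ → refl)

  D-neg : ∀ {m n} {f : Fun F m} → D n f → D n (λ p → - f p)
  D-neg d = D-cong (D-scale (- 1#) d) (λ p → solve 1 (λ x → :- x := :- con (1 , 0) :* x) refl _)

  D-sub : ∀ {m n} {f g : Fun F m} → D n f → D n g → D n (λ p → f p - g p)
  D-sub d d′ = D-+ d (D-neg d′)

  D-aff : ∀ {m n} {a f : Fun F m} → IsAff a → D n f → D (suc n) (λ p → a p * f p)
  D-aff A d = dmul A d (λ _ → refl)

  D-aff∸ : ∀ {m} n i {a f : Fun F m} → IsAff a → D (n ∸ i) f → D (suc n ∸ i) (λ p → a p * f p)
  D-aff∸ n i {a} A d with i ℕP.≤? n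
  ... | yes l = D-cast (sym (ℕP.+-∸-assoc 1 l)) (D-aff A d)
  ... | no ¬l = dzero (λ p → trans (cong (a p *_) (D-0 (D-cast (ℕP.m≤n⇒m∸n≡0 (ℕP.<⇒≤ (ℕP.≰⇒> ¬l))) d) p)) (zeroʳ _))

  D-aff-pred : ∀ {m} n {a f : Fun F m} → IsAff a → D (n ∸ 1) f → D n (λ p → a p * f p)
  D-aff-pred zero {a} A d = dzero (λ p → trans (cong (a p *_) (D-0 d p)) (zeroʳ _))
  D-aff-pred (suc n) A d = D-aff A d

  D-* : ∀ {m} a b {f g : Fun F m} → D (suc a) f → D b g → D (a ℕ.+ b) (λ p → f p * g p)
  D-* a b {g = g} (dzero z) d′ = dzero (λ p → trans (cong (_* g p) (z p)) (zeroˡ _))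
  D-* a b {g = g} (dconst c z) d′ = D-mono (ℕP.m≤n+m b a) (D-cong (D-scale c d′) (λ p → cong (_* g p) (z p)))
  D-* a b {g = g} (dadd d d″ z) d′ = dadd (D-* a b d d′) (D-* a b d″ d′) (λ p → trans (cong (_* g p) (z p)) (distribʳ _ _ _))
  D-* zero b {g = g} (dmul {a = u} A d z) d′ = dzero (λ p → trans (cong (_* g p) (z p)) (trans (cong (λ w → u p * w * g p) (D-0 d p))
    (solve 2 (λ x y → x :* con (0 , 0) :* y := con (0 , 0)) refl _ _)))
  D-* (suc a) b {g = g} (dmul A d z) d′ = dmul A (D-* a b d d′) (λ p → trans (cong (_* g p) (z p)) (*-assoc _ _ _))

  -- Expansion in the first coordinate: projection and division

  record NF {m} (n : ℕ) (f : Fun F (suc m)) : Set where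
    field
      h   : ℕ → Fun F m
      deg : ∀ i → i < q → D (n ∸ i) (h i)
      eq  : ∀ x z → f (x ∷ z) ≡ ev q (λ i → h i z) x

  -- The only overflow arises on multiplication by x, from the coefficient of x^(q-1). Since x^q =
  -- x, it moves to the exponent 1, where the bound on the degree is weaker, so the bounds survive.
  D⇒NF : ∀ {m n} {f : Fun F (suc m)} → D n f → NF n f
  D⇒NF (dzero z) = record { h = λ _ _ → 0# ; deg = λ _ _ → dzero (λ _ → refl) ; eq = λ x v → trans (z (x ∷ v)) (sym (ev-0 q _ x (λ _ _ → refl))) }
  D⇒NF {m} {suc n} (dconst c z) = record
    { h = λ i _ → c * unit 0 i
    ; deg = deg
    ; eq = λ x v → trans (z (x ∷ v)) (sym (trans (ev-* q c (unit 0) x) (trans (cong (c *_) (ev-unit q 0 x (s≤s z≤n))) (*-identityʳ c)))) }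
    where
    deg : ∀ i → i < q → D (suc n ∸ i) (λ _ → c * unit 0 i)
    deg zero    _ = dconst (c * 1#) (λ _ → refl)
    deg (suc i) _ = dzero (λ _ → zeroʳ c)
  D⇒NF (dadd d d′ z) = record
    { h = λ i v → N₁.h i v + N₂.h i v
    ; deg = λ i l → D-+ (N₁.deg i l) (N₂.deg i l)
    ; eq = λ x v → trans (z (x ∷ v)) (trans (cong₂ _+_ (N₁.eq x v) (N₂.eq x v)) (sym (ev-+ q (λ i → N₁.h i v) (λ i → N₂.h i v) x))) }
    where
    module N₁ = NF (D⇒NF d)
    module N₂ = NF (D⇒NF d′)
  D⇒NF {m} {suc n} {f} (dmul {a = a} {g = g} A d z) = record { h = h ; deg = deg ; eq = eq }
    where
    module G = NF (D⇒NF d)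
    λ₁ : Carrier
    λ₁ = IsAff.lin A (1# ∷ 0V)
    a₀ : Fun F m
    a₀ v = a (0# ∷ v)
    A₀ : IsAff a₀
    A₀ = aff-∘ A (map-at 0#)
    -- multiplication by x, reduced with x^q = x
    sh : ℕ → Fun F m
    sh zero          v = 0#
    sh (suc zero)    v = G.h 0 v + G.h Q v
    sh (suc (suc i)) v = G.h (suc i) v
    h : ℕ → Fun F m
    h i v = a₀ v * G.h i v + λ₁ * sh i v
    sh-deg : ∀ i → i < q → D (suc n ∸ i) (sh i)
    sh-deg zero          _ = dzero (λ _ → refl)
    sh-deg (suc zero)    _ = D-+ (G.deg 0 (s≤s z≤n)) (D-mono (ℕP.m∸n≤m n Q) (G.deg Q ℕP.≤-refl))
    sh-deg (suc (suc i)) l = G.deg (suc i) (ℕP.<-trans (ℕP.n<1+n _) l)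
    deg : ∀ i → i < q → D (suc n ∸ i) (h i)
    deg i l = D-+ (D-aff∸ n i A₀ (G.deg i l)) (D-scale λ₁ (sh-deg i l))
    ev-sh : ∀ x v → ev q (λ i → sh i v) x ≡ x * ev q (λ i → G.h i v) x
    ev-sh x v = begin
      0# + x * ev Q (λ i → sh (suc i) v) x ≡⟨ cong (λ w → 0# + x * w) (ev-cong Q x pt) ⟩
      0# + x * ev Q (λ i → G.h i v + G.h Q v * unit 0 i) x ≡⟨ cong (λ w → 0# + x * w) (trans (ev-+ Q _ _ x)
          (cong (ev Q (λ i → G.h i v) x +_) (trans (ev-* Q (G.h Q v) (unit 0) x) (cong (G.h Q v *_) (ev-unit Q 0 x 1≤Q))))) ⟩
      0# + x * (ev Q (λ i → G.h i v) x + G.h Q v * 1#) ≡⟨ solve 3 (λ x e u → con (0 , 0) :+ x :* (e :+ u :* con (1 , 0)) := x :* e :+ u :* x) refl x _ _ ⟩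
      x * ev Q (λ i → G.h i v) x + G.h Q v * x ≡⟨ cong (λ w → x * ev Q (λ i → G.h i v) x + G.h Q v * w) (sym (pow-q x)) ⟩
      x * ev Q (λ i → G.h i v) x + G.h Q v * (x * pow F x Q) ≡⟨ solve 4 (λ x e u w → x :* e :+ u :* (x :* w) := x :* (e :+ u :* w)) refl x _ _ _ ⟩
      x * (ev Q (λ i → G.h i v) x + G.h Q v * pow F x Q) ≡⟨ cong (x *_) (sym (ev-last Q (λ i → G.h i v) x)) ⟩
      x * ev q (λ i → G.h i v) x ∎
      where
      open ≡-Reasoning
      pt : ∀ i → i < Q → sh (suc i) v ≡ G.h i v + G.h Q v * unit 0 i
      pt zero    _ = cong (G.h 0 v +_) (sym (*-identityʳ _))
      pt (suc i) _ = sym (trans (cong (G.h (suc i) v +_) (zeroʳ _)) (+-identityʳ _))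
    eq : ∀ x v → f (x ∷ v) ≡ ev q (λ i → h i v) x
    eq x v = begin
      f (x ∷ v) ≡⟨ z (x ∷ v) ⟩
      a (x ∷ v) * g (x ∷ v) ≡⟨ cong₂ _*_ (aff-split A x v) (G.eq x v) ⟩
      (a₀ v + λ₁ * x) * e ≡⟨ solve 4 (λ a l x e → (a :+ l :* x) :* e := a :* e :+ l :* (x :* e)) refl _ _ _ _ ⟩
      a₀ v * e + λ₁ * (x * e) ≡⟨ cong (λ w → a₀ v * e + λ₁ * w) (sym (ev-sh x v)) ⟩
      a₀ v * e + λ₁ * ev q (λ i → sh i v) x ≡⟨ cong₂ _+_ (sym (ev-* q (a₀ v) (λ i → G.h i v) x)) (sym (ev-* q λ₁ (λ i → sh i v) x)) ⟩
      ev q (λ i → a₀ v * G.h i v) x + ev q (λ i → λ₁ * sh i v) x ≡⟨ sym (ev-+ q (λ i → a₀ v * G.h i v) (λ i → λ₁ * sh i v) x) ⟩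
      ev q (λ i → h i v) x ∎
      where
      open ≡-Reasoning
      e : Carrier
      e = ev q (λ i → G.h i v) x

  D-Σ : ∀ {m n} {f : Fun F (suc m)} → D n f → D (n ∸ Q) (λ z → ΣC (λ x → f (x ∷ z)))
  D-Σ d = D-cong (D-neg (G.deg Q ℕP.≤-refl)) (λ z → trans (ΣL-cong E (λ x → G.eq x z)) (Σ-ev-q (λ i → G.h i z)))
    where module G = NF (D⇒NF d)

  D-Q-Σ : ∀ {f : Fun F 1} → D Q f → ΣC (λ x → f (x ∷ [])) ≡ 0#
  D-Q-Σ d = D-0 (D-cast (ℕP.n∸n≡0 Q) (D-Σ d)) []

  D-ev : ∀ {m} N n (c : ℕ → Fun F m) → (∀ i → i < N → D (n ∸ i) (c i)) → D n (λ p → ev N (λ i → c i (tail p)) (head p))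
  D-ev zero    n c d = dzero (λ _ → refl)
  D-ev (suc N) n c d = D-+ (D-∘ (d 0 (s≤s z≤n)) map-tail) (D-aff-pred n aff-head
    (D-ev N (n ∸ 1) (c ∘ suc) (λ i l → D-cast (sym (ℕP.∸-+-assoc n 1 i)) (d (suc i) (s≤s l)))))

  D-ev-at : ∀ {m} N n (c : ℕ → Fun F m) b → (∀ i → i < N → D n (c i)) → D n (λ z → ev N (λ i → c i z) b)
  D-ev-at zero    n c b d = dzero (λ _ → refl)
  D-ev-at (suc N) n c b d = D-+ (d 0 (s≤s z≤n)) (D-scale b (D-ev-at N n (c ∘ suc) b (λ i l → d (suc i) (s≤s l))))

  D-quo : ∀ {m} N n (c : ℕ → Fun F m) b → (∀ i → i < N → D (n ∸ i) (c i)) →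
          ∀ i → suc i < N → D (n ∸ suc i) (λ z → quo N (λ j → c j z) b i)
  D-quo (suc N) n c b d zero _ =
    D-ev-at N (n ∸ 1) (c ∘ suc) b (λ i l → D-mono (ℕP.∸-monoʳ-≤ n (s≤s z≤n)) (d (suc i) (s≤s l)))
  D-quo (suc N) n c b d (suc i) (s≤s l) = D-cast (ℕP.∸-+-assoc n 1 (suc i))
    (D-quo N (n ∸ 1) (c ∘ suc) b (λ j j<N → D-cast (sym (ℕP.∸-+-assoc n 1 j)) (d (suc j) (s≤s j<N))) i l)

  -- The remainder of the synthetic division by x - b is the slice at b. Evaluating the coefficients
  -- at the constant b does not raise their degree in z.
  div-slice : ∀ {m n} {f : Fun F (suc m)} → D n f → ∀ b → (∀ z → f (b ∷ z) ≡ 0#) →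
              ∃ λ g → D (n ∸ 1) g × (∀ x z → f (x ∷ z) ≡ (x - b) * g (x ∷ z))
  div-slice {m} {n} {f} d b z = g , D-ev Q (n ∸ 1) c (λ i l → D-cast (sym (ℕP.∸-+-assoc n 1 i)) (D-quo q n G.h b G.deg i (s≤s l))) , eq
    where
    module G = NF (D⇒NF d)
    c : ℕ → Fun F m
    c i v = quo q (λ j → G.h j v) b i
    g : Fun F (suc m)
    g p = ev Q (λ i → c i (tail p)) (head p)
    eq : ∀ x v → f (x ∷ v) ≡ (x - b) * g (x ∷ v)
    eq x v = trans (G.eq x v) (trans (ev-quo Q (λ j → G.h j v) b x)
      (trans (cong (_+ (x - b) * g (x ∷ v)) (trans (sym (G.eq b v)) (z v))) (+-identityˡ _)))

  ΠB : List Carrier → Carrier → Carrier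
  ΠB B x = Π.ΣL B (λ b → x - b)

  ΠB≢0 : ∀ B x → (∀ {b} → b ∈ B → x ≢ b) → ΠB B x ≢ 0#
  ΠB≢0 []      x n = 1≢0
  ΠB≢0 (b ∷ B) x n = *≢0 (λ e → n (here refl) (-≡0⇒≡ e)) (ΠB≢0 B x (λ i → n (there i)))

  div-slices : ∀ {m n} {f : Fun F (suc m)} (B : List Carrier) → Unique B → D n f → (∀ {b} → b ∈ B → ∀ z → f (b ∷ z) ≡ 0#) →
               ∃ λ g → D (n ∸ List.length B) g × (∀ x z → f (x ∷ z) ≡ ΠB B x * g (x ∷ z))
  div-slices {f = f} [] _ d z = f , d , λ x v → sym (*-identityˡ _)
  div-slices {n = n} {f} (b ∷ B) (p ∷ u) d z with div-slice d b (z (here refl))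
  ... | g₁ , d₁ , e₁ with div-slices B u d₁ z₁
    where
    z₁ : ∀ {b′} → b′ ∈ B → ∀ v → g₁ (b′ ∷ v) ≡ 0#
    z₁ {b′} i v = *≡0 (λ e → All.lookup p i (sym (-≡0⇒≡ e))) (trans (sym (e₁ b′ v)) (z (there i) v))
  ... | g , d′ , e = g , D-cast (ℕP.∸-+-assoc n 1 (List.length B)) d′ ,
    λ x v → trans (e₁ x v) (trans (cong ((x - b) *_) (e x v)) (sym (*-assoc _ _ _)))

  Zero : ∀ {m} → Fun F m → Set
  Zero f = ∀ p → f p ≡ 0#

  Zero? : ∀ {m} (f : Fun F m) → Dec (Zero f)
  Zero? f with zero? f
  ... | inj₁ z = yes z
  ... | inj₂ (p , n) = no λ z → n (z p)

  slice : ∀ {m} → Fun F (suc m) → Carrier → Fun F m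
  slice f x z = f (x ∷ z)

  D-slice : ∀ {m n} {f : Fun F (suc m)} → D n f → ∀ x → D n (slice f x)
  D-slice d x = D-∘ d (map-at x)

  zeros : ∀ {m} → Fun F (suc m) → List Carrier
  zeros f = List.filter (λ x → Zero? (slice f x)) E

  #zeros : ∀ {m} → Fun F (suc m) → ℕ
  #zeros f = List.length (zeros f)

  ∈-zeros : ∀ {m} (f : Fun F (suc m)) {x} → Zero (slice f x) → x ∈ zeros f
  ∈-zeros f {x} z = ∈-filter⁺ (λ x → Zero? (slice f x)) (∈-E x) z

  zeros-∈ : ∀ {m} (f : Fun F (suc m)) {x} → x ∈ zeros f → Zero (slice f x)
  zeros-∈ f i = proj₂ (∈-filter⁻ (λ x → Zero? (slice f x)) {xs = E} i)

  div-zeros : ∀ {m n} {f : Fun F (suc m)} → D n f →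
              ∃ λ g → D (n ∸ #zeros f) g × (∀ x z → f (x ∷ z) ≡ ΠB (zeros f) x * g (x ∷ z))
  div-zeros {f = f} d = div-slices (zeros f) (UniqueP.filter⁺ (λ x → Zero? (slice f x)) unique-E) d (λ i → zeros-∈ f i)

  -- On a slice the divisor `ΠB` is a constant, so all slices inherit the lower degree of the
  -- quotient. Every count of weights below depends on this.
  D-slice-zeros : ∀ {m n} {f : Fun F (suc m)} → D n f → ∀ x → D (n ∸ #zeros f) (slice f x)
  D-slice-zeros {f = f} d x with div-zeros d
  ... | g , d′ , e = D-cong (D-scale (ΠB (zeros f) x) (D-slice d′ x)) (e x)

  -- The minimum weight

  module NS = +-*-Solver

  ∸≡ : ∀ {a b c} → a ≡ b ℕ.+ c → a ∸ b ≡ c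
  ∸≡ {b = b} {c} e = trans (cong (_∸ b) e) (ℕP.m+n∸m≡n b c)

  ∃+ : ∀ {a b} → a ≤ b → ∃ λ c → b ≡ a ℕ.+ c
  ∃+ {a} {b} l = b ∸ a , sym (ℕP.m+[n∸m]≡n l)

  -- The minimum weight of the functions of degree at most r in m variables.
  μ : ℕ → ℕ → ℕ
  μ zero    r = 1
  μ (suc m) r with r ℕP.≤? Q
  ... | yes _ = (q ∸ r) ℕ.* q ^ m
  ... | no _  = μ m (r ∸ Q)

  μ-≤ : ∀ m r → r ≤ Q → μ (suc m) r ≡ (q ∸ r) ℕ.* q ^ m
  μ-≤ m r l with r ℕP.≤? Q
  ... | yes _ = refl
  ... | no n = contradiction l n

  μ-eval : ∀ t n s → s ≤ Q → μ (t ℕ.+ suc n) (t ℕ.* Q ℕ.+ s) ≡ (q ∸ s) ℕ.* q ^ n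
  μ-eval zero n s l = μ-≤ n s l
  μ-eval (suc t) n s l with (Q ℕ.+ t ℕ.* Q ℕ.+ s) ℕP.≤? Q
  ... | no _ = trans (cong (μ (t ℕ.+ suc n)) (trans (cong (_∸ Q) (ℕP.+-assoc Q (t ℕ.* Q) s)) (ℕP.m+n∸m≡n Q _))) (μ-eval t n s l)
  ... | yes le with m+n≤m Q (t ℕ.* Q ℕ.+ s) (subst (_≤ Q) (ℕP.+-assoc Q (t ℕ.* Q) s) le)
    where
    m+n≤m : ∀ m n → m ℕ.+ n ≤ m → n ≡ 0
    m+n≤m m n l = ℕP.n≤0⇒n≡0 (ℕP.+-cancelˡ-≤ m n 0 (ℕP.≤-trans l (ℕP.≤-reflexive (sym (ℕP.+-identityʳ m)))))
  -- At r = q - 1 the first branch of `μ` is taken; its value 1 · q^(n+1) is also the expected q ·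
  -- q^n.
  μ-eval (suc zero) n .0 l | yes le | refl =
    trans (cong (λ k → (q ∸ k) ℕ.* q ^ suc n) (trans (ℕP.+-identityʳ _) (ℕP.+-identityʳ Q))) (trans (cong (ℕ._* q ^ suc n) (∸≡ (sym (ℕP.+-comm Q 1)))) (ℕP.+-identityʳ _))
  μ-eval (suc (suc t)) n s l | yes le | e = contradiction (ℕP.≤-trans 1≤Q (ℕP.≤-reflexive (ℕP.m+n≡0⇒m≡0 Q (trans (sym (ℕP.+-assoc Q _ s)) e)))) λ ()

  -- The right side is the least weight when j slices vanish. For r ≤ q - 1 it exceeds the left side
  -- by j(r - j) q^(m-1) if m ≥ 1. If r - j ≤ q - 1 < r = q - 1 + r', the excess is (q - 1 - j)(j -
  -- r') q^(m-1). If r - j is still greater than q - 1, both sides reduce by induction.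
  μ-step : ∀ m r j → j ≤ r → j ≤ Q → μ (suc m) r ≤ (q ∸ j) ℕ.* μ m (r ∸ j)
  μ-step m r j j≤r j≤Q with r ℕP.≤? Q
  μ-step zero r j j≤r j≤Q | yes r≤Q = ℕP.*-monoˡ-≤ 1 (ℕP.∸-monoʳ-≤ q j≤r)
  μ-step (suc m) r j j≤r j≤Q | yes r≤Q with ∃+ j≤r | ∃+ r≤Q
  ... | i , refl | e , Q≡ = begin
    (q ∸ (j ℕ.+ i)) ℕ.* (q ℕ.* q ^ m) ≡⟨ cong₂ (λ a b → a ℕ.* (b ℕ.* q ^ m)) (∸≡ q≡) q≡ ⟩
    suc e ℕ.* ((j ℕ.+ i ℕ.+ suc e) ℕ.* q ^ m) ≤⟨ ℕP.m≤m+n _ (j ℕ.* i ℕ.* q ^ m) ⟩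
    suc e ℕ.* ((j ℕ.+ i ℕ.+ suc e) ℕ.* q ^ m) ℕ.+ j ℕ.* i ℕ.* q ^ m
      ≡⟨ NS.solve 4 (λ j i e w → e NS.:* ((j NS.:+ i NS.:+ e) NS.:* w) NS.:+ j NS.:* i NS.:* w NS.:= (i NS.:+ e) NS.:* ((j NS.:+ e) NS.:* w)) refl j i (suc e) (q ^ m) ⟩
    (i ℕ.+ suc e) ℕ.* ((j ℕ.+ suc e) ℕ.* q ^ m)
      ≡⟨ cong₂ (λ a b → a ℕ.* (b ℕ.* q ^ m)) (sym (∸≡ {b = j} (trans q≡ (ℕP.+-assoc j i _)))) (sym (∸≡ {b = i} (trans q≡ (trans (cong (ℕ._+ suc e) (ℕP.+-comm j i)) (ℕP.+-assoc i j _))))) ⟩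
    (q ∸ j) ℕ.* ((q ∸ i) ℕ.* q ^ m) ≡⟨ cong (λ k → (q ∸ j) ℕ.* ((q ∸ k) ℕ.* q ^ m)) (sym (ℕP.m+n∸m≡n j i)) ⟩
    (q ∸ j) ℕ.* ((q ∸ (j ℕ.+ i ∸ j)) ℕ.* q ^ m) ≡⟨ cong ((q ∸ j) ℕ.*_) (sym (μ-≤ m (j ℕ.+ i ∸ j) (ℕP.≤-trans (ℕP.m∸n≤m (j ℕ.+ i) j) r≤Q))) ⟩
    (q ∸ j) ℕ.* μ (suc m) (j ℕ.+ i ∸ j) ∎
    where
    open ℕP.≤-Reasoning
    q≡ : q ≡ j ℕ.+ i ℕ.+ suc e
    q≡ = trans (cong suc Q≡) (sym (ℕP.+-suc _ e))
  μ-step zero r j j≤r j≤Q | no r≰Q = ℕP.≤-trans (ℕP.m<n⇒0<n∸m (s≤s j≤Q)) (ℕP.≤-reflexive (sym (ℕP.*-identityʳ _)))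
  μ-step (suc m) r j j≤r j≤Q | no r≰Q with (r ∸ j) ℕP.≤? Q
  ... | no r-j≰Q = ℕP.≤-trans (μ-step m (r ∸ Q) j j≤r-Q j≤Q) (ℕP.≤-reflexive (cong (λ k → (q ∸ j) ℕ.* μ m k) comm))
    where
    comm : r ∸ Q ∸ j ≡ r ∸ j ∸ Q
    comm = trans (ℕP.∸-+-assoc r Q j) (trans (cong (r ∸_) (ℕP.+-comm Q j)) (sym (ℕP.∸-+-assoc r j Q)))
    j≤r-Q : j ≤ r ∸ Q
    j≤r-Q = ℕP.m+n≤o⇒m≤o∸n j (ℕP.≤-trans (ℕP.+-monoʳ-≤ j (ℕP.<⇒≤ (ℕP.≰⇒> r-j≰Q))) (ℕP.≤-reflexive (ℕP.m+[n∸m]≡n j≤r)))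
  ... | yes r-j≤Q with ∃+ (ℕP.<⇒≤ (ℕP.≰⇒> r≰Q)) | ∃+ j≤Q
  ... | r′ , refl | a , Q≡ with ∃+ r′≤j
    where
    r′≤j : r′ ≤ j
    r′≤j = ℕP.+-cancelˡ-≤ Q r′ j (ℕP.≤-trans (ℕP.m≤n+m∸n (Q ℕ.+ r′) j) (ℕP.≤-trans (ℕP.+-monoʳ-≤ j r-j≤Q) (ℕP.≤-reflexive (ℕP.+-comm j Q))))
  ... | u , refl = begin
    μ (suc m) (Q ℕ.+ r′ ∸ Q) ≡⟨ trans (cong (μ (suc m)) (ℕP.m+n∸m≡n Q r′)) (μ-≤ m r′ (ℕP.≤-trans (ℕP.m≤m+n r′ u) j≤Q)) ⟩
    (q ∸ r′) ℕ.* q ^ m ≡⟨ cong (ℕ._* q ^ m) (∸≡ {b = r′} (trans q≡ (ℕP.+-assoc r′ u _))) ⟩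
    (u ℕ.+ suc a) ℕ.* q ^ m ≤⟨ ℕP.m≤m+n _ (a ℕ.* u ℕ.* q ^ m) ⟩
    (u ℕ.+ suc a) ℕ.* q ^ m ℕ.+ a ℕ.* u ℕ.* q ^ m
      ≡⟨ NS.solve 3 (λ u a w → (u NS.:+ (NS.con 1 NS.:+ a)) NS.:* w NS.:+ a NS.:* u NS.:* w NS.:= (NS.con 1 NS.:+ a) NS.:* ((NS.con 1 NS.:+ u) NS.:* w)) refl u a (q ^ m) ⟩
    suc a ℕ.* (suc u ℕ.* q ^ m) ≡⟨ cong₂ (λ b c → b ℕ.* (c ℕ.* q ^ m)) (sym (∸≡ q≡)) (sym (trans (cong (q ∸_) r-j≡) q∸)) ⟩
    (q ∸ (r′ ℕ.+ u)) ℕ.* ((q ∸ (Q ℕ.+ r′ ∸ (r′ ℕ.+ u))) ℕ.* q ^ m) ∎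
    where
    open ℕP.≤-Reasoning
    q≡ : q ≡ r′ ℕ.+ u ℕ.+ suc a
    q≡ = trans (cong suc Q≡) (sym (ℕP.+-suc _ a))
    r-j≡ : Q ℕ.+ r′ ∸ (r′ ℕ.+ u) ≡ r′ ℕ.+ a
    r-j≡ = ∸≡ {b = r′ ℕ.+ u} (trans (cong (ℕ._+ r′) Q≡) (NS.solve 3 (λ r u a → r NS.:+ u NS.:+ a NS.:+ r NS.:= r NS.:+ u NS.:+ (r NS.:+ a)) refl r′ u a))
    q∸ : q ∸ (r′ ℕ.+ a) ≡ suc u
    q∸ = ∸≡ (trans q≡ (NS.solve 3 (λ r u a → r NS.:+ u NS.:+ (NS.con 1 NS.:+ a) NS.:= r NS.:+ a NS.:+ (NS.con 1 NS.:+ u)) refl r′ u a))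

  private
    module _ {A : Set} {P : A → Set} (P? : ∀ x → Dec (P x)) (g : A → ℕ) (w : ℕ) (lb : ∀ x → ¬ P x → w ≤ g x) where
      nonmembers-weight : ∀ xs → ∃ λ c → List.length xs ≡ List.length (List.filter P? xs) ℕ.+ c × c ℕ.* w ≤ N.ΣL xs g
      nonmembers-weight [] = 0 , refl , z≤n
      nonmembers-weight (x ∷ xs) with nonmembers-weight xs
      ... | c , e , l with P? x
      ... | yes _ = c , cong suc e , ℕP.≤-trans l (ℕP.m≤n+m _ (g x))
      ... | no ¬p = suc c , trans (cong suc e) (sym (ℕP.+-suc _ c)) , ℕP.+-mono-≤ (lb x ¬p) l

      nonmembers-weight∈ : ∀ xs {x} → x ∈ xs → ¬ P x → ∃ λ c → List.length xs ≡ List.length (List.filter P? xs) ℕ.+ c × c ℕ.* w ℕ.+ (g x ∸ w) ≤ N.ΣL xs g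
      nonmembers-weight∈ (x ∷ xs) (here refl) ¬p with nonmembers-weight xs
      ... | c , e , l with P? x
      ... | yes p = contradiction p ¬p
      ... | no _ = suc c , trans (cong suc e) (sym (ℕP.+-suc _ c)) , (begin
        w ℕ.+ c ℕ.* w ℕ.+ (g x ∸ w) ≡⟨ NS.solve 3 (λ a b c → a NS.:+ b NS.:+ c NS.:= (a NS.:+ c) NS.:+ b) refl w (c ℕ.* w) (g x ∸ w) ⟩
        w ℕ.+ (g x ∸ w) ℕ.+ c ℕ.* w ≡⟨ cong (ℕ._+ c ℕ.* w) (ℕP.m+[n∸m]≡n (lb x ¬p)) ⟩
        g x ℕ.+ c ℕ.* w ≤⟨ ℕP.+-monoʳ-≤ (g x) l ⟩
        g x ℕ.+ N.ΣL xs g ∎)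
        where open ℕP.≤-Reasoning
      nonmembers-weight∈ (y ∷ xs) {x} (there i) ¬p with nonmembers-weight∈ xs i ¬p
      ... | c , e , l with P? y
      ... | yes _ = c , cong suc e , ℕP.≤-trans l (ℕP.m≤n+m _ (g y))
      ... | no ¬py = suc c , trans (cong suc e) (sym (ℕP.+-suc _ c)) , (begin
        w ℕ.+ c ℕ.* w ℕ.+ (g x ∸ w) ≡⟨ ℕP.+-assoc w _ _ ⟩
        w ℕ.+ (c ℕ.* w ℕ.+ (g x ∸ w)) ≤⟨ ℕP.+-mono-≤ (lb y ¬py) l ⟩
        g y ℕ.+ N.ΣL xs g ∎)
        where open ℕP.≤-Reasoning

  slices-bound : ∀ {m} (f : Fun F (suc m)) w → (∀ x → ¬ Zero (slice f x) → w ≤ wt (slice f x)) → (q ∸ #zeros f) ℕ.* w ≤ wt f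
  slices-bound f w lb with nonmembers-weight (λ x → Zero? (slice f x)) (λ x → wt (slice f x)) w lb E
  ... | c , e , l = subst₂ (λ a b → a ℕ.* w ≤ b) (sym (∸≡ {b = #zeros f} (trans (sym length-E) e))) (sym (wt-suc f)) l

  -- Keeps the surplus of one chosen slice over the common lower bound; it serves to bound single
  -- slices from above.
  slices-excess : ∀ {m} (f : Fun F (suc m)) w → (∀ x → ¬ Zero (slice f x) → w ≤ wt (slice f x)) →
                  ∀ x → ¬ Zero (slice f x) → (q ∸ #zeros f) ℕ.* w ℕ.+ (wt (slice f x) ∸ w) ≤ wt f
  slices-excess f w lb x ¬z = go (nonmembers-weight∈ (λ x → Zero? (slice f x)) (λ x → wt (slice f x)) w lb E (∈-E x) ¬z)
    where
    go : (∃ λ c → List.length E ≡ #zeros f ℕ.+ c × c ℕ.* w ℕ.+ (wt (slice f x) ∸ w) ≤ N.ΣC (λ x → wt (slice f x))) → _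
    go (c , e , l) = ℕP.≤-trans (ℕP.≤-reflexive (cong (λ k → k ℕ.* w ℕ.+ (wt (slice f x) ∸ w)) (∸≡ {b = #zeros f} (trans (sym length-E) e)))) (ℕP.≤-trans l (ℕP.≤-reflexive (sym (wt-suc f))))

  slices-tight : ∀ {m} (f : Fun F (suc m)) w → (∀ x → ¬ Zero (slice f x) → w ≤ wt (slice f x)) → wt f ≤ (q ∸ #zeros f) ℕ.* w →
                 ∀ x → ¬ Zero (slice f x) → wt (slice f x) ≡ w
  slices-tight f w lb ub x ¬z = ℕP.≤-antisym (ℕP.m∸n≡0⇒m≤n (ℕP.n≤0⇒n≡0 (ℕP.+-cancelˡ-≤ ((q ∸ #zeros f) ℕ.* w) _ 0
    (ℕP.≤-trans (slices-excess f w lb x ¬z) (ℕP.≤-trans ub (ℕP.≤-reflexive (sym (ℕP.+-identityʳ _)))))))) (lb x ¬z)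

  #zeros≤Q : ∀ {m} (f : Fun F (suc m)) {x} → ¬ Zero (slice f x) → #zeros f ≤ Q
  #zeros≤Q f {x} ¬z = ℕP.≤-pred (ℕP.≤-trans (ListP.filter-notAll (λ x → Zero? (slice f x)) E (Any.map (λ { refl → ¬z }) (∈-E x))) (ℕP.≤-reflexive length-E))

  -- Induction on m over the slices of the first coordinate: if j of them vanish, the other q - j
  -- have degree at most r - j, and `μ-step` compares the bounds.
  kasami : ∀ m {r} {f : Fun F m} → D (suc r) f → (∃ λ p → f p ≢ 0#) → μ m r ≤ wt f
  kasami zero {f = f} d (p , n) = wt-pos {f = f} p n
  kasami (suc m) {r} {f} d (x ∷ z , n) = ℕP.≤-trans (μ-step m r j j≤r j≤Q) (slices-bound f _ lb)
    where
    j : ℕ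
    j = #zeros f
    ¬z : ¬ Zero (slice f x)
    ¬z e = n (e z)
    j≤Q : j ≤ Q
    j≤Q = #zeros≤Q f ¬z
    j≤r : j ≤ r
    j≤r with j ℕP.≤? r
    ... | yes l = l
    ... | no l = contradiction (D-0 (D-cast (ℕP.m≤n⇒m∸n≡0 (ℕP.≰⇒> l)) (D-slice-zeros d x)) z) n
    lb : ∀ x → ¬ Zero (slice f x) → μ m (r ∸ j) ≤ wt (slice f x)
    lb x ¬z with zero? (slice f x)
    ... | inj₁ e = contradiction e ¬z
    ... | inj₂ nz = kasami m (D-cast (ℕP.+-∸-assoc 1 j≤r) (D-slice-zeros d x)) nz

  ¬Zero⇒∃ : ∀ {m} {f : Fun F m} → ¬ Zero f → ∃ λ p → f p ≢ 0#
  ¬Zero⇒∃ {f = f} ¬z with zero? f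
  ... | inj₁ e = contradiction e ¬z
  ... | inj₂ r = r

  -- The second weight and the number of zero slices

  -- σ s * q^n is the second weight of R_q(t(q-1)+s, t+2+n).
  σ : ℕ → ℕ
  σ s = suc (q ∸ s) ℕ.* Q

  q^>0 : ∀ n → 1 ≤ q ^ n
  q^>0 n = ℕP.m^n>0 q n

  few-zeros : ∀ t n s {f : Fun F (suc (t ℕ.+ suc n))} → s ≤ Q → D (suc (t ℕ.* Q ℕ.+ s)) f → #zeros f ≤ s →
              ∀ x → ¬ Zero (slice f x) → (q ∸ (s ∸ #zeros f)) ℕ.* q ^ n ≤ wt (slice f x)
  few-zeros t n s {f} s≤Q d j≤s x ¬z = ℕP.≤-trans (ℕP.≤-reflexive (sym (μ-eval t n (s ∸ #zeros f) (ℕP.≤-trans (ℕP.m∸n≤m s (#zeros f)) s≤Q))))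
    (kasami (t ℕ.+ suc n) (D-cast eq (D-slice-zeros d x)) (¬Zero⇒∃ ¬z))
    where
    eq : suc (t ℕ.* Q ℕ.+ s) ∸ #zeros f ≡ suc (t ℕ.* Q ℕ.+ (s ∸ #zeros f))
    eq = trans (cong (_∸ #zeros f) (sym (ℕP.+-suc _ s))) (trans (ℕP.+-∸-assoc (t ℕ.* Q) (ℕP.≤-trans j≤s (ℕP.n≤1+n s)))
      (trans (cong (t ℕ.* Q ℕ.+_) (ℕP.+-∸-assoc 1 j≤s)) (ℕP.+-suc _ _)))

  -- With i zero slices beyond s the division uses up s and borrows from t: the remaining degree is
  -- t(q - 1) + (q - 1 - i), whose minimum weight has the factor i + 1.
  many-zeros : ∀ t n s {f : Fun F (suc (suc t ℕ.+ suc n))} → D (suc (suc t ℕ.* Q ℕ.+ s)) f → s ≤ #zeros f →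
               ∀ x → ¬ Zero (slice f x) → suc (#zeros f ∸ s) ℕ.* q ^ suc n ≤ wt (slice f x)
  many-zeros t n s {f} d s≤j x ¬z = ℕP.≤-trans (ℕP.≤-reflexive (sym (trans (cong (λ k → μ k (t ℕ.* Q ℕ.+ (Q ∸ i))) (sym (ℕP.+-suc t (suc n))))
      (trans (μ-eval t (suc n) (Q ∸ i) (ℕP.m∸n≤m Q i)) (cong (ℕ._* q ^ suc n) q∸)))))
    (kasami (suc t ℕ.+ suc n) (D-cast eq (D-slice-zeros d x)) (¬Zero⇒∃ ¬z))
    where
    i : ℕ
    i = #zeros f ∸ s
    i≤Q : i ≤ Q
    i≤Q = ℕP.≤-trans (ℕP.m∸n≤m (#zeros f) s) (#zeros≤Q f ¬z)
    q∸ : q ∸ (Q ∸ i) ≡ suc i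
    q∸ = ∸≡ (trans (cong suc (sym (ℕP.m∸n+n≡m i≤Q))) (sym (ℕP.+-suc _ i)))
    eq : suc (suc t ℕ.* Q ℕ.+ s) ∸ #zeros f ≡ suc (t ℕ.* Q ℕ.+ (Q ∸ i))
    eq = ∸≡ (trans (cong (λ k → suc (k ℕ.+ t ℕ.* Q ℕ.+ s)) (sym (ℕP.m+[n∸m]≡n i≤Q)))
      (trans (NS.solve 4 (λ i e t s → NS.con 1 NS.:+ (i NS.:+ e NS.:+ t NS.:+ s) NS.:= (i NS.:+ s) NS.:+ (NS.con 1 NS.:+ (t NS.:+ e))) refl i (Q ∸ i) (t ℕ.* Q) s)
      (cong (ℕ._+ suc (t ℕ.* Q ℕ.+ (Q ∸ i))) (ℕP.m∸n+n≡m s≤j))))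

  none-if-many : ∀ {m} s {f : Fun F (suc m)} → D (suc s) f → s < #zeros f → Zero f
  none-if-many s d l (x ∷ z) = D-0 (D-cast (ℕP.m≤n⇒m∸n≡0 l) (D-slice-zeros d x)) z

  -- The parameter j is the number of zero slices and w the weight. In `k-full` the slices have
  -- degree at most t(q - 1); in `k-one` a single slice is nonzero. In `k-mid` all estimates are
  -- equalities, and `mid-weight` narrows j down further when that is needed.
  data Kind (t s n w j : ℕ) : Set where
    k-none : j ≡ 0 → Kind t s n w j
    k-full : j ≡ s → Kind t s n w j
    k-one : 1 ≤ t → j ≡ Q → Kind t s n w j
    k-mid : 1 ≤ j → j < s → w ≡ σ s ℕ.* q ^ n → (q ∸ j) ℕ.* (q ∸ (s ∸ j)) ≡ σ s → Kind t s n w j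

  -- The surplus j i is zero only if there is a single zero slice or the nonzero slices have degree
  -- 1 over t(q - 1); the arguments are shifted by one to make it visible.
  mid-weight : ∀ j i s → s ≡ suc j ℕ.+ suc i → s ≤ Q →
               (q ∸ suc j) ℕ.* (q ∸ suc i) ≡ σ s ℕ.+ j ℕ.* i
  mid-weight j i s s≡ s≤Q with ∃+ s≤Q
  ... | d , Q≡ = begin
    (q ∸ suc j) ℕ.* (q ∸ suc i) ≡⟨ cong₂ ℕ._*_ (∸≡ {b = suc j} q₁) (∸≡ {b = suc i} q₂) ⟩
    (suc i ℕ.+ suc d) ℕ.* (suc j ℕ.+ suc d)
      ≡⟨ NS.solve 3 (λ j i d → (NS.con 1 NS.:+ i NS.:+ (NS.con 1 NS.:+ d)) NS.:* (NS.con 1 NS.:+ j NS.:+ (NS.con 1 NS.:+ d))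
          NS.:= (NS.con 2 NS.:+ d) NS.:* ((NS.con 1 NS.:+ j) NS.:+ (NS.con 1 NS.:+ i) NS.:+ d) NS.:+ j NS.:* i) refl j i d ⟩
    suc (suc d) ℕ.* (suc j ℕ.+ suc i ℕ.+ d) ℕ.+ j ℕ.* i ≡⟨ cong₂ (λ a b → suc a ℕ.* b ℕ.+ j ℕ.* i) (sym (∸≡ (trans (cong suc Q≡) (sym (ℕP.+-suc s d))))) (sym (trans Q≡ (cong (ℕ._+ d) s≡))) ⟩
    σ s ℕ.+ j ℕ.* i ∎
    where
    open ≡-Reasoning
    q₁ : q ≡ suc j ℕ.+ (suc i ℕ.+ suc d)
    q₁ = trans (cong suc (trans Q≡ (cong (ℕ._+ d) s≡))) (NS.solve 3 (λ j i d → NS.con 1 NS.:+ (NS.con 1 NS.:+ j NS.:+ (NS.con 1 NS.:+ i) NS.:+ d) NS.:= NS.con 1 NS.:+ j NS.:+ (NS.con 1 NS.:+ i NS.:+ (NS.con 1 NS.:+ d))) refl j i d)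
    q₂ : q ≡ suc i ℕ.+ (suc j ℕ.+ suc d)
    q₂ = trans (cong suc (trans Q≡ (cong (ℕ._+ d) s≡))) (NS.solve 3 (λ j i d → NS.con 1 NS.:+ (NS.con 1 NS.:+ j NS.:+ (NS.con 1 NS.:+ i) NS.:+ d) NS.:= NS.con 1 NS.:+ i NS.:+ (NS.con 1 NS.:+ j NS.:+ (NS.con 1 NS.:+ d))) refl j i d)

  -- The possible numbers of zero slices of a function whose weight is at most the second weight.
  kind : ∀ t n s {f : Fun F (suc (t ℕ.+ suc n))} → 1 ≤ s → s ≤ Q → D (suc (t ℕ.* Q ℕ.+ s)) f → ¬ Zero f → wt f ≤ σ s ℕ.* q ^ n →
         Kind t s n (wt f) (#zeros f)
  kind t n s {f} 1≤s s≤Q d ¬z ub with ¬Zero⇒∃ ¬z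
  ... | x₀ ∷ z₀ , nz₀ with ℕP.<-cmp (#zeros f) s
  ... | tri≈ _ e _ = k-full e
  ... | tri< j<s _ _ = go (#zeros f) refl
    where
    go : ∀ j → #zeros f ≡ j → Kind t s n (wt f) (#zeros f)
    go zero e = k-none e
    go (suc j) e with ∃+ (subst (_< s) e j<s)
    ... | i , s≡′ = k-mid (subst (1 ≤_) (sym e) (s≤s z≤n)) j<s (ℕP.≤-antisym ub lb) (ℕP.≤-antisym σ≥ σ≤)
      where
      s≡ij : s ≡ suc j ℕ.+ suc i
      s≡ij = trans s≡′ (sym (ℕP.+-suc (suc j) i))
      prod : (q ∸ #zeros f) ℕ.* (q ∸ (s ∸ #zeros f)) ≡ σ s ℕ.+ j ℕ.* i
      prod = trans (cong (λ k → (q ∸ k) ℕ.* (q ∸ (s ∸ k))) e) (trans (cong (λ k → (q ∸ suc j) ℕ.* (q ∸ k)) (∸≡ {b = suc j} s≡ij)) (mid-weight j i s s≡ij s≤Q))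
      σ≤ : σ s ≤ (q ∸ #zeros f) ℕ.* (q ∸ (s ∸ #zeros f))
      σ≤ = ℕP.≤-trans (ℕP.m≤m+n _ _) (ℕP.≤-reflexive (sym prod))
      sb : (q ∸ #zeros f) ℕ.* (q ∸ (s ∸ #zeros f)) ℕ.* q ^ n ≤ wt f
      sb = ℕP.≤-trans (ℕP.≤-reflexive (ℕP.*-assoc (q ∸ #zeros f) _ _)) (slices-bound f _ (few-zeros t n s s≤Q d (ℕP.<⇒≤ j<s)))
      lb : σ s ℕ.* q ^ n ≤ wt f
      lb = ℕP.≤-trans (ℕP.*-monoˡ-≤ (q ^ n) σ≤) sb
      σ≥ : (q ∸ #zeros f) ℕ.* (q ∸ (s ∸ #zeros f)) ≤ σ s
      σ≥ = ℕP.*-cancelʳ-≤ _ _ (q ^ n) {{ℕP.m^n≢0 q n}} (ℕP.≤-trans sb ub)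
  kind zero n s {f} 1≤s s≤Q d ¬z ub | x₀ ∷ z₀ , nz₀ | tri> _ _ s<j = contradiction (none-if-many s d s<j (x₀ ∷ z₀)) nz₀
  kind (suc t) n s {f} 1≤s s≤Q d ¬z ub | x₀ ∷ z₀ , nz₀ | tri> _ _ s<j with ℕP.m≤n⇒m<n∨m≡n (#zeros≤Q f (λ e → nz₀ (e z₀)))
  ... | inj₂ e = k-one (s≤s z≤n) e
  ... | inj₁ j<Q with ∃+ s<j | ∃+ j<Q
  -- Now q - s = i + k + 3, so σ s = (i + k + 4)(q - 1). The k + 2 nonzero slices weigh at least (i
  -- + 2) q^(n+1) each, and (k + 2)(i + 2) exceeds i + k + 4 by ki + k + i.
  ... | i , j≡ | k , Q≡ = contradiction ub (ℕP.<⇒≱ (begin-strict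
    σ s ℕ.* q ^ n ≡⟨ cong (λ d → suc d ℕ.* Q ℕ.* q ^ n) (∸≡ q≡s) ⟩
    suc (suc (suc (i ℕ.+ suc k))) ℕ.* Q ℕ.* q ^ n <⟨ ℕP.*-monoˡ-< (q ^ n) {{ℕP.m^n≢0 q n}} (ℕP.*-monoʳ-< (suc (suc (suc (i ℕ.+ suc k)))) (ℕP.n<1+n Q)) ⟩
    suc (suc (suc (i ℕ.+ suc k))) ℕ.* q ℕ.* q ^ n ≤⟨ ℕP.m≤m+n _ ((k ℕ.* i ℕ.+ k ℕ.+ i) ℕ.* q ℕ.* q ^ n) ⟩
    suc (suc (suc (i ℕ.+ suc k))) ℕ.* q ℕ.* q ^ n ℕ.+ (k ℕ.* i ℕ.+ k ℕ.+ i) ℕ.* q ℕ.* q ^ n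
      ≡⟨ NS.solve 4 (λ k i q w → (NS.con 3 NS.:+ (i NS.:+ (NS.con 1 NS.:+ k))) NS.:* q NS.:* w NS.:+ (k NS.:* i NS.:+ k NS.:+ i) NS.:* q NS.:* w
          NS.:= (NS.con 2 NS.:+ k) NS.:* ((NS.con 2 NS.:+ i) NS.:* (q NS.:* w))) refl k i q (q ^ n) ⟩
    suc (suc k) ℕ.* (suc (suc i) ℕ.* q ^ suc n) ≡⟨ cong₂ (λ a b → a ℕ.* (suc b ℕ.* q ^ suc n)) (sym (∸≡ q≡j)) (sym (∸≡ (trans j≡ (sym (ℕP.+-suc s i))))) ⟩
    (q ∸ #zeros f) ℕ.* (suc (#zeros f ∸ s) ℕ.* q ^ suc n) ≤⟨ slices-bound f _ (many-zeros t n s d (ℕP.<⇒≤ s<j)) ⟩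
    wt f ∎))
    where
    open ℕP.≤-Reasoning
    q≡j : q ≡ #zeros f ℕ.+ suc (suc k)
    q≡j = trans (cong suc Q≡) (NS.solve 2 (λ j k → NS.con 2 NS.:+ (j NS.:+ k) NS.:= j NS.:+ (NS.con 2 NS.:+ k)) refl (#zeros f) k)
    q≡s : q ≡ s ℕ.+ suc (suc (i ℕ.+ suc k))
    q≡s = trans q≡j (trans (cong (ℕ._+ suc (suc k)) j≡) (NS.solve 3 (λ s i k → NS.con 1 NS.:+ s NS.:+ i NS.:+ (NS.con 2 NS.:+ k) NS.:= s NS.:+ (NS.con 2 NS.:+ (i NS.:+ (NS.con 1 NS.:+ k)))) refl s i k))

  -- Affine bijections

  record Iso (m : ℕ) : Set where
    constructor mkIso
    field
      to from : AffMap m m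
      to-from : ∀ p → app to (app from p) ≡ p
      from-to : ∀ p → app from (app to p) ≡ p

  infixl 8 _$_
  _$_ : ∀ {m} → Iso m → V m → V m
  φ $ p = app (Iso.to φ) p

  idI : ∀ {m} → Iso m
  idI = mkIso map-id map-id (λ _ → refl) (λ _ → refl)

  infixr 9 _∘I_
  _∘I_ : ∀ {m} → Iso m → Iso m → Iso m
  φ ∘I ψ = mkIso (map-∘ φ.to ψ.to) (map-∘ ψ.from φ.from)
    (λ p → trans (cong (app φ.to) (ψ.to-from _)) (φ.to-from p))
    (λ p → trans (cong (app ψ.from) (φ.from-to _)) (ψ.from-to p))
    where
    module φ = Iso φ
    module ψ = Iso ψ

  liftI : ∀ {m} → Iso m → Iso (suc m)
  liftI φ = mkIso (map-∷ aff-head (map-∘ φ.to map-tail)) (map-∷ aff-head (map-∘ φ.from map-tail))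
    (λ { (x ∷ p) → cong (x ∷_) (φ.to-from p) }) (λ { (x ∷ p) → cong (x ∷_) (φ.from-to p) })
    where module φ = Iso φ

  swapI : ∀ {m} → Iso (suc (suc m))
  swapI {m} = mkIso s s (λ { (x ∷ y ∷ p) → refl }) (λ { (x ∷ y ∷ p) → refl })
    where
    s : AffMap (suc (suc m)) (suc (suc m))
    s = map-∷ (aff-∘ aff-head map-tail) (map-∷ aff-head (map-∘ map-tail map-tail))

  translateI : ∀ {m} → V m → Iso m
  translateI v = mkIso (map-translate v) (map-translate (- 1# · v))
    (λ p → trans (sym (⊞-assoc v _ p)) (trans (cong (_⊞ p) (⊞-inverseʳ v)) (⊞-identityˡ p)))
    (λ p → trans (sym (⊞-assoc _ v p)) (trans (cong (_⊞ p) (trans (⊞-comm _ v) (⊞-inverseʳ v))) (⊞-identityˡ p)))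

  -- (x ∷ z) ↦ (x + a z ∷ z)
  shearI : ∀ {m} {a : Fun F m} → IsAff a → Iso (suc m)
  shearI {a = a} A = mkIso (map-∷ (aff-+ aff-head (aff-∘ A map-tail)) map-tail)
    (map-∷ (aff-+ aff-head (aff-* (- 1#) (aff-∘ A map-tail))) map-tail)
    (λ { (x ∷ z) → cong (_∷ z) (solve 2 (λ x a → x :+ :- con (1 , 0) :* a :+ a := x) refl x (a z)) })
    (λ { (x ∷ z) → cong (_∷ z) (solve 2 (λ x a → x :+ a :+ :- con (1 , 0) :* a := x) refl x (a z)) })

  -- (x ∷ z) ↦ (x ∷ z + x v)
  tiltI : ∀ {m} → V m → Iso (suc m)
  tiltI {m} v = mkIso (tilt v) (tilt (- 1# · v))
    (λ { (x ∷ z) → cong (x ∷_) (trans (⊞-assoc z _ _) (trans (cong (z ⊞_) (c₂ x)) (⊞-identityʳ z))) })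
    (λ { (x ∷ z) → cong (x ∷_) (trans (⊞-assoc z _ _) (trans (cong (z ⊞_) (c₁ x)) (⊞-identityʳ z))) })
    where
    tilt : V m → AffMap (suc m) (suc m)
    tilt v = mkMap (λ p → head p ∷ tail p ⊞ head p · v) (λ p → head p ∷ tail p ⊞ head p · v)
      (λ { (x ∷ p) (y ∷ w) → cong (x + y ∷_) (trans (cong (p ⊞ w ⊞_) (+-· x y v)) (⊞-interchange p w _ _)) })
      (λ { c (y ∷ w) → cong (c * y ∷_) (trans (cong (c · w ⊞_) (*-· c y v)) (sym (·-⊞ c w _))) })
    c₁ : ∀ x → x · v ⊞ x · (- 1# · v) ≡ 0V
    c₁ x = trans (sym (·-⊞ x v _)) (trans (cong (x ·_) (⊞-inverseʳ v)) (·0V x))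
    c₂ : ∀ x → x · (- 1# · v) ⊞ x · v ≡ 0V
    c₂ x = trans (⊞-comm _ _) (c₁ x)

  infixl 8 _∘f_
  _∘f_ : ∀ {m} → Fun F m → Iso m → Fun F m
  (f ∘f φ) p = f (φ $ p)

  wt-iso : ∀ {m} (f : Fun F m) (φ : Iso m) → wt (f ∘f φ) ≡ wt f
  wt-iso {m} f φ = N.reindexV m (app (Iso.to φ)) (app (Iso.from φ)) (Iso.from-to φ) (Iso.to-from φ) (λ p → nz (f p))

  D-iso : ∀ {m n} {f : Fun F m} → D n f → (φ : Iso m) → D n (f ∘f φ)
  D-iso d φ = D-∘ d (Iso.to φ)

  ¬Zero-iso : ∀ {m} {f : Fun F m} → ¬ Zero f → (φ : Iso m) → ¬ Zero (f ∘f φ)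
  ¬Zero-iso {f = f} n φ z = n λ p → trans (cong f (sym (Iso.to-from φ p))) (z (app (Iso.from φ) p))

  -- Some affine hyperplane misses the support.
  Empty : ∀ {m} → Fun F (suc m) → Set
  Empty {m} f = Σ (Iso (suc m)) λ φ → Zero (slice (f ∘f φ) 0#)

  Empty-iso : ∀ {m} (f : Fun F (suc m)) (φ : Iso (suc m)) → Empty (f ∘f φ) → Empty f
  Empty-iso f φ (ψ , z) = φ ∘I ψ , z

  Empty-slice : ∀ {m} (f : Fun F (suc m)) x → Zero (slice f x) → Empty f
  Empty-slice f x z = shearI (aff-const x) , λ p → trans (cong (λ y → f (y ∷ p)) (+-identityˡ x)) (z p)

  -- Projections and the weight they lose

  ΣV-1≡ : ∀ m → N.ΣV m (λ _ → 1) ≡ q ^ m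
  ΣV-1≡ zero = refl
  ΣV-1≡ (suc m) = trans (N.ΣV-suc m _) (trans (N.ΣL-cong E (λ _ → ΣV-1≡ m)) (ΣNC-const (q ^ m)))

  proj : ∀ {m} → Fun F (suc m) → Fun F m
  proj f w = ΣC (λ x → f (x ∷ w))

  fibre : ∀ {m} → Fun F (suc m) → V m → ℕ
  fibre f w = N.ΣC (λ x → nz (f (x ∷ w)))

  wt-fibre : ∀ {m} (f : Fun F (suc m)) → wt f ≡ N.ΣV m (fibre f)
  wt-fibre {m} f = trans (wt-suc f) (N.ΣL-swap E (pts m) (λ x w → nz (f (x ∷ w))))

  ΣN-pos : ∀ {A : Set} (xs : List A) (g : A → ℕ) → N.ΣL xs g ≡ 0 → ∀ {x} → x ∈ xs → g x ≡ 0
  ΣN-pos (x ∷ xs) g e (here refl) = ℕP.m+n≡0⇒m≡0 (g x) e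
  ΣN-pos (x ∷ xs) g e (there i) = ΣN-pos xs g (ℕP.m+n≡0⇒n≡0 (g x) e) i

  fibre≡0 : ∀ {m} (f : Fun F (suc m)) w → fibre f w ≡ 0 → ∀ x → f (x ∷ w) ≡ 0#
  fibre≡0 f w e x = nz≡0 (ΣN-pos E _ e (∈-E x))

  nz-proj : ∀ {m} (f : Fun F (suc m)) w → nz (proj f w) ≤ fibre f w
  nz-proj f w with fibre f w in e
  ... | suc k = ℕP.≤-trans (nz≤1 _) (s≤s z≤n)
  ... | zero = ℕP.≤-reflexive (nz-0 (trans (ΣL-cong E (fibre≡0 f w e)) (ΣL-ε E)))

  wt-proj : ∀ {m} (f : Fun F (suc m)) → wt (proj f) ≤ wt f
  wt-proj {m} f = ℕP.≤-trans (ΣN-mono (pts m) (nz-proj f)) (ℕP.≤-reflexive (sym (wt-fibre f)))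

  -- Among the q^m lines through a point of the support in a direction (1 , z), one contains no further point;
  -- the projection along it does not vanish.
  transversal : ∀ {m} (f : Fun F (suc m)) → ¬ Zero f → wt f < q ^ m → Σ (Iso (suc m)) λ φ → ¬ Zero (proj (f ∘f φ))
  transversal {m} f ¬z small with ¬Zero⇒∃ ¬z
  ... | p₀ , nz₀ = result (∃V? m lonely?)
    where
    f₁ : Fun F (suc m)
    f₁ = f ∘f translateI p₀
    Lonely : V m → Set
    Lonely z = ∀ l → l ≢ 0# → f₁ (l ∷ l · z) ≡ 0#
    lonely? : ∀ z → Dec (Lonely z)
    lonely? z with ∃C? {P = λ l → l ≢ 0# × f₁ (l ∷ l · z) ≢ 0#} dec
      where
      dec : ∀ l → Dec (l ≢ 0# × f₁ (l ∷ l · z) ≢ 0#)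
      dec l with l ≟ 0# | f₁ (l ∷ l · z) ≟ 0#
      ... | no a | no b = yes (a , b)
      ... | yes a | _ = no λ { (n , _) → n a }
      ... | _ | yes b = no λ { (_ , n) → n b }
    ... | inj₁ (l , a , b) = no λ h → b (h l a)
    ... | inj₂ none = yes λ l a → helper l a
      where
      helper : ∀ l → l ≢ 0# → f₁ (l ∷ l · z) ≡ 0#
      helper l a with f₁ (l ∷ l · z) ≟ 0#
      ... | yes e = e
      ... | no b = ⊥-elim (none l (a , b))
    g : Carrier → V m → ℕ
    g l z = pick (l ≟ 0#) 0 (nz (f₁ (l ∷ l · z)))
    g-sum : ∀ l → N.ΣV m (g l) ≤ wt (slice f₁ l)
    g-sum l with l ≟ 0#
    ... | yes _ = ℕP.≤-trans (ℕP.≤-reflexive (N.ΣL-ε (pts m))) z≤n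
    ... | no a = ℕP.≤-reflexive (N.reindexV m (l ·_) (inv l ·_)
      (λ v → trans (sym (*-· _ _ v)) (trans (cong (_· v) (inv-l a)) (1· v)))
      (λ v → trans (sym (*-· _ _ v)) (trans (cong (_· v) (inv-r a)) (1· v))) (λ v → nz (f₁ (l ∷ v))))
    result : (∃ Lonely) ⊎ (∀ z → ¬ Lonely z) → Σ (Iso (suc m)) λ φ → ¬ Zero (proj (f ∘f φ))
    result (inj₁ (z , lone)) = translateI p₀ ∘I tiltI z , λ e → nz₀ (begin
      f p₀ ≡⟨ cong f (sym (⊞-identityʳ p₀)) ⟩
      f₁ 0V ≡⟨ sym (δC 0# (λ _ → f₁ 0V)) ⟩
      ΣC (λ l → pick (l ≟ 0#) (f₁ 0V) 0#) ≡⟨ ΣL-cong E pt ⟩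
      proj (f ∘f (translateI p₀ ∘I tiltI z)) 0V ≡⟨ e 0V ⟩
      0# ∎)
      where
      open ≡-Reasoning
      pt : ∀ l → pick (l ≟ 0#) (f₁ 0V) 0# ≡ f₁ (l ∷ 0V ⊞ l · z)
      pt l with l ≟ 0#
      ... | yes refl = cong (λ v → f₁ (0# ∷ v)) (sym (trans (⊞-identityˡ _) (0· z)))
      ... | no a = sym (trans (cong (λ v → f₁ (l ∷ v)) (⊞-identityˡ _)) (lone l a))
    -- Every z now has a point of the support at some l ≠ 0. A point with first coordinate l ≠ 0
    -- belongs to just one z, so the weight would be at least q^m.
    result (inj₂ none) = contradiction small (ℕP.≤⇒≯ (begin
      q ^ m ≡⟨ sym (ΣV-1≡ m) ⟩
      N.ΣV m (λ _ → 1) ≤⟨ ΣN-mono (pts m) some ⟩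
      N.ΣV m (λ z → N.ΣC (λ l → g l z)) ≡⟨ N.ΣL-swap (pts m) E (λ z l → g l z) ⟩
      N.ΣC (λ l → N.ΣV m (g l)) ≤⟨ ΣN-mono E g-sum ⟩
      N.ΣC (λ l → wt (slice f₁ l)) ≡⟨ sym (wt-suc f₁) ⟩
      wt f₁ ≡⟨ wt-iso f (translateI p₀) ⟩
      wt f ∎))
      where
      open ℕP.≤-Reasoning
      some : ∀ z → 1 ≤ N.ΣC (λ l → g l z)
      some z with N.ΣC (λ l → g l z) in e
      ... | suc _ = s≤s z≤n
      ... | zero = ⊥-elim (none z λ l a → nz≡0 (trans (pick-no l a) (ΣN-pos E _ e (∈-E l))))
        where
        pick-no : ∀ l → l ≢ 0# → nz (f₁ (l ∷ l · z)) ≡ g l z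
        pick-no l a with l ≟ 0#
        ... | yes b = contradiction b a
        ... | no _ = refl

  -- Points of the support over the zero slices of the projection are not counted by it.
  collision : ∀ {m} (f : Fun F (suc (suc m))) w →
              let G = λ p → ΣC (λ l → f (head p ∷ l ∷ tail p)) in
              (∀ x → Zero (slice G x) → ¬ Zero (slice f x) → w ≤ wt (slice f x)) →
              wt G ℕ.+ (#zeros G ∸ #zeros f) ℕ.* w ≤ wt f
  collision {m} f w lb = begin
    wt G ℕ.+ (#zeros G ∸ #zeros f) ℕ.* w ≡⟨ cong (ℕ._+ (#zeros G ∸ #zeros f) ℕ.* w) (wt-suc G) ⟩
    N.ΣC gG ℕ.+ (#zeros G ∸ #zeros f) ℕ.* w ≤⟨ ℕP.+-monoʳ-≤ (N.ΣC gG) (ℕP.*-monoˡ-≤ w (ℕP.m≤n+o⇒m∸n≤o (#zeros G) (#zeros f) (proj₁ (proj₂ cnt)))) ⟩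
    N.ΣC gG ℕ.+ proj₁ cnt ℕ.* w ≤⟨ proj₂ (proj₂ cnt) ⟩
    N.ΣC gf ≡⟨ sym (wt-suc f) ⟩
    wt f ∎
    where
    open ℕP.≤-Reasoning
    G : Fun F (suc m)
    G p = ΣC (λ l → f (head p ∷ l ∷ tail p))
    gG gf : Carrier → ℕ
    gG x = wt (slice G x)
    gf x = wt (slice f x)
    gG≤gf : ∀ x → gG x ≤ gf x
    gG≤gf x = wt-proj (slice f x)
    count : ∀ xs → ∃ λ c → List.length (List.filter (λ x → Zero? (slice G x)) xs) ≤ List.length (List.filter (λ x → Zero? (slice f x)) xs) ℕ.+ c
                    × N.ΣL xs gG ℕ.+ c ℕ.* w ≤ N.ΣL xs gf
    count [] = 0 , z≤n , z≤n
    count (x ∷ xs) with count xs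
    ... | c , l , b with Zero? (slice G x) | Zero? (slice f x)
    ... | no _ | no _ = c , l , ℕP.≤-trans (ℕP.≤-reflexive (ℕP.+-assoc (gG x) _ _)) (ℕP.+-mono-≤ (gG≤gf x) b)
    ... | no _ | yes _ = c , ℕP.m≤n⇒m≤1+n l , ℕP.≤-trans (ℕP.≤-reflexive (ℕP.+-assoc (gG x) _ _)) (ℕP.+-mono-≤ (gG≤gf x) b)
    ... | yes _ | yes _ = c , s≤s l , ℕP.≤-trans (ℕP.≤-reflexive (ℕP.+-assoc (gG x) _ _)) (ℕP.+-mono-≤ (gG≤gf x) b)
    ... | yes zG | no nf = suc c , ℕP.≤-trans (s≤s l) (ℕP.≤-reflexive (sym (ℕP.+-suc _ c))) , (begin
      gG x ℕ.+ N.ΣL xs gG ℕ.+ (w ℕ.+ c ℕ.* w) ≡⟨ cong (λ k → k ℕ.+ N.ΣL xs gG ℕ.+ (w ℕ.+ c ℕ.* w)) (wt-≡0 zG) ⟩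
      N.ΣL xs gG ℕ.+ (w ℕ.+ c ℕ.* w) ≡⟨ NS.solve 3 (λ a b c → a NS.:+ (b NS.:+ c) NS.:= b NS.:+ (a NS.:+ c)) refl (N.ΣL xs gG) w (c ℕ.* w) ⟩
      w ℕ.+ (N.ΣL xs gG ℕ.+ c ℕ.* w) ≤⟨ ℕP.+-mono-≤ (lb x zG nf) b ⟩
      gf x ℕ.+ N.ΣL xs gf ∎)
    cnt : ∃ λ c → #zeros G ≤ #zeros f ℕ.+ c × N.ΣC gG ℕ.+ c ℕ.* w ≤ N.ΣC gf
    cnt = count E

  -- The second weight is the minimum weight plus s - 1 units. A contradiction is reached as soon as
  -- s units, one too many, are found on top of the minimum weight.
  σ+1 : ∀ s → 1 ≤ s → s ≤ Q → suc (σ s) ≡ (q ∸ s) ℕ.* q ℕ.+ s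
  σ+1 s 1≤s s≤Q with ∃+ s≤Q
  ... | d , Q≡ = begin
    suc (σ s) ≡⟨ cong₂ (λ a b → suc (suc a ℕ.* b)) q∸ Q≡ ⟩
    suc (suc (suc d) ℕ.* (s ℕ.+ d)) ≡⟨ NS.solve 2 (λ s d → NS.con 1 NS.:+ (NS.con 2 NS.:+ d) NS.:* (s NS.:+ d) NS.:= (NS.con 1 NS.:+ d) NS.:* (NS.con 1 NS.:+ (s NS.:+ d)) NS.:+ s) refl s d ⟩
    suc d ℕ.* suc (s ℕ.+ d) ℕ.+ s ≡⟨ cong₂ (λ a b → a ℕ.* suc b ℕ.+ s) (sym q∸) (sym Q≡) ⟩
    (q ∸ s) ℕ.* q ℕ.+ s ∎
    where
    open ≡-Reasoning
    q∸ : q ∸ s ≡ suc d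
    q∸ = ∸≡ (trans (cong suc Q≡) (sym (ℕP.+-suc s d)))

  σ<q² : ∀ s → 1 ≤ s → s ≤ Q → σ s < q ℕ.* q
  σ<q² s 1≤s s≤Q = ℕP.≤-<-trans (ℕP.*-monoˡ-≤ Q (s≤s (ℕP.≤-trans (ℕP.∸-monoʳ-≤ q 1≤s) ℕP.≤-refl))) (ℕP.*-monoʳ-< q (ℕP.n<1+n Q))

  d≥1 : ∀ {s} → s ≤ Q → 1 ≤ q ∸ s
  d≥1 l = ℕP.m<n⇒0<n∸m (s≤s l)

  σ-small : ∀ t n s → 1 ≤ s → s ≤ Q → σ s ℕ.* q ^ n < q ^ suc (t ℕ.+ suc n)
  σ-small t n s 1≤s s≤Q = ℕP.<-≤-trans (ℕP.*-monoˡ-< (q ^ n) {{ℕP.m^n≢0 q n}} (σ<q² s 1≤s s≤Q))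
    (ℕP.≤-trans (ℕP.≤-reflexive (ℕP.*-assoc q q (q ^ n))) (ℕP.^-monoʳ-≤ q {suc (suc n)} (s≤s (ℕP.m≤n+m (suc n) t))))

  min-wt : ∀ t n s {f : Fun F (t ℕ.+ suc n)} → s ≤ Q → D (suc (t ℕ.* Q ℕ.+ s)) f → ¬ Zero f → (q ∸ s) ℕ.* q ^ n ≤ wt f
  min-wt t n s s≤Q d ¬z = ℕP.≤-trans (ℕP.≤-reflexive (sym (μ-eval t n s s≤Q))) (kasami (t ℕ.+ suc n) d (¬Zero⇒∃ ¬z))

  min-wt′ : ∀ t n s {f : Fun F (suc (t ℕ.+ suc n))} → s ≤ Q → D (suc (t ℕ.* Q ℕ.+ s)) f → ¬ Zero f → (q ∸ s) ℕ.* q ^ suc n ≤ wt f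
  min-wt′ t n s {f} s≤Q d ¬z = ℕP.≤-trans (ℕP.≤-reflexive (sym (trans (cong (λ k → μ k (t ℕ.* Q ℕ.+ s)) (sym (ℕP.+-suc t (suc n)))) (μ-eval t (suc n) s s≤Q))))
    (kasami (suc (t ℕ.+ suc n)) d (¬Zero⇒∃ ¬z))

  -- Hyperplanes missing the support: the induction on t

  MissesHyperplane : ℕ → ℕ → ℕ → Set
  MissesHyperplane t n s = {f : Fun F (suc (t ℕ.+ suc n))} → D (suc (t ℕ.* Q ℕ.+ s)) f → ¬ Zero f → wt f ≤ σ s ℕ.* q ^ n → Empty f

  D-proj : ∀ t s {m} {f : Fun F (suc m)} → D (suc (suc t ℕ.* Q ℕ.+ s)) f → D (suc (t ℕ.* Q ℕ.+ s)) (proj f)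
  D-proj t s d = D-cast (∸≡ (NS.solve 3 (λ Q t s → NS.con 1 NS.:+ (Q NS.:+ t NS.:+ s) NS.:= Q NS.:+ (NS.con 1 NS.:+ (t NS.:+ s))) refl Q (t ℕ.* Q) s)) (D-Σ d)

  kind-zeros : ∀ {t s n w j} → Kind t s n w j → 1 ≤ s → s ≤ Q → 1 ≤ j → s ≤ j ⊎ (j < s × w ≡ σ s ℕ.* q ^ n)
  kind-zeros (k-none e) _ _ l = contradiction (subst (1 ≤_) e l) λ ()
  kind-zeros (k-full e) _ _ _ = inj₁ (ℕP.≤-reflexive (sym e))
  kind-zeros (k-one _ e) _ s≤Q _ = inj₁ (ℕP.≤-trans s≤Q (ℕP.≤-reflexive (sym e)))
  kind-zeros (k-mid _ l e _) _ _ _ = inj₂ (l , e)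

  1≤#zeros : ∀ {m} (f : Fun F (suc m)) x → Zero (slice f x) → 1 ≤ #zeros f
  1≤#zeros f x z with zeros f | ∈-zeros f {x} z
  ... | _ ∷ _ | _ = s≤s z≤n

  -- The projection G misses a hyperplane. If no hyperplane of the class above it missed the support
  -- of f, each zero slice of G would lose at least (q - s) q^n points. With s or more zero slices
  -- this adds s units to the minimum weight of G; with fewer, G already has the second weight and
  -- nothing may be lost.
  MissesHyperplane-suc : ∀ t n s → 1 ≤ s → s ≤ Q → MissesHyperplane t n s → MissesHyperplane (suc t) n s
  MissesHyperplane-suc t n s 1≤s s≤Q IH {f} d ¬z ub with transversal f ¬z (ℕP.≤-<-trans ub (σ-small t n s 1≤s s≤Q))
  ... | φ , ¬zπ with IH (D-proj t s (D-iso d φ)) ¬zπ (ℕP.≤-trans (wt-proj (f ∘f φ)) (ℕP.≤-trans (ℕP.≤-reflexive (wt-iso f φ)) ub))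
  ... | ψ , zψ with ∃C? (λ x → Zero? (slice (f ∘f (φ ∘I (liftI ψ ∘I swapI))) x))
  ... | inj₁ (x , zx) = Empty-iso f (φ ∘I (liftI ψ ∘I swapI)) (Empty-slice (f ∘f (φ ∘I (liftI ψ ∘I swapI))) x zx)
  ... | inj₂ none = contradiction bound (ℕP.<⇒≱ (too-big (kind-zeros (kind t n s 1≤s s≤Q dG ¬zG ubG) 1≤s s≤Q (1≤#zeros G 0# zψ))))
    where
    Φ : Iso _
    Φ = φ ∘I (liftI ψ ∘I swapI)
    f₃ : Fun F (suc (suc (t ℕ.+ suc n)))
    f₃ = f ∘f Φ
    G : Fun F (suc (t ℕ.+ suc n))
    G p = ΣC (λ l → f₃ (head p ∷ l ∷ tail p))
    G≡ : ∀ p → G p ≡ (proj (f ∘f φ) ∘f ψ) p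
    G≡ (x ∷ p) = refl
    dG : D (suc (t ℕ.* Q ℕ.+ s)) G
    dG = D-cong (D-iso (D-proj t s (D-iso d φ)) ψ) G≡
    ¬zG : ¬ Zero G
    ¬zG z = ¬Zero-iso ¬zπ ψ (λ p → trans (sym (G≡ p)) (z p))
    wt₃ : wt f₃ ≤ σ s ℕ.* q ^ n
    wt₃ = ℕP.≤-trans (ℕP.≤-reflexive (wt-iso f Φ)) ub
    w : ℕ
    w = (q ∸ s) ℕ.* q ^ n
    lb : ∀ x → Zero (slice G x) → ¬ Zero (slice f₃ x) → w ≤ wt (slice f₃ x)
    lb x _ nz = min-wt (suc t) n s s≤Q (D-slice (D-iso d Φ) x) nz
    no-zeros : #zeros f₃ ≡ 0
    no-zeros with zeros f₃ in e
    ... | [] = refl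
    ... | x ∷ _ = ⊥-elim (none x (zeros-∈ f₃ (subst (x ∈_) (sym e) (here refl))))
    bound : wt G ℕ.+ #zeros G ℕ.* w ≤ σ s ℕ.* q ^ n
    bound = ℕP.≤-trans (ℕP.≤-reflexive (cong (λ k → wt G ℕ.+ (#zeros G ∸ k) ℕ.* w) (sym no-zeros))) (ℕP.≤-trans (collision f₃ w lb) wt₃)
    ubG : wt G ≤ σ s ℕ.* q ^ n
    ubG = ℕP.≤-trans (ℕP.m≤m+n _ _) bound
    w>0 : 1 ≤ w
    w>0 = ℕP.*-mono-≤ (d≥1 s≤Q) (q^>0 n)
    too-big : s ≤ #zeros G ⊎ (#zeros G < s × wt G ≡ σ s ℕ.* q ^ n) → σ s ℕ.* q ^ n < wt G ℕ.+ #zeros G ℕ.* w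
    too-big (inj₂ (_ , e)) = subst (λ k → k < wt G ℕ.+ #zeros G ℕ.* w) e
      (ℕP.≤-trans (ℕP.≤-reflexive (ℕP.+-comm 1 (wt G))) (ℕP.+-monoʳ-≤ (wt G) (ℕP.*-mono-≤ (1≤#zeros G 0# zψ) w>0)))
    too-big (inj₁ l) = begin-strict
      σ s ℕ.* q ^ n <⟨ ℕP.*-monoˡ-< (q ^ n) {{ℕP.m^n≢0 q n}} (ℕP.n<1+n (σ s)) ⟩
      suc (σ s) ℕ.* q ^ n ≡⟨ cong (ℕ._* q ^ n) (σ+1 s 1≤s s≤Q) ⟩
      ((q ∸ s) ℕ.* q ℕ.+ s) ℕ.* q ^ n ≡⟨ NS.solve 4 (λ d q s w → (d NS.:* q NS.:+ s) NS.:* w NS.:= d NS.:* (q NS.:* w) NS.:+ s NS.:* (NS.con 1 NS.:* w)) refl (q ∸ s) q s (q ^ n) ⟩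
      (q ∸ s) ℕ.* q ^ suc n ℕ.+ s ℕ.* (1 ℕ.* q ^ n) ≤⟨ ℕP.+-mono-≤ (min-wt′ t n s s≤Q dG ¬zG) (ℕP.*-mono-≤ l (ℕP.*-monoˡ-≤ (q ^ n) (d≥1 s≤Q))) ⟩
      wt G ℕ.+ #zeros G ℕ.* w ∎
      where open ℕP.≤-Reasoning

  -- Bruen's bound: multiplicities of roots

  -- A degree bound for formal polynomials, here identified with their coefficient sequences. Below,
  -- `linP α β` is multiplication by α + βX, `root a` by X - a, and `pw a T` by (X - a)^T.
  Below : ℕ → Seq → Set
  Below n c = ∀ i → n ≤ i → c i ≡ 0#

  sh : Seq → Seq
  sh c zero    = 0#
  sh c (suc i) = c i

  linP : Carrier → Carrier → Seq → Seq
  linP α β c i = α * c i + β * sh c i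

  sh-cong : ∀ {c d : Seq} → (∀ i → c i ≡ d i) → ∀ i → sh c i ≡ sh d i
  sh-cong e zero    = refl
  sh-cong e (suc i) = e i

  linP-cong : ∀ α β {c d : Seq} → (∀ i → c i ≡ d i) → ∀ i → linP α β c i ≡ linP α β d i
  linP-cong α β e i = cong₂ (λ a b → α * a + β * b) (e i) (sh-cong e i)

  sh-linP : ∀ γ δ c i → sh (linP γ δ c) i ≡ γ * sh c i + δ * sh (sh c) i
  sh-linP γ δ c zero    = solve 2 (λ γ δ → con (0 , 0) := γ :* con (0 , 0) :+ δ :* con (0 , 0)) refl γ δ
  sh-linP γ δ c (suc i) = refl

  linP-comm : ∀ α β γ δ c i → linP α β (linP γ δ c) i ≡ linP γ δ (linP α β c) i
  linP-comm α β γ δ c i = trans (cong (λ w → α * linP γ δ c i + β * w) (sh-linP γ δ c i))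
    (trans (solve 7 (λ α β γ δ x y z → α :* (γ :* x :+ δ :* y) :+ β :* (γ :* y :+ δ :* z) := γ :* (α :* x :+ β :* y) :+ δ :* (α :* y :+ β :* z)) refl α β γ δ (c i) (sh c i) (sh (sh c) i))
      (cong (λ w → γ * linP α β c i + δ * w) (sym (sh-linP α β c i))))

  linP-Below : ∀ {n} α β {c} → Below n c → Below (suc n) (linP α β c)
  linP-Below α β s (suc i) (s≤s l) = trans (cong₂ (λ a b → α * a + β * b) (s (suc i) (ℕP.m≤n⇒m≤1+n l)) (s i l))
    (solve 2 (λ α β → α :* con (0 , 0) :+ β :* con (0 , 0) := con (0 , 0)) refl α β)

  Below-mono : ∀ {n k} {c : Seq} → n ≤ k → Below n c → Below k c
  Below-mono l s i k≤i = s i (ℕP.≤-trans l k≤i)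

  ev-linP : ∀ n α β c x → Below n c → ev (suc n) (linP α β c) x ≡ (α + β * x) * ev n c x
  ev-linP n α β c x s = begin
    ev (suc n) (linP α β c) x ≡⟨ ev-+ (suc n) (λ i → α * c i) (λ i → β * sh c i) x ⟩
    ev (suc n) (λ i → α * c i) x + ev (suc n) (λ i → β * sh c i) x
      ≡⟨ cong₂ _+_ (ev-* (suc n) α c x) (ev-* (suc n) β (sh c) x) ⟩
    α * ev (suc n) c x + β * (0# + x * ev n c x) ≡⟨ cong (λ w → α * w + β * (0# + x * ev n c x)) (ev-extend n (suc n) c x (ℕP.n≤1+n n) s) ⟩
    α * ev n c x + β * (0# + x * ev n c x) ≡⟨ solve 4 (λ α β x e → α :* e :+ β :* (con (0 , 0) :+ x :* e) := (α :+ β :* x) :* e) refl α β x _ ⟩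
    (α + β * x) * ev n c x ∎
    where open ≡-Reasoning

  root : Carrier → Seq → Seq
  root a = linP (- a) 1#

  pw : Carrier → ℕ → Seq → Seq
  pw a zero    c = c
  pw a (suc T) c = root a (pw a T c)

  pw-cong : ∀ a T {c d : Seq} → (∀ i → c i ≡ d i) → ∀ i → pw a T c i ≡ pw a T d i
  pw-cong a zero    e = e
  pw-cong a (suc T) e = linP-cong (- a) 1# (pw-cong a T e)

  pw-linP : ∀ a T α β c i → linP α β (pw a T c) i ≡ pw a T (linP α β c) i
  pw-linP a zero    α β c i = refl
  pw-linP a (suc T) α β c i = trans (linP-comm α β (- a) 1# (pw a T c) i) (linP-cong (- a) 1# (pw-linP a T α β c) i)

  pw-Below : ∀ {n} a T {c} → Below n c → Below (T ℕ.+ n) (pw a T c)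
  pw-Below a zero    s = s
  pw-Below a (suc T) s = linP-Below (- a) 1# (pw-Below a T s)

  ev-pw : ∀ n a T c x → Below n c → ev (T ℕ.+ n) (pw a T c) x ≡ pow F (x - a) T * ev n c x
  ev-pw n a zero    c x s = sym (*-identityˡ _)
  ev-pw n a (suc T) c x s = trans (ev-linP (T ℕ.+ n) (- a) 1# (pw a T c) x (pw-Below a T s))
    (trans (cong ((- a + 1# * x) *_) (ev-pw n a T c x s)) (solve 4 (λ a x p e → (:- a :+ con (1 , 0) :* x) :* (p :* e) := (x :- a) :* p :* e) refl a x _ _))

  pw-ΣC : ∀ a T (c : Carrier → Seq) i → ΣC (λ y → pw a T (c y) i) ≡ pw a T (λ j → ΣC (λ y → c y j)) i
  pw-ΣC a zero    c i = refl
  pw-ΣC a (suc T) c i = begin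
    ΣC (λ y → - a * pw a T (c y) i + 1# * sh (pw a T (c y)) i) ≡⟨ ΣL-∙ E _ _ ⟩
    ΣC (λ y → - a * pw a T (c y) i) + ΣC (λ y → 1# * sh (pw a T (c y)) i) ≡⟨ cong₂ _+_ (ΣL-*ˡ E (- a) _) (ΣL-*ˡ E 1# _) ⟩
    - a * ΣC (λ y → pw a T (c y) i) + 1# * ΣC (λ y → sh (pw a T (c y)) i)
      ≡⟨ cong₂ (λ u v → - a * u + 1# * v) (pw-ΣC a T c i) (shΣ i) ⟩
    pw a (suc T) (λ j → ΣC (λ y → c y j)) i ∎
    where
    open ≡-Reasoning
    shΣ : ∀ i → ΣC (λ y → sh (pw a T (c y)) i) ≡ sh (pw a T (λ j → ΣC (λ y → c y j))) i
    shΣ zero    = ΣL-ε E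
    shΣ (suc i) = pw-ΣC a T c i

  -- The recurrence c i = (coefficient i + 1 of the product) + a c (i + 1) is run downwards from the
  -- range where c is known to vanish.
  root-Below⁻ : ∀ a {d M} c → Below M c → Below d (root a c) → Below (d ∸ 1) c
  root-Below⁻ a {d} {M} c sM sd = go M sM
    where
    go : ∀ k → Below k c → Below (d ∸ 1) c
    go zero    s = Below-mono z≤n s
    go (suc k) s with (d ∸ 1) ℕP.≤? k
    ... | no l = Below-mono (ℕP.≰⇒> l) s
    ... | yes l = go k λ i k≤i → step i k≤i
      where
      d≤ : d ≤ suc k
      d≤ = ℕP.≤-trans (ℕP.m≤n+m∸n d 1) (s≤s l)
      step : ∀ i → k ≤ i → c i ≡ 0#
      step i k≤i = begin
        c i ≡⟨ solve 3 (λ a u v → u := (:- a :* v :+ con (1 , 0) :* u) :+ a :* v) refl a (c i) (c (suc i)) ⟩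
        root a c (suc i) + a * c (suc i) ≡⟨ cong₂ (λ u v → u + a * v) (sd (suc i) (ℕP.≤-trans d≤ (s≤s k≤i))) (s (suc i) (s≤s k≤i)) ⟩
        0# + a * 0# ≡⟨ solve 1 (λ a → con (0 , 0) :+ a :* con (0 , 0) := con (0 , 0)) refl a ⟩
        0# ∎
        where open ≡-Reasoning

  pw-Below⁻ : ∀ a T {d M} c → Below M c → Below d (pw a T c) → Below (d ∸ T) c
  pw-Below⁻ a zero    c sM sd = sd
  pw-Below⁻ a (suc T) {d} c sM sd = subst (λ k → Below k c) (ℕP.∸-+-assoc d 1 T) (pw-Below⁻ a T c sM (root-Below⁻ a (pw a T c) (pw-Below a T sM) sd))

  root-inj : ∀ a {M M′} c c′ → Below M c → Below M′ c′ → (∀ i → root a c i ≡ root a c′ i) → ∀ i → c i ≡ c′ i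
  root-inj a {M} {M′} c c′ s s′ e i = -≡0⇒≡ (trans (diff i) (root-Below⁻ a {0} {M ℕ.⊔ M′} e′ supp zero′ i z≤n))
    where
    e′ : Seq
    e′ j = c j + - 1# * c′ j
    diff : ∀ j → c j - c′ j ≡ e′ j
    diff j = solve 2 (λ a b → a :- b := a :+ :- con (1 , 0) :* b) refl (c j) (c′ j)
    supp : Below (M ℕ.⊔ M′) e′
    supp j l = trans (cong₂ (λ u v → u + - 1# * v) (s j (ℕP.≤-trans (ℕP.m≤m⊔n M M′) l)) (s′ j (ℕP.≤-trans (ℕP.m≤n⊔m M M′) l)))
      (solve 0 (con (0 , 0) :+ :- con (1 , 0) :* con (0 , 0) := con (0 , 0)) refl)
    sh-e : ∀ j → sh e′ j ≡ sh c j + - 1# * sh c′ j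
    sh-e zero = solve 0 (con (0 , 0) := con (0 , 0) :+ :- con (1 , 0) :* con (0 , 0)) refl
    sh-e (suc j) = refl
    zero′ : Below 0 (root a e′)
    zero′ j _ = begin
      - a * e′ j + 1# * sh e′ j ≡⟨ cong (λ w → - a * e′ j + 1# * w) (sh-e j) ⟩
      - a * (c j + - 1# * c′ j) + 1# * (sh c j + - 1# * sh c′ j)
        ≡⟨ solve 5 (λ a u v w z → :- a :* (u :+ :- con (1 , 0) :* v) :+ con (1 , 0) :* (w :+ :- con (1 , 0) :* z)
            := (:- a :* u :+ con (1 , 0) :* w) :- (:- a :* v :+ con (1 , 0) :* z)) refl a (c j) (c′ j) (sh c j) (sh c′ j) ⟩
      root a c j - root a c′ j ≡⟨ x-x≡0 (e j) ⟩
      0# ∎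
      where open ≡-Reasoning

  root-div : ∀ a n c → Below (suc n) c → ev (suc n) c a ≡ 0# → ∃ λ d → Below n d × (∀ i → c i ≡ root a d i)
  root-div a zero c s z = (λ _ → 0#) , (λ _ _ → refl) , eq
    where
    eq : ∀ i → c i ≡ root a (λ _ → 0#) i
    eq zero = trans (trans (solve 2 (λ c a → c := c :+ a :* con (0 , 0)) refl (c 0) a) z) (solve 1 (λ a → con (0 , 0) := :- a :* con (0 , 0) :+ con (1 , 0) :* con (0 , 0)) refl a)
    eq (suc i) = trans (s (suc i) (s≤s z≤n)) (solve 1 (λ a → con (0 , 0) := :- a :* con (0 , 0) :+ con (1 , 0) :* con (0 , 0)) refl a)
  root-div a (suc n) c s z = d , supp , eq
    where
    e₁ : Carrier
    e₁ = ev (suc n) (c ∘ suc) a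
    c′ : Seq
    c′ zero    = c 1 - e₁
    c′ (suc i) = c (suc (suc i))
    z′ : ev (suc n) c′ a ≡ 0#
    z′ = solve 3 (λ c a u → (c :- (c :+ a :* u)) :+ a :* u := con (0 , 0)) refl (c 1) a (ev n (λ i → c (suc (suc i))) a)
    s′ : Below (suc n) c′
    s′ (suc i) l = s (suc (suc i)) (s≤s l)
    r : ∃ λ d → Below n d × (∀ i → c′ i ≡ root a d i)
    r = root-div a n c′ s′ z′
    d′ d : Seq
    d′ = proj₁ r
    d zero    = e₁
    d (suc i) = d′ i
    supp : Below (suc n) d
    supp (suc i) (s≤s l) = proj₁ (proj₂ r) i l
    eq : ∀ i → c i ≡ root a d i
    eq zero = -≡0⇒≡ (trans (solve 3 (λ c a e → c :- (:- a :* e :+ con (1 , 0) :* con (0 , 0)) := c :+ a :* e) refl (c 0) a e₁) z)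
    eq (suc zero) = begin
      c 1 ≡⟨ solve 2 (λ c e → c := (c :- e) :+ e) refl (c 1) e₁ ⟩
      c′ 0 + e₁ ≡⟨ cong (_+ e₁) (proj₂ (proj₂ r) 0) ⟩
      (- a * d′ 0 + 1# * 0#) + e₁ ≡⟨ solve 3 (λ a u e → (:- a :* u :+ con (1 , 0) :* con (0 , 0)) :+ e := :- a :* u :+ con (1 , 0) :* e) refl a (d′ 0) e₁ ⟩
      root a d 1 ∎
      where open ≡-Reasoning
    eq (suc (suc i)) = proj₂ (proj₂ r) (suc i)

  Mult : ℕ → Seq → Carrier → Set
  Mult T c x = ∃ λ M → ∃ λ d → Below M d × (∀ i → c i ≡ pw x T d i)

  pow≢0 : ∀ {x} n → x ≢ 0# → pow F x n ≢ 0#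
  pow≢0 zero    p = 1≢0
  pow≢0 (suc n) p = *≢0 p (pow≢0 n p)

  -- Evaluation at a shows that the cofactor of (X - b)^T vanishes there, since a - b is invertible.
  -- Hence X - a divides the cofactor and can be cancelled on both sides.
  Mult-root : ∀ T a b {c M} → a ≢ b → Below M c → Mult T (root a c) b → Mult T c b
  Mult-root T a b {c} {M} a≢b sc (M′ , d , sd , e) = K , d₁ , sd₁ , eq
    where
    K : ℕ
    K = M ℕ.+ M′
    sc′ : Below K c
    sc′ = Below-mono (ℕP.m≤m+n M M′) sc
    sd′ : Below (suc K) d
    sd′ = Below-mono (ℕP.≤-trans (ℕP.m≤n+m M′ M) (ℕP.n≤1+n K)) sd
    zero-at : ev (suc K) d a ≡ 0#
    zero-at = *≡0 (pow≢0 T (λ e → a≢b (-≡0⇒≡ e))) (begin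
      pow F (a - b) T * ev (suc K) d a ≡⟨ sym (ev-pw (suc K) b T d a sd′) ⟩
      ev (T ℕ.+ suc K) (pw b T d) a ≡⟨ ev-cong (T ℕ.+ suc K) a (λ i _ → sym (e i)) ⟩
      ev (T ℕ.+ suc K) (root a c) a ≡⟨ ev-extend (suc K) (T ℕ.+ suc K) (root a c) a (ℕP.m≤n+m (suc K) T) (linP-Below (- a) 1# sc′) ⟩
      ev (suc K) (root a c) a ≡⟨ ev-linP K (- a) 1# c a sc′ ⟩
      (- a + 1# * a) * ev K c a ≡⟨ solve 2 (λ a e → (:- a :+ con (1 , 0) :* a) :* e := con (0 , 0)) refl a _ ⟩
      0# ∎)
      where open ≡-Reasoning
    rd : ∃ λ d₁ → Below K d₁ × (∀ i → d i ≡ root a d₁ i)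
    rd = root-div a K d sd′ zero-at
    d₁ : Seq
    d₁ = proj₁ rd
    sd₁ : Below K d₁
    sd₁ = proj₁ (proj₂ rd)
    eq : ∀ i → c i ≡ pw b T d₁ i
    eq = root-inj a c (pw b T d₁) sc (pw-Below b T sd₁)
      (λ i → trans (e i) (trans (pw-cong b T (proj₂ (proj₂ rd)) i) (sym (pw-linP b T (- a) 1# d₁ i))))

  Mult-pw : ∀ T T′ a b {c M} → a ≢ b → Below M c → Mult T (pw a T′ c) b → Mult T c b
  Mult-pw T zero     a b a≢b s m = m
  Mult-pw T (suc T′) a b a≢b s m = Mult-pw T T′ a b a≢b s (Mult-root T a b a≢b (pw-Below a T′ s) m)

  ∸-pos : ∀ d T {k} → suc k ≤ d ∸ T → T ≤ d
  ∸-pos d T {k} l with T ℕP.≤? d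
  ... | yes le = le
  ... | no n = contradiction (subst (suc k ≤_) (ℕP.m≤n⇒m∸n≡0 (ℕP.<⇒≤ (ℕP.≰⇒> n))) l) λ ()

  -- Each root is divided out with its multiplicity, which lowers the degree by T and, by `Mult-pw`,
  -- keeps the multiplicities at the other roots.
  Mult-count : ∀ T xs {c d} → Unique xs → Below d c → (∃ λ i → c i ≢ 0#) → (∀ {x} → x ∈ xs → Mult T c x) → suc (List.length xs ℕ.* T) ≤ d
  Mult-count T [] {c} {zero} _ s (i , n) m = contradiction (s i z≤n) n
  Mult-count T [] {c} {suc d} _ s (i , n) m = s≤s z≤n
  Mult-count T (x ∷ xs) {c} {d} (p ∷ u) s (i , n) m with m (here refl)
  ... | M , c′ , s′ , e = ℕP.≤-trans (ℕP.≤-reflexive (sym (ℕP.+-suc T _))) (ℕP.≤-trans (ℕP.+-monoʳ-≤ T IH)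
      (ℕP.≤-reflexive (ℕP.m+[n∸m]≡n (∸-pos d T IH))))
    where
    c′≢0 : ∃ λ j → c′ j ≢ 0#
    c′≢0 with search M
      where
      search : ∀ k → (∃ λ j → c′ j ≢ 0#) ⊎ (∀ j → j < k → c′ j ≡ 0#)
      search zero = inj₂ λ _ ()
      search (suc k) with search k
      ... | inj₁ r = inj₁ r
      ... | inj₂ z with c′ k ≟ 0#
      ... | no nz = inj₁ (k , nz)
      ... | yes zk = inj₂ λ j l → case-≤ j (ℕP.m≤n⇒m<n∨m≡n (ℕP.≤-pred l))
        where
        case-≤ : ∀ j → j < k ⊎ j ≡ k → c′ j ≡ 0#
        case-≤ j (inj₁ l) = z j l
        case-≤ j (inj₂ refl) = zk
    ... | inj₁ r = r
    ... | inj₂ z = contradiction (trans (e i) (pw0 T i)) n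
      where
      all : ∀ j → c′ j ≡ 0#
      all j with j ℕP.<? M
      ... | yes l = z j l
      ... | no l = s′ j (ℕP.≮⇒≥ l)
      pw0 : ∀ T i → pw x T c′ i ≡ 0#
      pw0 zero i = all i
      pw0 (suc T) zero = trans (cong (λ w → - x * w + 1# * 0#) (pw0 T 0)) (solve 1 (λ a → :- a :* con (0 , 0) :+ con (1 , 0) :* con (0 , 0) := con (0 , 0)) refl x)
      pw0 (suc T) (suc i) = trans (cong₂ (λ w v → - x * w + 1# * v) (pw0 T (suc i)) (pw0 T i)) (solve 1 (λ a → :- a :* con (0 , 0) :+ con (1 , 0) :* con (0 , 0) := con (0 , 0)) refl x)
    IH : suc (List.length xs ℕ.* T) ≤ d ∸ T
    IH = Mult-count T xs u (pw-Below⁻ x T c′ s′ (λ j l → trans (sym (e j)) (s j l))) c′≢0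
      (λ {b} i → Mult-pw T T x b (λ { refl → All.lookup p i refl }) s′ (Mult-cong (m (there i))))
      where
      Mult-cong : ∀ {b} → Mult T c b → Mult T (pw x T c′) b
      Mult-cong (M′ , d′ , s″ , e′) = M′ , d′ , s″ , λ i → trans (sym (e i)) (e′ i)

  -- Bruen's bound for multiple blocking sets of the affine plane: with P_y(X) = Π_b (1 - b₂y - b₁X), the
  -- polynomial Σ_y P_y(X) takes the value 1 at 0, has degree at most |B| - (q - 1), and vanishes to the
  -- order of blocking at every X ≠ 0.

  fst snd : V 2 → Carrier
  fst (a ∷ _ ∷ []) = a
  snd (_ ∷ b ∷ []) = b

  P : List (V 2) → Carrier → Seq
  P []      y = unit 0
  P (b ∷ B) y = linP (1# - snd b * y) (- fst b) (P B y)

  P-Below : ∀ B y → Below (suc (List.length B)) (P B y)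
  P-Below [] y (suc i) _ = refl
  P-Below (b ∷ B) y = linP-Below _ _ (P-Below B y)

  -- The total degree in X and y is at most |B|. So the sum over y kills the coefficient of X^i as
  -- soon as |B| - i < q - 1.
  D-P : ∀ B i → D {1} (suc (List.length B) ∸ i) (λ v → P B (head v) i)
  D-P [] zero = dconst 1# (λ _ → refl)
  D-P [] (suc i) = dzero (λ _ → refl)
  D-P (b ∷ B) i = D-+ (D-aff∸ (suc (List.length B)) i A (D-P B i)) (D-scale (- fst b) (D-sh i))
    where
    A : IsAff {1} (λ v → 1# - snd b * head v)
    A = aff-cong (aff-+ (aff-const 1#) (aff-* (- snd b) aff-head)) (λ p → solve 2 (λ s h → con (1 , 0) :- s :* h := con (1 , 0) :+ :- s :* h) refl (snd b) (head p))
    D-sh : ∀ i → D {1} (suc (suc (List.length B)) ∸ i) (λ v → sh (P B (head v)) i)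
    D-sh zero = dzero (λ _ → refl)
    D-sh (suc i) = D-P B i

  on? : ∀ x y (b : V 2) → Dec ((1# - snd b * y) ≡ fst b * x)
  on? x y b = (1# - snd b * y) ≟ (fst b * x)

  P-mult : ∀ B x y T → T ≤ N.ΣL B (λ b → pick (on? x y b) 1 0) → ∃ λ d → Below (suc (List.length B)) d × (∀ i → P B y i ≡ pw x T d i)
  P-mult [] x y zero l = unit 0 , P-Below [] y , λ i → refl
  P-mult (b ∷ B) x y T l with on? x y b
  P-mult (b ∷ B) x y zero l | yes e = P (b ∷ B) y , P-Below (b ∷ B) y , λ i → refl
  P-mult (b ∷ B) x y (suc T) (s≤s l) | yes e with P-mult B x y T l
  -- The equation 1 - b₂y = b₁x turns the factor of b into - b₁(X - x): one more root x, and the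
  -- scalar - b₁ goes into the cofactor.
  ... | d , s , eq = linP (- fst b) 0# d , linP-Below (- fst b) 0# s , λ i → begin
      linP (1# - snd b * y) (- fst b) (P B y) i ≡⟨ linP-cong _ _ eq i ⟩
      linP (1# - snd b * y) (- fst b) (pw x T d) i ≡⟨ cong (λ w → linP w (- fst b) (pw x T d) i) e ⟩
      linP (fst b * x) (- fst b) (pw x T d) i ≡⟨ factor i ⟩
      root x (linP (- fst b) 0# (pw x T d)) i ≡⟨ linP-cong (- x) 1# (pw-linP x T (- fst b) 0# d) i ⟩
      root x (pw x T (linP (- fst b) 0# d)) i ∎
    where
    open ≡-Reasoning
    factor : ∀ i → linP (fst b * x) (- fst b) (pw x T d) i ≡ root x (linP (- fst b) 0# (pw x T d)) i
    factor i = trans (solve 5 (λ a x u v w → a :* x :* u :+ :- a :* v := :- x :* (:- a :* u :+ con (0 , 0) :* v) :+ con (1 , 0) :* (:- a :* v :+ con (0 , 0) :* w)) refl (fst b) x (pw x T d i) (sh (pw x T d) i) (sh (sh (pw x T d)) i))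
      (cong (λ w → - x * linP (- fst b) 0# (pw x T d) i + 1# * w) (sym (sh-linP (- fst b) 0# (pw x T d) i)))
  P-mult (b ∷ B) x y T l | no _ with P-mult B x y T l
  ... | d , s , eq = linP (1# - snd b * y) (- fst b) d , linP-Below _ _ s , λ i → trans (linP-cong _ _ eq i) (pw-linP x T _ _ d i)

  P-0 : ∀ B → P B 0# 0 ≡ 1#
  P-0 [] = refl
  P-0 (b ∷ B) = trans (cong (λ w → (1# - snd b * 0#) * w + - fst b * 0#) (P-0 B)) (solve 2 (λ a b → (con (1 , 0) :- b :* con (0 , 0)) :* con (1 , 0) :+ :- a :* con (0 , 0) := con (1 , 0)) refl (fst b) (snd b))

  P-zero : ∀ B y {b} → b ∈ B → snd b * y ≡ 1# → P B y 0 ≡ 0#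
  P-zero (b ∷ B) y (here refl) e = trans (cong (λ w → (1# - w) * P B y 0 + - fst b * 0#) e) (solve 2 (λ p a → (con (1 , 0) :- con (1 , 0)) :* p :+ :- a :* con (0 , 0) := con (0 , 0)) refl _ _)
  P-zero (b ∷ B) y (there i) e = trans (cong (λ w → (1# - snd b * y) * w + - fst b * 0#) (P-zero B y i e)) (solve 2 (λ p a → p :* con (0 , 0) :+ :- a :* con (0 , 0) := con (0 , 0)) refl _ _)

  nonzeros : List Carrier
  nonzeros = List.filter (λ x → ¬? (x ≟ 0#)) E

  length-nonzeros : List.length nonzeros ≡ Q
  length-nonzeros = ℕP.suc-injective (trans (cong suc (len E)) (trans (ℕP.+-comm 1 _) (trans (cong (N.ΣL E (λ x → nz x) ℕ.+_) (sym (N.δC 0# (λ _ → 1)))) (trans (sym (N.ΣL-∙ E _ _)) (trans (N.ΣL-cong E one) (trans (ΣNC-const 1) (ℕP.*-identityʳ q)))))))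
    where
    len : ∀ xs → List.length (List.filter (λ x → ¬? (x ≟ 0#)) xs) ≡ N.ΣL xs (λ x → nz x)
    len [] = refl
    len (x ∷ xs) with x ≟ 0#
    ... | yes _ = len xs
    ... | no _ = cong suc (len xs)
    one : ∀ x → nz x ℕ.+ pick (x ≟ 0#) 1 0 ≡ 1
    one x with x ≟ 0#
    ... | yes _ = refl
    ... | no _ = refl

  bruen : ∀ (B : List (V 2)) T → (∀ x y → x ≢ 0# → T ≤ N.ΣL B (λ b → pick (on? x y b) 1 0)) →
          (∀ y → y ≢ 0# → ∃ λ b → b ∈ B × snd b * y ≡ 1#) → suc (Q ℕ.* T) ≤ suc (List.length B) ∸ Q
  bruen B T blocks blocks₀ = subst (λ k → suc (k ℕ.* T) ≤ suc (List.length B) ∸ Q) length-nonzeros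
    (Mult-count T nonzeros (UniqueP.filter⁺ (λ x → ¬? (x ≟ 0#)) unique-E) supp (0 , λ e → 0≢1 (trans (sym e) A0)) mult)
    where
    A : Seq
    A i = ΣC (λ y → P B y i)
    supp : Below (suc (List.length B) ∸ Q) A
    supp i l = D-Q-Σ (D-mono (ℕP.m≤n+o⇒m∸n≤o (suc (List.length B)) i (ℕP.≤-trans (ℕP.m≤n+m∸n (suc (List.length B)) Q) (ℕP.≤-trans (ℕP.+-monoʳ-≤ Q l) (ℕP.≤-reflexive (ℕP.+-comm Q i))))) (D-P B i))
    -- Only y = 0 contributes: for y ≠ 0 the line b₂y = 1 contains a point of B, whose factor has
    -- constant term 0.
    A0 : A 0 ≡ 1#
    A0 = trans (ΣL-cong E pt) (δC 0# (λ _ → 1#))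
      where
      pt : ∀ y → P B y 0 ≡ pick (y ≟ 0#) 1# 0#
      pt y with y ≟ 0#
      ... | yes refl = P-0 B
      ... | no n with blocks₀ y n
      ... | b , i , e = P-zero B y i e
    mult : ∀ {x} → x ∈ nonzeros → Mult T A x
    mult {x} i = suc (List.length B) , (λ j → ΣC (λ y → proj₁ (pm y) j)) ,
      (λ j l → trans (ΣL-cong E (λ y → proj₁ (proj₂ (pm y)) j l)) (ΣL-ε E)) ,
      λ j → trans (ΣL-cong E (λ y → proj₂ (proj₂ (pm y)) j)) (pw-ΣC x T (λ y → proj₁ (pm y)) j)
      where
      pm : ∀ y → ∃ λ d → Below (suc (List.length B)) d × (∀ i → P B y i ≡ pw x T d i)
      pm y = P-mult B x y T (blocks x y (proj₂ (∈-filter⁻ (λ x → ¬? (x ≟ 0#)) {xs = E} i)))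

  term≤ΣC : ∀ (g : Carrier → ℕ) x → g x ≤ N.ΣC g
  term≤ΣC g x = ℕP.≤-trans (ℕP.≤-reflexive (sym (N.δC x g))) (ΣN-mono E le)
    where
    le : ∀ y → pick (y ≟ x) (g y) 0 ≤ g y
    le y with y ≟ x
    ... | yes _ = ℕP.≤-refl
    ... | no _ = z≤n

  -- A point of the support is moved to the origin, and B is the rest of the support. If no line
  -- missed the support, every line b₁x + b₂y = 1 with x ≠ 0 would meet B in at least q - s points,
  -- by the minimum weight on a line. Bruen's bound then gives |B| ≥ (q - 1)(q - s + 1) = σ s, and
  -- the origin is one point more.
  MissesHyperplane-plane : ∀ s → s ≤ Q → MissesHyperplane 0 0 s
  MissesHyperplane-plane s s≤Q {f} d ¬z ub with ¬Zero⇒∃ ¬z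
  ... | p₀ , nz₀ = decide
    where
    f₁ : Fun F 2
    f₁ = f ∘f translateI p₀
    d₁ : D (suc s) f₁
    d₁ = D-iso d (translateI p₀)
    f₁0 : f₁ 0V ≢ 0#
    f₁0 e = nz₀ (trans (cong f (sym (⊞-identityʳ p₀))) e)
    a : Carrier → Carrier → V 1 → Carrier
    a x y v = inv x * (1# - head v * y)
    A : ∀ x y → IsAff (a x y)
    A x y = aff-* (inv x) (aff-cong (aff-+ (aff-const 1#) (aff-* (- y) aff-head)) (λ p → solve 2 (λ s h → con (1 , 0) :- h :* s := con (1 , 0) :+ :- s :* h) refl y (head p)))
    line : Carrier → Carrier → Fun F 1
    line x y = slice (f₁ ∘f shearI (A x y)) 0#
    inB? : ∀ b → Dec (f₁ b ≢ 0# × b ≢ 0V)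
    inB? b with f₁ b ≟ 0# | b ≟V 0V
    ... | no u | no v = yes (u , v)
    ... | yes u | _ = no λ { (n , _) → n u }
    ... | _ | yes v = no λ { (_ , n) → n v }
    B : List (V 2)
    B = List.filter inB? (pts 2)
    len : ∀ xs (g : V 2 → ℕ) → N.ΣL (List.filter inB? xs) g ≡ N.ΣL xs (λ b → pick (inB? b) (g b) 0)
    len [] g = refl
    len (x ∷ xs) g with inB? x
    ... | yes _ = cong (g x ℕ.+_) (len xs g)
    ... | no _ = len xs g
    length-B : suc (List.length B) ≡ wt f₁
    length-B = begin
      suc (List.length B) ≡⟨ cong suc (trans (sym (ℕP.*-identityʳ _)) (sym (ΣN-const B 1))) ⟩
      suc (N.ΣL B (λ _ → 1)) ≡⟨ cong₂ ℕ._+_ (sym (N.δV 2 0V (λ _ → 1))) (len (pts 2) (λ _ → 1)) ⟩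
      N.ΣV 2 (λ b → pick (b ≟V 0V) 1 0) ℕ.+ N.ΣV 2 (λ b → pick (inB? b) 1 0) ≡⟨ sym (N.ΣL-∙ (pts 2) _ _) ⟩
      N.ΣV 2 (λ b → pick (b ≟V 0V) 1 0 ℕ.+ pick (inB? b) 1 0) ≡⟨ N.ΣL-cong (pts 2) pt ⟩
      wt f₁ ∎
      where
      open ≡-Reasoning
      pt : ∀ b → pick (b ≟V 0V) 1 0 ℕ.+ pick (inB? b) 1 0 ≡ nz (f₁ b)
      pt b with f₁ b ≟ 0# | b ≟V 0V
      ... | yes u | no _ = refl
      ... | no _ | yes _ = refl
      ... | no _ | no _ = refl
      ... | yes u | yes refl = contradiction u f₁0
    ∈-pts : ∀ b → f₁ b ≢ 0# → b ≢ 0V → b ∈ B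
    ∈-pts b u v with List.filter inB? (pts 2) | N.δV 2 b (λ _ → 1) | go (pts 2)
      where
      go : ∀ xs → N.ΣL xs (λ c → pick (c ≟V b) 1 0) ≡ 1 → b ∈ List.filter inB? xs
      go (x ∷ xs) e with x ≟V b
      ... | yes refl = ∈-filter⁺ inB? (here refl) (u , v)
      ... | no _ with inB? x
      ... | yes _ = there (go xs e)
      ... | no _ = go xs e
    ... | _ | e | r = r e
    blocks : (∀ x y → x ≢ 0# → ¬ Zero (line x y)) → ∀ x y → x ≢ 0# → q ∸ s ≤ N.ΣL B (λ b → pick (on? x y b) 1 0)
    blocks nonempty x y x≢0 = begin
      q ∸ s ≡⟨ sym (ℕP.*-identityʳ _) ⟩
      (q ∸ s) ℕ.* q ^ 0 ≤⟨ min-wt 0 0 s s≤Q (D-slice (D-iso d₁ (shearI (A x y))) 0#) (nonempty x y x≢0) ⟩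
      wt (line x y) ≡⟨ N.ΣV-1 _ ⟩
      N.ΣC (λ v → nz (line x y (v ∷ []))) ≤⟨ ΣN-mono E pt ⟩
      N.ΣC (λ v → N.ΣC (λ u → g (u ∷ v ∷ []))) ≡⟨ N.ΣL-swap E E (λ v u → g (u ∷ v ∷ [])) ⟩
      N.ΣC (λ u → N.ΣC (λ v → g (u ∷ v ∷ []))) ≡⟨ N.ΣL-cong E (λ u → sym (N.ΣV-1 (λ w → g (u ∷ w)))) ⟩
      N.ΣC (λ u → N.ΣV 1 (λ w → g (u ∷ w))) ≡⟨ sym (N.ΣV-suc 1 g) ⟩
      N.ΣV 2 g ≡⟨ sym (len (pts 2) _) ⟩
      N.ΣL B (λ b → pick (on? x y b) 1 0) ∎
      where
      open ℕP.≤-Reasoning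
      g : V 2 → ℕ
      g b = pick (inB? b) (pick (on? x y b) 1 0) 0
      pt : ∀ v → nz (line x y (v ∷ [])) ≤ N.ΣC (λ u → g (u ∷ v ∷ []))
      pt v = ℕP.≤-trans le (term≤ΣC (λ u → g (u ∷ v ∷ [])) (0# + a x y (v ∷ [])))
        where
        b : V 2
        b = 0# + a x y (v ∷ []) ∷ v ∷ []
        on : 1# - snd b * y ≡ fst b * x
        on = sym (trans (cong (_* x) (+-identityˡ _)) (trans (*-comm _ x) (trans (sym (*-assoc _ _ _)) (trans (cong (_* (1# - v * y)) (inv-r x≢0)) (*-identityˡ _)))))
        b≢0 : b ≢ 0V
        b≢0 e = 1≢0 (trans (solve 1 (λ y → con (1 , 0) := con (1 , 0) :- con (0 , 0) :* y) refl y) (trans (cong (λ c → 1# - snd c * y) (sym e)) (trans on (trans (cong (λ c → fst c * x) e) (zeroˡ x)))))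
        le : nz (f₁ b) ≤ g b
        le with inB? b | on? x y b
        ... | yes _ | yes _ = nz≤1 _
        ... | yes _ | no n = contradiction on n
        ... | no n | _ = ℕP.≤-reflexive (nz-0 (z (f₁ b ≟ 0#)))
          where
          z : Dec (f₁ b ≡ 0#) → f₁ b ≡ 0#
          z (yes e) = e
          z (no ne) = ⊥-elim (n (ne , b≢0))
    blocks₀ : (∀ y → y ≢ 0# → ¬ Zero (slice (f₁ ∘f swapI) (inv y))) → ∀ y → y ≢ 0# → ∃ λ b → b ∈ B × snd b * y ≡ 1#
    blocks₀ nonempty y y≢0 with ¬Zero⇒∃ (nonempty y y≢0)
    ... | u ∷ [] , n = b , ∈-pts b n (λ e → inv≢0 y≢0 (cong snd e)) , inv-l y≢0
      where
      b : V 2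
      b = u ∷ inv y ∷ []
    big : (∀ x y → x ≢ 0# → ¬ Zero (line x y)) → (∀ y → y ≢ 0# → ¬ Zero (slice (f₁ ∘f swapI) (inv y))) → ⊥
    big h₁ h₂ = ℕP.<⇒≱ (begin-strict
      wt f ≤⟨ ub ⟩
      σ s ℕ.* q ^ 0 ≡⟨ ℕP.*-identityʳ _ ⟩
      Q ℕ.+ (q ∸ s) ℕ.* Q ≡⟨ cong (Q ℕ.+_) (ℕP.*-comm (q ∸ s) Q) ⟩
      Q ℕ.+ Q ℕ.* (q ∸ s) <⟨ ℕP.+-monoʳ-< Q (ℕP.n<1+n _) ⟩
      Q ℕ.+ suc (Q ℕ.* (q ∸ s)) ≤⟨ ℕP.+-monoʳ-≤ Q br ⟩
      Q ℕ.+ (suc (List.length B) ∸ Q) ≡⟨ ℕP.m+[n∸m]≡n (∸-pos (suc (List.length B)) Q br) ⟩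
      suc (List.length B) ≡⟨ trans length-B (wt-iso f (translateI p₀)) ⟩
      wt f ∎) ℕP.≤-refl
      where
      open ℕP.≤-Reasoning
      br : suc (Q ℕ.* (q ∸ s)) ≤ suc (List.length B) ∸ Q
      br = bruen B (q ∸ s) (blocks h₁) (blocks₀ h₂)
    decide : Empty f
    decide with ∃V? 2 {P = λ v → fst v ≢ 0# × Zero (line (fst v) (snd v))} dec
      where
      dec : ∀ v → Dec (fst v ≢ 0# × Zero (line (fst v) (snd v)))
      dec v with fst v ≟ 0# | Zero? (line (fst v) (snd v))
      ... | no u | yes z = yes (u , z)
      ... | yes u | _ = no λ { (n , _) → n u }
      ... | _ | no n = no λ { (_ , z) → n z }
    ... | inj₁ (x ∷ y ∷ [] , _ , z) = Empty-iso f (translateI p₀) (shearI (A x y) , z)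
    ... | inj₂ h₁ with ∃C? (λ y → Zero? (slice (f₁ ∘f swapI) y))
    ... | inj₁ (y , z) = Empty-iso f (translateI p₀) (Empty-iso f₁ swapI (Empty-slice (f₁ ∘f swapI) y z))
    ... | inj₂ h₂ = ⊥-elim (big (λ x y n z → h₁ (x ∷ y ∷ []) (n , z)) (λ y _ → h₂ (inv y)))

  -- Division by the equations of hyperplanes; a hyperplane is given by an isomorphism taking x = 0 to it.

  eqn : ∀ {m} → Iso (suc m) → Fun F (suc m)
  eqn φ p = head (app (Iso.from φ) p)

  eqn-aff : ∀ {m} (φ : Iso (suc m)) → IsAff (eqn φ)
  eqn-aff φ = aff-∘ aff-head (Iso.from φ)

  div-hyp : ∀ {m n} {f : Fun F (suc m)} → D n f → (φ : Iso (suc m)) → Zero (slice (f ∘f φ) 0#) →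
            ∃ λ g → D (n ∸ 1) g × (∀ p → f p ≡ eqn φ p * g p)
  div-hyp {f = f} d φ z with div-slice (D-iso d φ) 0# z
  ... | g , dg , e = (λ p → g (app (Iso.from φ) p)) , D-∘ dg (Iso.from φ) , eq
    where
    eq : ∀ p → f p ≡ eqn φ p * g (app (Iso.from φ) p)
    eq p with app (Iso.from φ) p | Iso.to-from φ p
    ... | x ∷ v | e′ = trans (cong f (sym e′)) (trans (e x v) (cong (_* g (x ∷ v)) (solve 1 (λ x → x :- con (0 , 0) := x) refl x)))

  Σ-at : ∀ a (g : Carrier → Carrier) → (∀ x → x ≢ a → g x ≡ 0#) → ΣC g ≡ g a
  Σ-at a g z = trans (ΣL-cong E pt) (δC a g)
    where
    pt : ∀ x → g x ≡ pick (x ≟ a) (g x) 0#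
    pt x with x ≟ a
    ... | yes _ = refl
    ... | no n = z x n

  D-line : ∀ {m n} {f : Fun F m} → D n f → ∀ p w → D {1} n (λ ξ → f (p ⊞ head ξ · w))
  D-line d p w = D-∘ d (map-line p w)

  D-Q-at : ∀ {f : Fun F 1} → D Q f → ∀ a → (∀ x → x ≢ a → f (x ∷ []) ≡ 0#) → f (a ∷ []) ≡ 0#
  D-Q-at {f} d a z = trans (sym (Σ-at a (λ x → f (x ∷ [])) z)) (D-Q-Σ d)

  -- On a line from a zero p₀ of a towards p₁, where a is nonzero, h vanishes except perhaps at p₀.
  -- As its degree is less than q - 1, its sum over the line is 0, and h vanishes at p₀ too.
  vanish : ∀ {m} {a h : Fun F m} → IsAff a → D Q h → ∀ p₁ → a p₁ ≢ 0# → (∀ p → a p * h p ≡ 0#) → Zero h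
  vanish {a = a} {h} A d p₁ n z p₀ with a p₀ ≟ 0#
  ... | no n₀ = *≡0 n₀ (z p₀)
  ... | yes e = trans (cong h (sym (trans (cong (p₀ ⊞_) (0· w)) (⊞-identityʳ p₀))))
      (D-Q-at (D-line d p₀ w) 0# λ x x≢0 → *≡0 (λ e′ → *≢0 x≢0 lin≢0 (trans (sym (a-line x)) e′)) (z _))
    where
    w : V _
    w = p₁ ⊞ - 1# · p₀
    lin≡ : IsAff.lin A w ≡ a p₁
    lin≡ = trans (sym (+-identityˡ _)) (trans (cong (_+ IsAff.lin A w) (sym e)) (trans (sym (IsAff.add A p₀ w)) (cong a (⊞-cancel p₀ p₁))))
    lin≢0 : IsAff.lin A w ≢ 0#
    lin≢0 e = n (trans (sym lin≡) e)
    a-line : ∀ x → a (p₀ ⊞ x · w) ≡ x * IsAff.lin A w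
    a-line x = trans (IsAff.add A p₀ (x · w)) (trans (cong₂ _+_ e (IsAff.hom A x w)) (+-identityˡ _))

  -- A point of the hyperplane of ψ outside that of φ. After division by `eqn φ`, it is what
  -- `vanish` requires on the hyperplane of ψ.
  Distinct : ∀ {m} → Iso (suc m) → Iso (suc m) → Set
  Distinct φ ψ = ∃ λ z → eqn φ (ψ $ (0# ∷ z)) ≢ 0#

  div-hyps : ∀ {m n} {f : Fun F (suc m)} (Hs : List (Iso (suc m))) → AllPairs Distinct Hs → n ≤ q → D n f →
             (∀ {φ} → φ ∈ Hs → Zero (slice (f ∘f φ) 0#)) →
             ∃ λ g → D (n ∸ List.length Hs) g × (∀ p → f p ≡ Π.ΣL Hs (λ φ → eqn φ p) * g p)
  div-hyps {f = f} [] _ _ d z = f , d , λ p → sym (*-identityˡ _)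
  div-hyps {n = n} {f} (φ ∷ Hs) (dφ ∷ ds) n≤q d z with div-hyp d φ (z (here refl))
  ... | g₁ , d₁ , e₁ with div-hyps Hs ds (ℕP.≤-trans (ℕP.m∸n≤m n 1) n≤q) d₁ z₁
    where
    z₁ : ∀ {ψ} → ψ ∈ Hs → Zero (slice (g₁ ∘f ψ) 0#)
    z₁ {ψ} i = vanish (aff-∘ (eqn-aff φ) (map-∘ (Iso.to ψ) (map-at 0#))) (D-mono (ℕP.∸-monoˡ-≤ 1 n≤q) (D-slice (D-iso d₁ ψ) 0#))
      (proj₁ (All.lookup dφ i)) (proj₂ (All.lookup dφ i)) (λ p → trans (sym (e₁ _)) (z (there i) p))
  ... | g , dg , e = g , D-cast (ℕP.∸-+-assoc n 1 (List.length Hs)) dg ,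
    λ p → trans (e₁ p) (trans (cong (eqn φ p *_) (e p)) (sym (*-assoc _ _ _)))

  -- Hyperplanes missing the support: more variables, t = 0

  min-structure : ∀ n s {h : Fun F (suc (suc n))} → 1 ≤ s → s ≤ Q → D (suc s) h → ¬ Zero h → wt h ≤ σ s ℕ.* q ^ n →
                  (wt h ≡ σ s ℕ.* q ^ n → s ≤ 1) → ∀ x → Zero (slice h x) → #zeros h ≡ s × (∀ y z z′ → h (y ∷ z) ≡ h (y ∷ z′))
  min-structure n s {h} 1≤s s≤Q d ¬z ub ne x zx with kind 0 n s 1≤s s≤Q d ¬z ub
  ... | k-none e = contradiction (subst (1 ≤_) e (1≤#zeros h x zx)) λ ()
  ... | k-one () _
  ... | k-mid 1≤j j<s e _ = contradiction (ℕP.≤-trans (ℕP.≤-trans (s≤s 1≤j) j<s) (ne e)) λ { (s≤s ()) }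
  ... | k-full e = e , λ y z z′ → trans (proj₂ (c y) z) (sym (proj₂ (c y) z′))
    where
    c : ∀ y → ∃ λ c → ∀ z → h (y ∷ z) ≡ c
    c y = D-1 (D-cast (trans (cong (suc s ∸_) e) (trans (ℕP.+-∸-assoc 1 (ℕP.≤-refl {s})) (cong suc (ℕP.n∸n≡0 s)))) (D-slice-zeros d y))

  -- Y ∷ X ∷ z ↦ X ∷ Y + θX + b ∷ z
  pencilI : ∀ {m} → Carrier → Carrier → Iso (suc (suc m))
  pencilI θ b = swapI ∘I shearI (aff-+ (aff-* θ aff-head) (aff-const b))

  Pencil : ∀ {n} → ℕ → Fun F (suc (suc (suc n))) → Carrier → Set
  Pencil s f θ = #zeros h ≡ s × ¬ Zero h × (∀ y z z′ → h (y ∷ z) ≡ h (y ∷ z′))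
    where
    h : Fun F _
    h = slice (f ∘f pencilI θ 0#) 0#

  -- The q other hyperplanes through the flat where the first two coordinates vanish partition the
  -- support outside the slice at 0. That slice takes a positive share, so one of them carries less
  -- than σ s q^n, and `min-structure` applies to it unless it misses the support.
  pencil : ∀ n s {f : Fun F (suc (suc (suc n)))} → 1 ≤ s → s ≤ Q → D (suc s) f → wt f ≤ σ s ℕ.* q ^ suc n →
           (∀ z → f (0# ∷ 0# ∷ z) ≡ 0#) → ¬ Zero (slice f 0#) → Empty f ⊎ ∃ (Pencil s f)
  pencil n s {f} 1≤s s≤Q d ub z₀ ¬z = go₁ (∃C? (λ θ → Zero? (h θ)))
    where
    w : ℕ
    w = σ s ℕ.* q ^ n
    h : Carrier → Fun F (suc (suc n))
    h θ = slice (f ∘f pencilI θ 0#) 0#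
    zero-slice : ∀ θ z → f (0# ∷ 0# + (θ * 0# + 0#) ∷ z) ≡ 0#
    zero-slice θ z = trans (cong (λ w → f (0# ∷ w ∷ z)) (solve 1 (λ t → con (0 , 0) :+ (t :* con (0 , 0) :+ con (0 , 0)) := con (0 , 0)) refl θ)) (z₀ z)
    g : Carrier → Carrier → ℕ
    g θ y = wt (slice (h θ) y)
    nz₀ : ∃ λ p → slice f 0# p ≢ 0#
    nz₀ = ¬Zero⇒∃ ¬z
    pt : ∀ y → Dec (y ≡ 0#) → N.ΣC (λ θ → g θ y) ℕ.+ pick (y ≟ 0#) (wt (slice f 0#)) 0 ≤ wt (slice f y)
    pt y (yes refl) = ℕP.≤-reflexive (cong₂ ℕ._+_ (trans (N.ΣL-cong E (λ θ → wt-≡0 (zero-slice θ))) (N.ΣL-ε E)) (pick-yes 0#))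
      where
      pick-yes : ∀ y → pick (y ≟ y) (wt (slice f 0#)) 0 ≡ wt (slice f 0#)
      pick-yes y with y ≟ y
      ... | yes _ = refl
      ... | no n = contradiction refl n
    pt y (no y≢0) = ℕP.≤-reflexive (trans (cong₂ ℕ._+_ (N.reindexC (λ θ → 0# + (θ * y + 0#)) (λ x → x * inv y) l r (λ x → wt (λ z → f (y ∷ x ∷ z)))) pick-no)
        (trans (ℕP.+-identityʳ _) (sym (wt-suc (slice f y)))))
      where
      pick-no : pick (y ≟ 0#) (wt (slice f 0#)) 0 ≡ 0
      pick-no with y ≟ 0#
      ... | yes e = contradiction e y≢0
      ... | no _ = refl
      l : ∀ θ → (0# + (θ * y + 0#)) * inv y ≡ θ
      l θ = trans (solve 3 (λ t y i → (con (0 , 0) :+ (t :* y :+ con (0 , 0))) :* i := t :* (y :* i)) refl θ y (inv y)) (trans (cong (θ *_) (inv-r y≢0)) (*-identityʳ θ))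
      r : ∀ x → 0# + (x * inv y * y + 0#) ≡ x
      r x = trans (solve 3 (λ x y i → con (0 , 0) :+ (x :* i :* y :+ con (0 , 0)) := x :* (y :* i)) refl x y (inv y)) (trans (cong (x *_) (inv-r y≢0)) (*-identityʳ x))
    too-heavy : (∀ θ → w ≤ wt (h θ)) → σ s ℕ.* q ^ suc n < wt f
    too-heavy heavy = begin-strict
      σ s ℕ.* (q ℕ.* q ^ n) ≡⟨ NS.solve 3 (λ a b c → a NS.:* (b NS.:* c) NS.:= b NS.:* (a NS.:* c)) refl (σ s) q (q ^ n) ⟩
      q ℕ.* w ≡⟨ sym (ΣNC-const w) ⟩
      N.ΣC (λ _ → w) ≤⟨ ΣN-mono E heavy ⟩
      N.ΣC (λ θ → wt (h θ)) <⟨ ℕP.m<m+n _ (wt-pos (proj₁ nz₀) (proj₂ nz₀)) ⟩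
      N.ΣC (λ θ → wt (h θ)) ℕ.+ wt (slice f 0#) ≡⟨ cong₂ ℕ._+_ (trans (N.ΣL-cong E (λ θ → wt-suc (h θ))) (N.ΣL-swap E E g)) (sym (N.δC 0# (λ _ → wt (slice f 0#)))) ⟩
      N.ΣC (λ y → N.ΣC (λ θ → g θ y)) ℕ.+ N.ΣC (λ y → pick (y ≟ 0#) (wt (slice f 0#)) 0) ≡⟨ sym (N.ΣL-∙ E _ _) ⟩
      N.ΣC (λ y → N.ΣC (λ θ → g θ y) ℕ.+ pick (y ≟ 0#) (wt (slice f 0#)) 0) ≤⟨ ΣN-mono E (λ y → pt y (y ≟ 0#)) ⟩
      N.ΣC (λ y → wt (slice f y)) ≡⟨ sym (wt-suc f) ⟩
      wt f ∎
      where open ℕP.≤-Reasoning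
    go₂ : (∀ θ → ¬ Zero (h θ)) → (∃ λ θ → wt (h θ) < w) ⊎ (∀ θ → ¬ (wt (h θ) < w)) → Empty f ⊎ ∃ (Pencil s f)
    go₂ nonzero (inj₁ (θ , l)) = inj₂ (θ , proj₁ ms , nonzero θ , proj₂ ms)
      where
      ms : #zeros (h θ) ≡ s × (∀ y z z′ → h θ (y ∷ z) ≡ h θ (y ∷ z′))
      ms = min-structure n s 1≤s s≤Q (D-slice (D-iso d (pencilI θ 0#)) 0#) (nonzero θ) (ℕP.<⇒≤ l) (λ e → contradiction l (ℕP.<-irrefl e)) 0# (zero-slice θ)
    go₂ nonzero (inj₂ heavy) = contradiction ub (ℕP.<⇒≱ (too-heavy (λ θ → ℕP.≮⇒≥ (heavy θ))))
    go₁ : (∃ λ θ → Zero (h θ)) ⊎ (∀ θ → ¬ Zero (h θ)) → Empty f ⊎ ∃ (Pencil s f)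
    go₁ (inj₁ (θ , z)) = inj₁ (pencilI θ 0# , z)
    go₁ (inj₂ nonzero) = go₂ nonzero (∃C? (λ θ → wt (h θ) ℕP.<? w))

  wt-indep : ∀ {m} (f : Fun F (suc m)) → (∀ x p → f (x ∷ p) ≡ f (0# ∷ p)) → wt f ≡ q ℕ.* wt (slice f 0#)
  wt-indep f e = trans (wt-suc f) (trans (N.ΣL-cong E (λ x → wt-cong (e x))) (ΣNC-const _))

  collect : ∀ {A : Set} {R : Set} {P : A → Set} (xs : List A) → (∀ {x} → x ∈ xs → R ⊎ P x) → R ⊎ (∀ {x} → x ∈ xs → P x)
  collect [] f = inj₂ λ ()
  collect (x ∷ xs) f with f (here refl) | collect xs (λ i → f (there i))
  ... | inj₁ r | _ = inj₁ r
  ... | _ | inj₁ r = inj₁ r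
  ... | inj₂ p | inj₂ g = inj₂ λ { (here refl) → p ; (there i) → g i }

  light-slice : ∀ {m} (f : Fun F (suc m)) w → wt f ≤ q ℕ.* w → ∃ λ x → wt (slice f x) ≤ w
  light-slice f w ub with ∃C? (λ x → wt (slice f x) ℕP.≤? w)
  ... | inj₁ r = r
  ... | inj₂ heavy = contradiction ub (ℕP.<⇒≱ (begin-strict
    q ℕ.* w <⟨ ℕP.*-monoʳ-< q (ℕP.n<1+n w) ⟩
    q ℕ.* suc w ≡⟨ sym (ΣNC-const (suc w)) ⟩
    N.ΣC (λ _ → suc w) ≤⟨ ΣN-mono E (λ x → ℕP.≰⇒> (heavy x)) ⟩
    N.ΣC (λ x → wt (slice f x)) ≡⟨ sym (wt-suc f) ⟩
    wt f ∎))
    where open ℕP.≤-Reasoning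

  wt-ub-iso : ∀ {m} {f : Fun F m} {w} → wt f ≤ w → (φ : Iso m) → wt (f ∘f φ) ≤ w
  wt-ub-iso {f = f} l φ = ℕP.≤-trans (ℕP.≤-reflexive (wt-iso f φ)) l

  -- Used to make the third coordinate the first one, so that it can be sliced away.
  rotI : ∀ {m} → Iso (suc (suc (suc m)))
  rotI = liftI swapI ∘I swapI

  -- Every hyperplane through one of the s zeros of the restriction to Y = 0 carries a line of the pencil on
  -- which f does not depend on z, so f(·, z) - f(·, z′) vanishes on s + 1 lines of the plane.
  indep : ∀ n s {f : Fun F (suc (suc (suc n)))} → 1 ≤ s → s ≤ Q → D (suc s) f → wt f ≤ σ s ℕ.* q ^ suc n →
          #zeros (slice f 0#) ≡ s → ¬ Zero (slice f 0#) → (∀ y z z′ → f (0# ∷ y ∷ z) ≡ f (0# ∷ y ∷ z′)) →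
          Empty f ⊎ (∀ Y X z z′ → f (Y ∷ X ∷ z) ≡ f (Y ∷ X ∷ z′))
  indep n s {f} 1≤s s≤Q d ub #z ¬z c₀ = go (collect B each)
    where
    B : List Carrier
    B = zeros (slice f 0#)
    Line : Carrier → Set
    Line b = ∃ λ θ → ∀ Y z z′ → f (Y ∷ 0# + (θ * Y + 0#) + b ∷ z) ≡ f (Y ∷ 0# + (θ * Y + 0#) + b ∷ z′)
    each : ∀ {b} → b ∈ B → Empty f ⊎ Line b
    each {b} i = choose (pencil n s 1≤s s≤Q (D-iso d φ) (wt-ub-iso ub φ) zb (¬Zero-iso ¬z (shearI (aff-const b))))
      where
      φ : Iso (suc (suc (suc n)))
      φ = liftI (shearI (aff-const b))
      zb : ∀ z → f (0# ∷ 0# + b ∷ z) ≡ 0#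
      zb z = trans (cong (λ w → f (0# ∷ w ∷ z)) (+-identityˡ b)) (zeros-∈ (slice f 0#) i z)
      choose : Empty (f ∘f φ) ⊎ ∃ (Pencil s (f ∘f φ)) → Empty f ⊎ Line b
      choose (inj₁ e) = inj₁ (Empty-iso f φ e)
      choose (inj₂ (θ , _ , _ , c)) = inj₂ (θ , c)
    module Lines (line : ∀ {b} → b ∈ B → Line b) where
      H : ∀ {b} → b ∈ B → Iso 2
      H {b} i = pencilI (proj₁ (line i)) b
      Hs : ∀ xs → (∀ b → b ∈ xs → b ∈ B) → List (Iso 2)
      Hs [] sub = []
      Hs (x ∷ xs) sub = H (sub _ (here refl)) ∷ Hs xs (λ b i → sub b (there i))
      length-Hs : ∀ xs sub → List.length (Hs xs sub) ≡ List.length xs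
      length-Hs [] sub = refl
      length-Hs (x ∷ xs) sub = cong suc (length-Hs xs (λ b i → sub b (there i)))
      ∈-Hs : ∀ xs sub {φ} → φ ∈ Hs xs sub → ∃ λ b → b ∈ xs × Σ (b ∈ B) λ i → φ ≡ H i
      ∈-Hs (x ∷ xs) sub (here refl) = x , here refl , sub _ (here refl) , refl
      ∈-Hs (x ∷ xs) sub (there j) = shift (∈-Hs xs (λ b i → sub b (there i)) j)
        where
        shift : ∀ {φ} → (∃ λ b → b ∈ xs × Σ (b ∈ B) λ i → φ ≡ H i) → ∃ λ b → b ∈ x ∷ xs × Σ (b ∈ B) λ i → φ ≡ H i
        shift (b , i , i′ , e) = b , there i , i′ , e
      distinct : ∀ {b b′} (i : b ∈ B) (i′ : b′ ∈ B) → b ≢ b′ → Distinct (H i) (H i′)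
      distinct {b} {b′} i i′ n = (0# ∷ []) , λ e → n (sym (-≡0⇒≡ (trans (eq b b′ (proj₁ (line i)) (proj₁ (line i′))) e)))
        where
        eq : ∀ b b′ t t′ → b′ - b ≡ (0# + (t′ * 0# + b′)) + - 1# * (t * 0# + b)
        eq b b′ t t′ = solve 4 (λ b b′ t t′ → b′ :- b := (con (0 , 0) :+ (t′ :* con (0 , 0) :+ b′)) :+ :- con (1 , 0) :* (t :* con (0 , 0) :+ b)) refl b b′ t t′
      pairs : ∀ xs sub → Unique xs → AllPairs Distinct (Hs xs sub)
      pairs [] sub _ = []
      pairs (x ∷ xs) sub (p ∷ u) = All.tabulate (λ j → apart (∈-Hs xs (λ b i → sub b (there i)) j)) ∷ pairs xs (λ b i → sub b (there i)) u
        where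
        apart : ∀ {ψ} → (∃ λ b → b ∈ xs × Σ (b ∈ B) λ i → ψ ≡ H i) → Distinct (H (sub x (here refl))) ψ
        apart (b , i , i′ , refl) = distinct _ i′ (All.lookup p i)
      ls : List (Iso 2)
      ls = Hs B (λ _ i → i)
      first : ∀ {ψ} → (∃ λ b → b ∈ B × Σ (b ∈ B) λ i → ψ ≡ H i) → Distinct idI ψ
      first (b , i , i′ , refl) = (1# ∷ []) , 1≢0
      at : V (suc n) → AffMap 2 (suc (suc (suc n)))
      at z = map-∷ aff-head (map-∷ (aff-∘ aff-head map-tail) (mkMap (λ _ → z) (λ _ → 0V) (λ _ _ → sym (⊞-identityʳ z)) (λ c _ → sym (·0V c))))
      δ : V (suc n) → V (suc n) → Fun F 2
      δ z z′ p = f (app (at z) p) - f (app (at z′) p)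
      on-line : ∀ z z′ {φ} → (∃ λ b → b ∈ B × Σ (b ∈ B) λ i → φ ≡ H i) → Zero (slice (δ z z′ ∘f φ) 0#)
      on-line z z′ (b , _ , i , refl) (Y ∷ []) = x-x≡0 (subst (λ w → f (Y ∷ w ∷ z) ≡ f (Y ∷ w ∷ z′))
        (solve 3 (λ t Y b → con (0 , 0) :+ (t :* Y :+ con (0 , 0)) :+ b := con (0 , 0) :+ (t :* Y :+ b)) refl (proj₁ (line i)) Y b) (proj₂ (line i) Y z z′))
      on : ∀ z z′ {φ} → φ ∈ idI ∷ ls → Zero (slice (δ z z′ ∘f φ) 0#)
      on z z′ (here refl) (y ∷ []) = x-x≡0 (c₀ y z z′)
      on z z′ (there j) p = on-line z z′ (∈-Hs B (λ _ i → i) j) p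
      divided : ∀ z z′ → ∃ λ g → D (suc s ∸ suc (List.length ls)) g × (∀ p → δ z z′ p ≡ Π.ΣL (idI ∷ ls) (λ φ → eqn φ p) * g p)
      divided z z′ = div-hyps (idI ∷ ls) (All.tabulate (λ j → first (∈-Hs B (λ _ i → i) j)) ∷ pairs B (λ _ i → i) (UniqueP.filter⁺ (λ x → Zero? (slice (slice f 0#) x)) unique-E))
        (s≤s s≤Q) (D-sub (D-∘ d (at z)) (D-∘ d (at z′))) (on z z′)
      len : suc s ∸ suc (List.length ls) ≡ 0
      len = trans (cong (s ∸_) (trans (length-Hs B (λ _ i → i)) #z)) (ℕP.n∸n≡0 s)
      δ≡0 : ∀ z z′ → Zero (δ z z′)
      δ≡0 z z′ p = trans (proj₂ (proj₂ (divided z z′)) p) (trans (cong (Π.ΣL (idI ∷ ls) (λ φ → eqn φ p) *_) (D-0 (D-cast len (proj₁ (proj₂ (divided z z′)))) p)) (zeroʳ _))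
    go : Empty f ⊎ (∀ {b} → b ∈ B → Line b) → Empty f ⊎ (∀ Y X z z′ → f (Y ∷ X ∷ z) ≡ f (Y ∷ X ∷ z′))
    go (inj₁ e) = inj₁ e
    go (inj₂ line) = inj₂ λ Y X z z′ → -≡0⇒≡ (Lines.δ≡0 line z z′ (Y ∷ X ∷ []))

  -- Fixing a coordinate on which f does not depend divides the weight by exactly q, and a missed
  -- hyperplane of the restriction extends to a cylinder.
  MissesHyperplane-indep : ∀ n s {f : Fun F (suc (suc (suc n)))} → MissesHyperplane 0 n s → D (suc s) f → ¬ Zero f → wt f ≤ σ s ℕ.* q ^ suc n →
                   (∀ Y X z z′ → f (Y ∷ X ∷ z) ≡ f (Y ∷ X ∷ z′)) → Empty f
  MissesHyperplane-indep n s {f} IH d ¬z ub c = go (IH (D-slice (D-iso d rotI) 0#) n₃ ub′)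
    where
    f₃ : Fun F (suc (suc (suc n)))
    f₃ = f ∘f rotI
    e₃ : ∀ x p → f₃ (x ∷ p) ≡ f₃ (0# ∷ p)
    e₃ x (Y ∷ X ∷ z) = c Y X (x ∷ z) (0# ∷ z)
    n₃ : ¬ Zero (slice f₃ 0#)
    n₃ z = ¬Zero-iso ¬z rotI λ { (x ∷ p) → trans (e₃ x p) (z p) }
    ub′ : wt (slice f₃ 0#) ≤ σ s ℕ.* q ^ n
    ub′ = ℕP.*-cancelˡ-≤ q (ℕP.≤-trans (ℕP.≤-reflexive (trans (sym (wt-indep f₃ e₃)) (wt-iso f rotI)))
      (ℕP.≤-trans ub (ℕP.≤-reflexive (NS.solve 3 (λ a b c → a NS.:* (b NS.:* c) NS.:= b NS.:* (a NS.:* c)) refl (σ s) q (q ^ n)))))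
    go : Empty (slice f₃ 0#) → Empty f
    go (ψ , z) = rotI ∘I (liftI ψ ∘I swapI) , λ { (x ∷ p) → trans (e₃ x (ψ $ (0# ∷ p))) (z p) }

  -- A slice of at most average weight misses, by induction, a flat of codimension 2. The pencil
  -- through it contains either a hyperplane missing the support or one from which `indep` can
  -- start.
  MissesHyperplane-0-suc : ∀ n s → 1 ≤ s → s ≤ Q → MissesHyperplane 0 n s → MissesHyperplane 0 (suc n) s
  MissesHyperplane-0-suc n s 1≤s s≤Q IH {f} d ¬z ub = go₁ (∃C? (λ x → Zero? (slice f x)))
    where
    light : ∃ λ a → wt (slice f a) ≤ σ s ℕ.* q ^ n
    light = light-slice f (σ s ℕ.* q ^ n) (ℕP.≤-trans ub (ℕP.≤-reflexive (NS.solve 3 (λ a b c → a NS.:* (b NS.:* c) NS.:= b NS.:* (a NS.:* c)) refl (σ s) q (q ^ n))))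
    a : Carrier
    a = proj₁ light
    go₃ : (Φ : Iso (suc (suc (suc n)))) → Empty (f ∘f Φ) ⊎ (∀ Y X z z′ → (f ∘f Φ) (Y ∷ X ∷ z) ≡ (f ∘f Φ) (Y ∷ X ∷ z′)) → Empty f
    go₃ Φ (inj₁ e) = Empty-iso f Φ e
    go₃ Φ (inj₂ ind) = Empty-iso f Φ (MissesHyperplane-indep n s IH (D-iso d Φ) (¬Zero-iso ¬z Φ) (wt-ub-iso ub Φ) ind)
    go₂ : (∀ x → ¬ Zero (slice f x)) → Empty (slice f a) → Empty f
    go₂ nonzero (φ , zφ) = fromPencil (pencil n s 1≤s s≤Q (D-iso d Φ) (wt-ub-iso ub Φ) (λ z → trans (slice₁ (0# ∷ z)) (zφ z))
        (λ z → ¬Zero-iso (nonzero a) φ (λ p → trans (sym (slice₁ p)) (z p))))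
      where
      Φ : Iso (suc (suc (suc n)))
      Φ = shearI (aff-const a) ∘I liftI φ
      slice₁ : ∀ p → slice (f ∘f Φ) 0# p ≡ (slice f a ∘f φ) p
      slice₁ p = cong (λ w → f (w ∷ (φ $ p))) (+-identityˡ a)
      fromPencil : Empty (f ∘f Φ) ⊎ ∃ (Pencil s (f ∘f Φ)) → Empty f
      fromPencil (inj₁ e) = Empty-iso f Φ e
      fromPencil (inj₂ (θ , #z , ¬z₀ , c)) = go₃ (Φ ∘I pencilI θ 0#)
        (indep n s 1≤s s≤Q (D-iso d (Φ ∘I pencilI θ 0#)) (wt-ub-iso ub (Φ ∘I pencilI θ 0#)) #z ¬z₀ c)
    go₁ : (∃ λ x → Zero (slice f x)) ⊎ (∀ x → ¬ Zero (slice f x)) → Empty f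
    go₁ (inj₁ (x , z)) = Empty-slice f x z
    go₁ (inj₂ nonzero) = go₂ nonzero (IH (D-slice d a) (nonzero a) (proj₂ light))

  misses-hyperplane : ∀ t n s → 1 ≤ s → s ≤ Q → MissesHyperplane t n s
  misses-hyperplane zero    zero    s 1≤s s≤Q = MissesHyperplane-plane s s≤Q
  misses-hyperplane zero    (suc n) s 1≤s s≤Q = MissesHyperplane-0-suc n s 1≤s s≤Q (misses-hyperplane zero n s 1≤s s≤Q)
  misses-hyperplane (suc t) n       s 1≤s s≤Q = MissesHyperplane-suc t n s 1≤s s≤Q (misses-hyperplane t n s 1≤s s≤Q)

  -- Derivatives

  mul : ℕ → Carrier → Carrier
  mul zero    x = 0#
  mul (suc n) x = x + mul n x

  mul-0 : ∀ n → mul n 0# ≡ 0#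
  mul-0 zero = refl
  mul-0 (suc n) = trans (+-identityˡ _) (mul-0 n)

  mul-+ : ∀ n x y → mul n (x + y) ≡ mul n x + mul n y
  mul-+ zero x y = sym (+-identityˡ 0#)
  mul-+ (suc n) x y = trans (cong (x + y +_) (mul-+ n x y)) (solve 4 (λ x y a b → x :+ y :+ (a :+ b) := (x :+ a) :+ (y :+ b)) refl x y _ _)

  mul-* : ∀ n a x → mul n (a * x) ≡ a * mul n x
  mul-* zero a x = sym (zeroʳ a)
  mul-* (suc n) a x = trans (cong (a * x +_) (mul-* n a x)) (sym (distribˡ a x _))

  mul-+ˡ : ∀ m n x → mul (m ℕ.+ n) x ≡ mul m x + mul n x
  mul-+ˡ zero n x = sym (+-identityˡ _)
  mul-+ˡ (suc m) n x = trans (cong (x +_) (mul-+ˡ m n x)) (sym (+-assoc x _ _))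

  mul-q : mul q 1# ≡ 0#
  mul-q = trans (cong (λ k → mul k 1#) (sym length-E)) (trans (sym (go E)) Σ-1)
    where
    go : ∀ xs → ΣL xs (λ _ → 1#) ≡ mul (List.length xs) 1#
    go [] = refl
    go (x ∷ xs) = cong (1# +_) (go xs)

  Below-0 : ∀ {n} {c : Seq} → (∀ i → c i ≡ 0#) → Below n c
  Below-0 z i _ = z i

  Below-+ : ∀ {n} {c d : Seq} → Below n c → Below n d → Below n (λ i → c i + d i)
  Below-+ s t i l = trans (cong₂ _+_ (s i l) (t i l)) (+-identityˡ 0#)

  Below-* : ∀ {n} a {c : Seq} → Below n c → Below n (λ i → a * c i)
  Below-* a s i l = trans (cong (a *_) (s i l)) (zeroʳ a)

  -- The coefficients 0, 1 and n of the expansion of f at p in the direction w are the value, the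
  -- derivative and a number T w independent of p.
  LineC : ∀ {m} → ℕ → Fun F m → (V m → Fun F m) → (V m → Carrier) → V m → V m → Set
  LineC n f d T p w = ∃ λ c → Below (suc n) c × (∀ ξ → f (p ⊞ ξ · w) ≡ ev (suc n) c ξ) × c 0 ≡ f p × c 1 ≡ d w p × c n ≡ T w

  DLineC : ∀ {m} → ℕ → (V m → Fun F m) → (V m → Carrier) → V m → V m → Set
  DLineC n d T p w = ∃ λ c → Below n c × (∀ ξ → d w (p ⊞ ξ · w) ≡ ev n c ξ) × c (n ∸ 1) ≡ mul n (T w)

  -- The derivatives of f of degree at most n, the expansions of f and of its derivative along lines, and
  -- the coefficient T of degree n of these expansions.
  record Jet {m} (n : ℕ) (f : Fun F m) : Set where
    field
      d     : V m → Fun F m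
      T     : V m → Carrier
      D-d   : ∀ w → D n (d w)
      d-lin : ∀ v w θ p → d (v ⊞ θ · w) p ≡ d v p + θ * d w p
      line  : ∀ p w → LineC n f d T p w
      dline : ∀ p w → DLineC n d T p w

  jet-zero : ∀ {m n} {f : Fun F m} → (∀ p → f p ≡ 0#) → Jet n f
  jet-zero {n = n} z = record
    { d = λ _ _ → 0# ; T = λ _ → 0# ; D-d = λ _ → dzero (λ _ → refl)
    ; d-lin = λ _ _ θ _ → solve 1 (λ t → con (0 , 0) := con (0 , 0) :+ t :* con (0 , 0)) refl θ
    ; line = λ p w → (λ _ → 0#) , Below-0 (λ _ → refl) , (λ ξ → trans (z _) (sym (ev-0 (suc n) (λ _ → 0#) ξ (λ _ _ → refl)))) , sym (z p) , refl , refl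
    ; dline = λ p w → (λ _ → 0#) , Below-0 (λ _ → refl) , (λ ξ → sym (ev-0 n (λ _ → 0#) ξ (λ _ _ → refl))) , sym (mul-0 n) }

  -- Derivatives follow the derivation of `D` by the Leibniz rule. The function alone does not
  -- determine them, x^q and x being the same function.
  jet : ∀ {m n} {f : Fun F m} → D (suc n) f → Jet n f
  jet (dzero z) = jet-zero z
  jet {n = n} (dconst k z) = record
    { d = λ _ _ → 0# ; T = λ _ → k * unit 0 n ; D-d = λ _ → dzero (λ _ → refl)
    ; d-lin = λ _ _ θ _ → solve 1 (λ t → con (0 , 0) := con (0 , 0) :+ t :* con (0 , 0)) refl θ
    ; line = λ p w → (λ i → k * unit 0 i) , supp , (λ ξ → trans (z _) (sym (trans (ev-* (suc n) k (unit 0) ξ) (trans (cong (k *_) (ev-unit (suc n) 0 ξ (s≤s z≤n))) (*-identityʳ k))))) ,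
        trans (*-identityʳ k) (sym (z p)) , zeroʳ k , refl
    ; dline = λ p w → (λ _ → 0#) , Below-0 (λ _ → refl) , (λ ξ → sym (ev-0 n (λ _ → 0#) ξ (λ _ _ → refl))) , sym (const-top n) }
    where
    supp : Below (suc n) (λ i → k * unit 0 i)
    supp (suc i) _ = zeroʳ k
    const-top : ∀ n → mul n (k * unit 0 n) ≡ 0#
    const-top zero = refl
    const-top (suc n) = trans (cong (mul (suc n)) (zeroʳ k)) (mul-0 (suc n))
  jet {n = n} {f} (dadd {g = g} {h = h} d₁ d₂ z) = record
    { d = λ w p → J₁.d w p + J₂.d w p ; T = λ w → J₁.T w + J₂.T w ; D-d = λ w → D-+ (J₁.D-d w) (J₂.D-d w)
    ; d-lin = λ v w θ p → trans (cong₂ _+_ (J₁.d-lin v w θ p) (J₂.d-lin v w θ p)) (solve 5 (λ a b t c e → (a :+ t :* b) :+ (c :+ t :* e) := (a :+ c) :+ t :* (b :+ e)) refl _ _ θ _ _)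
    ; line = λ p w → line (J₁.line p w) (J₂.line p w)
    ; dline = λ p w → dline (J₁.dline p w) (J₂.dline p w) }
    where
    module J₁ = Jet (jet d₁)
    module J₂ = Jet (jet d₂)
    line : ∀ {p w} → LineC n g J₁.d J₁.T p w → LineC n h J₂.d J₂.T p w → LineC n f (λ w p → J₁.d w p + J₂.d w p) (λ w → J₁.T w + J₂.T w) p w
    line (c₁ , s₁ , e₁ , z₁ , o₁ , t₁) (c₂ , s₂ , e₂ , z₂ , o₂ , t₂) =
      (λ i → c₁ i + c₂ i) , Below-+ s₁ s₂ , (λ ξ → trans (z _) (trans (cong₂ _+_ (e₁ ξ) (e₂ ξ)) (sym (ev-+ (suc n) c₁ c₂ ξ)))) ,
      trans (cong₂ _+_ z₁ z₂) (sym (z _)) , cong₂ _+_ o₁ o₂ , cong₂ _+_ t₁ t₂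
    dline : ∀ {p w} → DLineC n J₁.d J₁.T p w → DLineC n J₂.d J₂.T p w → DLineC n (λ w p → J₁.d w p + J₂.d w p) (λ w → J₁.T w + J₂.T w) p w
    dline (c₁ , s₁ , e₁ , t₁) (c₂ , s₂ , e₂ , t₂) = (λ i → c₁ i + c₂ i) , Below-+ s₁ s₂ ,
      (λ ξ → trans (cong₂ _+_ (e₁ ξ) (e₂ ξ)) (sym (ev-+ n c₁ c₂ ξ))) , trans (cong₂ _+_ t₁ t₂) (sym (mul-+ n _ _))
  jet {n = zero} (dmul {a = a} A d₀ z) = jet-zero (λ p → trans (z p) (trans (cong (a p *_) (D-0 d₀ p)) (zeroʳ _)))
  jet {n = suc n} {f} (dmul {a = a} {g = g} A d₀ z) = record
    { d = λ w p → a p * J.d w p + lin w * g p ; T = λ w → lin w * J.T w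
    ; D-d = λ w → D-+ (D-aff A (J.D-d w)) (D-scale (lin w) d₀)
    ; d-lin = λ v w θ p → trans (cong₂ (λ u l → a p * u + l * g p) (J.d-lin v w θ p) (lin-lin v w θ))
        (solve 7 (λ a x y t l l′ g → a :* (x :+ t :* y) :+ (l :+ t :* l′) :* g := (a :* x :+ l :* g) :+ t :* (a :* y :+ l′ :* g)) refl (a p) _ _ θ _ _ (g p))
    ; line = λ p w → line p w (J.line p w)
    ; dline = λ p w → dline p w (J.line p w) (J.dline p w) }
    where
    module J = Jet (jet d₀)
    lin : Fun F _
    lin = IsAff.lin A
    lin-lin : ∀ v w θ → lin (v ⊞ θ · w) ≡ lin v + θ * lin w
    lin-lin v w θ = begin
      lin (v ⊞ θ · w) ≡⟨ solve 2 (λ a l → l := (a :+ l) :- a) refl (a 0V) _ ⟩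
      (a 0V + lin (v ⊞ θ · w)) - a 0V ≡⟨ cong (_- a 0V) (sym (IsAff.add A 0V _)) ⟩
      a (0V ⊞ (v ⊞ θ · w)) - a 0V ≡⟨ cong (λ u → a u - a 0V) (sym (⊞-assoc 0V v _)) ⟩
      a ((0V ⊞ v) ⊞ θ · w) - a 0V ≡⟨ cong (_- a 0V) (trans (IsAff.add A _ _) (cong₂ _+_ (IsAff.add A 0V v) (IsAff.hom A θ w))) ⟩
      ((a 0V + lin v) + θ * lin w) - a 0V ≡⟨ solve 3 (λ a v w → ((a :+ v) :+ w) :- a := v :+ w) refl (a 0V) _ _ ⟩
      lin v + θ * lin w ∎
      where open ≡-Reasoning
    a-line : ∀ p w ξ → a (p ⊞ ξ · w) ≡ a p + lin w * ξ
    a-line p w ξ = trans (IsAff.add A p (ξ · w)) (cong (a p +_) (trans (IsAff.hom A ξ w) (*-comm _ _)))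
    line : ∀ p w → LineC n g J.d J.T p w → LineC (suc n) f (λ w p → a p * J.d w p + lin w * g p) (λ w → lin w * J.T w) p w
    line p w (c , s , e , z₀ , o , t) = linP (a p) (lin w) c , linP-Below (a p) (lin w) s ,
      (λ ξ → trans (z _) (trans (cong₂ _*_ (a-line p w ξ) (e ξ)) (sym (ev-linP (suc n) (a p) (lin w) c ξ s)))) ,
      trans (solve 3 (λ a l u → a :* u :+ l :* con (0 , 0) := a :* u) refl (a p) (lin w) (c 0)) (trans (cong (a p *_) z₀) (sym (z p))) ,
      cong₂ (λ u v → a p * u + lin w * v) o z₀ ,
      trans (cong₂ (λ u v → a p * u + lin w * v) (s (suc n) ℕP.≤-refl) t) (solve 2 (λ a l → a :* con (0 , 0) :+ l := l) refl (a p) _)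
    dline : ∀ p w → LineC n g J.d J.T p w → DLineC n J.d J.T p w → DLineC (suc n) (λ w p → a p * J.d w p + lin w * g p) (λ w → lin w * J.T w) p w
    dline p w (c , s , e , z₀ , o , t) (c′ , s′ , e′ , t′) =
      (λ i → linP (a p) (lin w) c′ i + lin w * c i) , Below-+ (linP-Below (a p) (lin w) s′) (Below-* (lin w) s) ,
      (λ ξ → trans (cong₂ _+_ (trans (cong₂ _*_ (a-line p w ξ) (e′ ξ)) (sym (ev-linP n (a p) (lin w) c′ ξ s′))) (trans (cong (lin w *_) (e ξ)) (sym (ev-* (suc n) (lin w) c ξ))))
        (sym (ev-+ (suc n) (linP (a p) (lin w) c′) (λ i → lin w * c i) ξ))) ,
      trans (cong₂ (λ u v → u + lin w * v) (top n s′ t′) t)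
        (trans (+-comm _ _) (cong (lin w * J.T w +_) (sym (mul-* n (lin w) (J.T w)))))
      where
      top : ∀ n → Below n c′ → c′ (n ∸ 1) ≡ mul n (J.T w) → linP (a p) (lin w) c′ n ≡ lin w * mul n (J.T w)
      top zero s t = trans (cong (λ u → a p * u + lin w * 0#) (s 0 z≤n)) (solve 2 (λ a l → a :* con (0 , 0) :+ l :* con (0 , 0) := l :* con (0 , 0)) refl (a p) (lin w))
      top (suc n) s t = trans (cong₂ (λ u v → a p * u + lin w * v) (s (suc n) ℕP.≤-refl) t) (solve 2 (λ a l → a :* con (0 , 0) :+ l := l) refl (a p) _)

  -- Products of polynomials

  conv : ℕ → Seq → Seq → Seq
  conv zero    u v i = 0#
  conv (suc n) u v i = u 0 * v i + sh (conv n (u ∘ suc) v) i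

  ev-conv : ∀ n k u v x → Below k v → ev (n ℕ.+ k) (conv n u v) x ≡ ev n u x * ev k v x
  ev-conv zero    k u v x s = trans (ev-0 k (λ _ → 0#) x (λ _ _ → refl)) (sym (zeroˡ _))
  ev-conv (suc n) k u v x s = begin
    ev (suc n ℕ.+ k) (conv (suc n) u v) x ≡⟨ ev-+ (suc n ℕ.+ k) (λ i → u 0 * v i) (sh (conv n (u ∘ suc) v)) x ⟩
    ev (suc n ℕ.+ k) (λ i → u 0 * v i) x + (0# + x * ev (n ℕ.+ k) (conv n (u ∘ suc) v) x)
      ≡⟨ cong₂ (λ a b → a + (0# + x * b)) (trans (ev-* (suc n ℕ.+ k) (u 0) v x) (cong (u 0 *_) (ev-extend k (suc n ℕ.+ k) v x (ℕP.m≤n+m k (suc n)) s))) (ev-conv n k (u ∘ suc) v x s) ⟩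
    u 0 * ev k v x + (0# + x * (ev n (u ∘ suc) x * ev k v x)) ≡⟨ solve 4 (λ u v x w → u :* v :+ (con (0 , 0) :+ x :* (w :* v)) := (u :+ x :* w) :* v) refl _ _ x _ ⟩
    ev (suc n) u x * ev k v x ∎
    where open ≡-Reasoning

  conv-top : ∀ n b u v → Below (suc b) v → conv (suc n) u v (n ℕ.+ b) ≡ u n * v b
  conv-top zero    b u v s = trans (cong (u 0 * v b +_) (sh0 b)) (+-identityʳ _)
    where
    sh0 : ∀ b → sh (conv 0 (u ∘ suc) v) b ≡ 0#
    sh0 zero = refl
    sh0 (suc b) = refl
  conv-top (suc n) b u v s = trans (cong₂ _+_ (trans (cong (u 0 *_) (s (suc n ℕ.+ b) (s≤s (ℕP.m≤n+m b n)))) (zeroʳ _)) (conv-top n b (u ∘ suc) v s)) (+-identityˡ _)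

  conv-Below : ∀ n k u v → Below k v → Below (n ℕ.+ k) (conv (suc n) u v)
  conv-Below zero k u v s i l = trans (cong₂ _+_ (trans (cong (u 0 *_) (s i l)) (zeroʳ _)) (sh0 i)) (+-identityˡ _)
    where
    sh0 : ∀ i → sh (conv 0 (u ∘ suc) v) i ≡ 0#
    sh0 zero = refl
    sh0 (suc i) = refl
  conv-Below (suc n) k u v s (suc i) (s≤s l) = trans (cong₂ _+_ (trans (cong (u 0 *_) (s (suc i) (ℕP.≤-trans (ℕP.m≤n+m k n) (ℕP.m≤n⇒m≤1+n l)))) (zeroʳ _)) (conv-Below n k (u ∘ suc) v s i l)) (+-identityˡ _)

  -- Sums weighted by inverses

  inv-inv : ∀ x → inv (inv x) ≡ x
  inv-inv x with x ≟ 0#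
  ... | yes refl = inv0
    where
    inv0 : inv 0# ≡ 0#
    inv0 with 0# ≟ 0#
    ... | yes _ = refl
    ... | no n = contradiction refl n
  ... | no n = *-cancelˡ (inv≢0′ ) (trans (inv-r inv≢0′) (sym (trans (*-comm _ _) (proj₂ (inverse x n)))))
    where
    inv≢0′ : proj₁ (inverse x n) ≢ 0#
    inv≢0′ e = 0≢1 (trans (sym (zeroʳ x)) (trans (cong (x *_) (sym e)) (proj₂ (inverse x n))))

  Σ-inv : ΣC inv ≡ 0#
  Σ-inv = trans (reindexC inv inv inv-inv inv-inv (λ x → x)) (trans (ΣL-cong E (λ x → sym (*-identityʳ x))) (Σ-pow 1 (ℕP.≤-trans (s≤s (s≤s z≤n)) 3≤Q)))

  inv-0 : inv 0# ≡ 0#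
  inv-0 with 0# ≟ 0#
  ... | yes _ = refl
  ... | no n = contradiction refl n

  -- Division by ξ moves the coefficients of ξ and ξ^q to the exponents 0 and q - 1, the only ones
  -- that contribute to the sum over ξ ≠ 0. On a product of two expansions this yields the
  -- derivative together with the product of the top coefficients.
  Σ-inv-ev : ∀ (w : Seq) → Below (suc q) w → ΣC (λ ξ → inv ξ * ev (suc q) w ξ) ≡ - (w 1 + w q)
  Σ-inv-ev w s = begin
    ΣC (λ ξ → inv ξ * ev (suc q) w ξ) ≡⟨ ΣL-cong E pt ⟩
    ΣC (λ ξ → w 0 * inv ξ + (ev q (w ∘ suc) ξ + pick (ξ ≟ 0#) (- w 1) 0#)) ≡⟨ ΣL-∙ E _ _ ⟩
    ΣC (λ ξ → w 0 * inv ξ) + ΣC (λ ξ → ev q (w ∘ suc) ξ + pick (ξ ≟ 0#) (- w 1) 0#)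
      ≡⟨ cong₂ _+_ (trans (ΣL-*ˡ E (w 0) inv) (cong (w 0 *_) Σ-inv)) (trans (ΣL-∙ E _ _) (cong₂ _+_ (Σ-ev-q (w ∘ suc)) (δC 0# (λ _ → - w 1)))) ⟩
    w 0 * 0# + (- w q + - w 1) ≡⟨ solve 3 (λ a b c → a :* con (0 , 0) :+ (:- b :+ :- c) := :- (c :+ b)) refl (w 0) (w q) (w 1) ⟩
    - (w 1 + w q) ∎
    where
    open ≡-Reasoning
    pt : ∀ ξ → inv ξ * ev (suc q) w ξ ≡ w 0 * inv ξ + (ev q (w ∘ suc) ξ + pick (ξ ≟ 0#) (- w 1) 0#)
    pt ξ = go (ξ ≟ 0#)
      where
      go : (dd : Dec (ξ ≡ 0#)) → inv ξ * ev (suc q) w ξ ≡ w 0 * inv ξ + (ev q (w ∘ suc) ξ + pick dd (- w 1) 0#)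
      go (yes refl) = trans (cong (_* ev (suc q) w 0#) inv-0) (trans (zeroˡ _) (sym (trans (cong₂ (λ a b → w 0 * a + (b + - w 1)) inv-0 at0)
        (solve 2 (λ a b → a :* con (0 , 0) :+ (b :- b) := con (0 , 0)) refl (w 0) (w 1)))))
        where
        at0 : ev q (w ∘ suc) 0# ≡ w 1
        at0 = trans (cong (w 1 +_) (zeroˡ _)) (+-identityʳ _)
      go (no n) = trans (solve 4 (λ i w x e → i :* (w :+ x :* e) := w :* i :+ (x :* i) :* e) refl (inv ξ) (w 0) ξ (ev q (w ∘ suc) ξ))
        (cong (w 0 * inv ξ +_) (trans (cong (_* ev q (w ∘ suc) ξ) (inv-r n)) (trans (*-identityˡ _) (sym (+-identityʳ _)))))

  Σ-inv-product : ∀ a b (u v : Seq) → suc a ℕ.+ b ≡ q → Below (suc (suc a)) u → Below (suc b) v →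
                  ΣC (λ ξ → inv ξ * (ev (suc (suc a)) u ξ * ev (suc b) v ξ)) ≡ - ((u 0 * v 1 + u 1 * v 0) + u (suc a) * v b)
  Σ-inv-product a b u v ab su sv = begin
    ΣC (λ ξ → inv ξ * (ev (suc (suc a)) u ξ * ev (suc b) v ξ)) ≡⟨ ΣL-cong E (λ ξ → cong (inv ξ *_) (pt ξ)) ⟩
    ΣC (λ ξ → inv ξ * ev (suc q) w ξ) ≡⟨ Σ-inv-ev w sw ⟩
    - (w 1 + w q) ≡⟨ cong₂ (λ s t → - (s + t)) (cong (u 0 * v 1 +_) (trans (cong (u 1 * v 0 +_) refl) (+-identityʳ _))) wq ⟩
    - ((u 0 * v 1 + u 1 * v 0) + u (suc a) * v b) ∎
    where
    open ≡-Reasoning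
    w : Seq
    w = conv (suc (suc a)) u v
    wq : w q ≡ u (suc a) * v b
    wq = trans (cong w (sym ab)) (conv-top (suc a) b u v sv)
    sw : Below (suc q) w
    sw = subst (λ k → Below k w) (trans (ℕP.+-suc (suc a) b) (cong suc ab)) (conv-Below (suc a) (suc b) u v sv)
    pt : ∀ ξ → ev (suc (suc a)) u ξ * ev (suc b) v ξ ≡ ev (suc q) w ξ
    pt ξ = trans (sym (ev-conv (suc (suc a)) (suc b) u v ξ sv)) (trans (cong (λ k → ev k w ξ) (trans (ℕP.+-suc (suc (suc a)) b) (cong (2 ℕ.+_) ab))) (ev-extend (suc q) (suc (suc q)) w ξ (ℕP.n≤1+n _) sw))

  -- Plane curves that are monic in y

  D-poly : ∀ n (c : Seq) → D {1} n (λ v → ev n c (head v))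
  D-poly zero    c = dzero (λ _ → refl)
  D-poly (suc n) c = D-+ (dconst (c 0) (λ _ → refl)) (D-aff aff-head (D-poly n (c ∘ suc)))

  roots-of : (Carrier → Carrier) → List Carrier
  roots-of h = List.filter (λ y → h y ≟ 0#) E

  #nz : (Carrier → Carrier) → ℕ
  #nz h = N.ΣC (λ y → nz (h y))

  roots+nz : ∀ h → List.length (roots-of h) ℕ.+ #nz h ≡ q
  roots+nz h = trans (go E) length-E
    where
    go : ∀ xs → List.length (List.filter (λ y → h y ≟ 0#) xs) ℕ.+ N.ΣL xs (λ y → nz (h y)) ≡ List.length xs
    go [] = refl
    go (x ∷ xs) with h x ≟ 0#
    ... | yes _ = cong suc (go xs)
    ... | no _ = trans (ℕP.+-suc _ _) (cong suc (go xs))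

  ∈-roots : ∀ h {y} → y ∈ roots-of h → h y ≡ 0#
  ∈-roots h i = proj₂ (∈-filter⁻ (λ y → h y ≟ 0#) {xs = E} i)

  unique-roots : ∀ h → Unique (roots-of h)
  unique-roots h = UniqueP.filter⁺ (λ y → h y ≟ 0#) unique-E

  #nz-poly : ∀ k (h : Carrier → Carrier) → k ≤ Q → D {1} (suc k) (λ v → h (head v)) → ∀ x → h x ≢ 0# → q ∸ k ≤ #nz h
  #nz-poly k h k≤Q d x n = ℕP.≤-trans (ℕP.≤-reflexive (sym (trans (μ-≤ 0 k k≤Q) (ℕP.*-identityʳ _)))) (ℕP.≤-trans (kasami 1 d (x ∷ [] , n)) (ℕP.≤-reflexive (N.ΣV-1 (λ v → nz (h (head v))))))

  infix 5 _∣_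
  _∣_ : Carrier → Carrier → V 2
  x ∣ y = x ∷ y ∷ []

  e₁ e₂ : V 2
  e₁ = 1# ∣ 0#
  e₂ = 0# ∣ 1#

  Monic : ℕ → Fun F 2 → Set
  Monic n h = ∀ x → ∃ λ c → (∀ y → h (x ∣ y) ≡ ev (suc n) c y) × c n ≡ 1#

  line-e₂ : ∀ x y ξ → (x ∣ y) ⊞ ξ · e₂ ≡ (x ∣ y + ξ)
  line-e₂ x y ξ = cong₂ _∣_ (solve 2 (λ x t → x :+ t :* con (0 , 0) := x) refl x ξ) (cong (y +_) (*-identityʳ ξ))

  top-monic : ∀ {n h} (J : Jet n h) → n ≤ Q → Monic n h → Jet.T J e₂ ≡ 1#
  top-monic {n} {h} J n≤Q M = go (Jet.line J (0# ∣ 0#) e₂) (M 0#)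
    where
    go : LineC n h (Jet.d J) (Jet.T J) (0# ∣ 0#) e₂ → (∃ λ c → (∀ y → h (0# ∣ y) ≡ ev (suc n) c y) × c n ≡ 1#) → Jet.T J e₂ ≡ 1#
    go (c , _ , e , _ , _ , t) (c′ , e′ , t′) = trans (sym t) (trans (ev-inj (suc n) c c′ (s≤s n≤Q) eq n ℕP.≤-refl) t′)
      where
      eq : ∀ ξ → ev (suc n) c ξ ≡ ev (suc n) c′ ξ
      eq ξ = trans (sym (e ξ)) (trans (cong h (trans (line-e₂ 0# 0# ξ) (cong (0# ∣_) (+-identityˡ ξ)))) (e′ ξ))

  expand-y : ∀ n {ε : Fun F 2} → suc n ≤ q → D (suc n) ε → ∃ λ c → (∀ i → i < suc n → D {1} (suc n ∸ i) (c i)) × (∀ x y → ε (x ∣ y) ≡ ev (suc n) (λ i → c i (x ∷ [])) y)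
  expand-y n {ε} n<q dε = NFε.h , (λ i l → NFε.deg i (ℕP.≤-trans l n<q)) , truncate
    where
    module NFε = NF (D⇒NF (D-iso dε swapI))
    c : Carrier → Seq
    c x i = NFε.h i (x ∷ [])
    truncate : ∀ x y → ε (x ∣ y) ≡ ev (suc n) (c x) y
    truncate x y = trans (NFε.eq y (x ∷ [])) (trans (ev-cong q y agree) (trans (ev-extend (suc n) q c′ y n<q below) (ev-cong (suc n) y (λ i l → sym (agree i (ℕP.≤-trans l n<q))))))
      where
      c′ : Seq
      -- The normal form controls its coefficients for i < q only; those beyond n are set to 0 to
      -- allow `ev-extend`.
      c′ i = pick (suc n ℕP.≤? i) 0# (c x i)
      agree : ∀ i → i < q → c x i ≡ c′ i
      agree i l with suc n ℕP.≤? i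
      ... | yes m = D-0 (D-cast (ℕP.m≤n⇒m∸n≡0 m) (NFε.deg i l)) (x ∷ [])
      ... | no _ = refl
      below : ∀ i → suc n ≤ i → c′ i ≡ 0#
      below i m with suc n ℕP.≤? i
      ... | yes _ = refl
      ... | no ¬m = contradiction m ¬m

  -- By total degree the coefficient of y^n in ε is a constant k. Then ε - k h has degree less than
  -- n in y but n roots in every column x ≠ 0, so it vanishes there; on the column x = 0 it vanishes
  -- because its sum over each horizontal line is 0.
  eigen : ∀ n {h ε : Fun F 2} → suc n ≤ Q → D (suc n) h → Monic n h → (∀ x → x ≢ 0# → List.length (roots-of (λ y → h (x ∣ y))) ≡ n) →
          D (suc n) ε → (∀ x y → x ≢ 0# → h (x ∣ y) ≡ 0# → ε (x ∣ y) ≡ 0#) → ∃ λ k → ∀ x y → ε (x ∣ y) ≡ k * h (x ∣ y)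
  eigen n {h} {ε} n<Q dh M full dε zε = k , λ x y → -≡0⇒≡ (N≡0 x y)
    where
    n<q : suc n ≤ q
    n<q = ℕP.m≤n⇒m≤1+n n<Q
    expansion : ∃ λ c → (∀ i → i < suc n → D {1} (suc n ∸ i) (c i)) × (∀ x y → ε (x ∣ y) ≡ ev (suc n) (λ i → c i (x ∷ [])) y)
    expansion = expand-y n n<q dε
    c : Carrier → Seq
    c x i = proj₁ expansion i (x ∷ [])
    top : ∃ λ k → ∀ p → proj₁ expansion n p ≡ k
    top = D-1 (D-cast (trans (ℕP.+-∸-assoc 1 (ℕP.≤-refl {n})) (cong suc (ℕP.n∸n≡0 n))) (proj₁ (proj₂ expansion) n ℕP.≤-refl))
    k : Carrier
    k = proj₁ top
    N : Fun F 2
    N p = ε p - k * h p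
    dN : D (suc n) N
    dN = D-sub dε (D-scale k dh)
    N≡0′ : ∀ x → x ≢ 0# → ∀ y → N (x ∣ y) ≡ 0#
    N≡0′ x x≢0 y = trans (as-ev y) (trans (ev-last n d y) (trans (cong₂ (λ a b → a + b * pow F y n) (ev-0 n d y (λ i l → small i l)) d-top) (solve 1 (λ p → con (0 , 0) :+ con (0 , 0) :* p := con (0 , 0)) refl _)))
      where
      m : ∃ λ c → (∀ y → h (x ∣ y) ≡ ev (suc n) c y) × c n ≡ 1#
      m = M x
      d : Seq
      d i = c x i + - k * proj₁ m i
      as-ev : ∀ y → N (x ∣ y) ≡ ev (suc n) d y
      as-ev y = trans (cong₂ (λ a b → a - k * b) (proj₂ (proj₂ expansion) x y) (proj₁ (proj₂ m) y))
        (sym (trans (ev-+ (suc n) (c x) (λ i → - k * proj₁ m i) y) (trans (cong (ev (suc n) (c x) y +_) (ev-* (suc n) (- k) (proj₁ m) y)) (solve 3 (λ a k b → a :+ :- k :* b := a :- k :* b) refl _ k _))))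
      d-top : d n ≡ 0#
      d-top = trans (cong₂ (λ a b → a + - k * b) (proj₂ top (x ∷ [])) (proj₂ (proj₂ m))) (solve 1 (λ k → k :+ :- k :* con (1 , 0) := con (0 , 0)) refl k)
      at-root : ∀ {y} → y ∈ roots-of (λ y → h (x ∣ y)) → ev n d y ≡ 0#
      at-root {y} i = trans (solve 2 (λ a p → a := a :+ con (0 , 0) :* p) refl _ (pow F y n)) (trans (cong (λ b → ev n d y + b * pow F y n) (sym d-top)) (trans (sym (ev-last n d y)) (trans (sym (as-ev y))
        (trans (cong₂ (λ a b → a - k * b) (zε x y x≢0 (∈-roots _ i)) (∈-roots _ i)) (solve 1 (λ k → con (0 , 0) :- k :* con (0 , 0) := con (0 , 0)) refl k)))))
      small : ∀ i → i < n → d i ≡ 0#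
      small = roots n d (roots-of (λ y → h (x ∣ y))) (unique-roots _) (ℕP.≤-reflexive (sym (full x x≢0))) at-root
    N≡0 : ∀ x y → N (x ∣ y) ≡ 0#
    N≡0 x y with x ≟ 0#
    ... | no n = N≡0′ x n y
    ... | yes refl = D-Q-at {f = λ v → N (head v ∣ y)} (D-mono n<Q (D-∘ dN (map-∷ aff-head (map-∷ (aff-const y) map-[])))) 0# (λ x n → N≡0′ x n y)

  -- The quotients of y^(k+e) by a monic polynomial of degree e.
  record Quot (e : ℕ) (f : Fun F 2) (k : ℕ) : Set where
    field
      quot  : Fun F 2
      rem   : ℕ → Fun F 1
      D-q   : D (suc k) quot
      D-r   : ∀ i → i < e → D (suc (k ℕ.+ e) ∸ i) (rem i)
      eq    : ∀ x y → pow F y (k ℕ.+ e) ≡ f (x ∣ y) * quot (x ∣ y) + ev e (λ i → rem i (x ∷ [])) y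
      monic : ∀ x → ∃ λ c → Below (suc k) c × (∀ y → quot (x ∣ y) ≡ ev (suc k) c y) × c k ≡ 1#

  module _ (e′ : ℕ) (f : Fun F 2) (c : ℕ → Fun F 1) (D-c : ∀ i → i < suc (suc e′) → D (suc (suc e′) ∸ i) (c i))
           (f≡ : ∀ x y → f (x ∣ y) ≡ ev (suc (suc e′)) (λ i → c i (x ∷ [])) y) (c-top : ∀ x → c (suc e′) x ≡ 1#) where
    private
      e : ℕ
      e = suc e′
      f-low : ∀ x y → pow F y e ≡ f (x ∣ y) - ev e (λ i → c i (x ∷ [])) y
      f-low x y = trans (solve 2 (λ a p → p := (a :+ con (1 , 0) :* p) :- a) refl (ev e (λ i → c i (x ∷ [])) y) (pow F y e))
        (cong (_- ev e (λ i → c i (x ∷ [])) y) (trans (cong (λ t → ev e (λ i → c i (x ∷ [])) y + t * pow F y e) (sym (c-top (x ∷ [])))) (trans (sym (ev-last e (λ i → c i (x ∷ [])) y)) (sym (f≡ x y)))))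

    -- Long division, one power of y at a time: after multiplication by y the overflow ρ y^e is
    -- replaced by means of ρ f. The bounds on the total degree persist because the coefficient of
    -- y^i in f has degree at most e - i.
    quotient : ∀ k → Quot e f k
    quotient zero = record
      { quot = λ _ → 1# ; rem = λ i v → - c i v ; D-q = dconst 1# (λ _ → refl) ; D-r = λ i l → D-neg (D-c i (ℕP.m≤n⇒m≤1+n l))
      ; eq = λ x y → trans (f-low x y) (trans (solve 2 (λ f r → f :- r := f :* con (1 , 0) :+ :- con (1 , 0) :* r) refl _ _) (cong (f (x ∣ y) * 1# +_) (trans (sym (ev-* e (- 1#) (λ i → c i (x ∷ [])) y))
          (ev-cong e y (λ i _ → solve 1 (λ u → :- con (1 , 0) :* u := :- u) refl (c i (x ∷ [])))))))
      ; monic = λ x → unit 0 , below , (λ y → sym (ev-unit 1 0 y (s≤s z≤n))) , refl }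
      where
      below : Below 1 (unit 0)
      below (suc i) _ = refl
    quotient (suc k) = record
      { quot = λ p → head (tail p) * P.quot p + ρ (head p ∷ []) ; rem = rem ; D-q = D-+ (D-aff (aff-∘ aff-head map-tail) P.D-q) (D-∘ Dρ (map-∷ aff-head map-[]))
      ; D-r = D-r ; eq = eq ; monic = λ x → monic x (P.monic x) }
      where
      module P = Quot (quotient k)
      ρ : Fun F 1
      ρ = P.rem e′
      Dρ : D (suc (suc k)) ρ
      Dρ = D-cast (trans (cong (λ t → suc t ∸ e′) (trans (ℕP.+-suc k e′) (cong suc (ℕP.+-comm k e′)))) (∸≡ {b = e′} (trans (sym (ℕP.+-suc _ k)) (sym (ℕP.+-suc e′ (suc k)))))) (P.D-r e′ ℕP.≤-refl)
      shρ : ℕ → Fun F 1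
      shρ zero    v = 0#
      shρ (suc i) v = P.rem i v
      rem : ℕ → Fun F 1
      rem i v = shρ i v - ρ v * c i v
      D-r : ∀ i → i < e → D (suc (suc (k ℕ.+ e)) ∸ i) (rem i)
      D-r i l = D-sub (D-sh i l) (D-cast deg (D-* (suc k) (suc e ∸ i) Dρ (D-c i (ℕP.m≤n⇒m≤1+n l))))
        where
        D-sh : ∀ i → i < e → D (suc (suc (k ℕ.+ e)) ∸ i) (shρ i)
        D-sh zero _ = dzero (λ _ → refl)
        D-sh (suc i) l = P.D-r i (ℕP.<-trans (ℕP.n<1+n i) l)
        deg : suc k ℕ.+ (suc e ∸ i) ≡ suc (suc (k ℕ.+ e)) ∸ i
        deg = sym (trans (cong (λ t → suc t ∸ i) (sym (ℕP.+-suc k e))) (ℕP.+-∸-assoc (suc k) (ℕP.≤-trans (ℕP.<⇒≤ l) (ℕP.n≤1+n e))))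
      eq : ∀ x y → y * pow F y (k ℕ.+ e) ≡ f (x ∣ y) * (y * P.quot (x ∣ y) + ρ (x ∷ [])) + ev e (λ i → rem i (x ∷ [])) y
      eq x y = begin
        y * pow F y (k ℕ.+ e) ≡⟨ cong (y *_) (P.eq x y) ⟩
        y * (f′ * P.quot (x ∣ y) + ev e (λ i → P.rem i (x ∷ [])) y) ≡⟨ solve 4 (λ y f u r → y :* (f :* u :+ r) := f :* (y :* u) :+ (con (0 , 0) :+ y :* r)) refl y f′ _ _ ⟩
        f′ * (y * P.quot (x ∣ y)) + ev (suc e) (λ i → shρ i (x ∷ [])) y ≡⟨ cong (f′ * (y * P.quot (x ∣ y)) +_) (trans (ev-last e (λ i → shρ i (x ∷ [])) y) (cong (λ t → ev e (λ i → shρ i (x ∷ [])) y + ρ′ * t) (f-low x y))) ⟩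
        f′ * (y * P.quot (x ∣ y)) + (ev e (λ i → shρ i (x ∷ [])) y + ρ′ * (f′ - ev e (λ i → c i (x ∷ [])) y))
          ≡⟨ solve 6 (λ f y u s r c → f :* (y :* u) :+ (s :+ r :* (f :- c)) := f :* (y :* u :+ r) :+ (s :+ :- r :* c)) refl f′ y _ _ ρ′ _ ⟩
        f′ * (y * P.quot (x ∣ y) + ρ′) + (ev e (λ i → shρ i (x ∷ [])) y + - ρ′ * ev e (λ i → c i (x ∷ [])) y)
          ≡⟨ cong (f′ * (y * P.quot (x ∣ y) + ρ′) +_) (trans (cong (ev e (λ i → shρ i (x ∷ [])) y +_) (sym (ev-* e (- ρ′) (λ i → c i (x ∷ [])) y))) (trans (sym (ev-+ e (λ i → shρ i (x ∷ [])) (λ i → - ρ′ * c i (x ∷ [])) y))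
            (ev-cong e y (λ i _ → solve 3 (λ s r c → s :+ :- r :* c := s :- r :* c) refl (shρ i (x ∷ [])) ρ′ (c i (x ∷ [])))))) ⟩
        f′ * (y * P.quot (x ∣ y) + ρ′) + ev e (λ i → rem i (x ∷ [])) y ∎
        where
        open ≡-Reasoning
        f′ ρ′ : Carrier
        f′ = f (x ∣ y)
        ρ′ = ρ (x ∷ [])
      monic : ∀ x → (∃ λ c → Below (suc k) c × (∀ y → P.quot (x ∣ y) ≡ ev (suc k) c y) × c k ≡ 1#) →
              ∃ λ c → Below (suc (suc k)) c × (∀ y → y * P.quot (x ∣ y) + ρ (x ∷ []) ≡ ev (suc (suc k)) c y) × c (suc k) ≡ 1#
      monic x (d , s , ed , t) = d′ , Below-+ (λ { (suc i) (s≤s l) → s i l }) (Below-* ρ′ (λ { (suc i) (s≤s _) → refl })) , ev-d′ , trans (cong₂ (λ a b → a + b) t (zeroʳ ρ′)) (+-identityʳ 1#)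
        where
        ρ′ : Carrier
        ρ′ = ρ (x ∷ [])
        d′ : Seq
        d′ i = sh d i + ρ′ * unit 0 i
        ev-d′ : ∀ y → y * P.quot (x ∣ y) + ρ′ ≡ ev (suc (suc k)) d′ y
        ev-d′ y = sym (trans (ev-+ (suc (suc k)) (sh d) (λ i → ρ′ * unit 0 i) y) (cong₂ _+_ (trans (+-identityˡ _) (cong (y *_) (sym (ed y))))
          (trans (ev-* (suc (suc k)) ρ′ (unit 0) y) (trans (cong (ρ′ *_) (ev-unit (suc (suc k)) 0 y (s≤s z≤n))) (*-identityʳ ρ′)))))

  mul₂ : ∀ (h : Carrier → Carrier) c → #nz (λ y → h (y + c)) ≡ #nz h
  mul₂ h c = N.reindexC (_+ c) (_- c) (λ x → solve 2 (λ x c → x :+ c :- c := x) refl x c) (λ x → solve 2 (λ x c → x :- c :+ c := x) refl x c) (λ y → nz (h y))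

  Σ-inv-id : ΣC (λ ξ → inv ξ * ξ) ≡ - 1#
  Σ-inv-id = trans (ΣL-cong E pt) (trans (ΣL-∙ E (λ _ → 1#) (λ ξ → pick (ξ ≟ 0#) (- 1#) 0#)) (trans (cong₂ _+_ Σ-1 (δC 0# (λ _ → - 1#))) (+-identityˡ _)))
    where
    pt : ∀ ξ → inv ξ * ξ ≡ 1# + pick (ξ ≟ 0#) (- 1#) 0#
    pt ξ = go (ξ ≟ 0#)
      where
      go : (d : Dec (ξ ≡ 0#)) → inv ξ * ξ ≡ 1# + pick d (- 1#) 0#
      go (yes refl) = trans (zeroʳ _) (sym (-‿inverseʳ 1#))
      go (no n) = trans (inv-l n) (sym (+-identityʳ 1#))

  product≡0 : ∀ {x y} → x * y ≡ 0# → x ≡ 0# ⊎ y ≡ 0#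
  product≡0 {x} {y} e = go (x ≟ 0#)
    where
    go : Dec (x ≡ 0#) → x ≡ 0# ⊎ y ≡ 0#
    go (yes p) = inj₁ p
    go (no p) = inj₂ (*≡0 p e)

  nz-product : ∀ {x y} → x * y ≡ 0# → nz x ℕ.+ nz y ≤ 1
  nz-product {x} {y} e = go (product≡0 e)
    where
    go : x ≡ 0# ⊎ y ≡ 0# → nz x ℕ.+ nz y ≤ 1
    go (inj₁ p) = ℕP.≤-trans (ℕP.≤-reflexive (cong (ℕ._+ nz y) (nz-0 p))) (nz≤1 y)
    go (inj₂ p) = ℕP.≤-trans (ℕP.≤-reflexive (trans (cong (nz x ℕ.+_) (nz-0 p)) (ℕP.+-identityʳ _))) (nz≤1 x)

  #nz-product : ∀ (u v : Carrier → Carrier) → (∀ x → u x * v x ≡ 0#) → #nz u ℕ.+ #nz v ≤ q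
  #nz-product u v e = ℕP.≤-trans (ℕP.≤-reflexive (sym (N.ΣL-∙ E _ _))) (ℕP.≤-trans (ΣN-mono E (λ x → nz-product (e x))) (ℕP.≤-reflexive (trans (ΣNC-const 1) (ℕP.*-identityʳ q))))

  -- A plane curve f = 0 of degree e, monic in y, all of whose vertical sections x ≠ 0 consist of e points.
  -- Let h be the quotient of y^q by f: then f h vanishes for x ≠ 0, and on a line of slope θ through (0, η)
  -- it is (x^(q-1) - 1)(α(θ) x + β(η)) with α(θ) = τ + (1 + ρ) θ and β(η) = κ + ρ η. Hence the tangent at a
  -- point of the curve has direction (x, - ρ y - τ x - κ), both f and h are eigenvectors of the derivation
  -- x ∂/∂x - (ρ y + τ x + κ) ∂/∂y, and comparing the two factorisations on the line x = 0 gives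
  -- (1 + ρ)(ρ y + κ) = 0. In both cases f h vanishes on a family of q lines, each of which lies in f = 0 or h = 0.
  module Curve (e′ g′ : ℕ) (eg : suc (suc e′) ℕ.+ suc (suc g′) ≡ q) (f : Fun F 2) (D-f : D (suc (suc (suc e′))) f)
               (c : ℕ → Fun F 1) (D-c : ∀ i → i < suc (suc (suc e′)) → D (suc (suc (suc e′)) ∸ i) (c i))
               (f≡ : ∀ x y → f (x ∣ y) ≡ ev (suc (suc (suc e′))) (λ i → c i (x ∷ [])) y) (c-top : ∀ x → c (suc (suc e′)) x ≡ 1#)
               (full : ∀ x → x ≢ 0# → List.length (roots-of (λ y → f (x ∣ y))) ≡ suc (suc e′)) where
    e g : ℕ
    e = suc (suc e′)
    g = suc (suc g′)

    ge : g ℕ.+ e ≡ q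
    ge = trans (ℕP.+-comm g e) eg

    module H = Quot (quotient (suc e′) f c D-c f≡ c-top g)
    h : Fun F 2
    h = H.quot

    e<Q : suc e ≤ Q
    e<Q = ℕP.≤-pred (ℕP.≤-trans (ℕP.≤-trans (s≤s (ℕP.≤-trans (ℕP.m≤m+n (suc e) g′) (ℕP.≤-reflexive (sym (ℕP.+-suc e g′))))) (ℕP.≤-reflexive (sym (ℕP.+-suc e (suc g′))))) (ℕP.≤-reflexive eg))

    g<Q : suc g ≤ Q
    g<Q = ℕP.≤-pred (ℕP.≤-trans (ℕP.≤-trans (s≤s (ℕP.≤-trans (ℕP.m≤m+n (suc g) e′) (ℕP.≤-reflexive (sym (ℕP.+-suc g e′))))) (ℕP.≤-reflexive (sym (ℕP.+-suc g (suc e′))))) (ℕP.≤-reflexive ge))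

    fh : Fun F 2
    fh p = f p * h p

    -- At the e roots of f in this column the remainder equals y^q = y. Both sides have degree less
    -- than e, for y because e ≥ 2.
    remainder : ∀ x → x ≢ 0# → ∀ y → ev e (λ i → H.rem i (x ∷ [])) y ≡ y
    remainder x x≢0 y = trans (ev-cong e y (λ i l → -≡0⇒≡ (trans (solve 2 (λ a b → a :- b := a :+ :- con (1 , 0) :* b) refl _ _) (small i l)))) (trans (ev-unit e 1 y (s≤s (s≤s z≤n))) (*-identityʳ y))
      where
      W : Seq
      W i = H.rem i (x ∷ []) + - 1# * unit 1 i
      at-root : ∀ {r} → r ∈ roots-of (λ y → f (x ∣ y)) → ev e W r ≡ 0#
      at-root {r} i = begin
        ev e W r ≡⟨ ev-+ e (λ i → H.rem i (x ∷ [])) (λ i → - 1# * unit 1 i) r ⟩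
        ev e (λ i → H.rem i (x ∷ [])) r + ev e (λ i → - 1# * unit 1 i) r ≡⟨ cong₂ _+_ rem-r (trans (ev-* e (- 1#) (unit 1) r) (cong (- 1# *_) (ev-unit e 1 r (s≤s (s≤s z≤n))))) ⟩
        r + - 1# * (r * 1#) ≡⟨ solve 1 (λ r → r :+ :- con (1 , 0) :* (r :* con (1 , 0)) := con (0 , 0)) refl r ⟩
        0# ∎
        where
        open ≡-Reasoning
        rem-r : ev e (λ i → H.rem i (x ∷ [])) r ≡ r
        rem-r = trans (sym (trans (cong (λ t → t * h (x ∣ r) + ev e (λ i → H.rem i (x ∷ [])) r) (∈-roots (λ y → f (x ∣ y)) i)) (trans (cong (_+ ev e (λ i → H.rem i (x ∷ [])) r) (zeroˡ _)) (+-identityˡ _)))) (trans (sym (H.eq x r)) (trans (cong (pow F r) ge) (pow-q r)))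
      small : ∀ i → i < e → W i ≡ 0#
      small = roots e W (roots-of (λ y → f (x ∣ y))) (unique-roots _) (ℕP.≤-reflexive (sym (full x x≢0))) at-root

    fh≡0 : ∀ x y → x ≢ 0# → fh (x ∣ y) ≡ 0#
    fh≡0 x y x≢0 = trans (solve 2 (λ a y → a := (a :+ y) :- y) refl (fh (x ∣ y)) y) (x-x≡0 (trans (cong (fh (x ∣ y) +_) (sym (remainder x x≢0 y))) (trans (sym (H.eq x y)) (trans (cong (pow F y) ge) (pow-q y)))))

    module JF = Jet (jet D-f)
    module JH = Jet (jet H.D-q)

    f-monic : Monic e f
    f-monic x = (λ i → c i (x ∷ [])) , f≡ x , c-top (x ∷ [])

    h-monic : Monic g h
    h-monic x = proj₁ (H.monic x) , proj₁ (proj₂ (proj₂ (H.monic x))) , proj₂ (proj₂ (proj₂ (H.monic x)))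

    TF : JF.T e₂ ≡ 1#
    TF = top-monic (jet D-f) (ℕP.<⇒≤ e<Q) f-monic

    TH : JH.T e₂ ≡ 1#
    TH = top-monic (jet H.D-q) (ℕP.<⇒≤ g<Q) h-monic

    d : V 2 → Fun F 2
    d w p = f p * JH.d w p + JF.d w p * h p

    extract : ∀ p w → ΣC (λ ξ → inv ξ * fh (p ⊞ ξ · w)) ≡ - (d w p + JF.T w * JH.T w)
    extract p w = go (JF.line p w) (JH.line p w)
      where
      go : LineC e f JF.d JF.T p w → LineC g h JH.d JH.T p w → ΣC (λ ξ → inv ξ * fh (p ⊞ ξ · w)) ≡ - (d w p + JF.T w * JH.T w)
      go (u , su , eu , u0 , u1 , ut) (v , sv , ev′ , v0 , v1 , vt) = trans (ΣL-cong E (λ ξ → cong (inv ξ *_) (cong₂ _*_ (eu ξ) (ev′ ξ))))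
        (trans (Σ-inv-product (suc e′) g u v eg su sv) (cong -_ (cong₂ _+_ (cong₂ _+_ (cong₂ _*_ u0 v1) (cong₂ _*_ u1 v0)) (cong₂ _*_ ut vt))))

    -- The product f h vanishes on the whole column, so the weighted sum in `extract` is 0, while
    -- both top coefficients are 1. The nonzero derivative excludes common zeros of f and h.
    d-vertical : ∀ x y → x ≢ 0# → d e₂ (x ∣ y) ≡ - 1#
    d-vertical x y x≢0 = -≡0⇒≡ (begin
      d e₂ (x ∣ y) - - 1# ≡⟨ solve 1 (λ d → d :- :- con (1 , 0) := :- (:- (d :+ con (1 , 0) :* con (1 , 0)))) refl _ ⟩
      - (- (d e₂ (x ∣ y) + 1# * 1#)) ≡⟨ cong (λ t → - (- (d e₂ (x ∣ y) + t))) (cong₂ _*_ (sym TF) (sym TH)) ⟩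
      - (- (d e₂ (x ∣ y) + JF.T e₂ * JH.T e₂)) ≡⟨ cong -_ (sym (extract (x ∣ y) e₂)) ⟩
      - ΣC (λ ξ → inv ξ * fh ((x ∣ y) ⊞ ξ · e₂)) ≡⟨ cong -_ (trans (ΣL-cong E (λ ξ → trans (cong (inv ξ *_) (trans (cong fh (line-e₂ x y ξ)) (fh≡0 x (y + ξ) x≢0))) (zeroʳ _))) (ΣL-ε E)) ⟩
      - 0# ≡⟨ solve 0 (:- con (0 , 0) := con (0 , 0)) refl ⟩
      0# ∎)
      where open ≡-Reasoning

    not-both : ∀ x y → x ≢ 0# → f (x ∣ y) ≡ 0# → h (x ∣ y) ≢ 0#
    not-both x y x≢0 zf zh = 1≢0 (trans (solve 0 (con (1 , 0) := :- :- con (1 , 0)) refl) (trans (cong -_ (trans (sym (d-vertical x y x≢0)) (cong₂ (λ a b → a * JH.d e₂ (x ∣ y) + JF.d e₂ (x ∣ y) * b) zf zh)))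
      (solve 2 (λ a b → :- (con (0 , 0) :* a :+ b :* con (0 , 0)) := con (0 , 0)) refl _ _)))

    h-full : ∀ x → x ≢ 0# → List.length (roots-of (λ y → h (x ∣ y))) ≡ g
    h-full x x≢0 = ℕP.+-cancelʳ-≡ (#nz (λ y → h (x ∣ y))) _ g (trans (roots+nz (λ y → h (x ∣ y))) (sym (trans (cong (g ℕ.+_) #nzh) ge)))
      where
      one : ∀ y → nz (f (x ∣ y)) ℕ.+ nz (h (x ∣ y)) ≡ 1
      one y = go (product≡0 (fh≡0 x y x≢0))
        where
        go : f (x ∣ y) ≡ 0# ⊎ h (x ∣ y) ≡ 0# → nz (f (x ∣ y)) ℕ.+ nz (h (x ∣ y)) ≡ 1
        go (inj₁ z) = cong₂ ℕ._+_ (nz-0 z) (nz-1 (not-both x y x≢0 z))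
        go (inj₂ z) = cong₂ ℕ._+_ (nz-1 (λ z′ → not-both x y x≢0 z′ z)) (nz-0 z)
      #nzh : #nz (λ y → h (x ∣ y)) ≡ e
      #nzh = ℕP.+-cancelˡ-≡ (#nz (λ y → f (x ∣ y))) _ _ (trans (sym (N.ΣL-∙ E _ _)) (trans (N.ΣL-cong E one) (trans (ΣNC-const 1) (trans (ℕP.*-identityʳ q)
        (trans (sym (roots+nz (λ y → f (x ∣ y)))) (trans (ℕP.+-comm _ (#nz (λ y → f (x ∣ y)))) (cong (#nz (λ y → f (x ∣ y)) ℕ.+_) (full x x≢0))))))))

    α β : Carrier → Carrier
    α θ = JF.T (1# ∣ θ) * JH.T (1# ∣ θ)
    β η = - fh (0# ∣ η)

    d-slope : ∀ θ p → d (1# ∣ θ) p ≡ d e₁ p + θ * d e₂ p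
    d-slope θ p = trans (cong₂ (λ a b → f p * a + b * h p) (trans (cong (λ w → JH.d w p) split) (JH.d-lin e₁ e₂ θ p)) (trans (cong (λ w → JF.d w p) split) (JF.d-lin e₁ e₂ θ p)))
      (solve 7 (λ f a b t c d h → f :* (a :+ t :* b) :+ (c :+ t :* d) :* h := (f :* a :+ c :* h) :+ t :* (f :* b :+ d :* h)) refl (f p) _ _ θ _ _ (h p))
      where
      split : (1# ∣ θ) ≡ e₁ ⊞ θ · e₂
      split = cong₂ _∣_ (solve 1 (λ t → con (1 , 0) := con (1 , 0) :+ t :* con (0 , 0)) refl θ) (solve 1 (λ t → t := con (0 , 0) :+ t :* con (1 , 0)) refl θ)

    -- On the line of slope θ through (x, y) the product f h is nonzero at most where it meets x =
    -- 0. So the weighted sum in `extract` reduces to the term ξ = - x.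
    slope : ∀ x y θ → x ≢ 0# → x * (d e₁ (x ∣ y) - θ + α θ) + β (y - x * θ) ≡ 0#
    slope x y θ x≢0 = begin
      x * (d e₁ p - θ + α θ) + β (y - x * θ)
        ≡⟨ cong (λ t → x * t + β (y - x * θ)) (trans (solve 3 (λ d t a → d :- t :+ a := (d :+ t :* :- con (1 , 0)) :+ a) refl (d e₁ p) θ (α θ)) (cong (_+ α θ) (trans (cong (λ t → d e₁ p + θ * t) (sym (d-vertical x y x≢0))) (sym (d-slope θ p))))) ⟩
      x * (d (1# ∣ θ) p + α θ) + β (y - x * θ) ≡⟨ solve 3 (λ x t b → x :* t :+ b := :- x :* :- t :+ b) refl x _ _ ⟩
      - x * (- (d (1# ∣ θ) p + α θ)) + β (y - x * θ) ≡⟨ cong (λ t → - x * t + β (y - x * θ)) (trans (sym (extract p (1# ∣ θ))) (trans (Σ-at (- x) (λ ξ → inv ξ * fh (p ⊞ ξ · (1# ∣ θ))) off) (cong (λ v → inv (- x) * fh v) at))) ⟩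
      - x * (inv (- x) * fh (0# ∣ y - x * θ)) + β (y - x * θ) ≡⟨ solve 3 (λ m i b → m :* (i :* b) :+ :- b := (m :* i) :* b :- b) refl (- x) (inv (- x)) _ ⟩
      - x * inv (- x) * fh (0# ∣ y - x * θ) - fh (0# ∣ y - x * θ) ≡⟨ cong (λ t → t * fh (0# ∣ y - x * θ) - fh (0# ∣ y - x * θ)) (inv-r -x≢0) ⟩
      1# * fh (0# ∣ y - x * θ) - fh (0# ∣ y - x * θ) ≡⟨ solve 1 (λ b → con (1 , 0) :* b :- b := con (0 , 0)) refl _ ⟩
      0# ∎
      where
      open ≡-Reasoning
      p : V 2
      p = x ∣ y
      -x≢0 : - x ≢ 0#
      -x≢0 e = x≢0 (trans (solve 1 (λ x → x := :- :- x) refl x) (trans (cong -_ e) (solve 0 (:- con (0 , 0) := con (0 , 0)) refl)))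
      at : p ⊞ - x · (1# ∣ θ) ≡ (0# ∣ y - x * θ)
      at = cong₂ _∣_ (solve 1 (λ x → x :+ :- x :* con (1 , 0) := con (0 , 0)) refl x) (solve 3 (λ x y t → y :+ :- x :* t := y :- x :* t) refl x y θ)
      off : ∀ ξ → ξ ≢ - x → inv ξ * fh (p ⊞ ξ · (1# ∣ θ)) ≡ 0#
      off ξ n = trans (cong (inv ξ *_) (fh≡0 (x + ξ * 1#) (y + ξ * θ) (λ e → n (-≡0⇒≡ (trans (solve 2 (λ x t → t :- :- x := x :+ t :* con (1 , 0)) refl x ξ) e))))) (zeroʳ _)

    τ κ ρ : Carrier
    τ = α 0#
    κ = β 0#
    ρ = α 1# - 1# - τ

    -- Comparing the slopes 0 and θ at the point (x, xθ) eliminates the unknown derivative; the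
    -- second line passes through the origin and contributes κ. The choices θ = 1 and x = 1 make β
    -- and α affine.
    β-step : ∀ x θ → x ≢ 0# → β (x * θ) ≡ κ + x * (α θ - θ - τ)
    β-step x θ x≢0 = -≡0⇒≡ (begin
      β (x * θ) - (κ + x * (α θ - θ - τ))
        ≡⟨ solve 7 (λ b k x a t τ d → b :- (k :+ x :* (a :- t :- τ)) := (x :* (d :- con (0 , 0) :+ τ) :+ b) :- (x :* (d :- t :+ a) :+ k)) refl (β (x * θ)) κ x (α θ) θ τ (d e₁ (x ∣ x * θ)) ⟩
      (x * (d e₁ (x ∣ x * θ) - 0# + τ) + β (x * θ)) - (x * (d e₁ (x ∣ x * θ) - θ + α θ) + κ)
        ≡⟨ cong₂ (λ a b → (x * (d e₁ (x ∣ x * θ) - 0# + τ) + β a) - (x * (d e₁ (x ∣ x * θ) - θ + α θ) + β b))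
          (solve 2 (λ x t → x :* t := x :* t :- x :* con (0 , 0)) refl x θ) (solve 2 (λ x t → con (0 , 0) := x :* t :- x :* t) refl x θ) ⟩
      (x * (d e₁ (x ∣ x * θ) - 0# + τ) + β (x * θ - x * 0#)) - (x * (d e₁ (x ∣ x * θ) - θ + α θ) + β (x * θ - x * θ))
        ≡⟨ cong₂ _-_ (slope x (x * θ) 0# x≢0) (slope x (x * θ) θ x≢0) ⟩
      0# - 0# ≡⟨ -‿inverseʳ 0# ⟩
      0# ∎)
      where open ≡-Reasoning

    β-affine : ∀ η → β η ≡ κ + ρ * η
    β-affine η = go (η ≟ 0#)
      where
      go : Dec (η ≡ 0#) → β η ≡ κ + ρ * η
      go (yes refl) = solve 2 (λ k r → k := k :+ r :* con (0 , 0)) refl κ ρ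
      go (no n) = trans (cong β (sym (*-identityʳ η))) (trans (β-step η 1# n) (cong (κ +_) (*-comm η ρ)))

    α-affine : ∀ θ → α θ ≡ τ + (1# + ρ) * θ
    α-affine θ = -≡0⇒≡ (trans (solve 5 (λ a τ r t k → a :- (τ :+ (con (1 , 0) :+ r) :* t) := (k :+ con (1 , 0) :* (a :- t :- τ)) :- (k :+ r :* t)) refl (α θ) τ ρ θ κ)
      (x-x≡0 (trans (sym (β-step 1# θ 1≢0)) (trans (cong β (*-identityˡ θ)) (β-affine θ)))))

    A : V 2 → Carrier
    A p = ρ * head (tail p) + τ * head p + κ

    A-aff : IsAff A
    A-aff = aff-+ (aff-+ (aff-* ρ (aff-∘ aff-head map-tail)) (aff-* τ aff-head)) (aff-const κ)

    x-d : ∀ x y → x ≢ 0# → x * d e₁ (x ∣ y) ≡ - A (x ∣ y)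
    x-d x y x≢0 = -≡0⇒≡ (begin
      x * d e₁ (x ∣ y) - - A (x ∣ y) ≡⟨ solve 6 (λ x d r y t k → x :* d :- :- (r :* y :+ t :* x :+ k) := x :* (d :- con (0 , 0) :+ t) :+ (k :+ r :* y)) refl x (d e₁ (x ∣ y)) ρ y τ κ ⟩
      x * (d e₁ (x ∣ y) - 0# + τ) + (κ + ρ * y) ≡⟨ cong (x * (d e₁ (x ∣ y) - 0# + τ) +_) (trans (sym (β-affine y)) (cong β (solve 2 (λ x y → y := y :- x :* con (0 , 0)) refl x y))) ⟩
      x * (d e₁ (x ∣ y) - 0# + τ) + β (y - x * 0#) ≡⟨ slope x y 0# x≢0 ⟩
      0# ∎)
      where open ≡-Reasoning

    ε : (V 2 → Fun F 2) → Fun F 2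
    ε ∂ p = head p * ∂ e₁ p - A p * ∂ e₂ p

    D-ε : ∀ {n} {∂ : V 2 → Fun F 2} → (∀ w → D n (∂ w)) → D (suc n) (ε ∂)
    D-ε dd = D-sub (D-aff aff-head (dd e₁)) (D-aff A-aff (dd e₂))

    -- At a zero of f the derivative of f h is h times that of f. Along the direction (x, - A) it is
    -- 0 by `x-d` and `d-vertical`, and h is nonzero at this point.
    tangent-f : ∀ x y → x ≢ 0# → f (x ∣ y) ≡ 0# → ε JF.d (x ∣ y) ≡ 0#
    tangent-f x y x≢0 z = *≡0 (not-both x y x≢0 z) (begin
      h p * (x * JF.d e₁ p - A p * JF.d e₂ p) ≡⟨ solve 7 (λ h x a A b u v → h :* (x :* a :- A :* b) := x :* (con (0 , 0) :* u :+ a :* h) :- A :* (con (0 , 0) :* v :+ b :* h)) refl (h p) x (JF.d e₁ p) (A p) (JF.d e₂ p) (JH.d e₁ p) (JH.d e₂ p) ⟩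
      x * (0# * JH.d e₁ p + JF.d e₁ p * h p) - A p * (0# * JH.d e₂ p + JF.d e₂ p * h p) ≡⟨ cong (λ t → x * (t * JH.d e₁ p + JF.d e₁ p * h p) - A p * (t * JH.d e₂ p + JF.d e₂ p * h p)) (sym z) ⟩
      x * d e₁ p - A p * d e₂ p ≡⟨ cong₂ (λ a b → a - A p * b) (x-d x y x≢0) (d-vertical x y x≢0) ⟩
      - A p - A p * - 1# ≡⟨ solve 1 (λ a → :- a :- a :* :- con (1 , 0) := con (0 , 0)) refl (A p) ⟩
      0# ∎)
      where
      open ≡-Reasoning
      p : V 2
      p = x ∣ y

    tangent-h : ∀ x y → x ≢ 0# → h (x ∣ y) ≡ 0# → ε JH.d (x ∣ y) ≡ 0#
    tangent-h x y x≢0 z = *≡0 (λ zf → not-both x y x≢0 zf z) (begin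
      f p * (x * JH.d e₁ p - A p * JH.d e₂ p) ≡⟨ solve 7 (λ h x a A b u v → h :* (x :* a :- A :* b) := x :* (h :* a :+ u :* con (0 , 0)) :- A :* (h :* b :+ v :* con (0 , 0))) refl (f p) x (JH.d e₁ p) (A p) (JH.d e₂ p) (JF.d e₁ p) (JF.d e₂ p) ⟩
      x * (f p * JH.d e₁ p + JF.d e₁ p * 0#) - A p * (f p * JH.d e₂ p + JF.d e₂ p * 0#) ≡⟨ cong (λ t → x * (f p * JH.d e₁ p + JF.d e₁ p * t) - A p * (f p * JH.d e₂ p + JF.d e₂ p * t)) (sym z) ⟩
      x * d e₁ p - A p * d e₂ p ≡⟨ cong₂ (λ a b → a - A p * b) (x-d x y x≢0) (d-vertical x y x≢0) ⟩
      - A p - A p * - 1# ≡⟨ solve 1 (λ a → :- a :- a :* :- con (1 , 0) := con (0 , 0)) refl (A p) ⟩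
      0# ∎)
      where
      open ≡-Reasoning
      p : V 2
      p = x ∣ y

    -- On x = 0 the eigenvalue equation reads (ρ y + κ) u′ = - k u; compare leading coefficients.
    eigenvalue : ∀ n {u : Fun F 2} (J : Jet (suc n) u) → suc n ≤ Q → Jet.T J e₂ ≡ 1# → ∀ k → (∀ x y → ε (Jet.d J) (x ∣ y) ≡ k * u (x ∣ y)) → k ≡ - (ρ * mul (suc n) 1#)
    eigenvalue n {u} J n<Q T1 k eig = go (Jet.line J (0# ∣ 0#) e₂) (Jet.dline J (0# ∣ 0#) e₂)
      where
      go : LineC (suc n) u (Jet.d J) (Jet.T J) (0# ∣ 0#) e₂ → DLineC (suc n) (Jet.d J) (Jet.T J) (0# ∣ 0#) e₂ → k ≡ - (ρ * mul (suc n) 1#)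
      go (c , s , e , _ , _ , t) (c′ , s′ , e′ , t′) = trans (solve 1 (λ k → k := :- (:- k :* con (1 , 0))) refl k) (cong -_ (trans (cong (- k *_) (sym (trans t T1))) (sym coef)))
        where
        at : ∀ ξ → (0# ∣ 0#) ⊞ ξ · e₂ ≡ (0# ∣ ξ)
        at ξ = trans (line-e₂ 0# 0# ξ) (cong (0# ∣_) (+-identityˡ ξ))
        fun : ∀ ξ → ev (suc (suc n)) (linP κ ρ c′) ξ ≡ ev (suc (suc n)) (λ i → - k * c i) ξ
        fun ξ = begin
          ev (suc (suc n)) (linP κ ρ c′) ξ ≡⟨ ev-linP (suc n) κ ρ c′ ξ s′ ⟩
          (κ + ρ * ξ) * ev (suc n) c′ ξ ≡⟨ cong ((κ + ρ * ξ) *_) (trans (sym (e′ ξ)) (cong (Jet.d J e₂) (at ξ))) ⟩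
          (κ + ρ * ξ) * Jet.d J e₂ (0# ∣ ξ) ≡⟨ solve 6 (λ k r x a t u → (k :+ r :* x) :* a := :- (con (0 , 0) :* u :- (r :* x :+ t :* con (0 , 0) :+ k) :* a)) refl κ ρ ξ (Jet.d J e₂ (0# ∣ ξ)) τ (Jet.d J e₁ (0# ∣ ξ)) ⟩
          - ε (Jet.d J) (0# ∣ ξ) ≡⟨ cong -_ (eig 0# ξ) ⟩
          - (k * u (0# ∣ ξ)) ≡⟨ solve 2 (λ k u → :- (k :* u) := :- k :* u) refl k _ ⟩
          - k * u (0# ∣ ξ) ≡⟨ cong (- k *_) (trans (cong u (sym (at ξ))) (e ξ)) ⟩
          - k * ev (suc (suc n)) c ξ ≡⟨ sym (ev-* (suc (suc n)) (- k) c ξ) ⟩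
          ev (suc (suc n)) (λ i → - k * c i) ξ ∎
          where open ≡-Reasoning
        coef : ρ * mul (suc n) 1# ≡ - k * c (suc n)
        coef = trans (sym (trans (cong₂ (λ a b → κ * a + ρ * b) (s′ (suc n) ℕP.≤-refl) (trans t′ (cong (mul (suc n)) T1))) (solve 2 (λ k r → k :* con (0 , 0) :+ r := r) refl κ _)))
          (ev-inj (suc (suc n)) (linP κ ρ c′) (λ i → - k * c i) (s≤s n<Q) fun (suc n) ℕP.≤-refl)

    -- The two eigenvalues add up to - ρ(e + g) = - ρ q = 0, so the derivation kills f h everywhere.
    -- On x = 0 only the term in ∂/∂y remains, where the derivative of f h is - (1 + ρ); thus (ρ y +
    -- κ)(1 + ρ) = 0 for all y.
    degenerate : (1# + ρ) * κ ≡ 0# × (1# + ρ) * ρ ≡ 0#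
    degenerate = trans (solve 2 (λ r k → (con (1 , 0) :+ r) :* k := (k :+ r :* con (0 , 0)) :* (con (1 , 0) :+ r)) refl ρ κ) (key 0#) ,
      trans (solve 2 (λ r k → (con (1 , 0) :+ r) :* r := (k :+ r :* con (1 , 0)) :* (con (1 , 0) :+ r) :- (k :+ r :* con (0 , 0)) :* (con (1 , 0) :+ r)) refl ρ κ) (trans (cong₂ _-_ (key 1#) (key 0#)) (-‿inverseʳ 0#))
      where
      eF : ∃ λ k → ∀ x y → ε JF.d (x ∣ y) ≡ k * f (x ∣ y)
      eF = eigen e e<Q D-f f-monic full (D-ε JF.D-d) tangent-f
      eH : ∃ λ k → ∀ x y → ε JH.d (x ∣ y) ≡ k * h (x ∣ y)
      eH = eigen g g<Q H.D-q h-monic h-full (D-ε JH.D-d) tangent-h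
      kF kH : Carrier
      kF = proj₁ eF
      kH = proj₁ eH
      sum0 : kF + kH ≡ 0#
      sum0 = begin
        kF + kH ≡⟨ cong₂ _+_ (eigenvalue (suc e′) (jet D-f) (ℕP.<⇒≤ e<Q) TF kF (proj₂ eF)) (eigenvalue (suc g′) (jet H.D-q) (ℕP.<⇒≤ g<Q) TH kH (proj₂ eH)) ⟩
        - (ρ * mul e 1#) + - (ρ * mul g 1#) ≡⟨ solve 3 (λ r a b → :- (r :* a) :+ :- (r :* b) := :- (r :* (a :+ b))) refl ρ _ _ ⟩
        - (ρ * (mul e 1# + mul g 1#)) ≡⟨ cong (λ t → - (ρ * t)) (trans (sym (mul-+ˡ e g 1#)) (trans (cong (λ k → mul k 1#) eg) mul-q)) ⟩
        - (ρ * 0#) ≡⟨ solve 1 (λ r → :- (r :* con (0 , 0)) := con (0 , 0)) refl ρ ⟩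
        0# ∎
        where open ≡-Reasoning
      d₀ : ∀ y → d e₂ (0# ∣ y) ≡ - (1# + ρ)
      d₀ y = -≡0⇒≡ (begin
        d e₂ (0# ∣ y) - - (1# + ρ) ≡⟨ solve 2 (λ d r → d :- :- (con (1 , 0) :+ r) := r :- :- (d :+ con (1 , 0) :* con (1 , 0))) refl _ ρ ⟩
        ρ - - (d e₂ (0# ∣ y) + 1# * 1#) ≡⟨ cong (λ t → ρ - - (d e₂ (0# ∣ y) + t)) (cong₂ _*_ (sym TF) (sym TH)) ⟩
        ρ - - (d e₂ (0# ∣ y) + JF.T e₂ * JH.T e₂) ≡⟨ cong (λ t → ρ - t) (sym (extract (0# ∣ y) e₂)) ⟩
        ρ - ΣC (λ ξ → inv ξ * fh ((0# ∣ y) ⊞ ξ · e₂)) ≡⟨ cong (λ t → ρ - t) (trans (ΣL-cong E pt) (trans (ΣL-∙ E _ _) (cong₂ _+_ (trans (ΣL-*ˡ E (- (κ + ρ * y)) inv) (cong (- (κ + ρ * y) *_) Σ-inv)) (trans (ΣL-*ˡ E (- ρ) (λ ξ → inv ξ * ξ)) (cong (- ρ *_) Σ-inv-id))))) ⟩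
        ρ - (- (κ + ρ * y) * 0# + - ρ * - 1#) ≡⟨ solve 3 (λ r k y → r :- (:- (k :+ r :* y) :* con (0 , 0) :+ :- r :* :- con (1 , 0)) := con (0 , 0)) refl ρ κ y ⟩
        0# ∎)
        where
        open ≡-Reasoning
        pt : ∀ ξ → inv ξ * fh ((0# ∣ y) ⊞ ξ · e₂) ≡ - (κ + ρ * y) * inv ξ + - ρ * (inv ξ * ξ)
        pt ξ = trans (cong (λ p → inv ξ * fh p) (line-e₂ 0# y ξ)) (trans (solve 2 (λ i b → i :* b := i :* :- :- b) refl (inv ξ) _) (trans (cong (λ t → inv ξ * - t) (β-affine (y + ξ)))
          (solve 5 (λ i k r y x → i :* :- (k :+ r :* (y :+ x)) := :- (k :+ r :* y) :* i :+ :- r :* (i :* x)) refl (inv ξ) κ ρ y ξ)))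
      key : ∀ y → (κ + ρ * y) * (1# + ρ) ≡ 0#
      key y = begin
        (κ + ρ * y) * (1# + ρ) ≡⟨ solve 2 (λ a b → a :* b := :- (a :* :- b)) refl _ _ ⟩
        - ((κ + ρ * y) * - (1# + ρ)) ≡⟨ cong (λ t → - ((κ + ρ * y) * t)) (sym (d₀ y)) ⟩
        - ((κ + ρ * y) * d e₂ p) ≡⟨ solve 9 (λ k r y f u v h t w → :- ((k :+ r :* y) :* (f :* u :+ v :* h))
              := f :* (con (0 , 0) :* w :- (r :* y :+ t :* con (0 , 0) :+ k) :* u) :+ (con (0 , 0) :* w :- (r :* y :+ t :* con (0 , 0) :+ k) :* v) :* h) refl κ ρ y (f p) (JH.d e₂ p) (JF.d e₂ p) (h p) τ 0# ⟩
        f p * (0# * 0# - A p * JH.d e₂ p) + (0# * 0# - A p * JF.d e₂ p) * h p ≡⟨ cong₂ (λ a b → f p * (a - A p * JH.d e₂ p) + (b - A p * JF.d e₂ p) * h p) (trans (zeroˡ 0#) (sym (zeroˡ _))) (trans (zeroˡ 0#) (sym (zeroˡ _))) ⟩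
        f p * ε JH.d p + ε JF.d p * h p ≡⟨ cong₂ (λ a b → f p * a + b * h p) (proj₂ eH 0# y) (proj₂ eF 0# y) ⟩
        f p * (kH * h p) + kF * f p * h p ≡⟨ solve 4 (λ f a h b → f :* (a :* h) :+ b :* f :* h := (b :+ a) :* (f :* h)) refl (f p) kH (h p) kF ⟩
        (kF + kH) * (f p * h p) ≡⟨ cong (_* (f p * h p)) sum0 ⟩
        0# * (f p * h p) ≡⟨ zeroˡ _ ⟩
        0# ∎
        where
        open ≡-Reasoning
        p : V 2
        p = 0# ∣ y

    on : Fun F 2 → Carrier → Carrier → Carrier → Carrier
    on u η θ x = u (x ∣ η + θ * x)

    on≡ : ∀ (u : Fun F 2) η θ x → u ((0# ∣ η) ⊞ x · (1# ∣ θ)) ≡ on u η θ x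
    on≡ u η θ x = cong u (cong₂ _∣_ (solve 1 (λ x → con (0 , 0) :+ x :* con (1 , 0) := x) refl x) (cong (η +_) (*-comm x θ)))

    D-on : ∀ {n} {u : Fun F 2} → D n u → ∀ η θ → D {1} n (λ v → on u η θ (head v))
    D-on {u = u} du η θ = D-cong (D-line du (0# ∣ η) (1# ∣ θ)) (λ v → sym (on≡ u η θ (head v)))

    D-on-top : ∀ {n} {u : Fun F 2} (J : Jet n u) η θ → Jet.T J (1# ∣ θ) ≡ 0# → D {1} n (λ v → on u η θ (head v))
    D-on-top {n} {u} J η θ T0 = go (Jet.line J (0# ∣ η) (1# ∣ θ))
      where
      go : LineC n u (Jet.d J) (Jet.T J) (0# ∣ η) (1# ∣ θ) → D {1} n (λ v → on u η θ (head v))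
      go (c , s , e , _ , _ , t) = D-cong (D-poly n c) (λ v → trans (sym (on≡ u η θ (head v))) (trans (e (head v)) (trans (ev-last n c (head v))
        (trans (cong (λ w → ev n c (head v) + w * pow F (head v) n) (trans t T0)) (solve 2 (λ a p → a :+ con (0 , 0) :* p := a) refl _ _)))))

    on-zero : ∀ {n} {u : Fun F 2} (J : Jet n u) → n ≤ Q → ∀ η θ → (∀ x → on u η θ x ≡ 0#) → Jet.T J (1# ∣ θ) ≡ 0#
    on-zero {n} {u} J n≤Q η θ z = go (Jet.line J (0# ∣ η) (1# ∣ θ))
      where
      go : LineC n u (Jet.d J) (Jet.T J) (0# ∣ η) (1# ∣ θ) → Jet.T J (1# ∣ θ) ≡ 0#
      go (c , s , e , _ , _ , t) = trans (sym t) (ev≡0⇒≡0 (suc n) c (s≤s n≤Q) (λ x → trans (sym (e x)) (trans (on≡ u η θ x) (z x))) n ℕP.≤-refl)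

    fh-on : ∀ η θ → fh (0# ∣ η) ≡ 0# → ∀ x → on f η θ x * on h η θ x ≡ 0#
    fh-on η θ z x = go (x ≟ 0#)
      where
      go : Dec (x ≡ 0#) → fh (x ∣ η + θ * x) ≡ 0#
      go (yes refl) = trans (cong (λ y → fh (0# ∣ y)) (solve 2 (λ a t → a :+ t :* con (0 , 0) := a) refl η θ)) z
      go (no n) = fh≡0 x _ n

    nonzero? : ∀ (u : Carrier → Carrier) → (∃ λ x → u x ≢ 0#) ⊎ (∀ x → u x ≡ 0#)
    nonzero? u = go (∃C? (λ x → ¬? (u x ≟ 0#)))
      where
      go : (∃ λ x → u x ≢ 0#) ⊎ (∀ x → ¬ (u x ≢ 0#)) → (∃ λ x → u x ≢ 0#) ⊎ (∀ x → u x ≡ 0#)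
      go (inj₁ r) = inj₁ r
      go (inj₂ n) = inj₂ λ x → dec x (u x ≟ 0#)
        where
        dec : ∀ x → Dec (u x ≡ 0#) → u x ≡ 0#
        dec x (yes z) = z
        dec x (no z) = ⊥-elim (n x z)

    q∸g : q ∸ g ≡ e
    q∸g = ∸≡ {b = g} (sym ge)
    q∸e : q ∸ e ≡ g
    q∸e = ∸≡ {b = e} (sym eg)

    -- If neither vanished on the line, f and h would have at least q - e and q - g nonzero values
    -- there, together q. As α θ = 0, one of the two degrees drops on this line, giving more than q
    -- nonzero values, whereas f h vanishes on all its q points.
    one-is-zero : ∀ η θ → fh (0# ∣ η) ≡ 0# → α θ ≡ 0# → (∀ x → on f η θ x ≡ 0#) ⊎ (∀ x → on h η θ x ≡ 0#)
    one-is-zero η θ z αz = go (nonzero? (on f η θ)) (nonzero? (on h η θ))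
      where
      sum≤q : #nz (on f η θ) ℕ.+ #nz (on h η θ) ≤ q
      sum≤q = #nz-product (on f η θ) (on h η θ) (fh-on η θ z)
      absurd : q < #nz (on f η θ) ℕ.+ #nz (on h η θ) → (∀ x → on f η θ x ≡ 0#) ⊎ (∀ x → on h η θ x ≡ 0#)
      absurd l = contradiction sum≤q (ℕP.<⇒≱ l)
      go : (∃ λ x → on f η θ x ≢ 0#) ⊎ (∀ x → on f η θ x ≡ 0#) → (∃ λ x → on h η θ x ≢ 0#) ⊎ (∀ x → on h η θ x ≡ 0#) → (∀ x → on f η θ x ≡ 0#) ⊎ (∀ x → on h η θ x ≡ 0#)
      go (inj₂ zf) _ = inj₁ zf
      go (inj₁ _) (inj₂ zh) = inj₂ zh
      go (inj₁ (x , nx)) (inj₁ (y , ny)) = tops (product≡0 αz)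
        where
        tops : JF.T (1# ∣ θ) ≡ 0# ⊎ JH.T (1# ∣ θ) ≡ 0# → (∀ x → on f η θ x ≡ 0#) ⊎ (∀ x → on h η θ x ≡ 0#)
        tops (inj₁ t) = absurd (ℕP.≤-trans (ℕP.≤-reflexive (cong suc (sym ge)))
          (ℕP.+-mono-≤ (ℕP.≤-trans (ℕP.≤-reflexive (sym (∸≡ {b = suc e′} (trans (sym eg) (sym (ℕP.+-suc (suc e′) g)))))) (#nz-poly (suc e′) (on f η θ) (ℕP.≤-trans (ℕP.n≤1+n (suc e′)) (ℕP.<⇒≤ e<Q)) (D-on-top (jet D-f) η θ t) x nx))
            (ℕP.≤-trans (ℕP.≤-reflexive (sym q∸g)) (#nz-poly g (on h η θ) (ℕP.<⇒≤ g<Q) (D-on H.D-q η θ) y ny))))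
        tops (inj₂ t) = absurd (ℕP.≤-trans (ℕP.≤-reflexive (trans (cong suc (sym ge)) (sym (ℕP.+-suc g e))))
          (ℕP.+-mono-≤ (ℕP.≤-trans (ℕP.≤-reflexive (sym q∸e)) (#nz-poly e (on f η θ) (ℕP.<⇒≤ e<Q) (D-on D-f η θ) x nx))
            (ℕP.≤-trans (ℕP.≤-reflexive (sym (∸≡ {b = suc g′} (trans (sym ge) (sym (ℕP.+-suc (suc g′) e)))))) (#nz-poly (suc g′) (on h η θ) (ℕP.≤-trans (ℕP.n≤1+n (suc g′)) (ℕP.<⇒≤ g<Q)) (D-on-top (jet H.D-q) η θ t) y ny))))

    -- If α is a nonzero constant, f has exactly e zeros on each of the q lines through (0, κ), which is
    -- incompatible with having e zeros in each column x ≠ 0.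
    τ≡0 : 1# + ρ ≡ 0# → fh (0# ∣ κ) ≡ 0# → τ ≡ 0#
    τ≡0 ρ-1 z = go (τ ≟ 0#)
      where
      α-const : ∀ θ → α θ ≡ τ
      α-const θ = trans (α-affine θ) (trans (cong (λ r → τ + r * θ) ρ-1) (solve 2 (λ t x → t :+ con (0 , 0) :* x := t) refl τ θ))
      go : Dec (τ ≡ 0#) → τ ≡ 0#
      go (yes t) = t
      go (no t≢0) = ⊥-elim (count (nz (f (0# ∣ κ))) (nz≤1 _) g≡)
        where
        exact : ∀ θ → #nz (on f κ θ) ≡ g
        exact θ = ℕP.≤-antisym (ℕP.+-cancelʳ-≤ e _ _ (ℕP.≤-trans (ℕP.+-monoʳ-≤ (#nz (on f κ θ)) h≥) (ℕP.≤-trans (#nz-product (on f κ θ) (on h κ θ) (fh-on κ θ z)) (ℕP.≤-reflexive (sym ge))))) f≥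
          where
          α≢0 : α θ ≢ 0#
          α≢0 e = t≢0 (trans (sym (α-const θ)) e)
          f≥ : g ≤ #nz (on f κ θ)
          f≥ = some (nonzero? (on f κ θ))
            where
            some : (∃ λ x → on f κ θ x ≢ 0#) ⊎ (∀ x → on f κ θ x ≡ 0#) → g ≤ #nz (on f κ θ)
            some (inj₁ (x , n)) = ℕP.≤-trans (ℕP.≤-reflexive (sym q∸e)) (#nz-poly e (on f κ θ) (ℕP.<⇒≤ e<Q) (D-on D-f κ θ) x n)
            some (inj₂ zz) = contradiction (trans (cong (_* JH.T (1# ∣ θ)) (on-zero (jet D-f) (ℕP.<⇒≤ e<Q) κ θ zz)) (zeroˡ _)) α≢0
          h≥ : e ≤ #nz (on h κ θ)
          h≥ = some (nonzero? (on h κ θ))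
            where
            some : (∃ λ x → on h κ θ x ≢ 0#) ⊎ (∀ x → on h κ θ x ≡ 0#) → e ≤ #nz (on h κ θ)
            some (inj₁ (x , n)) = ℕP.≤-trans (ℕP.≤-reflexive (sym q∸g)) (#nz-poly g (on h κ θ) (ℕP.<⇒≤ g<Q) (D-on H.D-q κ θ) x n)
            some (inj₂ zz) = contradiction (trans (cong (JF.T (1# ∣ θ) *_) (on-zero (jet H.D-q) (ℕP.<⇒≤ g<Q) κ θ zz)) (zeroʳ _)) α≢0
        column : ∀ x → N.ΣC (λ θ → nz (on f κ θ x)) ℕ.+ pick (x ≟ 0#) g 0 ≡ g ℕ.+ pick (x ≟ 0#) (q ℕ.* nz (f (0# ∣ κ))) 0
        column x = by (x ≟ 0#)
          where
          by : (dd : Dec (x ≡ 0#)) → N.ΣC (λ θ → nz (on f κ θ x)) ℕ.+ pick dd g 0 ≡ g ℕ.+ pick dd (q ℕ.* nz (f (0# ∣ κ))) 0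
          by (yes refl) = trans (ℕP.+-comm _ g) (cong (g ℕ.+_) (trans (N.ΣL-cong E (λ θ → cong (λ y → nz (f (0# ∣ y))) (solve 2 (λ a t → a :+ t :* con (0 , 0) := a) refl κ θ))) (ΣNC-const _)))
          by (no n) = cong (ℕ._+ 0) (trans (N.reindexC (λ θ → κ + θ * x) (λ y → (y - κ) * inv x) l r (λ y → nz (f (x ∣ y)))) (ℕP.+-cancelˡ-≡ e _ g (trans (trans (cong (ℕ._+ #nz (λ y → f (x ∣ y))) (sym (full x n))) (roots+nz (λ y → f (x ∣ y)))) (sym eg))))
            where
            l : ∀ θ → (κ + θ * x - κ) * inv x ≡ θ
            l θ = trans (solve 4 (λ k t x i → (k :+ t :* x :- k) :* i := t :* (x :* i)) refl κ θ x (inv x)) (trans (cong (θ *_) (inv-r n)) (*-identityʳ θ))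
            r : ∀ y → κ + (y - κ) * inv x * x ≡ y
            r y = trans (solve 4 (λ k y x i → k :+ (y :- k) :* i :* x := k :+ (y :- k) :* (x :* i)) refl κ y x (inv x)) (trans (cong (λ t → κ + (y - κ) * t) (inv-r n)) (solve 2 (λ k y → k :+ (y :- k) :* con (1 , 0) := y) refl κ y))
        g≡ : g ≡ q ℕ.* nz (f (0# ∣ κ))
        -- The nonzero values of f on the q lines through (0, κ) are counted by lines and by
        -- columns. A fictitious g at x = 0 gives all columns the same share, leaving q times the
        -- indicator of f ≠ 0 at (0, κ).
        g≡ = ℕP.+-cancelˡ-≡ (q ℕ.* g) _ _ (begin
          q ℕ.* g ℕ.+ g ≡⟨ cong₂ ℕ._+_ (sym (trans (N.ΣL-cong E exact) (ΣNC-const g))) (sym (N.δC 0# (λ _ → g))) ⟩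
          N.ΣC (λ θ → #nz (on f κ θ)) ℕ.+ N.ΣC (λ x → pick (x ≟ 0#) g 0) ≡⟨ cong (ℕ._+ N.ΣC (λ x → pick (x ≟ 0#) g 0)) (N.ΣL-swap E E (λ θ x → nz (on f κ θ x))) ⟩
          N.ΣC (λ x → N.ΣC (λ θ → nz (on f κ θ x))) ℕ.+ N.ΣC (λ x → pick (x ≟ 0#) g 0) ≡⟨ sym (N.ΣL-∙ E _ _) ⟩
          N.ΣC (λ x → N.ΣC (λ θ → nz (on f κ θ x)) ℕ.+ pick (x ≟ 0#) g 0) ≡⟨ N.ΣL-cong E column ⟩
          N.ΣC (λ x → g ℕ.+ pick (x ≟ 0#) (q ℕ.* nz (f (0# ∣ κ))) 0) ≡⟨ N.ΣL-∙ E (λ _ → g) _ ⟩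
          N.ΣC (λ _ → g) ℕ.+ N.ΣC (λ x → pick (x ≟ 0#) (q ℕ.* nz (f (0# ∣ κ))) 0) ≡⟨ cong₂ ℕ._+_ (ΣNC-const g) (N.δC 0# (λ _ → q ℕ.* nz (f (0# ∣ κ)))) ⟩
          q ℕ.* g ℕ.+ q ℕ.* nz (f (0# ∣ κ)) ∎)
          where open ≡-Reasoning
        count : ∀ n → n ≤ 1 → g ≡ q ℕ.* n → ⊥
        count zero _ e = contradiction (trans e (ℕP.*-zeroʳ q)) λ ()
        count (suc zero) _ e = ℕP.<⇒≢ (ℕP.≤-trans g<Q (ℕP.n≤1+n Q)) (trans e (ℕP.*-identityʳ q))
        count (suc (suc n)) (s≤s ()) _

    Parallel-lines Concurrent-lines : Set
    Parallel-lines = ∃ λ τ → ∃ λ L → Unique L × List.length L ≡ e × (∀ {r} → r ∈ L → ∀ x → f (x ∣ r + τ * x) ≡ 0#)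
    Concurrent-lines = ∃ λ κ → ∃ λ L → Unique L × List.length L ≡ e × (∀ {θ} → θ ∈ L → ∀ x → f (x ∣ κ + θ * x) ≡ 0#)

    length-roots : ∀ (u : Carrier → Carrier) → #nz u ≡ #nz (λ y → f (1# ∣ y)) → List.length (roots-of u) ≡ e
    length-roots u eq = trans (ℕP.+-cancelʳ-≡ (#nz u) _ _ (trans (roots+nz u) (trans (sym (roots+nz (λ y → f (1# ∣ y)))) (cong (List.length (roots-of (λ y → f (1# ∣ y))) ℕ.+_) (sym eq))))) (full 1# 1≢0)

    f-line : ∀ η θ → (∀ x → on f η θ x ≡ 0#) ⊎ (∀ x → on h η θ x ≡ 0#) → on f η θ 1# ≡ 0# → ∀ x → on f η θ x ≡ 0#
    f-line η θ (inj₁ z) _ = z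
    f-line η θ (inj₂ zh) z1 = contradiction (zh 1#) (not-both 1# _ 1≢0 z1)

    -- If 1 + ρ ≠ 0, then ρ = κ = 0, so β is identically 0 and α vanishes at - τ: the lines of slope
    -- - τ qualify. If ρ = - 1, then β vanishes at κ and α is identically 0: the lines through (0,
    -- κ) qualify. The column x = 1 selects those on which f vanishes.
    lines : Parallel-lines ⊎ Concurrent-lines
    lines = go ((1# + ρ) ≟ 0#)
      where
      fh-β : ∀ η → κ + ρ * η ≡ 0# → fh (0# ∣ η) ≡ 0#
      fh-β η z = trans (solve 1 (λ b → b := :- :- b) refl _) (trans (cong -_ (trans (β-affine η) z)) (solve 0 (:- con (0 , 0) := con (0 , 0)) refl))
      go : Dec (1# + ρ ≡ 0#) → Parallel-lines ⊎ Concurrent-lines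
      go (no n) = inj₁ (- τ , roots-of (λ η → on f η (- τ) 1#) , unique-roots _ , length-roots _ (mul₂ (λ y → f (1# ∣ y)) (- τ * 1#)) ,
        λ {η} i → f-line η (- τ) (one-is-zero η (- τ) (fh-β η (trans (cong₂ (λ k r → k + r * η) κ0 ρ0) (solve 1 (λ x → con (0 , 0) :+ con (0 , 0) :* x := con (0 , 0)) refl η)))
          (trans (α-affine (- τ)) (trans (cong (λ r → τ + (1# + r) * - τ) ρ0) (solve 1 (λ t → t :+ (con (1 , 0) :+ con (0 , 0)) :* :- t := con (0 , 0)) refl τ)))) (∈-roots (λ η → on f η (- τ) 1#) i))
        where
        κ0 : κ ≡ 0#
        κ0 = *≡0 n (proj₁ degenerate)
        ρ0 : ρ ≡ 0#
        ρ0 = *≡0 n (proj₂ degenerate)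
      go (yes ρ-1) = inj₂ (κ , roots-of (λ θ → on f κ θ 1#) , unique-roots _ , length-roots _ (trans (N.reindexC (λ θ → κ + θ * 1#) (λ y → y - κ) (λ θ → solve 2 (λ k t → k :+ t :* con (1 , 0) :- k := t) refl κ θ)
          (λ y → solve 2 (λ k y → k :+ (y :- k) :* con (1 , 0) := y) refl κ y) (λ y → nz (f (1# ∣ y)))) refl) ,
        λ {θ} i → f-line κ θ (one-is-zero κ θ z (trans (α-affine θ) (trans (cong₂ (λ t r → t + r * θ) (τ≡0 ρ-1 z) ρ-1) (solve 1 (λ x → con (0 , 0) :+ con (0 , 0) :* x := con (0 , 0)) refl θ)))) (∈-roots (λ θ → on f κ θ 1#) i))
        where
        z : fh (0# ∣ κ) ≡ 0#
        z = fh-β κ (trans (solve 2 (λ k r → k :+ r :* k := (con (1 , 0) :+ r) :* k) refl κ ρ) (proj₁ degenerate))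

  -- Second weight functions of the plane

  slices-upper : ∀ {m} (f : Fun F (suc m)) w → (∀ x → wt (slice f x) ≤ w) → wt f ≤ (q ∸ #zeros f) ℕ.* w
  slices-upper f w ub = fromCount (go E)
    where
    go : ∀ xs → ∃ λ c → List.length xs ≡ List.length (List.filter (λ x → Zero? (slice f x)) xs) ℕ.+ c × N.ΣL xs (λ x → wt (slice f x)) ≤ c ℕ.* w
    go [] = 0 , refl , z≤n
    go (x ∷ xs) = step (go xs)
      where
      step : (∃ λ c → List.length xs ≡ List.length (List.filter (λ x → Zero? (slice f x)) xs) ℕ.+ c × N.ΣL xs (λ x → wt (slice f x)) ≤ c ℕ.* w) →
             ∃ λ c → List.length (x ∷ xs) ≡ List.length (List.filter (λ x → Zero? (slice f x)) (x ∷ xs)) ℕ.+ c × N.ΣL (x ∷ xs) (λ x → wt (slice f x)) ≤ c ℕ.* w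
      step (c , e , l) with Zero? (slice f x)
      ... | yes z = c , cong suc e , ℕP.≤-trans (ℕP.≤-reflexive (cong (ℕ._+ N.ΣL xs (λ x → wt (slice f x))) (wt-≡0 z))) l
      ... | no _ = suc c , trans (cong suc e) (sym (ℕP.+-suc _ c)) , ℕP.+-mono-≤ (ub x) l
    fromCount : (∃ λ c → List.length E ≡ #zeros f ℕ.+ c × N.ΣC (λ x → wt (slice f x)) ≤ c ℕ.* w) → wt f ≤ (q ∸ #zeros f) ℕ.* w
    fromCount (c , e , l) = ℕP.≤-trans (ℕP.≤-reflexive (wt-suc f)) (ℕP.≤-trans l (ℕP.≤-reflexive (cong (ℕ._* w) (sym (∸≡ {b = #zeros f} (trans (sym length-E) e))))))

  wt-1 : (f : Fun F 1) → wt f ≡ #nz (λ y → f (y ∷ []))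
  wt-1 f = N.ΣV-1 (λ v → nz (f v))

  data Normal (s : ℕ) (f : Fun F 2) : Set where
    parallel   : ∀ c L → c ≢ 0# → Unique L → suc (List.length L) ≡ s → (∀ x y → f (x ∣ y) ≡ c * (ΠB L x * y)) → Normal s f
    concurrent : ∀ c L → c ≢ 0# → Unique L → suc (List.length L) ≡ s → (∀ x y → f (x ∣ y) ≡ c * (x * Π.ΣL L (λ θ → y - θ * x))) → Normal s f

  Normal-form : ℕ → Fun F 2 → Set
  Normal-form s f = Σ (Iso 2) λ φ → Normal s (f ∘f φ)

  Normal-iso : ∀ {s} f (φ : Iso 2) → Normal-form s (f ∘f φ) → Normal-form s f
  Normal-iso f φ (ψ , parallel c L c≢0 u l e) = φ ∘I ψ , parallel c L c≢0 u l e
  Normal-iso f φ (ψ , concurrent c L c≢0 u l e) = φ ∘I ψ , concurrent c L c≢0 u l e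

  -- The cofactor is affine with a nonzero coefficient b of y; the shear y ↦ y - g(x, 0)/b reduces
  -- it to b y.
  normal-affine : ∀ {s} {f g : Fun F 2} L → Unique L → suc (List.length L) ≡ s → D 2 g → (∀ x z → f (x ∷ z) ≡ ΠB L x * g (x ∷ z)) →
                  (∃ λ x → ∃ λ y → g (x ∣ y) ≢ g (x ∣ 0#)) → Normal-form s f
  normal-affine {s} {f} {g} L u l dg fg (x₀ , y₀ , n) = swapI ∘I (shearI A ∘I swapI) , parallel b L b≢0 u l eq
    where
    G : IsAff (g ∘f swapI)
    G = aff-∘ (D-2 dg) (Iso.to swapI)
    b : Carrier
    b = IsAff.lin G (1# ∷ 0V)
    split : ∀ x y → g (x ∣ y) ≡ g (x ∣ 0#) + b * y
    split x y = aff-split G y (x ∷ [])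
    b≢0 : b ≢ 0#
    b≢0 e = n (trans (split x₀ y₀) (trans (cong (λ t → g (x₀ ∣ 0#) + t * y₀) e) (solve 2 (λ a y → a :+ con (0 , 0) :* y := a) refl _ y₀)))
    A : IsAff {1} (λ v → - inv b * g (head v ∣ 0#))
    A = aff-* (- inv b) (aff-∘ (D-2 dg) (map-∷ aff-head (map-∷ (aff-const 0#) map-[])))
    eq : ∀ x y → f (x ∣ y + - inv b * g (x ∣ 0#)) ≡ b * (ΠB L x * y)
    eq x y = trans (fg x _) (trans (cong (ΠB L x *_) (trans (split x _) (trans (solve 4 (λ g b y i → g :+ b :* (y :+ :- i :* g) := g :+ (b :* y :- (b :* i) :* g)) refl (g (x ∣ 0#)) b y (inv b))
      (trans (cong (λ t → g (x ∣ 0#) + (b * y - t * g (x ∣ 0#))) (inv-r b≢0)) (solve 3 (λ g b y → g :+ (b :* y :- con (1 , 0) :* g) := b :* y) refl (g (x ∣ 0#)) b y)))))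
      (solve 3 (λ p b y → p :* (b :* y) := b :* (p :* y)) refl (ΠB L x) b y))

  pencil-distinct : ∀ {m θ θ′} → θ ≢ θ′ → Distinct {suc m} (pencilI θ 0#) (pencilI θ′ 0#)
  pencil-distinct {m} {θ} {θ′} n = (1# ∷ 0V) , λ e → n (-≡0⇒≡ (trans (solve 2 (λ t t′ → t :- t′ := :- ((con (0 , 0) :+ (t′ :* con (1 , 0) :+ con (0 , 0))) :+ :- con (1 , 0) :* (t :* con (1 , 0) :+ con (0 , 0)))) refl θ θ′) (trans (cong -_ e) (solve 0 (:- con (0 , 0) := con (0 , 0)) refl))))

  length-1 : ∀ {A : Set} {x : A} (xs : List A) → x ∈ xs → List.length xs ≡ 1 → xs ≡ x ∷ []
  length-1 (_ ∷ []) (here refl) _ = refl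
  length-1 (_ ∷ []) (there ()) _

  -- The case of a single zero slice. The coefficient of y^e in g is constant by total degree, and
  -- nonzero since otherwise the column x = 1 would contain more than q - e nonzero values. Division
  -- by it gives the monic curve required by `Curve`.
  module Columns (e′ g′ : ℕ) (eg : suc (suc e′) ℕ.+ suc (suc g′) ≡ q) {f g : Fun F 2} (f≢0 : ¬ Zero f) (dg : D (suc (suc (suc e′))) g)
                 (fg : ∀ x y → f (x ∣ y) ≡ x * g (x ∣ y)) (#g : ∀ x → x ≢ 0# → #nz (λ y → g (x ∣ y)) ≡ suc (suc g′)) where
    private
      e : ℕ
      e = suc (suc e′)
      e≤Q : e ≤ Q
      e≤Q = ℕP.≤-pred (ℕP.≤-trans (ℕP.≤-trans (ℕP.m≤m+n (suc e) (suc g′)) (ℕP.≤-reflexive (sym (ℕP.+-suc e (suc g′))))) (ℕP.≤-reflexive eg))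
      expansion : ∃ λ c → (∀ i → i < suc e → D {1} (suc e ∸ i) (c i)) × (∀ x y → g (x ∣ y) ≡ ev (suc e) (λ i → c i (x ∷ [])) y)
      expansion = expand-y e (s≤s e≤Q) dg
      c : ℕ → Fun F 1
      c = proj₁ expansion
      top : ∃ λ t → ∀ p → c e p ≡ t
      top = D-1 (D-cast (trans (ℕP.+-∸-assoc 1 (ℕP.≤-refl {e})) (cong suc (ℕP.n∸n≡0 e))) (proj₁ (proj₂ expansion) e ℕP.≤-refl))
      a : Carrier
      a = proj₁ top
      a≢0 : a ≢ 0#
      a≢0 z = contradiction (ℕP.≤-trans (ℕP.≤-reflexive (sym (∸≡ {b = suc e′} (trans (sym eg) (sym (ℕP.+-suc (suc e′) (suc (suc g′)))))))) (ℕP.≤-trans low (ℕP.≤-reflexive (#g 1# 1≢0)))) (ℕP.<-irrefl refl)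
        where
        u : Carrier → Carrier
        u y = g (1# ∣ y)
        du : D {1} (suc (suc e′)) (λ v → u (head v))
        du = D-cong (D-poly e (λ i → c i (1# ∷ []))) (λ v → trans (proj₂ (proj₂ expansion) 1# (head v)) (trans (ev-last e (λ i → c i (1# ∷ [])) (head v))
          (trans (cong (λ w → ev e (λ i → c i (1# ∷ [])) (head v) + w * pow F (head v) e) (trans (proj₂ top (1# ∷ [])) z)) (solve 2 (λ a p → a :+ con (0 , 0) :* p := a) refl _ _))))
        some : (∃ λ y → u y ≢ 0#) ⊎ (∀ y → ¬ (u y ≢ 0#)) → q ∸ suc e′ ≤ #nz u
        some (inj₁ (y , n)) = #nz-poly (suc e′) u (ℕP.≤-trans (ℕP.n≤1+n (suc e′)) e≤Q) du y n
        some (inj₂ n) = contradiction (trans (sym (trans (N.ΣL-cong E (λ y → zero′ y (u y ≟ 0#))) (N.ΣL-ε E))) (#g 1# 1≢0)) λ ()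
          where
          zero′ : ∀ y → Dec (u y ≡ 0#) → nz (u y) ≡ 0
          zero′ y (yes z) = nz-0 z
          zero′ y (no z) = ⊥-elim (n y z)
        low : q ∸ suc e′ ≤ #nz u
        low = some (∃C? (λ y → ¬? (u y ≟ 0#)))
      g₁ : Fun F 2
      g₁ p = inv a * g p
      g₁-full : ∀ x → x ≢ 0# → List.length (roots-of (λ y → g₁ (x ∣ y))) ≡ e
      g₁-full x x≢0 = ℕP.+-cancelʳ-≡ (#nz (λ y → g₁ (x ∣ y))) _ e (trans (roots+nz (λ y → g₁ (x ∣ y))) (trans (sym eg) (cong (e ℕ.+_) (trans (sym (#g x x≢0)) (N.ΣL-cong E (λ y → nz-cong (λ z → trans (cong (inv a *_) z) (zeroʳ _)) (*≡0 (inv≢0 a≢0))))))))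
      module C = Curve e′ g′ eg g₁ (D-scale (inv a) dg) (λ i v → inv a * c i v) (λ i l → D-scale (inv a) (proj₁ (proj₂ expansion) i l))
        (λ x y → trans (cong (inv a *_) (proj₂ (proj₂ expansion) x y)) (sym (ev-* (suc e) (inv a) (λ i → c i (x ∷ [])) y))) (λ x → trans (cong (inv a *_) (proj₂ top x)) (inv-l a≢0)) g₁-full

      constant : ∀ {h : Fun F 2} → D (suc e ∸ e) h → ∃ λ k → ∀ p → h p ≡ k
      constant d = D-1 (D-cast (trans (ℕP.+-∸-assoc 1 (ℕP.≤-refl {e})) (cong suc (ℕP.n∸n≡0 e))) d)

    normal : Normal-form (suc e) f
    normal = go C.lines
      where
      nonzero : ∀ k (φ : Iso 2) (u : V 2 → Carrier) → (∀ p → f (φ $ p) ≡ k * u p) → k ≢ 0#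
      nonzero k φ u eq z = ¬Zero-iso f≢0 φ (λ p → trans (eq p) (trans (cong (_* u p) z) (zeroˡ _)))
      go : C.Parallel-lines ⊎ C.Concurrent-lines → Normal-form (suc e) f
      go (inj₁ (τ , L , u , l , on)) = φ , parallel k L (nonzero k φ (λ p → ΠB L (head p) * head (tail p)) (λ { (x ∷ y ∷ []) → eq x y })) u (cong suc l) eq
        where
        φ : Iso 2
        φ = pencilI τ 0#
        G : Fun F 2
        G = g ∘f φ
        dG : D (suc e) G
        dG = D-iso dg φ
        zeroS : ∀ {r} → r ∈ L → ∀ z → G (r ∷ z) ≡ 0#
        zeroS {r} i (x ∷ []) = *≡0 (inv≢0 a≢0) (trans (cong (λ t → g₁ (x ∣ t)) (solve 3 (λ r t x → r :+ (t :* x :+ con (0 , 0)) := r :+ t :* x) refl r τ x)) (on i x))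
        divided : ∃ λ h → D (suc e ∸ List.length L) h × (∀ x z → G (x ∷ z) ≡ ΠB L x * h (x ∷ z))
        divided = div-slices {f = G} L u dG zeroS
        h : Fun F 2
        h = proj₁ divided
        cst : ∃ λ k → ∀ p → h p ≡ k
        cst = constant (D-cast (cong (suc e ∸_) l) (proj₁ (proj₂ divided)))
        k : Carrier
        k = proj₁ cst
        eq : ∀ x y → f (φ $ (x ∣ y)) ≡ k * (ΠB L x * y)
        eq x y = trans (fg y _) (trans (cong (y *_) (trans (proj₂ (proj₂ divided) x (y ∷ [])) (cong (ΠB L x *_) (proj₂ cst _)))) (solve 3 (λ y p k → y :* (p :* k) := k :* (p :* y)) refl y _ k))
      go (inj₂ (κ , L , u , l , on)) = φ , concurrent k L (nonzero k φ (λ p → head p * Π.ΣL L (λ θ → head (tail p) - θ * head p)) (λ { (x ∷ y ∷ []) → eq x y })) u (cong suc l) eq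
        where
        φ : Iso 2
        φ = liftI (shearI (aff-const κ))
        G : Fun F 2
        G = g ∘f φ
        dG : D (suc e) G
        dG = D-iso dg φ
        line : Carrier → Iso 2
        line θ = pencilI θ 0#
        Hs : List (Iso 2)
        Hs = List.map line L
        pairs : ∀ {L} → Unique L → AllPairs Distinct (List.map line L)
        pairs u = AllPairsP.map⁺ (AllPairs.map pencil-distinct u)
        zeroH : ∀ {ψ} → (∃ λ θ → θ ∈ L × ψ ≡ line θ) → Zero (slice (G ∘f ψ) 0#)
        zeroH (θ , i , refl) (x ∷ []) = *≡0 (inv≢0 a≢0) (trans (cong (λ t → g₁ (x ∣ t)) (solve 3 (λ k t x → (con (0 , 0) :+ (t :* x :+ con (0 , 0))) :+ k := k :+ t :* x) refl κ θ x)) (on i x))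
        zeroHs : ∀ {ψ} → ψ ∈ Hs → Zero (slice (G ∘f ψ) 0#)
        zeroHs i = zeroH (∈-map⁻ line i)
        divided : ∃ λ h → D (suc e ∸ List.length Hs) h × (∀ p → G p ≡ Π.ΣL Hs (λ ψ → eqn ψ p) * h p)
        divided = div-hyps {f = G} Hs (pairs u) (s≤s e≤Q) dG zeroHs
        h : Fun F 2
        h = proj₁ divided
        cst : ∃ λ k → ∀ p → h p ≡ k
        cst = constant (D-cast (cong (suc e ∸_) (trans (ListP.length-map line L) l)) (proj₁ (proj₂ divided)))
        k : Carrier
        k = proj₁ cst
        eq : ∀ x y → f (φ $ (x ∣ y)) ≡ k * (x * Π.ΣL L (λ θ → y - θ * x))
        eq x y = trans (fg x _) (trans (cong (x *_) (trans (proj₂ (proj₂ divided) (x ∣ y)) (cong₂ _*_ (trans (Π.ΣL-map line L (λ ψ → eqn ψ (x ∣ y))) (Π.ΣL-cong L (λ θ → solve 3 (λ y t x → y :+ :- con (1 , 0) :* (t :* x :+ con (0 , 0)) := y :- t :* x) refl y θ x))) (proj₂ cst _))))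
          (solve 3 (λ x p k → x :* (p :* k) := k :* (x :* p)) refl x _ k))

  σ>0 : ∀ s → 1 ≤ σ s
  σ>0 s = ℕP.≤-trans 1≤Q (ℕP.m≤m+n Q ((q ∸ s) ℕ.* Q))

  wt-¬Zero : ∀ {m} {f : Fun F m} {k} → wt f ≡ k → 1 ≤ k → ¬ Zero f
  wt-¬Zero e l z = contradiction (subst (1 ≤_) (trans (sym e) (wt-≡0 z)) l) λ ()

  -- With s zero slices the weight would be at most (q - s) q < σ s. So 1 ≤ j < s, all nonzero
  -- slices have minimum weight, and `mid-weight` leaves j = s - 1 or j = 1.
  plane : ∀ s {f : Fun F 2} → 2 ≤ s → suc s ≤ Q → D (suc s) f → wt f ≡ σ s → Normal-form s f
  plane s {f} 2≤s s<Q d e = start (misses-hyperplane 0 0 s 1≤s s≤Q d f≢0 ub)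
    where
    1≤s : 1 ≤ s
    1≤s = ℕP.≤-trans (s≤s z≤n) 2≤s
    s≤Q : s ≤ Q
    s≤Q = ℕP.<⇒≤ s<Q
    f≢0 : ¬ Zero f
    f≢0 = wt-¬Zero e (σ>0 s)
    ub : wt f ≤ σ s ℕ.* q ^ 0
    ub = ℕP.≤-reflexive (trans e (sym (ℕP.*-identityʳ _)))
    start : Empty f → Normal-form s f
    start (φ , zφ) = Normal-iso f φ (byKind (kind 0 0 s 1≤s s≤Q d₁ f₁≢0 ub₁))
      where
      f₁ : Fun F 2
      f₁ = f ∘f φ
      d₁ : D (suc s) f₁
      d₁ = D-iso d φ
      f₁≢0 : ¬ Zero f₁
      f₁≢0 = ¬Zero-iso f≢0 φ
      wt₁ : wt f₁ ≡ σ s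
      wt₁ = trans (wt-iso f φ) e
      ub₁ : wt f₁ ≤ σ s ℕ.* q ^ 0
      ub₁ = wt-ub-iso ub φ
      j : ℕ
      j = #zeros f₁
      divided : ∃ λ g → D (suc s ∸ j) g × (∀ x z → f₁ (x ∷ z) ≡ ΠB (zeros f₁) x * g (x ∷ z))
      divided = div-zeros d₁
      g : Fun F 2
      g = proj₁ divided
      tight : j ≤ s → (q ∸ j) ℕ.* (q ∸ (s ∸ j)) ≡ σ s → ∀ x → ¬ Zero (slice f₁ x) → wt (slice f₁ x) ≡ q ∸ (s ∸ j)
      tight l eq x n = trans (slices-tight f₁ ((q ∸ (s ∸ j)) ℕ.* q ^ 0) (few-zeros 0 0 s s≤Q d₁ l) (ℕP.≤-reflexive (trans wt₁ (trans (sym eq) (cong ((q ∸ j) ℕ.*_) (sym (ℕP.*-identityʳ _)))))) x n) (ℕP.*-identityʳ _)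
      byKind : Kind 0 s 0 (wt f₁) j → Normal-form s f₁
      byKind (k-none z) = contradiction (subst (1 ≤_) z (1≤#zeros f₁ 0# zφ)) λ ()
      byKind (k-one () _)
      byKind (k-full z) = contradiction (ℕP.≤-trans (ℕP.≤-reflexive (sym wt₁)) (slices-upper f₁ q (λ x → ℕP.≤-trans (ℕP.≤-reflexive (wt-1 (slice f₁ x))) (ℕP.≤-trans (ΣN-mono E (λ y → nz≤1 _)) (ℕP.≤-reflexive (trans (ΣNC-const 1) (ℕP.*-identityʳ q))))))) (ℕP.<⇒≱ (ℕP.≤-pred (begin
        suc (suc ((q ∸ j) ℕ.* q)) ≡⟨ cong (λ k → suc (suc ((q ∸ k) ℕ.* q))) z ⟩
        2 ℕ.+ (q ∸ s) ℕ.* q ≡⟨ ℕP.+-comm 2 _ ⟩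
        (q ∸ s) ℕ.* q ℕ.+ 2 ≤⟨ ℕP.+-monoʳ-≤ ((q ∸ s) ℕ.* q) 2≤s ⟩
        (q ∸ s) ℕ.* q ℕ.+ s ≡⟨ sym (σ+1 s 1≤s s≤Q) ⟩
        suc (σ s) ∎)))
        where open ℕP.≤-Reasoning
      byKind (k-mid 1≤j j<s _ eq) = mid (∃+ 1≤j) (∃+ j<s)
        where
        mid : (∃ λ a → j ≡ 1 ℕ.+ a) → (∃ λ b → s ≡ suc j ℕ.+ b) → Normal-form s f₁
        mid (a , ja) (b , sb) = cases a b ja (trans sb (trans (cong (λ k → suc k ℕ.+ b) ja) (sym (ℕP.+-suc (suc a) b)))) (ℕP.m*n≡0⇒m≡0∨n≡0 a ab≡0)
          where
          s≡ : s ≡ suc a ℕ.+ suc b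
          s≡ = trans sb (trans (cong (λ k → suc k ℕ.+ b) ja) (sym (ℕP.+-suc (suc a) b)))
          ab≡0 : a ℕ.* b ≡ 0
          ab≡0 = ℕP.+-cancelˡ-≡ (σ s) _ 0 (trans (sym (mid-weight a b s s≡ s≤Q)) (trans (cong₂ (λ k i → (q ∸ k) ℕ.* (q ∸ i)) (sym ja) (sym (trans (cong (s ∸_) ja) (∸≡ {b = suc a} s≡)))) (trans eq (sym (ℕP.+-identityʳ _)))))
          -- s - j = 1
          affine : ∀ j′ → j ≡ suc j′ → s ≡ suc (suc j′) → Normal-form s f₁
          affine j′ jj ss = normal-affine {f = f₁} {g = g} (zeros f₁) (UniqueP.filter⁺ (λ x → Zero? (slice f₁ x)) unique-E) (trans (cong suc jj) (sym ss)) (D-cast (trans (cong₂ (λ u v → suc u ∸ v) ss jj) (∸≡ {b = suc j′} (sym (trans (ℕP.+-comm (suc j′) 2) refl)))) (proj₁ (proj₂ divided))) (proj₂ (proj₂ divided)) (varies (¬Zero⇒∃ f₁≢0))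
            where
            sj : s ∸ j ≡ 1
            sj = trans (cong₂ _∸_ ss jj) (∸≡ {b = suc j′} (ℕP.+-comm 1 (suc j′)))
            varies : (∃ λ p → f₁ p ≢ 0#) → ∃ λ x → ∃ λ y → g (x ∣ y) ≢ g (x ∣ 0#)
            varies (x ∷ y ∷ [] , n) = vary (∃C? (λ y → ¬? (g (x ∣ y) ≟ g (x ∣ 0#))))
              where
              vary : (∃ λ y → g (x ∣ y) ≢ g (x ∣ 0#)) ⊎ (∀ y → ¬ (g (x ∣ y) ≢ g (x ∣ 0#))) → ∃ λ x → ∃ λ y → g (x ∣ y) ≢ g (x ∣ 0#)
              vary (inj₁ (y , n)) = x , y , n
              -- A cofactor constant on this column would give q nonzero values, but the slice
              -- weighs q - 1.
              vary (inj₂ c) = contradiction (trans (sym (trans (N.ΣL-cong E (λ y′ → nz-1 (nonzero y′))) (trans (ΣNC-const 1) (ℕP.*-identityʳ q)))) (trans (sym (wt-1 (slice f₁ x))) (trans (tight (ℕP.<⇒≤ j<s) eq x (λ z → n (z (y ∷ [])))) (cong (q ∸_) sj)))) (λ eq′ → ℕP.<⇒≢ (ℕP.n<1+n Q) (sym eq′))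
                where
                same : ∀ y → Dec (g (x ∣ y) ≡ g (x ∣ 0#)) → g (x ∣ y) ≡ g (x ∣ 0#)
                same y (yes e) = e
                same y (no n) = ⊥-elim (c y n)
                f₁-const : ∀ y′ → f₁ (x ∣ y′) ≡ f₁ (x ∣ y)
                f₁-const y′ = trans (proj₂ (proj₂ divided) x (y′ ∷ [])) (trans (cong (ΠB (zeros f₁) x *_) (trans (same y′ (_ ≟ _)) (sym (same y (_ ≟ _))))) (sym (proj₂ (proj₂ divided) x (y ∷ []))))
                nonzero : ∀ y′ → f₁ (x ∣ y′) ≢ 0#
                nonzero y′ e = n (trans (sym (f₁-const y′)) e)
          -- j = 1, s ≥ 3
          columns : ∀ e′ → j ≡ 1 → s ≡ suc (suc (suc e′)) → Normal-form s f₁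
          columns e′ j1 ss = subst (λ k → Normal-form k f₁) (sym ss) (Columns.normal e′ g′ eg f₁≢0 (D-cast (cong₂ (λ u v → suc u ∸ v) ss j1) (proj₁ (proj₂ divided))) fg #g)
            where
            room : ∃ λ k → Q ≡ suc s ℕ.+ k
            room = ∃+ s<Q
            g′ : ℕ
            g′ = suc (proj₁ room)
            eg : suc (suc e′) ℕ.+ suc (suc g′) ≡ q
            eg = trans (NS.solve 2 (λ e k → NS.con 2 NS.:+ e NS.:+ (NS.con 3 NS.:+ k) NS.:= NS.con 1 NS.:+ (NS.con 1 NS.:+ (NS.con 3 NS.:+ e) NS.:+ k)) refl e′ (proj₁ room)) (cong suc (sym (trans (proj₂ room) (cong (λ t → suc t ℕ.+ proj₁ room) ss))))
            zeros≡ : zeros f₁ ≡ 0# ∷ []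
            zeros≡ = length-1 (zeros f₁) (∈-zeros f₁ zφ) j1
            fg : ∀ x y → f₁ (x ∣ y) ≡ x * g (x ∣ y)
            fg x y = trans (proj₂ (proj₂ divided) x (y ∷ [])) (cong (_* g (x ∣ y)) (trans (cong (λ L → ΠB L x) zeros≡) (solve 1 (λ x → (x :- con (0 , 0)) :* con (1 , 0) := x) refl x)))
            not-zero : ∀ x → x ≢ 0# → ¬ Zero (slice f₁ x)
            not-zero x x≢0 z = only (subst (x ∈_) zeros≡ (∈-zeros f₁ z))
              where
              only : x ∈ (0# ∷ []) → ⊥
              only (here e) = x≢0 e
            #g : ∀ x → x ≢ 0# → #nz (λ y → g (x ∣ y)) ≡ suc (suc g′)
            #g x x≢0 = trans (N.ΣL-cong E (λ y → nz-cong (λ z → trans (fg x y) (trans (cong (x *_) z) (zeroʳ x))) (λ z → *≡0 x≢0 (trans (sym (fg x y)) z)))) (trans (sym (wt-1 (slice f₁ x))) (trans (tight (ℕP.<⇒≤ j<s) eq x (not-zero x x≢0))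
              (trans (cong (q ∸_) (trans (cong₂ _∸_ ss j1) refl)) (∸≡ {b = suc (suc e′)} (sym eg)))))
          cases : ∀ a b → j ≡ suc a → s ≡ suc a ℕ.+ suc b → a ≡ 0 ⊎ b ≡ 0 → Normal-form s f₁
          -- For s = 2 both alternatives hold; `affine` comes first because `columns` needs s - 1 ≥
          -- 2.
          cases a zero ja ss _ = affine a ja (trans ss (ℕP.+-comm (suc a) 1))
          cases zero (suc b) ja ss _ = columns b ja ss
          cases (suc a) (suc b) ja ss (inj₁ ())
          cases (suc a) (suc b) ja ss (inj₂ ())

  -- More variables, t = 0: dependence on two coordinates

  symI : ∀ {m} → Iso m → Iso m
  symI φ = mkIso (Iso.from φ) (Iso.to φ) (Iso.from-to φ) (Iso.to-from φ)

  wt≤ : ∀ {m} (f : Fun F m) → wt f ≤ q ^ m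
  wt≤ {m} f = ℕP.≤-trans (ΣN-mono (pts m) (λ p → nz≤1 (f p))) (ℕP.≤-reflexive (ΣV-1≡ m))

  σ≥ : ∀ s → 1 ≤ s → s ≤ Q → (q ∸ s) ℕ.* q ≤ σ s
  σ≥ s 1≤s s≤Q = ℕP.≤-pred (ℕP.≤-trans (ℕP.≤-trans (ℕP.≤-reflexive (ℕP.+-comm 1 _)) (ℕP.+-monoʳ-≤ ((q ∸ s) ℕ.* q) 1≤s)) (ℕP.≤-reflexive (sym (σ+1 s 1≤s s≤Q))))

  σ> : ∀ s → 2 ≤ s → s ≤ Q → (q ∸ s) ℕ.* q < σ s
  σ> s 2≤s s≤Q = ℕP.≤-pred (ℕP.≤-trans (ℕP.≤-trans (ℕP.≤-reflexive (ℕP.+-comm 2 _)) (ℕP.+-monoʳ-≤ ((q ∸ s) ℕ.* q) 2≤s)) (ℕP.≤-reflexive (sym (σ+1 s (ℕP.≤-trans (s≤s z≤n) 2≤s) s≤Q))))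

  -- The minimum weight does not exceed the second weight, so some hyperplane misses the support and
  -- `min-structure` applies. Its proviso s ≤ 1 is needed because the two weights coincide for s =
  -- 1.
  min-form : ∀ n s {u : Fun F (suc (suc n))} → 1 ≤ s → s ≤ Q → D (suc s) u → wt u ≡ (q ∸ s) ℕ.* q ^ suc n →
             Σ (Iso (suc (suc n))) λ ψ → #zeros (u ∘f ψ) ≡ s × (∀ y z z′ → u (ψ $ (y ∷ z)) ≡ u (ψ $ (y ∷ z′)))
  min-form n s {u} 1≤s s≤Q d e = go (misses-hyperplane 0 n s 1≤s s≤Q d u≢0 ub)
    where
    e′ : wt u ≡ (q ∸ s) ℕ.* q ℕ.* q ^ n
    e′ = trans e (sym (ℕP.*-assoc (q ∸ s) q (q ^ n)))
    u≢0 : ¬ Zero u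
    u≢0 = wt-¬Zero e (ℕP.*-mono-≤ (d≥1 s≤Q) (q^>0 (suc n)))
    ub : wt u ≤ σ s ℕ.* q ^ n
    ub = ℕP.≤-trans (ℕP.≤-reflexive e′) (ℕP.*-monoˡ-≤ (q ^ n) (σ≥ s 1≤s s≤Q))
    small : ∀ {w} → w ≡ wt u → w ≡ σ s ℕ.* q ^ n → s ≤ 1
    small w≡ eq = ℕP.≮⇒≥ (λ 2≤s → ℕP.<⇒≢ (ℕP.*-monoˡ-< (q ^ n) {{ℕP.m^n≢0 q n}} (σ> s 2≤s s≤Q)) (trans (sym e′) (trans (sym w≡) eq)))
    go : Empty u → Σ (Iso (suc (suc n))) λ ψ → #zeros (u ∘f ψ) ≡ s × (∀ y z z′ → u (ψ $ (y ∷ z)) ≡ u (ψ $ (y ∷ z′)))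
    go (ψ , zψ) = ψ , min-structure n s 1≤s s≤Q (D-iso d ψ) (¬Zero-iso u≢0 ψ) (wt-ub-iso ub ψ) (small (wt-iso u ψ)) 0# zψ

  -- A function of a linear form δ with exactly s zeros has q - s nonzero values on a line on which δ is not
  -- constant, so a restriction of degree less than s forces δ to be constant.
  invariant : ∀ n s {u : Fun F (suc (suc n))} (w : V (suc (suc n))) → 1 ≤ s → s ≤ Q → D (suc s) u → wt u ≡ (q ∸ s) ℕ.* q ^ suc n →
              (∀ p → D {1} s (λ ξ → u (p ⊞ head ξ · w))) → ∀ p ξ → u (p ⊞ ξ · w) ≡ u p
  invariant n (suc s) {u} w 1≤s s≤Q d e low = go (min-form n (suc s) 1≤s s≤Q d e)
    where
    go : (Σ (Iso (suc (suc n))) λ ψ → #zeros (u ∘f ψ) ≡ suc s × (∀ y z z′ → u (ψ $ (y ∷ z)) ≡ u (ψ $ (y ∷ z′)))) → ∀ p ξ → u (p ⊞ ξ · w) ≡ u p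
    go (ψ , #z , c) p ξ = trans (u≡k (p ⊞ ξ · w)) (trans (cong k (trans (IsAff.add (eqn-aff ψ) p (ξ · w)) (trans (cong (eqn ψ p +_) (trans (IsAff.hom (eqn-aff ψ) ξ w) (trans (cong (ξ *_) δ≡0) (zeroʳ ξ)))) (+-identityʳ _)))) (sym (u≡k p)))
      where
      k : Carrier → Carrier
      k y = u (ψ $ (y ∷ 0V))
      u≡k : ∀ p → u p ≡ k (eqn ψ p)
      u≡k p = trans (cong u (sym (Iso.to-from ψ p))) (by (app (Iso.from ψ) p))
        where
        by : ∀ v → u (ψ $ v) ≡ k (head v)
        by (y ∷ z) = c y z 0V
      δ : Carrier
      δ = IsAff.lin (eqn-aff ψ) w
      #zk : List.length (roots-of k) ≡ suc s
      #zk = trans (same E) #z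
        where
        same : ∀ xs → List.length (List.filter (λ y → k y ≟ 0#) xs) ≡ List.length (List.filter (λ y → Zero? (slice (u ∘f ψ) y)) xs)
        same [] = refl
        same (x ∷ xs) with k x ≟ 0# | Zero? (slice (u ∘f ψ) x)
        ... | yes _ | yes _ = cong suc (same xs)
        ... | no _ | no _ = same xs
        ... | yes z | no n = contradiction (λ v → trans (c x v 0V) z) n
        ... | no n | yes z = contradiction (z 0V) n
      #nzk : #nz k ≡ q ∸ suc s
      #nzk = sym (∸≡ {b = suc s} (sym (trans (cong (ℕ._+ #nz k) (sym #zk)) (roots+nz k))))
      k≢0 : ∃ λ y → k y ≢ 0#
      k≢0 = some (¬Zero⇒∃ (wt-¬Zero {f = u} e (ℕP.*-mono-≤ (d≥1 s≤Q) (q^>0 (suc n)))))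
        where
        some : (∃ λ p → u p ≢ 0#) → ∃ λ y → k y ≢ 0#
        some (p , n) = eqn ψ p , λ z → n (trans (u≡k p) z)
      dec : Dec (δ ≡ 0#) → δ ≡ 0#
      dec (yes z) = z
      dec (no δ≢0) = contradiction (ℕP.≤-trans (ℕP.≤-reflexive (sym (∸≡ {b = s} (trans (sym (ℕP.m+[n∸m]≡n (ℕP.≤-trans s≤Q (ℕP.n≤1+n Q)))) (sym (ℕP.+-suc s (q ∸ suc s))))))) (ℕP.≤-trans (#nz-poly s v (ℕP.≤-trans (ℕP.n≤1+n s) s≤Q) (low p) ξ₀ nv) (ℕP.≤-reflexive (trans count #nzk)))) (ℕP.<-irrefl refl)
        where
        v : Carrier → Carrier
        v ξ = u (p ⊞ ξ · w)
        v≡ : ∀ ξ → v ξ ≡ k (eqn ψ p + ξ * δ)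
        v≡ ξ = trans (u≡k (p ⊞ ξ · w)) (cong k (trans (IsAff.add (eqn-aff ψ) p (ξ · w)) (cong (eqn ψ p +_) (IsAff.hom (eqn-aff ψ) ξ w))))
        l : ∀ ξ → (eqn ψ p + ξ * δ - eqn ψ p) * inv δ ≡ ξ
        l ξ = trans (solve 4 (λ a x d i → (a :+ x :* d :- a) :* i := x :* (d :* i)) refl (eqn ψ p) ξ δ (inv δ)) (trans (cong (ξ *_) (inv-r δ≢0)) (*-identityʳ ξ))
        r : ∀ y → eqn ψ p + (y - eqn ψ p) * inv δ * δ ≡ y
        r y = trans (solve 4 (λ a y d i → a :+ (y :- a) :* i :* d := a :+ (y :- a) :* (d :* i)) refl (eqn ψ p) y δ (inv δ)) (trans (cong (λ t → eqn ψ p + (y - eqn ψ p) * t) (inv-r δ≢0)) (solve 2 (λ a y → a :+ (y :- a) :* con (1 , 0) := y) refl (eqn ψ p) y))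
        count : #nz v ≡ #nz k
        count = trans (N.ΣL-cong E (λ ξ → cong nz (v≡ ξ))) (N.reindexC (λ ξ → eqn ψ p + ξ * δ) (λ y → (y - eqn ψ p) * inv δ) l r (λ y → nz (k y)))
        ξ₀ : Carrier
        ξ₀ = (proj₁ k≢0 - eqn ψ p) * inv δ
        nv : v ξ₀ ≢ 0#
        nv z = proj₂ k≢0 (trans (cong k (sym (r (proj₁ k≢0)))) (trans (sym (v≡ ξ₀)) z))
      δ≡0 : δ ≡ 0#
      δ≡0 = dec (δ ≟ 0#)

  Cylinder : ∀ n → ℕ → Fun F (suc (suc n)) → Set
  Cylinder n s f = Σ (Iso (suc (suc n))) λ φ → Σ (Fun F 2) λ f̄ → Normal s f̄ × (∀ x y z → f (φ $ (x ∷ y ∷ z)) ≡ f̄ (x ∣ y))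

  Cylinder-suc : ∀ n s (f : Fun F (suc (suc (suc n)))) (φ : Iso (suc (suc (suc n)))) → (∀ z p → f (φ $ (z ∷ p)) ≡ f (φ $ (0# ∷ p))) →
                 Cylinder n s (slice (f ∘f φ) 0#) → Cylinder (suc n) s f
  Cylinder-suc n s f φ c (ψ , f̄ , N , e) = φ ∘I (liftI ψ ∘I symI rotI) , f̄ , N , λ { x y (z ∷ zs) → trans (c z (ψ $ (x ∷ y ∷ zs))) (e x y zs) }

  -- The slices of f are functions of minimum weight, hence functions of one linear form each. If the form of
  -- one slice vanishes on w, then the coefficient of top degree along w vanishes, and so it does for the others.
  cylinder-step : ∀ n s {f : Fun F (suc (suc (suc n)))} → 2 ≤ s → suc s ≤ Q → D (suc s) f → wt f ≡ σ s ℕ.* q ^ suc n →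
                  (∀ {g : Fun F (suc (suc n))} → D (suc s) g → wt g ≡ σ s ℕ.* q ^ n → Cylinder n s g) → Cylinder (suc n) s f
  cylinder-step n s {f} 2≤s s<Q d e IH = start (misses-hyperplane 0 (suc n) s 1≤s s≤Q d f≢0 (ℕP.≤-reflexive e))
    where
    1≤s : 1 ≤ s
    1≤s = ℕP.≤-trans (s≤s z≤n) 2≤s
    s≤Q : s ≤ Q
    s≤Q = ℕP.<⇒≤ s<Q
    f≢0 : ¬ Zero f
    f≢0 = wt-¬Zero e (ℕP.*-mono-≤ (σ>0 s) (q^>0 (suc n)))
    finish : (φ : Iso (suc (suc (suc n)))) → (∀ z p → f (φ $ (z ∷ p)) ≡ f (φ $ (0# ∷ p))) → Cylinder (suc n) s f
    finish φ c = Cylinder-suc n s f φ c (IH (D-slice (D-iso d φ) 0#) (ℕP.*-cancelˡ-≡ _ _ q (trans (sym (wt-indep (f ∘f φ) c)) (trans (wt-iso f φ) (trans e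
      (NS.solve 3 (λ a b c → a NS.:* (b NS.:* c) NS.:= b NS.:* (a NS.:* c)) refl (σ s) q (q ^ n)))))))
    start : Empty f → Cylinder (suc n) s f
    start (φ , zφ) = byKind (kind 0 (suc n) s 1≤s s≤Q d₁ f₁≢0 (ℕP.≤-reflexive wt₁))
      where
      f₁ : Fun F (suc (suc (suc n)))
      f₁ = f ∘f φ
      d₁ : D (suc s) f₁
      d₁ = D-iso d φ
      f₁≢0 : ¬ Zero f₁
      f₁≢0 = ¬Zero-iso f≢0 φ
      wt₁ : wt f₁ ≡ σ s ℕ.* q ^ suc n
      wt₁ = trans (wt-iso f φ) e
      j s′ : ℕ
      j = #zeros f₁
      s′ = s ∸ j
      byKind : Kind 0 s (suc n) (wt f₁) j → Cylinder (suc n) s f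
      byKind (k-none z) = contradiction (subst (1 ≤_) z (1≤#zeros f₁ 0# zφ)) λ ()
      byKind (k-one () _)
      byKind (k-full z) = contradiction (ℕP.≤-trans (ℕP.≤-reflexive (sym wt₁)) (ℕP.≤-trans (slices-upper f₁ (q ^ suc (suc n)) (λ x → wt≤ (slice f₁ x))) (ℕP.≤-reflexive (trans (cong (λ k → (q ∸ k) ℕ.* q ^ suc (suc n)) z) (sym (ℕP.*-assoc (q ∸ s) q (q ^ suc n)))))))
        (ℕP.<⇒≱ (ℕP.*-monoˡ-< (q ^ suc n) {{ℕP.m^n≢0 q (suc n)}} (σ> s 2≤s s≤Q)))
      byKind (k-mid 1≤j j<s _ eq) = build (¬Zero⇒∃ f₁≢0)
        where
        1≤s′ : 1 ≤ s′
        1≤s′ = ℕP.m<n⇒0<n∸m j<s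
        s′≤Q : s′ ≤ Q
        s′≤Q = ℕP.≤-trans (ℕP.m∸n≤m s j) s≤Q
        deg : suc s ∸ j ≡ suc s′
        deg = ℕP.+-∸-assoc 1 (ℕP.<⇒≤ j<s)
        divided : ∃ λ g → D (suc s ∸ j) g × (∀ x z → f₁ (x ∷ z) ≡ ΠB (zeros f₁) x * g (x ∷ z))
        divided = div-zeros d₁
        g : Fun F (suc (suc (suc n)))
        g = proj₁ divided
        dg : D (suc s′) g
        dg = D-cast deg (proj₁ (proj₂ divided))
        ds : ∀ x → D (suc s′) (slice f₁ x)
        ds x = D-cast deg (D-slice-zeros d₁ x)
        tight : ∀ x → ¬ Zero (slice f₁ x) → wt (slice f₁ x) ≡ (q ∸ s′) ℕ.* q ^ suc n
        tight = slices-tight f₁ ((q ∸ s′) ℕ.* q ^ suc n) (few-zeros 0 (suc n) s s≤Q d₁ (ℕP.<⇒≤ j<s))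
          (ℕP.≤-reflexive (trans wt₁ (trans (cong (ℕ._* q ^ suc n) (sym eq)) (ℕP.*-assoc (q ∸ j) (q ∸ s′) _))))
        build : (∃ λ p → f₁ p ≢ 0#) → Cylinder (suc n) s f
        build (a ∷ p₀ , na) = useForm (min-form n s′ 1≤s′ s′≤Q (ds a) (tight a (λ z → na (z p₀))))
          where
          useForm : (Σ (Iso (suc (suc n))) λ ψ → #zeros (slice f₁ a ∘f ψ) ≡ s′ × (∀ y z z′ → f₁ (a ∷ ψ $ (y ∷ z)) ≡ f₁ (a ∷ ψ $ (y ∷ z′)))) → Cylinder (suc n) s f
          useForm (ψ , _ , c) = finish (φ ∘I (liftI ψ ∘I rotI)) λ z → λ { (x ∷ y ∷ p) → indep-z x y z p (Zero? (slice f₁ x)) }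
            where
            g₂ : Fun F (suc (suc (suc n)))
            g₂ = g ∘f liftI ψ
            w′ : V (suc (suc n))
            -- After ψ the slice at a depends on its first coordinate only, so it is constant in
            -- this direction.
            w′ = 0# ∷ 1# ∷ 0V
            Jg : Jet s′ g₂
            Jg = jet (D-iso dg (liftI ψ))
            module J = Jet Jg
            shift : ∀ x y z p ξ → (x ∷ y ∷ z ∷ p) ⊞ ξ · (0# ∷ w′) ≡ x ∷ y ∷ z + ξ ∷ p
            shift x y z p ξ = cong₂ _∷_ (solve 2 (λ x t → x :+ t :* con (0 , 0) := x) refl x ξ) (cong₂ _∷_ (solve 2 (λ x t → x :+ t :* con (0 , 0) := x) refl y ξ)
              (cong₂ _∷_ (cong (z +_) (*-identityʳ ξ)) (trans (cong (p ⊞_) (·0V ξ)) (⊞-identityʳ p))))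
            Pa≢0 : ΠB (zeros f₁) a ≢ 0#
            Pa≢0 z = na (trans (proj₂ (proj₂ divided) a p₀) (trans (cong (_* g (a ∷ p₀)) z) (zeroˡ _)))
            g₂-const : ∀ y z z′ → g₂ (a ∷ y ∷ z) ≡ g₂ (a ∷ y ∷ z′)
            g₂-const y z z′ = *-cancelˡ Pa≢0 (trans (sym (proj₂ (proj₂ divided) a (ψ $ (y ∷ z)))) (trans (c y z z′) (proj₂ (proj₂ divided) a (ψ $ (y ∷ z′)))))
            top≡0 : J.T (0# ∷ w′) ≡ 0#
            top≡0 = go (J.line (a ∷ 0# ∷ 0# ∷ 0V) (0# ∷ w′))
              where
              v : Carrier
              v = g₂ (a ∷ 0# ∷ 0# ∷ 0V)
              unit0 : ∀ k → 1 ≤ k → v * unit 0 k ≡ 0#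
              unit0 (suc k) _ = zeroʳ v
              go : LineC s′ g₂ J.d J.T (a ∷ 0# ∷ 0# ∷ 0V) (0# ∷ w′) → J.T (0# ∷ w′) ≡ 0#
              go (b , _ , eb , _ , _ , t) = trans (sym t) (trans (ev-inj (suc s′) b (λ i → v * unit 0 i) (s≤s s′≤Q) same s′ ℕP.≤-refl) (unit0 s′ 1≤s′))
                where
                same : ∀ ξ → ev (suc s′) b ξ ≡ ev (suc s′) (λ i → v * unit 0 i) ξ
                same ξ = trans (sym (eb ξ)) (trans (cong g₂ (shift a 0# 0# 0V ξ)) (trans (g₂-const 0# (0# + ξ ∷ 0V) (0# ∷ 0V)) (sym (trans (ev-* (suc s′) v (unit 0) ξ) (trans (cong (v *_) (ev-unit (suc s′) 0 ξ (s≤s z≤n))) (*-identityʳ v))))))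
            low : ∀ x p → D {1} s′ (λ ξ → (f₁ ∘f liftI ψ) (x ∷ p ⊞ head ξ · w′))
            low x p = go (J.line (x ∷ p) (0# ∷ w′))
              where
              go : LineC s′ g₂ J.d J.T (x ∷ p) (0# ∷ w′) → D {1} s′ (λ ξ → (f₁ ∘f liftI ψ) (x ∷ p ⊞ head ξ · w′))
              go (b , _ , eb , _ , _ , t) = D-cong (D-scale (ΠB (zeros f₁) x) (D-poly s′ b)) λ ξ → trans (proj₂ (proj₂ divided) x _) (cong (ΠB (zeros f₁) x *_)
                (trans (trans (cong (λ x′ → g₂ (x′ ∷ p ⊞ head ξ · w′)) (solve 2 (λ x t → x := x :+ t :* con (0 , 0)) refl x (head ξ))) (eb (head ξ))) (trans (ev-last s′ b (head ξ)) (trans (cong (λ u → ev s′ b (head ξ) + u * pow F (head ξ) s′) (trans t top≡0)) (solve 2 (λ a p → a :+ con (0 , 0) :* p := a) refl _ _)))))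
            indep-z : ∀ x y z p → Dec (Zero (slice f₁ x)) → f₁ (x ∷ ψ $ (y ∷ z ∷ p)) ≡ f₁ (x ∷ ψ $ (y ∷ 0# ∷ p))
            indep-z x y z p (yes zx) = trans (zx _) (sym (zx _))
            indep-z x y z p (no nx) = trans (cong (λ v → f₁ (x ∷ ψ $ v)) (sym (trans (cong tail (shift x y 0# p z)) (cong (λ t → y ∷ t ∷ p) (+-identityˡ z)))))
              (invariant n s′ w′ 1≤s′ s′≤Q (D-iso (ds x) ψ) (trans (wt-iso (slice f₁ x) ψ) (tight x nx)) (low x) (y ∷ 0# ∷ p) z)

  cylinder : ∀ n s {f : Fun F (suc (suc n))} → 2 ≤ s → suc s ≤ Q → D (suc s) f → wt f ≡ σ s ℕ.* q ^ n → Cylinder n s f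
  cylinder zero s {f} 2≤s s<Q d e = go (plane s 2≤s s<Q d (trans e (ℕP.*-identityʳ _)))
    where
    go : Normal-form s f → Cylinder 0 s f
    go (φ , N) = φ , f ∘f φ , N , λ { x y [] → refl }
  cylinder (suc n) s 2≤s s<Q d e = cylinder-step n s 2≤s s<Q d e (cylinder n s 2≤s s<Q)

  -- Support in a hyperplane, t ≥ 1

  InHyp : ∀ {m} → Fun F (suc m) → Set
  InHyp {m} f = Σ (Iso (suc m)) λ φ → ∀ x → x ≢ 0# → Zero (slice (f ∘f φ) x)

  InHyp-iso : ∀ {m} (f : Fun F (suc m)) (φ : Iso (suc m)) → InHyp (f ∘f φ) → InHyp f
  InHyp-iso f φ (ψ , z) = φ ∘I ψ , z

  ΣN-one : ∀ (g : Carrier → ℕ) → N.ΣC g ≤ 1 → ∀ a → 1 ≤ g a → ∀ x → x ≢ a → g x ≡ 0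
  ΣN-one g l a ga x x≢a = ℕP.n≤0⇒n≡0 (ℕP.≤-pred (ℕP.≤-trans (ℕP.≤-trans (ℕP.+-mono-≤ ga (ℕP.≤-refl {g x})) two) l))
    where
    pick≤ : ∀ y → pick (y ≟ a) (g y) 0 ℕ.+ pick (y ≟ x) (g y) 0 ≤ g y
    pick≤ y with y ≟ a | y ≟ x
    ... | yes _ | no _ = ℕP.≤-reflexive (ℕP.+-identityʳ _)
    ... | no _ | yes _ = ℕP.≤-refl
    ... | no _ | no _ = z≤n
    ... | yes refl | yes e = contradiction (sym e) x≢a
    two : g a ℕ.+ g x ≤ N.ΣC g
    two = ℕP.≤-trans (ℕP.≤-reflexive (sym (trans (N.ΣL-∙ E _ _) (cong₂ ℕ._+_ (N.δC a g) (N.δC x g))))) (ΣN-mono E pick≤)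

  lone-slice : ∀ {m} (f : Fun F (suc m)) → ¬ Zero f → #zeros f ≡ Q → ∃ λ x → ¬ Zero (slice f x) × (∀ y → y ≢ x → Zero (slice f y)) × wt f ≡ wt (slice f x)
  lone-slice {m} f ¬z j≡Q = go (¬Zero⇒∃ ¬z)
    where
    ind : ∀ {x} → Dec (Zero (slice f x)) → ℕ
    ind (yes _) = 0
    ind (no _) = 1
    g : Carrier → ℕ
    g x = ind (Zero? (slice f x))
    count : ∀ xs → List.length (List.filter (λ x → Zero? (slice f x)) xs) ℕ.+ N.ΣL xs g ≡ List.length xs
    count [] = refl
    count (x ∷ xs) with Zero? (slice f x)
    ... | yes _ = cong suc (count xs)
    ... | no _ = trans (ℕP.+-suc _ _) (cong suc (count xs))
    Σg : N.ΣC g ≤ 1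
    Σg = ℕP.≤-reflexive (ℕP.+-cancelˡ-≡ Q _ 1 (trans (cong (ℕ._+ N.ΣC g) (sym j≡Q)) (trans (count E) (trans length-E (ℕP.+-comm 1 Q)))))
    go : (∃ λ p → f p ≢ 0#) → _
    go (x ∷ p , n) = x , nx , others , trans (wt-suc f) (trans (N.ΣL-cong E (λ y → only y (y ≟ x))) (N.δC x (λ y → wt (slice f y))))
      where
      nx : ¬ Zero (slice f x)
      nx z = n (z p)
      gx : (d : Dec (Zero (slice f x))) → 1 ≤ ind d
      gx (yes z) = contradiction z nx
      gx (no _) = s≤s z≤n
      others : ∀ y → y ≢ x → Zero (slice f y)
      others y y≢x = from (Zero? (slice f y)) (ΣN-one g Σg x (gx (Zero? (slice f x))) y y≢x)
        where
        from : (d : Dec (Zero (slice f y))) → ind d ≡ 0 → Zero (slice f y)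
        from (yes z) _ = z
      only : ∀ y → (d : Dec (y ≡ x)) → wt (slice f y) ≡ pick d (wt (slice f y)) 0
      only y (yes _) = refl
      only y (no n) = wt-≡0 (others y n)

  lone⇒InHyp : ∀ {m} (f : Fun F (suc m)) → ¬ Zero f → #zeros f ≡ Q → InHyp f
  lone⇒InHyp {m} f ¬z j≡Q = go (lone-slice f ¬z j≡Q)
    where
    go : (∃ λ x → ¬ Zero (slice f x) × (∀ y → y ≢ x → Zero (slice f y)) × wt f ≡ wt (slice f x)) → InHyp f
    go (x , _ , z , _) = shearI (aff-const x) , λ y y≢0 → z (y + x) (λ e → y≢0 (trans (solve 2 (λ y x → y := (y :+ x) :- x) refl y x) (x-x≡0 e)))

  -- The degree (t + 1)(q - 1) is read as t(q - 1) + s with s = q - 1. Below the second weight for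
  -- this s only one slice is nonzero, and induction applies to it.
  gap : ∀ t n {f : Fun F (t ℕ.+ suc n)} → D (suc (t ℕ.* Q)) f → ¬ Zero f → wt f < σ Q ℕ.* q ^ n → wt f ≡ q ^ suc n
  gap zero n {f} d ¬z _ = go (D-1 d)
    where
    go : (∃ λ c → ∀ p → f p ≡ c) → wt f ≡ q ^ suc n
    go (c , e) = trans (N.ΣL-cong (pts (suc n)) (λ p → nz-1 (λ z → ¬z (λ p′ → trans (e p′) (trans (sym (e p)) z))))) (ΣV-1≡ (suc n))
  gap (suc t) n {f} d ¬z l = start (misses-hyperplane t n Q 1≤Q ℕP.≤-refl d′ ¬z (ℕP.<⇒≤ l))
    where
    d′ : D (suc (t ℕ.* Q ℕ.+ Q)) f
    d′ = D-cast (cong suc (ℕP.+-comm Q (t ℕ.* Q))) d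
    start : Empty f → wt f ≡ q ^ suc n
    start (φ , zφ) = byKind (kind t n Q 1≤Q ℕP.≤-refl (D-iso d′ φ) (¬Zero-iso ¬z φ) (wt-ub-iso (ℕP.<⇒≤ l) φ))
      where
      f₁ : Fun F (suc (t ℕ.+ suc n))
      f₁ = f ∘f φ
      lone : #zeros f₁ ≡ Q → wt f ≡ q ^ suc n
      lone e = go (lone-slice f₁ (¬Zero-iso ¬z φ) e)
        where
        go : (∃ λ x → ¬ Zero (slice f₁ x) × (∀ y → y ≢ x → Zero (slice f₁ y)) × wt f₁ ≡ wt (slice f₁ x)) → wt f ≡ q ^ suc n
        go (x , nx , _ , w) = trans w≡ (gap t n (D-cast deg (D-slice-zeros (D-iso d′ φ) x)) nx (subst (_< σ Q ℕ.* q ^ n) w≡ l))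
          where
          w≡ : wt f ≡ wt (slice f₁ x)
          w≡ = trans (sym (wt-iso f φ)) w
          deg : suc (t ℕ.* Q ℕ.+ Q) ∸ #zeros f₁ ≡ suc (t ℕ.* Q)
          deg = trans (cong (suc (t ℕ.* Q ℕ.+ Q) ∸_) e) (ℕP.m+n∸n≡m (suc (t ℕ.* Q)) Q)
      byKind : Kind t Q n (wt f₁) (#zeros f₁) → wt f ≡ q ^ suc n
      byKind (k-none z) = contradiction (subst (1 ≤_) z (1≤#zeros f₁ 0# zφ)) λ ()
      byKind (k-full e) = lone e
      byKind (k-one _ e) = lone e
      byKind (k-mid _ _ e _) = contradiction l (ℕP.<-irrefl (trans (sym (wt-iso f φ)) e))

  ab≥a+b : ∀ a b → a ℕ.+ b < suc a ℕ.* suc b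
  ab≥a+b a b = ℕP.≤-trans (ℕP.m≤m+n _ (a ℕ.* b)) (ℕP.≤-reflexive (NS.solve 2 (λ a b → NS.con 1 NS.:+ (a NS.:+ b) NS.:+ a NS.:* b NS.:= (NS.con 1 NS.:+ a) NS.:* (NS.con 1 NS.:+ b)) refl a b))

  i*[q-i]≥Q : ∀ i → 1 ≤ i → i ≤ Q → Q ≤ i ℕ.* (q ∸ i)
  i*[q-i]≥Q (suc a) _ l = go (∃+ l)
    where
    go : (∃ λ b → Q ≡ suc a ℕ.+ b) → Q ≤ suc a ℕ.* (q ∸ suc a)
    go (b , e) = ℕP.≤-trans (ℕP.≤-reflexive e) (ℕP.≤-trans (ab≥a+b a b) (ℕP.≤-reflexive (cong (suc a ℕ.*_) (sym (∸≡ {b = suc a} (trans (cong suc e) (sym (ℕP.+-suc (suc a) b))))))))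

  -- With s zero slices the others weigh at least q^(n+1), and only (s - 1) q^n is left over. So
  -- each weighs less than (q + s) q^n ≤ 2(q - 1) q^n, where s ≤ q - 2 enters. By `gap` each weighs
  -- exactly q^(n+1), and the total is too small.
  full-slices : ∀ t n s {f : Fun F (suc (suc t ℕ.+ suc n))} → 2 ≤ s → suc s ≤ Q → D (suc (suc t ℕ.* Q ℕ.+ s)) f → wt f ≡ σ s ℕ.* q ^ n → #zeros f ≢ s
  full-slices t n s {f} 2≤s s<Q d e j≡s = ℕP.<⇒≱ (ℕP.*-monoˡ-< (q ^ n) {{ℕP.m^n≢0 q n}} (σ> s 2≤s s≤Q)) (begin
    σ s ℕ.* q ^ n ≡⟨ sym e ⟩
    wt f ≤⟨ slices-upper f (q ^ suc n) (λ x → up x (Zero? (slice f x))) ⟩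
    (q ∸ #zeros f) ℕ.* q ^ suc n ≡⟨ cong (λ k → (q ∸ k) ℕ.* q ^ suc n) j≡s ⟩
    (q ∸ s) ℕ.* q ^ suc n ≡⟨ sym (ℕP.*-assoc (q ∸ s) q (q ^ n)) ⟩
    (q ∸ s) ℕ.* q ℕ.* q ^ n ∎)
    where
    open ℕP.≤-Reasoning
    s≤Q : s ≤ Q
    s≤Q = ℕP.<⇒≤ s<Q
    1≤s : 1 ≤ s
    1≤s = ℕP.≤-trans (s≤s z≤n) 2≤s
    ds : ∀ x → D (suc (suc t ℕ.* Q)) (slice f x)
    ds x = D-cast (trans (cong (suc (suc t ℕ.* Q ℕ.+ s) ∸_) j≡s) (ℕP.m+n∸n≡m (suc (suc t ℕ.* Q)) s)) (D-slice-zeros d x)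
    lb : ∀ x → ¬ Zero (slice f x) → q ^ suc n ≤ wt (slice f x)
    lb x nx = min-wt (suc t) n 0 z≤n (D-cast (cong suc (sym (ℕP.+-identityʳ _))) (ds x)) nx
    light : ∀ x → ¬ Zero (slice f x) → wt (slice f x) < σ Q ℕ.* q ^ n
    light x nx = begin-strict
      wt (slice f x) ≡⟨ sym (ℕP.m+[n∸m]≡n (lb x nx)) ⟩
      q ^ suc n ℕ.+ ε <⟨ ℕP.+-monoʳ-< (q ^ suc n) ε<s ⟩
      q ^ suc n ℕ.+ s ℕ.* q ^ n ≡⟨ sym (ℕP.*-distribʳ-+ (q ^ n) q s) ⟩
      (q ℕ.+ s) ℕ.* q ^ n ≤⟨ ℕP.*-monoˡ-≤ (q ^ n) q+s≤ ⟩
      σ Q ℕ.* q ^ n ∎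
      where
      ε : ℕ
      ε = wt (slice f x) ∸ q ^ suc n
      q+s≤ : q ℕ.+ s ≤ σ Q
      q+s≤ = ℕP.≤-trans (ℕP.≤-reflexive (trans (cong suc (ℕP.+-comm Q s)) refl)) (ℕP.≤-trans (ℕP.+-monoˡ-≤ Q s<Q) (ℕP.≤-reflexive (cong (Q ℕ.+_) (sym (trans (cong (ℕ._* Q) (∸≡ {b = Q} (ℕP.+-comm 1 Q))) (ℕP.*-identityˡ Q))))))
      ε<s : ε < s ℕ.* q ^ n
      ε<s = ℕP.+-cancelˡ-< ((q ∸ s) ℕ.* q ℕ.* q ^ n) ε _ (begin-strict
        (q ∸ s) ℕ.* q ℕ.* q ^ n ℕ.+ ε ≡⟨ cong (ℕ._+ ε) (trans (ℕP.*-assoc (q ∸ s) q (q ^ n)) (cong (λ k → (q ∸ k) ℕ.* q ^ suc n) (sym j≡s))) ⟩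
        (q ∸ #zeros f) ℕ.* q ^ suc n ℕ.+ ε ≤⟨ slices-excess f (q ^ suc n) lb x nx ⟩
        wt f ≡⟨ e ⟩
        σ s ℕ.* q ^ n <⟨ ℕP.*-monoˡ-< (q ^ n) {{ℕP.m^n≢0 q n}} (ℕP.n<1+n (σ s)) ⟩
        suc (σ s) ℕ.* q ^ n ≡⟨ trans (cong (ℕ._* q ^ n) (σ+1 s 1≤s s≤Q)) (ℕP.*-distribʳ-+ (q ^ n) ((q ∸ s) ℕ.* q) s) ⟩
        (q ∸ s) ℕ.* q ℕ.* q ^ n ℕ.+ s ℕ.* q ^ n ∎)
    up : ∀ x → Dec (Zero (slice f x)) → wt (slice f x) ≤ q ^ suc n
    up x (yes z) = ℕP.≤-trans (ℕP.≤-reflexive (wt-≡0 z)) z≤n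
    up x (no nx) = ℕP.≤-reflexive (gap (suc t) n (ds x) nx (light x nx))

  -- The projection loses points: the slices over its zero slices are then too heavy, unless only one slice is nonzero.
  collided : ∀ t n s (f : Fun F (suc (suc (t ℕ.+ suc n)))) → 2 ≤ s → suc s ≤ Q → D (suc (suc t ℕ.* Q ℕ.+ s)) f → wt f ≡ σ s ℕ.* q ^ n →
             let G = λ p → ΣC (λ l → f (head p ∷ l ∷ tail p)) in
             D (suc (t ℕ.* Q ℕ.+ s)) G → ¬ Zero G → wt G < σ s ℕ.* q ^ n → Zero (slice G 0#) → InHyp f
  collided t n s f 2≤s s<Q d e dG ¬zG lG zG = cases (ℕP.<-≤-connex j s)
    where
    s≤Q : s ≤ Q
    s≤Q = ℕP.<⇒≤ s<Q
    1≤s : 1 ≤ s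
    1≤s = ℕP.≤-trans (s≤s z≤n) 2≤s
    G : Fun F (suc (t ℕ.+ suc n))
    G p = ΣC (λ l → f (head p ∷ l ∷ tail p))
    j : ℕ
    j = #zeros f
    f≢0 : ¬ Zero f
    f≢0 = wt-¬Zero e (ℕP.*-mono-≤ (σ>0 s) (q^>0 n))
    s≤jG : s ≤ #zeros G
    s≤jG = pickˡ (kind-zeros (kind t n s 1≤s s≤Q dG ¬zG (ℕP.<⇒≤ lG)) 1≤s s≤Q (1≤#zeros G 0# zG))
      where
      pickˡ : s ≤ #zeros G ⊎ (#zeros G < s × wt G ≡ σ s ℕ.* q ^ n) → s ≤ #zeros G
      pickˡ (inj₁ l) = l
      pickˡ (inj₂ (_ , eq)) = contradiction lG (ℕP.<-irrefl eq)
    -- At least i = s - j zero slices of G come from nonzero slices of f, of weight at least (q - i)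
    -- q^n. As i(q - i) ≥ q - 1 ≥ s, this puts s units on top of the minimum weight of G.
    few : j < s → InHyp f
    few j<s = contradiction (begin
        suc (σ s) ℕ.* q ^ n ≡⟨ trans (cong (ℕ._* q ^ n) (σ+1 s 1≤s s≤Q)) (trans (ℕP.*-distribʳ-+ (q ^ n) ((q ∸ s) ℕ.* q) s) (cong (ℕ._+ s ℕ.* q ^ n) (ℕP.*-assoc (q ∸ s) q (q ^ n)))) ⟩
        (q ∸ s) ℕ.* q ^ suc n ℕ.+ s ℕ.* q ^ n ≤⟨ ℕP.+-mono-≤ (min-wt′ t n s s≤Q dG ¬zG) (ℕP.*-monoˡ-≤ (q ^ n) (ℕP.≤-trans s≤Q (i*[q-i]≥Q i (ℕP.m<n⇒0<n∸m j<s) (ℕP.≤-trans (ℕP.m∸n≤m s j) s≤Q)))) ⟩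
        wt G ℕ.+ i ℕ.* (q ∸ i) ℕ.* q ^ n ≡⟨ cong (wt G ℕ.+_) (ℕP.*-assoc i (q ∸ i) (q ^ n)) ⟩
        wt G ℕ.+ i ℕ.* w ≤⟨ ℕP.+-monoʳ-≤ (wt G) (ℕP.*-monoˡ-≤ w (ℕP.∸-monoˡ-≤ j s≤jG)) ⟩
        wt G ℕ.+ (#zeros G ∸ j) ℕ.* w ≤⟨ collision f w (λ x _ nx → few-zeros (suc t) n s s≤Q d (ℕP.<⇒≤ j<s) x nx) ⟩
        wt f ≡⟨ e ⟩
        σ s ℕ.* q ^ n ∎) (ℕP.<⇒≱ (ℕP.*-monoˡ-< (q ^ n) {{ℕP.m^n≢0 q n}} (ℕP.n<1+n (σ s))))
      where
      open ℕP.≤-Reasoning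
      i w : ℕ
      i = s ∸ j
      w = (q ∸ i) ℕ.* q ^ n
    many : s ≤ j → Kind (suc t) s n (wt f) j → InHyp f
    many l (k-none z) = contradiction (ℕP.≤-trans 1≤s (ℕP.≤-trans l (ℕP.≤-reflexive z))) λ ()
    many l (k-full eq) = contradiction eq (full-slices t n s 2≤s s<Q d e)
    many l (k-one _ eq) = lone⇒InHyp f f≢0 eq
    many l (k-mid _ j<s _ _) = contradiction j<s (ℕP.≤⇒≯ l)
    cases : j < s ⊎ s ≤ j → InHyp f
    cases (inj₁ l) = few l
    cases (inj₂ l) = many l (kind (suc t) n s 1≤s s≤Q d f≢0 (ℕP.≤-reflexive e))

  exact-fibres : ∀ {m} (f : Fun F (suc m)) → wt (proj f) ≡ wt f → ∀ w → nz (proj f w) ≡ fibre f w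
  exact-fibres {m} f e w = ℕP.≤-antisym (nz-proj f w) (ℕP.m∸n≡0⇒m≤n (ℕP.n≤0⇒n≡0 (ℕP.≤-trans (term≤ΣV m gap′ w) (ℕP.≤-reflexive zero′))))
    where
    gap′ : V m → ℕ
    gap′ w = fibre f w ∸ nz (proj f w)
    zero′ : N.ΣV m gap′ ≡ 0
    zero′ = ℕP.+-cancelˡ-≡ (wt (proj f)) _ 0 (trans (sym (N.ΣL-∙ (pts m) _ _)) (trans (N.ΣL-cong (pts m) (λ w → ℕP.m+[n∸m]≡n (nz-proj f w))) (trans (sym (wt-fibre f)) (trans (sym e) (sym (ℕP.+-identityʳ _))))))

  -- The zero set as a union of hyperplanes (see eqn).
  record Split {m} (s : ℕ) (G : Fun F (suc m)) : Set where
    field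
      Hs     : List (Iso (suc m))
      pairs  : AllPairs Distinct Hs
      len    : List.length Hs ≡ s
      c      : Carrier
      c≢0    : c ≢ 0#
      factor : ∀ p → G p ≡ c * Π.ΣL Hs (λ φ → eqn φ p)

  Normal⇒Split : ∀ {n s f̄} {G : Fun F (suc (suc n))} → Normal s f̄ → (∀ x y z → G (x ∷ y ∷ z) ≡ f̄ (x ∣ y)) → Split s G
  Normal⇒Split {n} {s} {f̄} {G} (parallel c L c≢0 u l eq) e = record
    { Hs = swapI ∷ List.map col L ; pairs = AllP.map⁺ (All.tabulate (λ {b} _ → swap-col b)) ∷ AllPairsP.map⁺ (AllPairs.map col-col u)
    ; len = trans (cong suc (ListP.length-map col L)) l ; c = c ; c≢0 = c≢0 ; factor = λ { (x ∷ y ∷ z) → factor x y z } }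
    where
    col : Carrier → Iso (suc (suc n))
    col b = shearI (aff-const b)
    swap-col : ∀ b → Distinct swapI (col b)
    swap-col b = (1# ∷ 0V) , 1≢0
    col-col : ∀ {b b′} → b ≢ b′ → Distinct (col b) (col b′)
    col-col {b} {b′} n = 0V , λ z → n (sym (-≡0⇒≡ (trans (solve 2 (λ b b′ → b′ :- b := (con (0 , 0) :+ b′) :+ :- con (1 , 0) :* b) refl b b′) z)))
    factor : ∀ x y z → G (x ∷ y ∷ z) ≡ c * (y * Π.ΣL (List.map col L) (λ φ → eqn φ (x ∷ y ∷ z)))
    factor x y z = trans (e x y z) (trans (eq x y) (cong (c *_) (trans (*-comm _ y) (cong (y *_) (sym (trans (Π.ΣL-map col L (λ φ → eqn φ (x ∷ y ∷ z))) (Π.ΣL-cong L (λ b → solve 2 (λ x b → x :+ :- con (1 , 0) :* b := x :- b) refl x b))))))))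
  Normal⇒Split {n} {s} {f̄} {G} (concurrent c L c≢0 u l eq) e = record
    { Hs = idI ∷ List.map line L ; pairs = AllP.map⁺ (All.tabulate (λ {θ} _ → id-line θ)) ∷ AllPairsP.map⁺ (AllPairs.map pencil-distinct u)
    ; len = trans (cong suc (ListP.length-map line L)) l ; c = c ; c≢0 = c≢0 ; factor = λ { (x ∷ y ∷ z) → factor x y z } }
    where
    line : Carrier → Iso (suc (suc n))
    line θ = pencilI θ 0#
    id-line : ∀ θ → Distinct idI (line θ)
    id-line θ = (1# ∷ 0V) , 1≢0
    factor : ∀ x y z → G (x ∷ y ∷ z) ≡ c * (x * Π.ΣL (List.map line L) (λ φ → eqn φ (x ∷ y ∷ z)))
    factor x y z = trans (e x y z) (trans (eq x y) (cong (λ t → c * (x * t)) (sym (trans (Π.ΣL-map line L (λ φ → eqn φ (x ∷ y ∷ z))) (Π.ΣL-cong L (λ θ → solve 3 (λ y t x → y :+ :- con (1 , 0) :* (t :* x :+ con (0 , 0)) := y :- t :* x) refl y θ x))))))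

  Π-zero : ∀ {A : Set} (xs : List A) (g : A → Carrier) {x} → x ∈ xs → g x ≡ 0# → Π.ΣL xs g ≡ 0#
  Π-zero (x ∷ xs) g (here refl) z = trans (cong (_* Π.ΣL xs g) z) (zeroˡ _)
  Π-zero (x ∷ xs) g (there i) z = trans (cong (g x *_) (Π-zero xs g i z)) (zeroʳ _)

  -- The s hyperplanes use up all but one of the s + 1 degrees of H, so the cofactor is affine.
  split-div : ∀ {m} s {G H : Fun F (suc m)} → suc s ≤ Q → Split s G → D (suc (suc s)) H → (∀ p → G p ≡ 0# → H p ≡ 0#) → ∃ λ a → IsAff a × (∀ p → H p ≡ G p * a p)
  split-div {m} s {G} {H} s<Q S dH z = go (div-hyps S.Hs S.pairs (s≤s s<Q) dH zeroHs)
    where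
    module S = Split S
    zeroHs : ∀ {ψ} → ψ ∈ S.Hs → Zero (slice (H ∘f ψ) 0#)
    zeroHs {ψ} i p = z _ (trans (S.factor _) (trans (cong (S.c *_) (Π-zero S.Hs (λ φ → eqn φ (ψ $ (0# ∷ p))) i (cong head (Iso.from-to ψ (0# ∷ p))))) (zeroʳ _)))
    go : (∃ λ g → D (suc (suc s) ∸ List.length S.Hs) g × (∀ p → H p ≡ Π.ΣL S.Hs (λ φ → eqn φ p) * g p)) → ∃ λ a → IsAff a × (∀ p → H p ≡ G p * a p)
    go (g , dg , eq) = (λ p → inv S.c * g p) , aff-* (inv S.c) (D-2 (D-cast (trans (cong (suc (suc s) ∸_) S.len) (∸≡ {b = s} (ℕP.+-comm 2 s))) dg)) ,
      λ p → trans (eq p) (sym (trans (cong (_* (inv S.c * g p)) (S.factor p)) (trans (solve 4 (λ c P i g → c :* P :* (i :* g) := (c :* i) :* (P :* g)) refl S.c _ (inv S.c) (g p)) (trans (cong (_* (Π.ΣL S.Hs (λ φ → eqn φ p) * g p)) (inv-r S.c≢0)) (*-identityˡ _)))))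

  -- If all fibres of the projection have at most one point, the support is the graph of F₁ / G, where
  -- G = Σ f and F₁ = Σ λ f.
  graph : ∀ n s (f : Fun F (suc (suc (suc n)))) → suc s ≤ Q → D (suc (1 ℕ.* Q ℕ.+ s)) f → (∀ w → nz (proj f w) ≡ fibre f w) → Split s (proj f) → InHyp f
  graph n s f s<Q d ex S = go (split-div s s<Q S dF₁ zF₁)
    where
    F₁ : Fun F (suc (suc n))
    F₁ = proj (λ p → head p * f p)
    -- The factor λ costs one degree and the projection removes q - 1, leaving s + 1.
    dF₁ : D (suc (suc s)) F₁
    dF₁ = D-proj 0 (suc s) (D-cast (cong suc (sym (ℕP.+-suc (1 ℕ.* Q) s))) (D-aff aff-head d))
    none : ∀ p → proj f p ≡ 0# → ∀ l → f (l ∷ p) ≡ 0#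
    none p z = fibre≡0 f p (trans (sym (ex p)) (nz-0 z))
    zF₁ : ∀ p → proj f p ≡ 0# → F₁ p ≡ 0#
    zF₁ p z = trans (ΣL-cong E (λ l → trans (cong (l *_) (none p z l)) (zeroʳ l))) (ΣL-ε E)
    go : (∃ λ a → IsAff a × (∀ p → F₁ p ≡ proj f p * a p)) → InHyp f
    go (a , A , eq) = shearI A , λ x x≢0 p → dec x x≢0 p (f (x + a p ∷ p) ≟ 0#)
      where
      dec : ∀ x → x ≢ 0# → ∀ p → Dec (f (x + a p ∷ p) ≡ 0#) → f (x + a p ∷ p) ≡ 0#
      dec x x≢0 p (yes z) = z
      dec x x≢0 p (no n) = contradiction (trans (solve 2 (λ x a → x := (x :+ a) :- a) refl x (a p)) (x-x≡0 l≡a)) x≢0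
        where
        l : Carrier
        l = x + a p
        single : ∀ y → y ≢ l → f (y ∷ p) ≡ 0#
        single y y≢l = nz≡0 (ΣN-one (λ y → nz (f (y ∷ p))) (ℕP.≤-trans (ℕP.≤-reflexive (sym (ex p))) (nz≤1 _)) l (ℕP.≤-reflexive (sym (nz-1 n))) y y≢l)
        G≡ : proj f p ≡ f (l ∷ p)
        G≡ = Σ-at l (λ y → f (y ∷ p)) single
        F₁≡ : F₁ p ≡ l * f (l ∷ p)
        F₁≡ = Σ-at l (λ y → y * f (y ∷ p)) (λ y y≢l → trans (cong (y *_) (single y y≢l)) (zeroʳ y))
        l≡a : l ≡ a p
        l≡a = *-cancelˡ n (trans (*-comm _ l) (trans (sym F₁≡) (trans (eq p) (cong (_* a p) G≡))))

  -- If the projection loses weight, `collided` applies. Otherwise the projection has the second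
  -- weight itself and every fibre has at most one point: a hyperplane containing its support lifts
  -- to f, and at the lowest level, where there is none, `graph` uses its factorisation.
  inHyp : ∀ t n s {f : Fun F (suc (suc t ℕ.+ suc n))} → 2 ≤ s → suc s ≤ Q → D (suc (suc t ℕ.* Q ℕ.+ s)) f → wt f ≡ σ s ℕ.* q ^ n → InHyp f
  inHyp t n s {f} 2≤s s<Q d e = start (transversal f f≢0 (ℕP.≤-<-trans (ℕP.≤-reflexive e) (σ-small t n s 1≤s s≤Q)))
    where
    s≤Q : s ≤ Q
    s≤Q = ℕP.<⇒≤ s<Q
    1≤s : 1 ≤ s
    1≤s = ℕP.≤-trans (s≤s z≤n) 2≤s
    f≢0 : ¬ Zero f
    f≢0 = wt-¬Zero e (ℕP.*-mono-≤ (σ>0 s) (q^>0 n))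
    start : (Σ (Iso (suc (suc t ℕ.+ suc n))) λ φ → ¬ Zero (proj (f ∘f φ))) → InHyp f
    start (φ , ¬zG) = InHyp-iso f φ (cases (ℕP.m≤n⇒m<n∨m≡n (wt-proj f₂)))
      where
      f₂ : Fun F (suc (suc (t ℕ.+ suc n)))
      f₂ = f ∘f φ
      d₂ : D (suc (suc t ℕ.* Q ℕ.+ s)) f₂
      d₂ = D-iso d φ
      e₂′ : wt f₂ ≡ σ s ℕ.* q ^ n
      e₂′ = trans (wt-iso f φ) e
      G : Fun F (suc (t ℕ.+ suc n))
      G = proj f₂
      dG : D (suc (t ℕ.* Q ℕ.+ s)) G
      dG = D-proj t s d₂
      less : wt G < wt f₂ → Empty G → InHyp f₂
      less l (ψ , zψ) = InHyp-iso f₂ Ψ (collided t n s (f₂ ∘f Ψ) 2≤s s<Q (D-iso d₂ Ψ) (trans (wt-iso f₂ Ψ) e₂′) (D-cong (D-iso dG ψ) G≡) (λ z → ¬Zero-iso ¬zG ψ (λ p → trans (sym (G≡ p)) (z p)))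
          (subst₂ _<_ (sym (trans (wt-cong G≡) (wt-iso G ψ))) e₂′ l) zψ)
        where
        Ψ : Iso (suc (suc (t ℕ.+ suc n)))
        Ψ = liftI ψ ∘I swapI
        G≡ : ∀ p → ΣC (λ l → (f₂ ∘f Ψ) (head p ∷ l ∷ tail p)) ≡ (G ∘f ψ) p
        G≡ (x ∷ p) = refl
      cases : wt G < wt f₂ ⊎ wt G ≡ wt f₂ → InHyp f₂
      cases (inj₁ l) = less l (misses-hyperplane t n s 1≤s s≤Q dG ¬zG (ℕP.≤-trans (ℕP.<⇒≤ l) (ℕP.≤-reflexive e₂′)))
      cases (inj₂ eq) = exact t dG (trans eq e₂′) d₂ (exact-fibres f₂ eq)
        where
        exact : ∀ t {f₂ : Fun F (suc (suc (t ℕ.+ suc n)))} → D (suc (t ℕ.* Q ℕ.+ s)) (proj f₂) → wt (proj f₂) ≡ σ s ℕ.* q ^ n → D (suc (suc t ℕ.* Q ℕ.+ s)) f₂ →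
                (∀ w → nz (proj f₂ w) ≡ fibre f₂ w) → InHyp f₂
        exact zero {f₂} dG eG d₂ ex = byCylinder (cylinder n s 2≤s s<Q dG eG)
          where
          byCylinder : Cylinder n s (proj f₂) → InHyp f₂
          byCylinder (Φ , f̄ , nf , eq) = InHyp-iso f₂ (liftI Φ) (graph n s (f₂ ∘f liftI Φ) s<Q (D-iso d₂ (liftI Φ)) (λ w → ex (Φ $ w)) (Normal⇒Split nf eq))
        exact (suc t) {f₂} dG eG d₂ ex = byIH (inHyp t n s 2≤s s<Q dG eG)
          where
          byIH : InHyp (proj f₂) → InHyp f₂
          byIH (ψ , z) = liftI ψ ∘I swapI , λ { x x≢0 (l ∷ p) → fibre≡0 f₂ (ψ $ (x ∷ p)) (trans (sym (ex _)) (nz-0 (z x x≢0 p))) l }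

  -- Reed-Muller codewords and restriction to a flat of codimension t

  D-pow* : ∀ {m k} {a f : Fun F m} e → IsAff a → D k f → D (e ℕ.+ k) (λ p → pow F (a p) e * f p)
  D-pow* zero A d = D-cong d (λ _ → *-identityˡ _)
  D-pow* (suc e) A d = D-cong (D-aff A (D-pow* e A d)) (λ _ → *-assoc _ _ _)

  D-monomial : ∀ {m} (e : Vec (Fin q) m) → D (suc (totalDeg F e)) (monomial F e)
  D-monomial [] = dconst 1# (λ { [] → refl })
  D-monomial (e ∷ es) = D-cong (D-cast (ℕP.+-suc (toℕ e) _) (D-pow* (toℕ e) aff-head (D-∘ (D-monomial es) map-tail))) (λ { (x ∷ xs) → refl })

  InRM⇒D : ∀ {r m} {f : Fun F m} → InRM F r m f → D (suc r) f
  InRM⇒D {r} {m} {f} (c , e , deg) = D-cong (sumD (allVecs (List.allFin q) m)) e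
    where
    term : ∀ es → D (suc r) (λ x → c es * monomial F es x)
    term es with c es ≟ 0#
    ... | yes z = dzero (λ x → trans (cong (_* monomial F es x) z) (zeroˡ _))
    ... | no nz = D-scale (c es) (D-mono (s≤s (deg es nz)) (D-monomial es))
    sumD : ∀ ess → D (suc r) (λ x → sumL F (List.map (λ es → c es * monomial F es x) ess))
    sumD [] = dzero (λ _ → refl)
    sumD (es ∷ ess) = D-+ (term es) (sumD ess)

  pad : ∀ t {k} → V k → V (t ℕ.+ k)
  pad zero v = v
  pad (suc t) v = 0# ∷ pad t v

  CylinderOn0 : ∀ t n → ℕ → Fun F (t ℕ.+ suc (suc n)) → Set
  CylinderOn0 t n s f = Σ (Iso (t ℕ.+ suc (suc n))) λ φ →
    Σ (Fun F 2) λ f̄ → Normal s f̄ ×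
    (∀ x y z → f (φ $ pad t (x ∷ y ∷ z)) ≡ f̄ (x ∣ y)) ×
    (∀ p → f (φ $ p) ≢ 0# → ∃ λ v → p ≡ pad t v)

  -- Dividing by the equations of the q - 1 zero slices lowers t by one, and no weight is lost.
  hyperplane-slice : ∀ t s {m} {f : Fun F (suc m)} → (∀ x → x ≢ 0# → Zero (slice f x)) → D (suc (suc t ℕ.* Q ℕ.+ s)) f →
                     D (suc (t ℕ.* Q ℕ.+ s)) (slice f 0#) × wt (slice f 0#) ≡ wt f
  hyperplane-slice t s {f = f} z d = deg , weq
    where
    weq : wt (slice f 0#) ≡ wt f
    weq = sym (trans (wt-suc f) (trans (N.ΣL-cong E pt) (N.δC 0# (λ x → wt (slice f x)))))
      where
      pt : ∀ x → wt (slice f x) ≡ pick (x ≟ 0#) (wt (slice f x)) 0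
      pt x with x ≟ 0#
      ... | yes _ = refl
      ... | no n = wt-≡0 (z x n)
    deg : D (suc (t ℕ.* Q ℕ.+ s)) (slice f 0#)
    deg = go (div-slices nonzeros (UniqueP.filter⁺ (λ x → ¬? (x ≟ 0#)) unique-E) d (λ i → z _ (proj₂ (∈-filter⁻ (λ x → ¬? (x ≟ 0#)) {xs = E} i))))
      where
      go : (∃ λ g → D (suc (suc t ℕ.* Q ℕ.+ s) ∸ List.length nonzeros) g × (∀ x v → f (x ∷ v) ≡ ΠB nonzeros x * g (x ∷ v))) → D (suc (t ℕ.* Q ℕ.+ s)) (slice f 0#)
      go (g , dg , e) = D-cong (D-scale (ΠB nonzeros 0#) (D-slice (D-cast eq dg) 0#)) (e 0#)
        where
        eq : suc (suc t ℕ.* Q ℕ.+ s) ∸ List.length nonzeros ≡ suc (t ℕ.* Q ℕ.+ s)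
        eq = trans (cong (suc (suc t ℕ.* Q ℕ.+ s) ∸_) length-nonzeros)
          (∸≡ (NS.solve 3 (λ Q t s → NS.con 1 NS.:+ (Q NS.:+ t NS.:+ s) NS.:= Q NS.:+ (NS.con 1 NS.:+ (t NS.:+ s))) refl Q (t ℕ.* Q) s))

  inHyp′ : ∀ t n s {k} → k ≡ suc (t ℕ.+ suc n) → {f : Fun F (suc k)} → 2 ≤ s → suc s ≤ Q →
           D (suc (suc t ℕ.* Q ℕ.+ s)) f → wt f ≡ σ s ℕ.* q ^ n → InHyp f
  inHyp′ t n s refl = inHyp t n s

  restrict-to-flat : ∀ t n s {f : Fun F (t ℕ.+ suc (suc n))} → 2 ≤ s → suc s ≤ Q → D (suc (t ℕ.* Q ℕ.+ s)) f → wt f ≡ σ s ℕ.* q ^ n → CylinderOn0 t n s f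
  restrict-to-flat zero n s {f} 2≤s s<Q d e = go (cylinder n s 2≤s s<Q d e)
    where
    go : Cylinder n s f → CylinderOn0 0 n s f
    go (φ , f̄ , N , eq) = φ , f̄ , N , eq , λ p _ → p , refl
  restrict-to-flat (suc t) n s {f} 2≤s s<Q d e = start (inHyp′ t n s (ℕP.+-suc t (suc n)) 2≤s s<Q d e)
    where
    start : InHyp f → CylinderOn0 (suc t) n s f
    start (φ , z) = go (hyperplane-slice t s z (D-iso d φ))
      where
      f₀ : Fun F (t ℕ.+ suc (suc n))
      f₀ = slice (f ∘f φ) 0#
      finish : CylinderOn0 t n s f₀ → CylinderOn0 (suc t) n s f
      finish (ψ , f̄ , N , eq , supp) = φ ∘I liftI ψ , f̄ , N , eq , λ { (x ∷ p) nz → on x p nz (x ≟ 0#) }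
        where
        on : ∀ x p → f ((φ ∘I liftI ψ) $ (x ∷ p)) ≢ 0# → Dec (x ≡ 0#) → ∃ λ v → x ∷ p ≡ pad (suc t) v
        on x p nz (no x≢0) = contradiction (z x x≢0 (ψ $ p)) nz
        on x p nz (yes refl) = proj₁ (supp p nz) , cong (0# ∷_) (proj₂ (supp p nz))
      go : D (suc (t ℕ.* Q ℕ.+ s)) f₀ × wt f₀ ≡ wt (f ∘f φ) → CylinderOn0 (suc t) n s f
      go (d₀ , w₀) = finish (restrict-to-flat t n s 2≤s s<Q d₀ (trans w₀ (trans (wt-iso f φ) e)))

  -- Affine subspaces as ranges of injective affine maps

  Inj : ∀ {d m} → AffMap d m → Set
  Inj ι = ∀ u v → app ι u ≡ app ι v → u ≡ v

  lin-⊞ : ∀ {d m} (ι : AffMap d m) u v → AffMap.lin ι (u ⊞ v) ≡ AffMap.lin ι u ⊞ AffMap.lin ι v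
  lin-⊞ ι u v = ⊞-cancelˡ (app ι 0V) (begin
    app ι 0V ⊞ ι.lin (u ⊞ v) ≡⟨ sym (ι.add 0V (u ⊞ v)) ⟩
    app ι (0V ⊞ (u ⊞ v)) ≡⟨ cong (app ι) (sym (⊞-assoc 0V u v)) ⟩
    app ι ((0V ⊞ u) ⊞ v) ≡⟨ ι.add (0V ⊞ u) v ⟩
    app ι (0V ⊞ u) ⊞ ι.lin v ≡⟨ cong (_⊞ ι.lin v) (ι.add 0V u) ⟩
    (app ι 0V ⊞ ι.lin u) ⊞ ι.lin v ≡⟨ ⊞-assoc _ _ _ ⟩
    app ι 0V ⊞ (ι.lin u ⊞ ι.lin v) ∎)
    where
    module ι = AffMap ι
    open ≡-Reasoning
    ⊞-cancelˡ : ∀ {m} (a : V m) {b c} → a ⊞ b ≡ a ⊞ c → b ≡ c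
    ⊞-cancelˡ a {b} {c} e = trans (back b) (trans (cong (- 1# · a ⊞_) e) (sym (back c)))
      where
      back : ∀ b → b ≡ - 1# · a ⊞ (a ⊞ b)
      back b = sym (trans (sym (⊞-assoc _ a b)) (trans (cong (_⊞ b) (trans (⊞-comm _ a) (⊞-inverseʳ a))) (⊞-identityˡ b)))

  images : ∀ {d m} → (V d → V m) → Vec (V m) d
  images {zero}  L = []
  images {suc d} L = L (1# ∷ 0V) ∷ images (λ v → L (0# ∷ v))

  lincomb-images : ∀ {d m} (L : V d → V m) → (∀ u v → L (u ⊞ v) ≡ L u ⊞ L v) → (∀ c v → L (c · v) ≡ c · L v) →
                   ∀ as → lincomb F as (images L) ≡ L as
  lincomb-images L add hom [] = sym (trans (hom 0# []) (0· (L [])))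
  lincomb-images L add hom (a ∷ as) = begin
    a · L (1# ∷ 0V) ⊞ lincomb F as (images (λ v → L (0# ∷ v))) ≡⟨ cong₂ _⊞_ (sym (hom a _)) (lincomb-images (λ v → L (0# ∷ v)) add₀ hom₀ as) ⟩
    L (a · (1# ∷ 0V)) ⊞ L (0# ∷ as) ≡⟨ sym (add _ _) ⟩
    L (a * 1# + 0# ∷ a · 0V ⊞ as) ≡⟨ cong L (cong₂ _∷_ (solve 1 (λ a → a :* con (1 , 0) :+ con (0 , 0) := a) refl a) (trans (cong (_⊞ as) (·0V a)) (⊞-identityˡ as))) ⟩
    L (a ∷ as) ∎
    where
    open ≡-Reasoning
    add₀ : ∀ u v → L (0# ∷ u ⊞ v) ≡ L (0# ∷ u) ⊞ L (0# ∷ v)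
    add₀ u v = trans (cong (λ z → L (z ∷ u ⊞ v)) (sym (+-identityˡ 0#))) (add (0# ∷ u) (0# ∷ v))
    hom₀ : ∀ c v → L (0# ∷ c · v) ≡ c · L (0# ∷ v)
    hom₀ c v = trans (cong (λ z → L (z ∷ c · v)) (sym (zeroʳ c))) (hom c (0# ∷ v))

  module _ {d m} (ι : AffMap d m) where
    private module ι = AffMap ι

    lincomb-lin : ∀ as → lincomb F as (images ι.lin) ≡ ι.lin as
    lincomb-lin = lincomb-images ι.lin (lin-⊞ ι) ι.hom

    app-lin : ∀ v → app ι v ≡ app ι 0V ⊞ ι.lin v
    app-lin v = trans (cong (app ι) (sym (⊞-identityˡ v))) (ι.add 0V v)

    lin-injective : Inj ι → ∀ u v → ι.lin u ≡ ι.lin v → u ≡ v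
    lin-injective inj u v e = inj u v (trans (app-lin u) (trans (cong (app ι 0V ⊞_) e) (sym (app-lin v))))

    lin-0V : ι.lin 0V ≡ 0V
    lin-0V = trans (cong ι.lin (sym (0· 0V))) (trans (ι.hom 0# 0V) (0· (ι.lin 0V)))

    range : Inj ι → AffSub F m d
    range inj = record
      { base = app ι 0V
      ; dirs = images ι.lin
      ; indep = λ as e → lin-injective inj as 0V (trans (sym (lincomb-lin as)) (trans e (sym lin-0V)))
      }

    ∈-range : ∀ inj v {x} → x ≡ app ι v → _∈A_ F x (range inj)
    ∈-range inj v e = v , trans e (trans (app-lin v) (cong (app ι 0V ⊞_) (sym (lincomb-lin v))))

    range-∈ : ∀ inj {x} → _∈A_ F x (range inj) → ∃ λ v → x ≡ app ι v
    range-∈ inj (v , e) = v , trans e (trans (cong (app ι 0V ⊞_) (lincomb-lin v)) (sym (app-lin v)))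

  InSpan-self : ∀ {m d} (vs : Vec (V m) d) i → InSpan F (Vec.lookup vs i) vs
  InSpan-self (v ∷ vs) zero = 1# ∷ 0V , sym (trans (cong₂ _⊞_ (1· v) (lincomb-0 vs)) (⊞-identityʳ v))
    where
    lincomb-0 : ∀ {m d} (vs : Vec (V m) d) → lincomb F 0V vs ≡ 0V
    lincomb-0 [] = refl
    lincomb-0 (v ∷ vs) = trans (cong₂ _⊞_ (0· v) (lincomb-0 vs)) (⊞-identityˡ 0V)
  InSpan-self (v ∷ vs) (suc i) = 0# ∷ proj₁ (InSpan-self vs i) , trans (proj₂ (InSpan-self vs i)) (sym (trans (cong (_⊞ _) (0· v)) (⊞-identityˡ _)))

  -- Enumeration of the field elements outside a list

  remove : Carrier → List Carrier → List Carrier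
  remove a = List.filter (λ x → ¬? (x ≟ a))

  length-remove : ∀ {a xs} → Unique xs → a ∈ xs → suc (List.length (remove a xs)) ≡ List.length xs
  length-remove {a} {b ∷ xs} (p ∷ u) i with b ≟ a
  length-remove {a} {b ∷ xs} (p ∷ u) i | yes refl = cong (suc ∘ List.length) (ListP.filter-all (λ x → ¬? (x ≟ a)) (All.map (λ n e → n (sym e)) p))
  length-remove {a} {b ∷ xs} (p ∷ u) (here e) | no n = contradiction (sym e) n
  length-remove {a} {b ∷ xs} (p ∷ u) (there i) | no n = cong suc (length-remove u i)

  complement : List Carrier → List Carrier
  complement = List.foldr remove E

  ∈-complement : ∀ {x} L → x ∉ L → x ∈ complement L
  ∈-complement []      n = ∈-E _
  ∈-complement (a ∷ L) n = ∈-filter⁺ (λ x → ¬? (x ≟ a)) (∈-complement L (n ∘ there)) (n ∘ here)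

  complement-∉ : ∀ {x} L → x ∈ complement L → x ∉ L
  complement-∉ (a ∷ L) i (here e)  = proj₂ (∈-filter⁻ (λ x → ¬? (x ≟ a)) {xs = complement L} i) e
  complement-∉ (a ∷ L) i (there j) = complement-∉ L (proj₁ (∈-filter⁻ (λ x → ¬? (x ≟ a)) {xs = complement L} i)) j

  unique-complement : ∀ L → Unique (complement L)
  unique-complement []      = unique-E
  unique-complement (a ∷ L) = UniqueP.filter⁺ (λ x → ¬? (x ≟ a)) (unique-complement L)

  length-complement : ∀ L → Unique L → List.length (complement L) ℕ.+ List.length L ≡ q
  length-complement []      _       = trans (ℕP.+-identityʳ _) length-E
  length-complement (a ∷ L) (p ∷ u) = trans (ℕP.+-suc _ _) (trans (cong (ℕ._+ List.length L) (length-remove (unique-complement L) (∈-complement L (λ i → All.lookup p i refl)))) (length-complement L u))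

  lookup-injective : ∀ {A : Set} {xs : List A} → Unique xs → ∀ i j → List.lookup xs i ≡ List.lookup xs j → i ≡ j
  lookup-injective (p ∷ u) zero    zero    e = refl
  lookup-injective (p ∷ u) zero    (suc j) e = contradiction e (All.lookup p (∈-lookup j))
  lookup-injective (p ∷ u) (suc i) zero    e = contradiction (sym e) (All.lookup p (∈-lookup i))
  lookup-injective (p ∷ u) (suc i) (suc j) e = cong suc (lookup-injective u i j e)

  record Enumeration (k : ℕ) (L : List Carrier) : Set where
    field
      at     : Fin k → Carrier
      at-inj : ∀ i j → at i ≡ at j → i ≡ j
      at-∉   : ∀ i → at i ∉ L
      cover  : ∀ {x} → x ∉ L → ∃ λ i → at i ≡ x

  enumerate : ∀ {k} L → Unique L → k ℕ.+ List.length L ≡ q → Enumeration k L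
  enumerate {k} L u e = subst (λ k → Enumeration k L) (ℕP.+-cancelʳ-≡ (List.length L) _ k (trans (length-complement L u) (sym e))) (record
    { at = List.lookup (complement L)
    ; at-inj = lookup-injective (unique-complement L)
    ; at-∉ = λ i → complement-∉ L (∈-lookup i)
    ; cover = λ n → Any.index (∈-complement L n) , sym (lookup-index (∈-complement L n))
    })

  -- The dichotomy of the theorem with its dimensions as parameters: it is built for n + 2, n + 1
  -- and n, and transported only at the end to differences such as m ∸ t, which do not compute.
  HyperplaneUnion : ∀ {m d₀ d₁} → ℕ → ℕ → AffSub F m d₀ → Fun F m → Set
  HyperplaneUnion {m} {d₀} {d₁} d₂ k G f =
    (Σ (Fin k → AffSub F m d₁) λ A → Σ (AffSub F m d₁) λ B →
       (∀ i x → _∈A_ F x (A i) → _∈A_ F x G)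
       × (∀ i j → i ≢ j → ¬ SameSet F (A i) (A j))
       × (∀ i j → Parallel F (A i) (A j))
       × (∀ i → ¬ Parallel F (A i) B)
       × (∀ x → Supp F f x → (∃ λ i → _∈A_ F x (A i)) × ¬ _∈A_ F x B)
       × (∀ x → (∃ λ i → _∈A_ F x (A i)) → ¬ _∈A_ F x B → Supp F f x))
    ⊎ (Σ (Fin k → AffSub F m d₁) λ A → Σ (AffSub F m d₂) λ C →
       (∀ i x → _∈A_ F x (A i) → _∈A_ F x G)
       × (∀ i j → i ≢ j → ¬ SameSet F (A i) (A j))
       × (∀ x → ((∀ i → _∈A_ F x (A i)) → _∈A_ F x C) × (_∈A_ F x C → ∀ i → _∈A_ F x (A i)))
       × (∀ x → Supp F f x → (∃ λ i → _∈A_ F x (A i)) × ¬ _∈A_ F x C)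
       × (∀ x → (∃ λ i → _∈A_ F x (A i)) → ¬ _∈A_ F x C → Supp F f x))

  Structure : ∀ {m} → ℕ → ℕ → ℕ → ℕ → Fun F m → Set
  Structure {m} d₀ d₁ d₂ k f = Σ (AffSub F m d₀) λ G → (∀ x → Supp F f x → _∈A_ F x G) × HyperplaneUnion {d₁ = d₁} d₂ k G f

  map-pad : ∀ t {k} → AffMap k (t ℕ.+ k)
  map-pad zero    = map-id
  map-pad (suc t) = map-∷ (aff-const 0#) (map-pad t)

  app-pad : ∀ t {k} (v : V k) → app (map-pad t) v ≡ pad t v
  app-pad zero    v = refl
  app-pad (suc t) v = cong (0# ∷_) (app-pad t v)

  pad-injective : ∀ t {k} {u v : V k} → pad t u ≡ pad t v → u ≡ v
  pad-injective zero    e = e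
  pad-injective (suc t) e = pad-injective t (VecP.∷-injectiveʳ e)

  fixSecond : ∀ {n} → AffMap (suc n) (suc (suc n))
  fixSecond = map-∷ aff-head (map-∷ (aff-const 0#) map-tail)

  graphOf : ∀ {n} → Carrier → AffMap (suc n) (suc (suc n))
  graphOf θ = map-∷ aff-head (map-∷ (aff-* θ aff-head) map-tail)

  module _ {m n k : ℕ} {f : Fun F m} {f̄ : Fun F 2} (ι : AffMap (suc (suc n)) m) (inj : Inj ι)
           (supp : ∀ x → f x ≢ 0# → ∃ λ v → x ≡ app ι v) (val : ∀ x y z → f (app ι (x ∷ y ∷ z)) ≡ f̄ (x ∣ y)) where

    private
      G : AffSub F m (suc (suc n))
      G = range ι inj

      ∘-inj : ∀ {d} (κ : AffMap d (suc (suc n))) → Inj κ → Inj (map-∘ ι κ)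
      ∘-inj κ κ-inj u v e = κ-inj u v (inj _ _ e)

      sub : ∀ {d} (κ : AffMap d (suc (suc n))) → Inj κ → AffSub F m d
      sub κ κ-inj = range (map-∘ ι κ) (∘-inj κ κ-inj)

      ∈-sub : ∀ {d} (κ : AffMap d (suc (suc n))) (κ-inj : Inj κ) u v → v ≡ app κ u → _∈A_ F (app ι v) (sub κ κ-inj)
      ∈-sub κ κ-inj u v e = ∈-range (map-∘ ι κ) (∘-inj κ κ-inj) u (cong (app ι) e)

      sub-∈ : ∀ {d} (κ : AffMap d (suc (suc n))) (κ-inj : Inj κ) {x} → _∈A_ F x (sub κ κ-inj) → ∃ λ u → x ≡ app ι (app κ u)
      sub-∈ κ κ-inj = range-∈ (map-∘ ι κ) (∘-inj κ κ-inj)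

      sub-∈ι : ∀ {d} (κ : AffMap d (suc (suc n))) (κ-inj : Inj κ) {v} → _∈A_ F (app ι v) (sub κ κ-inj) → ∃ λ u → v ≡ app κ u
      sub-∈ι κ κ-inj i with sub-∈ κ κ-inj i
      ... | u , e = u , inj _ _ e

      in-G : ∀ {d} (κ : AffMap d (suc (suc n))) (κ-inj : Inj κ) x → _∈A_ F x (sub κ κ-inj) → _∈A_ F x G
      in-G κ κ-inj x i with sub-∈ κ κ-inj i
      ... | u , e = ∈-range ι inj (app κ u) e

      at-inj : ∀ {n} a → Inj {suc n} (map-at a)
      at-inj a u v e = VecP.∷-injectiveʳ e

      second-inj : Inj (fixSecond {n})
      second-inj (x ∷ u) (y ∷ v) e = cong₂ _∷_ (VecP.∷-injectiveˡ e) (VecP.∷-injectiveʳ (VecP.∷-injectiveʳ e))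

      graph-inj : ∀ θ → Inj (graphOf {n} θ)
      graph-inj θ (x ∷ u) (y ∷ v) e = cong₂ _∷_ (VecP.∷-injectiveˡ e) (VecP.∷-injectiveʳ (VecP.∷-injectiveʳ e))

      origin : AffMap n (suc (suc n))
      origin = map-∘ (map-at 0#) (map-at 0#)

      origin-inj : Inj origin
      origin-inj u v e = VecP.∷-injectiveʳ (VecP.∷-injectiveʳ e)

    -- The product is nonzero exactly when x avoids L and y ≠ 0. So the parallel subspaces are x = a
    -- for a outside L, and y = 0 is removed.
    parallel-structure : ∀ c L → c ≢ 0# → Enumeration k L → (∀ x y → f̄ (x ∣ y) ≡ c * (ΠB L x * y)) →
                         Structure (suc (suc n)) (suc n) n k f
    parallel-structure c L c≢0 en form = G , (λ x nz → ∈-range ι inj _ (proj₂ (supp x nz))) , inj₁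
      (A , B , (λ i → in-G (map-at (at i)) (at-inj (at i))) , distinct , (λ i j → InSpan-self (AffSub.dirs (A i)) , InSpan-self (AffSub.dirs (A i))) , transverse , into , outof)
      where
      open Enumeration en renaming (at-inj to at-injective)
      A : Fin k → AffSub F m (suc n)
      A i = sub (map-at (at i)) (at-inj (at i))
      B : AffSub F m (suc n)
      B = sub fixSecond second-inj
      distinct : ∀ i j → i ≢ j → ¬ SameSet F (A i) (A j)
      distinct i j i≢j same = i≢j (at-injective i j (cong head (proj₂ (sub-∈ι (map-at (at j)) (at-inj (at j))
        (proj₁ (same _) (∈-sub (map-at (at i)) (at-inj (at i)) 0V _ refl))))))
      transverse : ∀ i → ¬ Parallel F (A i) B
      -- The first direction of `A i` is that of y, whereas all directions of `B` have y-coordinate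
      -- 0.
      transverse i (par , _) with par zero
      ... | as , e = 1≢0 (cong (head ∘ tail) (lin-injective ι inj _ _ (trans e (lincomb-lin (map-∘ ι fixSecond) as))))
      into : ∀ x → Supp F f x → (∃ λ i → _∈A_ F x (A i)) × ¬ _∈A_ F x B
      into x nz with supp x nz
      ... | a ∷ b ∷ z , refl = on-A (cover a∉L) , not-B
        where
        nz′ : c * (ΠB L a * b) ≢ 0#
        nz′ e = nz (trans (val a b z) (trans (form a b) e))
        a∉L : a ∉ L
        a∉L i = nz′ (trans (cong (λ u → c * (u * b)) (Π-zero L (λ b′ → a - b′) i (-‿inverseʳ a))) (trans (cong (c *_) (zeroˡ b)) (zeroʳ c)))
        on-A : (∃ λ i → at i ≡ a) → ∃ λ i → _∈A_ F (app ι (a ∷ b ∷ z)) (A i)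
        on-A (i , e) = i , ∈-sub (map-at (at i)) (at-inj (at i)) (b ∷ z) _ (cong (_∷ b ∷ z) (sym e))
        not-B : ¬ _∈A_ F (app ι (a ∷ b ∷ z)) B
        not-B i with sub-∈ι fixSecond second-inj i
        ... | u , e = nz′ (trans (cong (λ w → c * (ΠB L a * w)) (cong (head ∘ tail) e)) (trans (cong (c *_) (zeroʳ _)) (zeroʳ c)))
      outof : ∀ x → (∃ λ i → _∈A_ F x (A i)) → ¬ _∈A_ F x B → Supp F f x
      outof x (i , x∈A) x∉B with sub-∈ (map-at (at i)) (at-inj (at i)) x∈A
      ... | y ∷ z , refl = λ e → *≢0 c≢0 (*≢0 (ΠB≢0 L (at i) (λ j e → at-∉ i (subst (_∈ L) (sym e) j))) y≢0) (trans (sym (trans (val (at i) y z) (form (at i) y))) e)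
        where
        y≢0 : y ≢ 0#
        y≢0 y≡0 = x∉B (∈-sub fixSecond second-inj (at i ∷ z) _ (cong (λ w → at i ∷ w ∷ z) y≡0))

    -- Of the q + 1 hyperplanes of G through x = y = 0, the function vanishes on x = 0 and on y = θx
    -- for θ in L; the subspaces are the others. By 2 ≤ k there are two of them, whose intersection
    -- is already the centre.
    concurrent-structure : ∀ c L → c ≢ 0# → Enumeration k L → 2 ≤ k → (∀ x y → f̄ (x ∣ y) ≡ c * (x * Π.ΣL L (λ θ → y - θ * x))) →
                           Structure (suc (suc n)) (suc n) n k f
    concurrent-structure c L c≢0 en (s≤s (s≤s _)) form = G , (λ x nz → ∈-range ι inj _ (proj₂ (supp x nz))) , inj₂
      (A , C , (λ i → in-G (graphOf (at i)) (graph-inj (at i))) , distinct , (λ x → common x , centre x) , into , outof)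
      where
      open Enumeration en renaming (at-inj to at-injective)
      A : Fin k → AffSub F m (suc n)
      A i = sub (graphOf (at i)) (graph-inj (at i))
      C : AffSub F m n
      C = sub origin origin-inj
      distinct : ∀ i j → i ≢ j → ¬ SameSet F (A i) (A j)
      distinct i j i≢j same = go (sub-∈ι (graphOf (at j)) (graph-inj (at j)) (proj₁ (same _) (∈-sub (graphOf (at i)) (graph-inj (at i)) (1# ∷ 0V) _ refl)))
        where
        go : (∃ λ u → app (graphOf (at i)) (1# ∷ 0V) ≡ app (graphOf (at j)) u) → ⊥
        go (y ∷ u , e) = i≢j (at-injective i j (trans (sym (*-identityʳ (at i))) (trans (cong (head ∘ tail) e) (trans (cong (at j *_) (sym (cong head e))) (*-identityʳ (at j))))))
      common : ∀ x → (∀ i → _∈A_ F x (A i)) → _∈A_ F x C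
      common x all = go (sub-∈ (graphOf (at zero)) (graph-inj (at zero)) (all zero))
        where
        go : (∃ λ u → x ≡ app ι (app (graphOf (at zero)) u)) → _∈A_ F x C
        go (a ∷ z , refl) = go₁ (sub-∈ι (graphOf (at (suc zero))) (graph-inj (at (suc zero))) (all (suc zero)))
          where
          go₁ : (∃ λ u → app (graphOf (at zero)) (a ∷ z) ≡ app (graphOf (at (suc zero))) u) → _∈A_ F x C
          go₁ (b ∷ u , e) = ∈-sub origin origin-inj z _ (cong₂ (λ p r → p ∷ r ∷ z) a≡0 (trans (cong (at zero *_) a≡0) (zeroʳ _)))
            where
            different : at zero - at (suc zero) ≢ 0#
            different d = contradiction (at-injective zero (suc zero) (-≡0⇒≡ d)) λ ()
            a≡0 : a ≡ 0#
            a≡0 = *≡0 different (trans (solve 3 (λ s t a → (s :- t) :* a := s :* a :- t :* a) refl (at zero) (at (suc zero)) a)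
              (x-x≡0 (trans (cong (head ∘ tail) e) (cong (at (suc zero) *_) (sym (cong head e))))))
      centre : ∀ x → _∈A_ F x C → ∀ i → _∈A_ F x (A i)
      centre x x∈C i with sub-∈ origin origin-inj x∈C
      ... | z , refl = ∈-sub (graphOf (at i)) (graph-inj (at i)) (0# ∷ z) _ (cong (λ w → 0# ∷ w ∷ z) (sym (zeroʳ (at i))))
      into : ∀ x → Supp F f x → (∃ λ i → _∈A_ F x (A i)) × ¬ _∈A_ F x C
      into x nz with supp x nz
      ... | a ∷ b ∷ z , refl = on-A (cover θ∉L) , not-C
        where
        Πθ : Carrier
        Πθ = Π.ΣL L (λ θ → b - θ * a)
        nz′ : c * (a * Πθ) ≢ 0#
        nz′ e = nz (trans (val a b z) (trans (form a b) e))
        a≢0 : a ≢ 0#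
        a≢0 e = nz′ (trans (cong (λ u → c * (u * Πθ)) e) (trans (cong (c *_) (zeroˡ _)) (zeroʳ c)))
        on-line : b * inv a * a ≡ b
        on-line = trans (*-assoc _ _ _) (trans (cong (b *_) (inv-l a≢0)) (*-identityʳ b))
        θ∉L : b * inv a ∉ L
        θ∉L i = nz′ (trans (cong (λ u → c * (a * u)) (Π-zero L (λ θ → b - θ * a) i (x-x≡0 (sym on-line)))) (trans (cong (c *_) (zeroʳ a)) (zeroʳ c)))
        on-A : (∃ λ i → at i ≡ b * inv a) → ∃ λ i → _∈A_ F (app ι (a ∷ b ∷ z)) (A i)
        on-A (i , e) = i , ∈-sub (graphOf (at i)) (graph-inj (at i)) (a ∷ z) _ (cong (λ w → a ∷ w ∷ z) (trans (sym on-line) (cong (_* a) (sym e))))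
        not-C : ¬ _∈A_ F (app ι (a ∷ b ∷ z)) C
        not-C i = a≢0 (cong head (proj₂ (sub-∈ι origin origin-inj i)))
      outof : ∀ x → (∃ λ i → _∈A_ F x (A i)) → ¬ _∈A_ F x C → Supp F f x
      outof x (i , x∈A) x∉C with sub-∈ (graphOf (at i)) (graph-inj (at i)) x∈A
      ... | a ∷ z , refl = λ e → *≢0 c≢0 (*≢0 a≢0 (Π≢0∈ L (λ j e → at-∉ i (subst (_∈ L) (sym (θ≡ e)) j)))) (trans (sym (trans (val a (at i * a) z) (form a (at i * a)))) e)
        where
        a≢0 : a ≢ 0#
        a≢0 a≡0 = x∉C (∈-sub origin origin-inj z _ (cong₂ (λ p r → p ∷ r ∷ z) a≡0 (trans (cong (at i *_) a≡0) (zeroʳ _))))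
        θ≡ : ∀ {θ} → at i * a - θ * a ≡ 0# → at i ≡ θ
        θ≡ e = *-cancelˡ a≢0 (trans (*-comm _ _) (trans (-≡0⇒≡ e) (*-comm _ _)))
        Π≢0∈ : ∀ K {g : Carrier → Carrier} → (∀ {θ} → θ ∈ K → g θ ≢ 0#) → Π.ΣL K g ≢ 0#
        Π≢0∈ []      n = 1≢0
        Π≢0∈ (θ ∷ K) n = *≢0 (n (here refl)) (Π≢0∈ K (n ∘ there))

  second-weight-structure : ∀ t n s {f : Fun F (t ℕ.+ suc (suc n))} → 2 ≤ s → suc s ≤ Q → D (suc (t ℕ.* Q ℕ.+ s)) f → wt f ≡ σ s ℕ.* q ^ n →
                            Structure (suc (suc n)) (suc n) n (q ∸ s ℕ.+ 1) f
  second-weight-structure t n s {f} 2≤s s<Q d e = go (restrict-to-flat t n s 2≤s s<Q d e)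
    where
    s≤q : s ≤ q
    s≤q = ℕP.≤-trans (ℕP.<⇒≤ s<Q) (ℕP.n≤1+n Q)
    count : ∀ {l} → suc l ≡ s → q ∸ s ℕ.+ 1 ℕ.+ l ≡ q
    count refl = trans (ℕP.+-assoc (q ∸ s) 1 _) (ℕP.m∸n+n≡m s≤q)
    2≤k : 2 ≤ q ∸ s ℕ.+ 1
    2≤k = ℕP.+-mono-≤ (ℕP.m<n⇒0<n∸m (ℕP.≤-trans s<Q (ℕP.n≤1+n Q))) (s≤s z≤n)
    go : CylinderOn0 t n s f → Structure (suc (suc n)) (suc n) n (q ∸ s ℕ.+ 1) f
    go (φ , f̄ , N , val , supp) = byForm N
      where
      ι : AffMap (suc (suc n)) (t ℕ.+ suc (suc n))
      ι = map-∘ (Iso.to φ) (map-pad t)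
      $-injective : ∀ {p p′} → φ $ p ≡ φ $ p′ → p ≡ p′
      $-injective {p} {p′} e = trans (sym (Iso.from-to φ p)) (trans (cong (app (Iso.from φ)) e) (Iso.from-to φ p′))
      inj : Inj ι
      inj u v e = pad-injective t (trans (sym (app-pad t u)) (trans ($-injective e) (app-pad t v)))
      val-ι : ∀ x y z → f (app ι (x ∷ y ∷ z)) ≡ f̄ (x ∣ y)
      val-ι x y z = trans (cong (λ p → f (φ $ p)) (app-pad t _)) (val x y z)
      supp-ι : ∀ x → f x ≢ 0# → ∃ λ v → x ≡ app ι v
      supp-ι x nz = through (supp (app (Iso.from φ) x) (λ e → nz (trans (cong f (sym (Iso.to-from φ x))) e)))
        where
        through : (∃ λ v → app (Iso.from φ) x ≡ pad t v) → ∃ λ v → x ≡ app ι v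
        through (v , e) = v , trans (sym (Iso.to-from φ x)) (cong (φ $_) (trans e (sym (app-pad t v))))
      byForm : Normal s f̄ → Structure (suc (suc n)) (suc n) n (q ∸ s ℕ.+ 1) f
      byForm (parallel c L c≢0 u l form) = parallel-structure {f̄ = f̄} ι inj supp-ι val-ι c L c≢0 (enumerate L u (count l)) form
      byForm (concurrent c L c≢0 u l form) = concurrent-structure {f̄ = f̄} ι inj supp-ι val-ι c L c≢0 (enumerate L u (count l)) 2≤k form

  second-weight-words : ∀ {m t s n} {f : Fun F m} → m ≡ t ℕ.+ suc (suc n) → 2 ≤ s → suc s ≤ Q → InRM F (t ℕ.* Q ℕ.+ s) m f →
                        weight F f ≡ (q ∸ s ℕ.+ 1) ℕ.* Q ℕ.* q ^ (m ∸ t ∸ 2) → Structure (m ∸ t) (m ∸ (t ℕ.+ 1)) (m ∸ (t ℕ.+ 2)) (q ∸ s ℕ.+ 1) f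
  second-weight-words {t = t} {s} {n} {f} refl 2≤s s<Q rm w =
    cast (sym d₀) (sym d₁) (sym d₂) (second-weight-structure t n s 2≤s s<Q (InRM⇒D rm)
      (trans (sym (weight≡wt f)) (trans w (cong₂ (λ a b → a ℕ.* Q ℕ.* q ^ b) (ℕP.+-comm (q ∸ s) 1) (cong (_∸ 2) d₀)))))
    where
    cast : ∀ {a a′ b b′ c c′ k} → a ≡ a′ → b ≡ b′ → c ≡ c′ → Structure a b c k f → Structure a′ b′ c′ k f
    cast refl refl refl S = S
    d₀ : t ℕ.+ suc (suc n) ∸ t ≡ suc (suc n)
    d₀ = ℕP.m+n∸m≡n t _
    d₁ : t ℕ.+ suc (suc n) ∸ (t ℕ.+ 1) ≡ suc n
    d₁ = ℕP.[m+n]∸[m+o]≡n∸o t _ 1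
    d₂ : t ℕ.+ suc (suc n) ∸ (t ℕ.+ 2) ≡ n
    d₂ = ℕP.[m+n]∸[m+o]≡n∸o t _ 2

open import Data.Nat using (_+_; _*_)

theorem2p3 : (q : ℕ) (F : FiniteField q) (m t s : ℕ) →
    4 ≤ q → 2 ≤ m → t ≤ m ∸ 2 → 2 ≤ s → s ≤ q ∸ 2 →
    (f : Fun F m) →
    InRM F (t * (q ∸ 1) + s) m f →
    weight F f ≡ (q ∸ s + 1) * (q ∸ 1) * q ^ (m ∸ t ∸ 2) →
    Σ (AffCodim F m t) λ G →
    (∀ x → Supp F f x → _∈A_ F x G)
    × ((Σ (Fin (q ∸ s + 1) → AffCodim F m (t + 1)) λ A →
    Σ (AffCodim F m (t + 1)) λ B →
    (∀ i x → _∈A_ F x (A i) → _∈A_ F x G)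
    × (∀ i j → i ≢ j → ¬ SameSet F (A i) (A j))
    × (∀ i j → Parallel F (A i) (A j))
    × (∀ i → ¬ Parallel F (A i) B)
    × (∀ x → Supp F f x → (∃ λ i → _∈A_ F x (A i)) × ¬ _∈A_ F x B)
    × (∀ x → (∃ λ i → _∈A_ F x (A i)) → ¬ _∈A_ F x B → Supp F f x))
    ⊎ (Σ (Fin (q ∸ s + 1) → AffCodim F m (t + 1)) λ A →
    Σ (AffCodim F m (t + 2)) λ C →
    (∀ i x → _∈A_ F x (A i) → _∈A_ F x G)
    × (∀ i j → i ≢ j → ¬ SameSet F (A i) (A j))
    × (∀ x → ((∀ i → _∈A_ F x (A i)) → _∈A_ F x C)
    × (_∈A_ F x C → ∀ i → _∈A_ F x (A i)))
    × (∀ x → Supp F f x → (∃ λ i → _∈A_ F x (A i)) × ¬ _∈A_ F x C)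
    × (∀ x → (∃ λ i → _∈A_ F x (A i)) → ¬ _∈A_ F x C → Supp F f x)))
-- Matching on q makes q ∸ 1 reduce to Q; the number n of free coordinates is m ∸ 2 ∸ t.
theorem2p3 (suc Q) F m t s (s≤s 3≤Q) 2≤m t≤m∸2 2≤s s≤q∸2 f rm w = Proof.second-weight-words F 3≤Q m≡ 2≤s s<Q rm w
  where
  m≡ : m ≡ t + suc (suc (m ∸ 2 ∸ t))
  m≡ = trans (sym (ℕP.m∸n+n≡m 2≤m)) (trans (cong (_+ 2) (sym (ℕP.m+[n∸m]≡n t≤m∸2))) (trans (ℕP.+-assoc t _ 2) (cong (t +_) (ℕP.+-comm _ 2))))
  s<Q : suc s ≤ Q
  s<Q = ℕP.≤-trans (s≤s s≤q∸2) (ℕP.≤-reflexive (ℕP.m+[n∸m]≡n (ℕP.≤-trans (s≤s z≤n) 3≤Q)))
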